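{- There is a Monte Carlo algorithm that takes as input an instance $x,y\in[m]^n$ of List Disjointness with $m\le \mathrm{poly}(n)$, a positive integer $s$, and an upper bound $p$ on the sum of the squared frequencies of the entries in the lists, i.e. $\sum_{v=1}^m\left(|x^{ -1}(v)|^2+|y^{ -1}(v)|^2\right)\le p$, and solves the List Disjointness instance $x,y$ in time $\tilde{O}(n\sqrt{p/s})$ and $O(s\log n)$ space for any $s\le n^2/p$. The algorithm assumes random read-only access to a random function $h:[m]\to[n]$.
   Context: $[k]=\{1,\ldots,k\}$. List Disjointness: given random read-only access to two lists $x,y\in[m]^n$, determine whether there exist indices $i,j\in[n]$ with $x_i=y_j$ (a YES-instance is one where such indices exist). For a list $z\in[m]^n$ and a value $v$, $z^{ -1}(v)=\{i\in[n]:z_i=v\}$. The notation $\tilde{O}(T)$ means $O(T\cdot\mathrm{polylog}(T))$. A Monte Carlo algorithm is a randomized algorithm with no false positives (it never claims a NO-instance to be a YES-instance) and with false negatives occurring only with (at most some) constant probability (smaller than 1). Random read-only access to a random function $h$ means that $h$ is chosen uniformly at random among all functions $[m]\to[n]$, any evaluation of $h$ can be read in constant time, and the storage of $h$ (like that of the input) is not counted in the space usage. -}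

module Defs where

open import Data.Bool using (Bool; true; false; if_then_else_; _≟_)
open import Data.Fin using (Fin; toℕ; fromℕ<)
open import Data.Integer using (+_)
open import Data.List using (List; []; _∷_; map; length; filter; upTo; allFin;
  cartesianProduct; cartesianProductWith)
open import Data.Maybe using (Maybe; just; nothing; Is-just)
open import Data.Maybe.Properties using (≡-dec)
open import Data.Nat using (ℕ; zero; suc; _+_; _*_; _∸_; _^_; _⊔_; _/_; _%_; _≤_; _≡ᵇ_; _<?_)
open import Data.Nat.DivMod using (_mod_)
open import Data.Nat.ListAction using (sum)
open import Data.Nat.Logarithm using (⌈log₂_⌉)
open import Data.Nat.Properties using (m^n≢0)
open import Data.Product using (_×_; _,_; ∃₂)
open import Data.Rational as ℚ using (ℚ)
open import Data.Vec as Vec using (Vec; []; _∷_)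
import Data.Fin.Properties as Fin
open import Relation.Binary.PropositionalEquality using (_≡_)
open import Relation.Nullary using (yes; no)

------------------------------------------------------------------------
-- List Disjointness.  The paper's [k] = {1,…,k} is Fin k = {0,…,k-1}.

NotDisjoint : ∀ {n m} → (x y : Vec (Fin m) n) → Set
NotDisjoint x y = ∃₂ λ i j → Vec.lookup x i ≡ Vec.lookup y j

-- |z⁻¹(v)|
freq : ∀ {n m} → Fin m → Vec (Fin m) n → ℕ
freq v z = Vec.count (v Fin.≟_) z

sumSquaredFreqs : ∀ {n m} → (x y : Vec (Fin m) n) → ℕ
sumSquaredFreqs {m = m} x y = sum (map (λ v → freq v x ^ 2 + freq v y ^ 2) (allFin m))

------------------------------------------------------------------------
-- Randomized word RAM with read-only access to x, y and h.

Addr Label : Set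
Addr  = ℕ
Label = ℕ

Word : ℕ → Set
Word w = Fin (2 ^ w)

truncate : ∀ w → ℕ → Word w
truncate w v = _mod_ v (2 ^ w) {{m^n≢0 2 w}}

data Op : Set where
  add sub mul div rem : Op

-- Subtraction is cut off at 0; division by 0 and remainder by 0 give 0.
⟦_⟧ : Op → ℕ → ℕ → ℕ
⟦ add ⟧ a b       = a + b
⟦ sub ⟧ a b       = a ∸ b
⟦ mul ⟧ a b       = a * b
⟦ div ⟧ a zero    = 0
⟦ div ⟧ a (suc b) = a / suc b
⟦ rem ⟧ a zero    = 0
⟦ rem ⟧ a (suc b) = a % suc b

data Param : Set where
  n-param m-param s-param p-param : Param

data ReadOnly : Set where
  x-list y-list h-fun : ReadOnly

data Instr : Set where
  const : Addr → ℕ → Instr                 -- M[d] := c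
  arith : Op → Addr → Addr → Addr → Instr  -- M[d] := M[a] op M[b]
  load  : Addr → Addr → Instr              -- M[d] := M[M[a]]
  store : Addr → Addr → Instr              -- M[M[a]] := M[b]
  param : Addr → Param → Instr             -- M[d] := n, m, s or p
  read  : ReadOnly → Addr → Addr → Instr   -- M[d] := x, y or h at position M[a]
  coin  : Addr → Instr                     -- M[d] := a fresh uniform bit
  jumpz : Addr → Label → Instr             -- if M[a] = 0 then goto l
  halt  : Bool → Instr                     -- true: claim YES, false: claim NO

-- One finite program serves all inputs; it runs with words of
-- wordFactor · (⌈log₂ n⌉ + ⌈log₂ m⌉) bits.
record Algorithm : Set where
  field
    code       : List Instr
    wordFactor : ℕ

wordSize : Algorithm → ℕ → ℕ → ℕ
wordSize A n m = Algorithm.wordFactor A * (⌈log₂ n ⌉ + ⌈log₂ m ⌉)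

record Input (n m : ℕ) : Set where
  constructor input
  field
    s p : ℕ
    x y : Vec (Fin m) n

RandomFunction : (n m : ℕ) → Set
RandomFunction n m = Vec (Fin n) m

record State (w : ℕ) : Set where
  constructor state
  field
    pc     : Label
    memory : Addr → Word w
    -- 1 + the largest address written so far; every cell from there on still
    -- has its initial value 0
    used   : ℕ
    output : Maybe Bool

open State public

fetch : List Instr → Label → Maybe Instr
fetch []       _       = nothing
fetch (i ∷ _)  zero    = just i
fetch (_ ∷ is) (suc l) = fetch is l

-- Reading out of range gives 0.
entry : ∀ {k l} → Vec (Fin k) l → ℕ → ℕ
entry {l = l} z i with i <? l
... | yes i<l = toℕ (Vec.lookup z (fromℕ< i<l))
... | no  _   = 0

module _ {n m w : ℕ} (I : Input n m) (h : RandomFunction n m) where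

  open Input I

  paramValue : Param → ℕ
  paramValue n-param = n
  paramValue m-param = m
  paramValue s-param = s
  paramValue p-param = p

  readValue : ReadOnly → ℕ → ℕ
  readValue x-list = entry x
  readValue y-list = entry y
  readValue h-fun  = entry h

  write : Addr → ℕ → State w → State w
  write d v σ = record σ
    { pc     = suc (pc σ)
    ; memory = λ a → if a ≡ᵇ d then truncate w v else memory σ a
    ; used   = used σ ⊔ suc d
    }

  exec : Instr → Bool → State w → State w
  exec instr bit σ = go instr
    where
    M : Addr → ℕ
    M a = toℕ (memory σ a)

    go : Instr → State w
    go (const d c)      = write d c σ
    go (arith op d a b) = write d (⟦ op ⟧ (M a) (M b)) σ
    go (load d a)       = write d (M (M a)) σ
    go (store a b)      = write (M a) (M b) σ
    go (param d q)      = write d (paramValue q) σ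
    go (read r d a)     = write d (readValue r (M a)) σ
    go (coin d)         = write d (if bit then 1 else 0) σ
    go (jumpz a l)      = record σ { pc = if M a ≡ᵇ 0 then l else suc (pc σ) }
    go (halt b)         = record σ { output = just b }

  -- A halted machine stays put; leaving the program amounts to claiming NO.
  step : List Instr → Bool → State w → State w
  step code bit σ with output σ | fetch code (pc σ)
  ... | just _  | _          = σ
  ... | nothing | nothing    = record σ { output = just false }
  ... | nothing | just instr = exec instr bit σ

  -- Step number i uses the i-th coin if it executes a coin instruction and
  -- ignores it otherwise, so Vec Bool t carries both the randomness and the
  -- number of steps.
  steps : List Instr → ∀ {t} → Vec Bool t → State w → State w
  steps code []           σ = σ
  steps code (bit ∷ bits) σ = steps code bits (step code bit σ)

initial : ∀ w → State w
initial w = state 0 (λ _ → truncate w 0) 0 nothing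

run : (A : Algorithm) → ∀ {n m t} → Input n m → RandomFunction n m → Vec Bool t →
      State (wordSize A n m)
run A {n} {m} I h coins = steps I h (Algorithm.code A) coins (initial (wordSize A n m))

------------------------------------------------------------------------
-- Probability over a uniform h : [m] → [n] and independent fair coins.

vecs : ∀ {a} {A : Set a} → List A → ∀ k → List (Vec A k)
vecs as zero    = [] ∷ []
vecs as (suc k) = cartesianProductWith _∷_ as (vecs as k)

sampleSpace : ∀ n m t → List (RandomFunction n m × Vec Bool t)
sampleSpace n m t = cartesianProduct (vecs (allFin n) m) (vecs (true ∷ false ∷ []) t)

runsClaimingNo : Algorithm → ∀ {n m} → Input n m → ∀ t →
                 List (RandomFunction n m × Vec Bool t)
runsClaimingNo A {n} {m} I t =
  filter (λ (h , coins) → ≡-dec _≟_ (output (run A I h coins)) (just false))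
         (sampleSpace n m t)

-- Pr[A claims NO] ≤ ε, with the denominator n^m · 2^t multiplied out.
ProbClaimingNo≤ : ℚ → Algorithm → ∀ {n m} → Input n m → ℕ → Set
ProbClaimingNo≤ ε A {n} {m} I t =
  (+ length (runsClaimingNo A I t) ℚ./ 1)
    ℚ.≤ ε ℚ.* (+ length (sampleSpace n m t) ℚ./ 1)

-- A solves I with one-sided error ε, always within the given number of steps
-- and bits of memory.
record MonteCarloSolves (A : Algorithm) (ε : ℚ) {n m : ℕ} (I : Input n m)
                        (time space : ℕ) : Set where
  open Input I
  field
    halts            : ∀ h (coins : Vec Bool time) → Is-just (output (run A I h coins))
    spaceBound       : ∀ h (coins : Vec Bool time) →
                       used (run A I h coins) * wordSize A n m ≤ space
    noFalsePositives : ∀ h (coins : Vec Bool time) →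
                       output (run A I h coins) ≡ just true → NotDisjoint x y
    falseNegatives   : NotDisjoint x y → ProbClaimingNo≤ ε A I time

------------------------------------------------------------------------

-- ⌈ n √(p/s) ⌉ for s ≥ 1: the number of naturals r < n √(p/s), i.e. with
-- s r² < n² p; every such r is below n² p.
⌈_√[_/_]⌉ : ℕ → ℕ → ℕ → ℕ
⌈ n √[ p / s ]⌉ = length (filter (λ r → s * r ^ 2 <? n ^ 2 * p) (upTo (n ^ 2 * p)))

-- C · T · (log T)^k
Õ-bound : (C k T : ℕ) → ℕ
Õ-bound C k T = C * (T * ⌈log₂ T ⌉ ^ k)

-- Walk on [n] by v ↦ h(label v) + g(v), where label v is the list entry at v and
-- g is a degree-three polynomial hash, so that the walk is random for most h and
-- repeated rounds with fresh g behave almost independently. If x_i = y_j, two of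
-- 2q walks, one through i and one through j, then continue along the same path.
-- They stop at the first vertex of a random interval of length about n / ℓ,
-- where a table of s slots remembers the start of the last walk, so both are
-- found and traced again in step up to the collision.
-- A good meeting is isolated and light. Its expectation over (g , h) is computed
-- from the first moment; the second moment over h, with two independent hashes
-- g and g′, is bounded by counting the tables that satisfy the constraints of
-- both pairs of walks. A tangent to the convex failure probability then turns
-- p / q + 1 rounds into constant success probability, and q runs over s, s / 2, …
-- because the number of colliding pairs is unknown. An even
-- vertex stands for a position of x and an odd one for a position of y; six
-- relative rotations of the lists make every pair of positions visible.

module Submission where

open import Defs using (vecs; entry; freq; sumSquaredFreqs)
open import Data.Bool using (Bool; true; false; if_then_else_)
import Data.Bool as Bool
open import Data.Empty using (⊥; ⊥-elim)
open import Data.Fin as Fin using (Fin; zero; suc; toℕ; fromℕ<; _↑ˡ_; _↑ʳ_; splitAt)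
import Data.Fin.Properties as Fin
open import Data.Integer as ℤ using (ℤ; -[1+_]; _⊖_) renaming (+_ to ι_)
import Data.Integer.DivMod as ℤ
import Data.Integer.Properties as ℤ
import Data.Integer.Tactic.RingSolver as ℤ-Solver
open import Data.List using (List; []; _∷_; _++_; map; length; filter; upTo; applyUpTo; allFin; tabulate; cartesianProduct; cartesianProductWith)
import Data.List.Properties as List
open import Data.List.Membership.Propositional using (_∈_; _∉_; find)
import Data.List.Membership.Propositional.Properties as Mem
open import Data.List.Relation.Unary.All as All using (All; []; _∷_)
import Data.List.Relation.Unary.All.Properties as All
open import Data.List.Relation.Unary.AllPairs as AllPairs using (AllPairs; []; _∷_)
import Data.List.Relation.Unary.AllPairs.Properties as AllPairs
open import Data.List.Relation.Unary.Any as Any using (here; there)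
import Data.List.Relation.Unary.Unique.DecPropositional as DecUnique
open import Data.List.Relation.Unary.Unique.Propositional using (Unique)
import Data.List.Relation.Unary.Unique.Propositional.Properties as Unique
open import Data.Maybe using (Maybe; just; nothing; Is-just)
import Data.Maybe.Properties as Maybe
import Data.Maybe.Relation.Unary.Any as MaybeAny
open import Data.Nat
open import Data.Nat.DivMod
open import Data.Nat.Induction using (<-rec)
open import Data.Nat.ListAction using (sum)
open import Data.Nat.Logarithm
open import Data.Nat.Properties renaming (≤-trans to ⊑; ≤-reflexive to leq; ≤-refl to rfl≤; *-monoʳ-≤ to *ʳ; *-monoˡ-≤ to *ˡ; +-monoʳ-≤ to +ʳ; +-monoˡ-≤ to +ˡ; *-mono-≤ to *≤; +-mono-≤ to +≤; +-identityʳ to +0; *-identityʳ to *1; *-cancelˡ-≤ to /ˡ; *-cancelʳ-≤ to /ʳ; <-≤-trans to <≤; ≤-<-trans to ≤<; module ≤-Reasoning to ≤R)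
open import Data.Nat.Tactic.RingSolver using () renaming (solve-∀ to ring)
open import Data.Product using (Σ; Σ-syntax; ∃; ∃-syntax; ∃₂; _×_; _,_; proj₁; proj₂)
open import Data.Rational as ℚ using (ℚ; 1ℚ) renaming (_<_ to _<ℚ_)
import Data.Rational.Properties as ℚ
open import Data.Rational.Unnormalised as ℚᵘ using (mkℚᵘ; *≤*; *<*)
import Data.Rational.Unnormalised.Properties as ℚᵘ
open import Data.Sum using (_⊎_; inj₁; inj₂; [_,_]′)
open import Data.Unit using (⊤; tt)
open import Data.Vec as Vec using (Vec; []; _∷_; lookup; toList; _[_]≔_)
import Data.Vec.Properties as Vec
open import Function using (_∘_; id)
open import Relation.Binary.Definitions using (Tri; tri<; tri≈; tri>)
open import Relation.Binary.PropositionalEquality renaming (trans to tr; cong to ap; cong₂ to ap₂; module ≡-Reasoning to ≡R)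
open import Relation.Nullary using (Dec; yes; no; ¬_; ¬?; does) renaming (contradiction to refute)
open import Relation.Nullary.Decidable using (_×-dec_)

-- Degree three is what the second moment asks for. Once the values of `h` seen by one pair of walks
-- are known, a walk of an independent pair reaches its end through a fresh value of `h` at its last
-- or last but one step, or else through two known values in a row, which only the new hash
-- randomizes. The two walks together thus involve at most four hash values. The modulus of the hash
-- is a power of two, because coins draw a uniform residue directly. The factors left behind are
-- differences of points; a modulus of at least `(2 + m ^ 3) * n`, of which the hash keeps the
-- leading part, absorbs them. The length `ℓ` is, up to a constant, as large as `s p ℓ² ≤ n²`
-- permits, so that a meeting stays undisturbed by all other walks with constant probability. A
-- round of `2 q` walks takes about `q ℓ` steps, and about `p / q` rounds are made; hence every
-- level `q` costs about `p ℓ`, which is about `n √(p / s)`, and trying all levels adds a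
-- logarithmic factor only.

private variable
 𝓐 𝓑 𝓒 : Set

-- Finite sums and indicators.

Ʃ : List 𝓐 -> (𝓐 -> ℕ) -> ℕ
Ʃ [] φ = 0
Ʃ (x ∷ xs) φ = φ x + Ʃ xs φ

Ʃ-syntax : List 𝓐 -> (𝓐 -> ℕ) -> ℕ
Ʃ-syntax = Ʃ

infixr 8 Ʃ-syntax
syntax Ʃ-syntax xs (λ x -> e) = Ʃ[ x ← xs ] e

Ʃ≡ : ∀ {φ ψ : 𝓐 -> ℕ} xs -> (∀ x -> φ x ≡ ψ x) -> Ʃ xs φ ≡ Ʃ xs ψ
Ʃ≡ [] eq = refl
Ʃ≡ (x ∷ xs) eq = ap₂ _+_ (eq x) (Ʃ≡ xs eq)

Ʃ-mono-∈ : ∀ {φ ψ : 𝓐 -> ℕ} xs -> (∀ x -> x ∈ xs -> φ x ≤ ψ x) -> Ʃ xs φ ≤ Ʃ xs ψ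
Ʃ-mono-∈ [] le = z≤n
Ʃ-mono-∈ (x ∷ xs) le = +≤ (le x (here refl)) (Ʃ-mono-∈ xs (λ y y∈ -> le y (there y∈)))

Ʃ≤ : ∀ {φ ψ : 𝓐 -> ℕ} xs -> (∀ x -> φ x ≤ ψ x) -> Ʃ xs φ ≤ Ʃ xs ψ
Ʃ≤ xs le = Ʃ-mono-∈ xs (λ x _ -> le x)

Ʃ-0 : ∀ (xs : List 𝓐) -> Ʃ xs (λ _ -> 0) ≡ 0
Ʃ-0 [] = refl
Ʃ-0 (x ∷ xs) = Ʃ-0 xs

Ʃ-+ : ∀ xs (φ ψ : 𝓐 -> ℕ) -> Ʃ[ x ← xs ] (φ x + ψ x) ≡ Ʃ xs φ + Ʃ xs ψ
Ʃ-+ [] φ ψ = refl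
Ʃ-+ (x ∷ xs) φ ψ = tr (ap ((φ x + ψ x) +_) (Ʃ-+ xs φ ψ)) (alg (φ x) (ψ x) (Ʃ xs φ) (Ʃ xs ψ))
 where
 alg : ∀ a b c d -> a + b + (c + d) ≡ a + c + (b + d)
 alg = ring

Ʃ-*ˡ : ∀ c xs (φ : 𝓐 -> ℕ) -> Ʃ[ x ← xs ] (c * φ x) ≡ c * Ʃ xs φ
Ʃ-*ˡ c [] φ = sym (*-zeroʳ c)
Ʃ-*ˡ c (x ∷ xs) φ = tr (ap (c * φ x +_) (Ʃ-*ˡ c xs φ)) (sym (*-distribˡ-+ c (φ x) (Ʃ xs φ)))

Ʃ-*ʳ : ∀ c xs (φ : 𝓐 -> ℕ) -> Ʃ[ x ← xs ] (φ x * c) ≡ Ʃ xs φ * c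
Ʃ-*ʳ c xs φ = tr (Ʃ≡ xs (λ x -> *-comm (φ x) c)) (tr (Ʃ-*ˡ c xs φ) (*-comm c (Ʃ xs φ)))

Ʃ-const : ∀ (xs : List 𝓐) c -> Ʃ[ _ ← xs ] c ≡ length xs * c
Ʃ-const [] c = refl
Ʃ-const (x ∷ xs) c = ap (c +_) (Ʃ-const xs c)

Ʃ-≤-const : ∀ (xs : List 𝓐) {φ} c -> (∀ x -> φ x ≤ c) -> Ʃ xs φ ≤ length xs * c
Ʃ-≤-const xs c le = ⊑ (Ʃ≤ xs le) (leq (Ʃ-const xs c))

Ʃ-++ : ∀ xs ys (φ : 𝓐 -> ℕ) -> Ʃ (xs ++ ys) φ ≡ Ʃ xs φ + Ʃ ys φ
Ʃ-++ [] ys φ = refl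
Ʃ-++ (x ∷ xs) ys φ = tr (ap (φ x +_) (Ʃ-++ xs ys φ)) (sym (+-assoc (φ x) _ _))

Ʃ-map : ∀ (f : 𝓐 -> 𝓑) xs (φ : 𝓑 -> ℕ) -> Ʃ (map f xs) φ ≡ Ʃ xs (φ ∘ f)
Ʃ-map f [] φ = refl
Ʃ-map f (x ∷ xs) φ = ap (φ (f x) +_) (Ʃ-map f xs φ)

Ʃ⇆ : ∀ (xs : List 𝓐) (ys : List 𝓑) (φ : 𝓐 -> 𝓑 -> ℕ) ->
 Ʃ[ x ← xs ] Ʃ[ y ← ys ] φ x y ≡ Ʃ[ y ← ys ] Ʃ[ x ← xs ] φ x y
Ʃ⇆ [] ys φ = sym (Ʃ-0 ys)
Ʃ⇆ (x ∷ xs) ys φ = tr (ap (Ʃ ys (φ x) +_) (Ʃ⇆ xs ys φ))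
 (sym (Ʃ-+ ys (φ x) (λ y -> Ʃ[ x ← xs ] φ x y)))

Ʃ-⊗ : ∀ (f : 𝓐 -> 𝓑 -> 𝓒) xs ys (φ : 𝓒 -> ℕ) ->
 Ʃ (cartesianProductWith f xs ys) φ ≡ Ʃ[ x ← xs ] Ʃ[ y ← ys ] φ (f x y)
Ʃ-⊗ f [] ys φ = refl
Ʃ-⊗ f (x ∷ xs) ys φ =
 tr (Ʃ-++ (map (f x) ys) (cartesianProductWith f xs ys) φ)
  (ap₂ _+_ (Ʃ-map (f x) ys φ) (Ʃ-⊗ f xs ys φ))

Ʃ-*-Ʃ : ∀ xs ys (φ : 𝓐 -> ℕ) (ψ : 𝓑 -> ℕ) ->
 Ʃ xs φ * Ʃ ys ψ ≡ Ʃ[ x ← xs ] Ʃ[ y ← ys ] (φ x * ψ y)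
Ʃ-*-Ʃ xs ys φ ψ = sym (tr (Ʃ≡ xs (λ x -> Ʃ-*ˡ (φ x) ys ψ)) (Ʃ-*ʳ (Ʃ ys ψ) xs φ))

term≤Ʃ : ∀ {x} {xs : List 𝓐} φ -> x ∈ xs -> φ x ≤ Ʃ xs φ
term≤Ʃ φ (here refl) = m≤m+n _ _
term≤Ʃ φ (there x∈) = ⊑ (term≤Ʃ φ x∈) (m≤n+m _ _)

Ʃ>0⇒∃ : ∀ xs (φ : 𝓐 -> ℕ) -> 0 < Ʃ xs φ -> ∃ λ x -> x ∈ xs × 0 < φ x
Ʃ>0⇒∃ (x ∷ xs) φ pos with φ x in eq
... | suc _ = x , here refl , subst (0 <_) (sym eq) (s≤s z≤n)
... | zero = let y , y∈ , py = Ʃ>0⇒∃ xs φ pos in y , there y∈ , py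

-- Mutually exclusive indicators add up to an indicator. This is how a count of meetings becomes an
-- event.
Ʃ≤1 : ∀ xs (φ : 𝓐 -> ℕ) -> Unique xs -> (∀ x -> φ x ≤ 1) ->
 (∀ x y -> x ∈ xs -> y ∈ xs -> 0 < φ x -> 0 < φ y -> x ≡ y) -> Ʃ xs φ ≤ 1
Ʃ≤1 [] φ _ _ _ = z≤n
Ʃ≤1 (x ∷ xs) φ (x∉ ∷ u) le1 excl with φ x in eq | Ʃ xs φ in eq'
... | zero | _ = subst (_≤ 1) eq' (Ʃ≤1 xs φ u le1 (λ y z y∈ z∈ -> excl y z (there y∈) (there z∈)))
... | suc n | zero = subst (_≤ 1) (tr eq (sym (+0 _))) (le1 x)
... | suc n | suc k =
 let y , y∈ , py = Ʃ>0⇒∃ xs φ (subst (0 <_) (sym eq') (s≤s z≤n))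
 in refute (excl x y (here refl) (there y∈) (subst (0 <_) (sym eq) (s≤s z≤n)) py) (All.lookup x∉ y∈)

𝟙 : ∀ {P : Set} -> Dec P -> ℕ
𝟙 d = if does d then 1 else 0

𝟙-yes : ∀ {P : Set} (d : Dec P) -> P -> 𝟙 d ≡ 1
𝟙-yes (yes _) _ = refl
𝟙-yes (no ¬p) p = refute p ¬p

𝟙-no : ∀ {P : Set} (d : Dec P) -> ¬ P -> 𝟙 d ≡ 0
𝟙-no (yes p) ¬p = refute p ¬p
𝟙-no (no _) _ = refl

𝟙>0 : ∀ {P : Set} (d : Dec P) -> 0 < 𝟙 d -> P
𝟙>0 (yes p) _ = p

𝟙≤1 : ∀ {P : Set} (d : Dec P) -> 𝟙 d ≤ 1
𝟙≤1 (yes _) = rfl≤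
𝟙≤1 (no _) = z≤n

𝟙-mono : ∀ {P Q : Set} (p : Dec P) (q : Dec Q) -> (P -> Q) -> 𝟙 p ≤ 𝟙 q
𝟙-mono (yes p) q f = leq (sym (𝟙-yes q (f p)))
𝟙-mono (no _) q f = z≤n

𝟙-cong : ∀ {P Q : Set} (p : Dec P) (q : Dec Q) -> (P -> Q) -> (Q -> P) -> 𝟙 p ≡ 𝟙 q
𝟙-cong p q f g = ≤-antisym (𝟙-mono p q f) (𝟙-mono q p g)

*>0ˡ : ∀ a {b} -> 0 < a * b -> 0 < a
*>0ˡ (suc a) _ = s≤s z≤n

*>0ʳ : ∀ a {b} -> 0 < a * b -> 0 < b
*>0ʳ a {zero} p = ⊥-elim (n≮0 (subst (0 <_) (*-zeroʳ a) p))
*>0ʳ a {suc b} p = s≤s z≤n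

filter-length : ∀ {P : 𝓐 -> Set} (P? : ∀ x -> Dec (P x)) xs -> length (filter P? xs) ≡ Ʃ[ x ← xs ] 𝟙 (P? x)
filter-length P? [] = refl
filter-length P? (x ∷ xs) with does (P? x)
... | true = ap suc (filter-length P? xs)
... | false = filter-length P? xs

-- Sums over ranges and finite types.

Ʃ< : ℕ -> (ℕ -> ℕ) -> ℕ
Ʃ< n = Ʃ (upTo n)

Ʃ<-suc : ∀ n φ -> Ʃ< (suc n) φ ≡ φ 0 + Ʃ< n (φ ∘ suc)
Ʃ<-suc n φ = ap (φ 0 +_) (tr (ap (λ xs -> Ʃ xs φ) (sym (List.map-upTo suc n))) (Ʃ-map suc (upTo n) φ))

Ʃ<-+ : ∀ a b φ -> Ʃ< (a + b) φ ≡ Ʃ< a φ + Ʃ< b (λ x -> φ (a + x))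
Ʃ<-+ zero b φ = refl
Ʃ<-+ (suc a) b φ = begin _ ≡⟨ Ʃ<-suc (a + b) φ ⟩
 _ ≡⟨ ap (φ 0 +_) (Ʃ<-+ a b (φ ∘ suc)) ⟩
 _ ≡⟨ sym (+-assoc (φ 0) _ _) ⟩
 _ ≡⟨ ap (_+ Ʃ< b (λ x -> φ (suc (a + x)))) (sym (Ʃ<-suc a φ)) ⟩ _ ∎
 where open ≡R

Ʃ<-last : ∀ n φ -> Ʃ< (suc n) φ ≡ Ʃ< n φ + φ n
Ʃ<-last n φ = begin _ ≡⟨ ap (λ k -> Ʃ< k φ) (sym (+-comm n 1)) ⟩
 _ ≡⟨ Ʃ<-+ n 1 φ ⟩
 _ ≡⟨ ap (Ʃ< n φ +_) (tr (+0 _) (ap φ (+0 n))) ⟩ _ ∎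
 where open ≡R

Ʃ<-mono : ∀ n {φ ψ : ℕ -> ℕ} -> (∀ x -> x < n -> φ x ≤ ψ x) -> Ʃ< n φ ≤ Ʃ< n ψ
Ʃ<-mono zero le = z≤n
Ʃ<-mono (suc n) {φ} {ψ} le = subst₂ _≤_ (sym (Ʃ<-suc n φ)) (sym (Ʃ<-suc n ψ))
 (+≤ (le 0 (s≤s z≤n)) (Ʃ<-mono n (λ x x<n -> le (suc x) (s≤s x<n))))

Ʃ<-cong : ∀ n {φ ψ : ℕ -> ℕ} -> (∀ x -> x < n -> φ x ≡ ψ x) -> Ʃ< n φ ≡ Ʃ< n ψ
Ʃ<-cong n eq = ≤-antisym (Ʃ<-mono n (λ x x<n -> leq (eq x x<n)))
 (Ʃ<-mono n (λ x x<n -> leq (sym (eq x x<n))))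

Ʃ<-const : ∀ n c -> Ʃ< n (λ _ -> c) ≡ n * c
Ʃ<-const n c = tr (Ʃ-const (upTo n) c) (ap (_* c) (List.length-upTo n))

Ʃ<-* : ∀ a b φ -> Ʃ< (a * b) φ ≡ Ʃ< a (λ i -> Ʃ< b (λ j -> φ (i * b + j)))
Ʃ<-* zero b φ = refl
Ʃ<-* (suc a) b φ = begin _ ≡⟨ Ʃ<-+ b (a * b) φ ⟩
 _ ≡⟨ ap (Ʃ< b φ +_) (Ʃ<-* a b (λ x -> φ (b + x))) ⟩
 _ ≡⟨ ap (Ʃ< b φ +_) (Ʃ≡ (upTo a) λ i -> Ʃ≡ (upTo b) λ j -> ap φ (sym (+-assoc b (i * b) j))) ⟩
 _ ≡⟨ Ʃ<-suc a (λ i -> Ʃ< b (λ j -> φ (i * b + j))) ⟨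
 _ ∎
 where open ≡R

Ʃ<-shift : ∀ M φ -> (∀ x -> φ (M + x) ≡ φ x) -> ∀ s -> Ʃ< M (λ x -> φ (s + x)) ≡ Ʃ< M φ
Ʃ<-shift M φ per zero = refl
Ʃ<-shift M φ per (suc s) = begin _ ≡⟨ Ʃ≡ (upTo M) (λ x -> ap φ (sym (+-suc s x))) ⟩
 _ ≡⟨ one (λ x -> φ (s + x)) per' ⟩
 _ ≡⟨ Ʃ<-shift M φ per s ⟩ _ ∎
 where
 open ≡R
 per' : φ (s + M) ≡ φ (s + 0)
 per' = tr (ap φ (+-comm s M)) (tr (per s) (ap φ (sym (+0 s))))
 one : ∀ (ψ : ℕ -> ℕ) -> ψ M ≡ ψ 0 -> Ʃ< M (ψ ∘ suc) ≡ Ʃ< M ψ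
 one ψ eq = +-cancelˡ-≡ (ψ 0) _ _ (begin _ ≡⟨ Ʃ<-suc M ψ ⟨
  _ ≡⟨ Ʃ<-last M ψ ⟩
  _ ≡⟨ tr (ap (Ʃ< M ψ +_) eq) (+-comm _ (ψ 0)) ⟩ _ ∎)

Ʃ-allFin-suc : ∀ n (φ : Fin (suc n) -> ℕ) -> Ʃ (allFin (suc n)) φ ≡ φ zero + Ʃ (allFin n) (φ ∘ suc)
Ʃ-allFin-suc n φ = ap (φ zero +_) (tr (ap (λ xs -> Ʃ xs φ) (sym (List.map-tabulate id suc))) (Ʃ-map suc (allFin n) φ))

Ʃ-allFin : ∀ n (φ : ℕ -> ℕ) -> Ʃ (allFin n) (φ ∘ toℕ) ≡ Ʃ< n φ
Ʃ-allFin zero φ = refl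
Ʃ-allFin (suc n) φ = tr (Ʃ-allFin-suc n (φ ∘ toℕ)) (tr (ap (φ 0 +_) (Ʃ-allFin n (φ ∘ suc))) (sym (Ʃ<-suc n φ)))

Ʃ-Fin : ∀ n c -> Ʃ (allFin n) (λ _ -> c) ≡ n * c
Ʃ-Fin n c = tr (Ʃ-const (allFin n) c) (ap (_* c) (List.length-tabulate {n = n} id))

Ʃ-allFin-δ : ∀ {n} (c : Fin n) (φ : Fin n -> ℕ) -> Ʃ[ x ← allFin n ] (𝟙 (c Fin.≟ x) * φ x) ≡ φ c
Ʃ-allFin-δ {suc n} zero φ = tr (Ʃ-allFin-suc n (λ x -> 𝟙 (zero Fin.≟ x) * φ x)) (tr (ap₂ _+_ (+0 (φ zero)) (Ʃ-0 (allFin n))) (+0 _))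
Ʃ-allFin-δ {suc n} (suc c) φ = tr (Ʃ-allFin-suc n (λ x -> 𝟙 (suc c Fin.≟ x) * φ x))
 (tr (Ʃ≡ (allFin n) (λ x -> ap (_* φ (suc x)) (𝟙-cong (suc c Fin.≟ suc x) (c Fin.≟ x) Fin.suc-injective (ap suc))))
  (Ʃ-allFin-δ c (φ ∘ suc)))

-- Sums over vectors and resampling of entries.

Ʃ-vecs-suc : ∀ (as : List 𝓐) k (φ : Vec 𝓐 (suc k) -> ℕ) ->
 Ʃ (vecs as (suc k)) φ ≡ Ʃ[ a ← as ] Ʃ[ v ← vecs as k ] φ (a ∷ v)
Ʃ-vecs-suc as k φ = Ʃ-⊗ _∷_ as (vecs as k) φ

Ʃ-vecs-++ : ∀ (as : List 𝓐) j k (φ : Vec 𝓐 (j + k) -> ℕ) ->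
 Ʃ (vecs as (j + k)) φ ≡ Ʃ[ u ← vecs as j ] Ʃ[ v ← vecs as k ] φ (u Vec.++ v)
Ʃ-vecs-++ as zero k φ = sym (+0 _)
Ʃ-vecs-++ as (suc j) k φ = begin _ ≡⟨ Ʃ-vecs-suc as (j + k) φ ⟩
 _ ≡⟨ Ʃ≡ as (λ a -> Ʃ-vecs-++ as j k (φ ∘ (a ∷_))) ⟩
 _ ≡⟨ Ʃ-vecs-suc as j _ ⟨
 _ ∎
 where open ≡R

length-vecs : ∀ (as : List 𝓐) k -> length (vecs as k) ≡ length as ^ k
length-vecs as k = tr (sym (*1 _)) (tr (sym (Ʃ-const (vecs as k) 1)) (go k))
 where
 go : ∀ k -> Ʃ (vecs as k) (λ _ -> 1) ≡ length as ^ k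
 go zero = refl
 go (suc k) = tr (Ʃ-vecs-suc as k _) (tr (Ʃ-const as _) (ap (length as *_) (go k)))

-- In a uniform vector the entry at `i` is uniform and independent of the others, so a fresh element
-- may take its place wherever `φ` sees the entry only through its second argument.
resample : ∀ (as : List 𝓐) {k} (i : Fin k) (φ : Vec 𝓐 k -> 𝓐 -> ℕ) ->
 (∀ v a x -> φ (v [ i ]≔ a) x ≡ φ v x) ->
 length as * Ʃ[ v ← vecs as k ] φ v (lookup v i) ≡ Ʃ[ v ← vecs as k ] Ʃ[ x ← as ] φ v x
resample as {suc k} zero φ inv = begin _ ≡⟨ ap (length as *_) (Ʃ-vecs-suc as k _) ⟩
 _ ≡⟨ sym (Ʃ-const as _) ⟩
 _ ≡⟨ Ʃ≡ as (λ b -> Ʃ⇆ as (vecs as k) _) ⟩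
 _ ≡⟨ Ʃ≡ as (λ b -> Ʃ≡ (vecs as k) λ v -> Ʃ≡ as λ a -> inv (b ∷ v) a a) ⟩
 _ ≡⟨ Ʃ-vecs-suc as k _ ⟨
 _ ∎
 where open ≡R
resample as {suc k} (suc i) φ inv = begin _ ≡⟨ ap (length as *_) (Ʃ-vecs-suc as k _) ⟩
 _ ≡⟨ Ʃ-*ˡ (length as) as _ ⟨
 _ ≡⟨ Ʃ≡ as (λ a -> resample as i (φ ∘ (a ∷_)) (λ v -> inv (a ∷ v))) ⟩
 _ ≡⟨ Ʃ-vecs-suc as k _ ⟨
 _ ∎
 where open ≡R

-- Resampling the entry at a position that may depend on the vector, as long
-- as it does not depend on the entry at that position.
adaptive-resample : ∀ (as : List 𝓐) {k} {G : Vec 𝓐 k -> Set} (G? : ∀ v -> Dec (G v)) (q : Vec 𝓐 k -> Fin k) (φ : Vec 𝓐 k -> 𝓐 -> ℕ) ->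
 (∀ v a -> G v -> G (v [ q v ]≔ a) × q (v [ q v ]≔ a) ≡ q v × (∀ x -> φ (v [ q v ]≔ a) x ≡ φ v x)) ->
 length as * Ʃ[ v ← vecs as k ] (𝟙 (G? v) * φ v (lookup v (q v))) ≡ Ʃ[ v ← vecs as k ] (𝟙 (G? v) * Ʃ[ x ← as ] φ v x)
adaptive-resample {𝓐 = 𝓐} as {k} {G} G? q φ inv = begin _ ≡⟨ ap (length as *_) (Ʃ≡ (vecs as k) λ v -> sym (Ʃ-allFin-δ (q v) (λ i -> 𝟙 (G? v) * φ v (lookup v i)))) ⟩
 _ ≡⟨ ap (length as *_) (Ʃ⇆ (vecs as k) (allFin k) _) ⟩
 _ ≡⟨ sym (Ʃ-*ˡ (length as) (allFin k) _) ⟩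
 _ ≡⟨ Ʃ≡ (allFin k) (λ i -> resample as i (Ψ i) (stable i)) ⟩
 _ ≡⟨ Ʃ⇆ (allFin k) (vecs as k) _ ⟩
 _ ≡⟨ Ʃ≡ (vecs as k) (λ v -> tr (Ʃ≡ (allFin k) λ i -> Ʃ-*ˡ (𝟙 (q v Fin.≟ i)) as _) (tr (Ʃ-allFin-δ (q v) _) (Ʃ-*ˡ (𝟙 (G? v)) as _))) ⟩ _ ∎
 where
 open ≡R
 -- The part of the sum on which `q v ≡ i`. Its position is fixed, so `resample` applies.
 Ψ : Fin k -> Vec 𝓐 k -> 𝓐 -> ℕ
 Ψ i v x = 𝟙 (q v Fin.≟ i) * (𝟙 (G? v) * φ v x)
 Ψ-yes : ∀ i v x -> q v ≡ i -> G v -> Ψ i v x ≡ φ v x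
 Ψ-yes i v x p g = tr (ap₂ (λ a b -> a * (b * φ v x)) (𝟙-yes (q v Fin.≟ i) p) (𝟙-yes (G? v) g)) (tr (+0 _) (+0 _))
 Ψ-no : ∀ i v x -> ¬ (q v ≡ i × G v) -> Ψ i v x ≡ 0
 Ψ-no i v x ¬p with q v Fin.≟ i | G? v
 ... | yes p | yes g = refute (p , g) ¬p
 ... | yes _ | no _ = refl
 ... | no _ | _ = refl
 stable : ∀ i v a x -> Ψ i (v [ i ]≔ a) x ≡ Ψ i v x
 stable i v a x with q v Fin.≟ i | G? v
 ... | yes refl | yes g = let g' , q≡ , φ≡ = inv v a g in tr (Ψ-yes i _ x q≡ g') (tr (φ≡ x) (sym (tr (+0 _) (+0 _))))
 -- Writing the old entry back shows that the condition cannot arise by changing the entry.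
 ... | yes refl | no ¬g = Ψ-no i _ x (λ (q≡ , g') -> ¬g (subst G (tr (ap (λ j -> (v [ i ]≔ a) [ j ]≔ lookup v i) q≡) (tr (Vec.[]≔-idempotent v i) (Vec.[]≔-lookup v i))) (proj₁ (inv _ (lookup v i) g'))))
 ... | no ¬q | _ = Ψ-no i _ x (λ (q≡ , g') -> ¬q (tr (sym (ap q (tr (ap (λ j -> (v [ i ]≔ a) [ j ]≔ lookup v i) q≡) (tr (Vec.[]≔-idempotent v i) (Vec.[]≔-lookup v i)))))
  (tr (proj₁ (proj₂ (inv _ (lookup v i) g'))) q≡)))

-- Rotations of the vertices and walks through a table.

module _ {n : ℕ} .{{_ : NonZero n}} where

 V : List (Fin n)
 V = allFin n

 shift : ℕ -> Fin n -> Fin n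
 shift s x = (toℕ x + s) mod n

 unshift : ℕ -> Fin n -> Fin n
 unshift s y = shift (n ∸ s % n) y

 toℕ-shift : ∀ s x -> toℕ (shift s x) ≡ (toℕ x + s) % n
 toℕ-shift s x = Fin.toℕ-fromℕ< (m%n<n (toℕ x + s) n)

 private
  %-+ʳ : ∀ a b -> (a % n + b) % n ≡ (a + b) % n
  %-+ʳ a b = tr (%-distribˡ-+ (a % n) b n) (tr (ap (λ c -> (c + b % n) % n) (m%n%n≡m%n a n)) (sym (%-distribˡ-+ a b n)))

  +-cancel : ∀ s x -> (toℕ {n} x + (s + (n ∸ s % n))) % n ≡ toℕ x
  +-cancel s x = begin _ ≡⟨ ap (_% n) (+-comm (toℕ x) _) ⟩
   _ ≡⟨ %-+ʳ (s + (n ∸ s % n)) (toℕ x) ⟨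
   _ ≡⟨ ap (λ c -> (c + toℕ x) % n) zero≡ ⟩
   _ ≡⟨ m<n⇒m%n≡m (Fin.toℕ<n x) ⟩ _ ∎
   where
   open ≡R
   zero≡ : (s + (n ∸ s % n)) % n ≡ 0
   zero≡ = tr (sym (%-+ʳ s (n ∸ s % n))) (tr (ap (_% n) (m+[n∸m]≡n (<⇒≤ (m%n<n s n)))) (n%n≡0 n))

 unshift-shift : ∀ s x -> unshift s (shift s x) ≡ x
 unshift-shift s x = Fin.toℕ-injective (tr (toℕ-shift (n ∸ s % n) (shift s x)) (tr (ap (λ c -> (c + (n ∸ s % n)) % n) (toℕ-shift s x))
  (tr (%-+ʳ (toℕ x + s) (n ∸ s % n)) (tr (ap (_% n) (+-assoc (toℕ x) s _)) (+-cancel s x)))))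

 shift-unshift : ∀ s y -> shift s (unshift s y) ≡ y
 shift-unshift s y = Fin.toℕ-injective (tr (toℕ-shift s (unshift s y)) (tr (ap (λ c -> (c + s) % n) (toℕ-shift (n ∸ s % n) y))
  (tr (%-+ʳ (toℕ y + (n ∸ s % n)) s) (tr (ap (_% n) (tr (+-assoc (toℕ y) _ s) (ap (toℕ y +_) (+-comm _ s)))) (+-cancel s y)))))

 shift-≟ : ∀ s x y -> 𝟙 (shift s x Fin.≟ y) ≡ 𝟙 (unshift s y Fin.≟ x)
 shift-≟ s x y = 𝟙-cong (shift s x Fin.≟ y) (unshift s y Fin.≟ x) (λ { refl -> unshift-shift s x }) (λ { refl -> shift-unshift s y })

 Ʃ-shift : ∀ s (φ : Fin n -> ℕ) -> Ʃ[ x ← V ] φ (shift s x) ≡ Ʃ V φ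
 Ʃ-shift s φ = begin _ ≡⟨ Ʃ≡ V (λ x -> sym (Ʃ-allFin-δ (shift s x) φ)) ⟩
  _ ≡⟨ Ʃ⇆ V V _ ⟩
  _ ≡⟨ Ʃ≡ V (λ y -> Ʃ≡ V λ x -> ap (_* φ y) (shift-≟ s x y)) ⟩
  _ ≡⟨ Ʃ≡ V (λ y -> Ʃ-allFin-δ (unshift s y) (λ _ -> φ y)) ⟩ _ ∎
  where open ≡R

 length-V : length V ≡ n
 length-V = List.length-tabulate {n = n} id

 module Walks {K : ℕ} (sh : Fin K -> ℕ) (nx : Fin n -> Fin K) where

  Table : Set
  Table = Vec (Fin n) K

  tables : List Table
  tables = vecs V K

  F : Table -> Fin K -> Fin n
  F h k = shift (sh k) (lookup h k)

  Consts : Set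
  Consts = List (Fin K × Fin n)

  sat : Table -> Consts -> ℕ
  sat h [] = 1
  sat h ((k , y) ∷ cs) = 𝟙 (F h k Fin.≟ y) * sat h cs

  sat-++ : ∀ h cs ds -> sat h (cs ++ ds) ≡ sat h cs * sat h ds
  sat-++ h [] ds = sym (+0 _)
  sat-++ h ((k , y) ∷ cs) ds = tr (ap (𝟙 (F h k Fin.≟ y) *_) (sat-++ h cs ds)) (sym (*-assoc (𝟙 (F h k Fin.≟ y)) _ _))

  F-update : ∀ h k c k' -> k' ≢ k -> F (h [ k ]≔ c) k' ≡ F h k'
  F-update h k c k' k'≢k = ap (shift (sh k')) (Vec.lookup∘updateAt′ k' k k'≢k h)

  sat-update : ∀ h k c cs -> All (k ≢_) (map proj₁ cs) -> sat (h [ k ]≔ c) cs ≡ sat h cs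
  sat-update h k c [] [] = refl
  sat-update h k c ((k' , y) ∷ cs) (k≢ ∷ ks) =
   ap₂ _*_ (ap (λ x -> 𝟙 (x Fin.≟ y)) (F-update h k c k' (k≢ ∘ sym))) (sat-update h k c cs ks)

  -- Shifts are bijections, so each constraint on a new key prescribes one table entry and divides
  -- the number of tables by `n`.
  sat-count : ∀ cs -> Unique (map proj₁ cs) -> n ^ length cs * Ʃ[ h ← tables ] sat h cs ≡ n ^ K
  sat-count [] _ = tr (+0 _) (tr (Ʃ-const tables 1) (tr (*1 _) (tr (length-vecs V K) (ap (_^ K) length-V))))
  sat-count ((k , y) ∷ cs) (k∉ ∷ u) = begin _ ≡⟨ alg n (n ^ length cs) _ ⟩
   _ ≡⟨ ap (λ l -> n ^ length cs * (l * Ʃ[ h ← tables ] (𝟙 (F h k Fin.≟ y) * sat h cs))) (sym length-V) ⟩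
   _ ≡⟨ ap (n ^ length cs *_) (resample V k φ (λ h c x -> ap (𝟙 (shift (sh k) x Fin.≟ y) *_) (sat-update h k c cs k∉))) ⟩
   _ ≡⟨ ap (n ^ length cs *_) (Ʃ≡ tables once) ⟩
   _ ≡⟨ sat-count cs u ⟩
   n ^ K ∎
   where
   open ≡R
   φ : Table -> Fin n -> ℕ
   φ h x = 𝟙 (shift (sh k) x Fin.≟ y) * sat h cs
   once : ∀ h -> Ʃ[ x ← V ] (𝟙 (shift (sh k) x Fin.≟ y) * sat h cs) ≡ sat h cs
   once h = tr (Ʃ≡ V (λ x -> ap (_* sat h cs) (shift-≟ (sh k) x y))) (Ʃ-allFin-δ (unshift (sh k) y) (λ _ -> sat h cs))
   alg : ∀ a b c -> a * b * c ≡ b * (a * c)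
   alg = ring

  vertex : Table -> Fin K -> ℕ -> Fin n
  vertex h k zero = F h k
  vertex h k (suc j) = vertex h (nx (F h k)) j

  path : Table -> Fin K -> ∀ a -> Vec (Fin n) a
  path h k zero = []
  path h k (suc a) = F h k ∷ path h (nx (F h k)) a

  first : ∀ {a} -> Vec (Fin n) a -> Fin n -> Fin n
  first [] i = i
  first (u ∷ _) i = u

  -- The constraints of a walk after its first vertex, which `link` adds. The keys involved are
  -- therefore those of the vertices alone and do not mention the key where the walk starts.
  path# : ∀ {a} -> Vec (Fin n) a -> Fin n -> Consts
  path# [] i = []
  path# (u ∷ us) i = (nx u , first us i) ∷ path# us i

  keys-followed : ∀ {a} (us : Vec (Fin n) a) i -> map proj₁ (path# us i) ≡ map nx (toList us)
  keys-followed [] i = refl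
  keys-followed (u ∷ us) i = ap (nx u ∷_) (keys-followed us i)

  length-followed : ∀ {a} (us : Vec (Fin n) a) i -> length (path# us i) ≡ a
  length-followed [] i = refl
  length-followed (u ∷ us) i = ap suc (length-followed us i)

  link : Table -> Fin K -> ∀ {a} -> Vec (Fin n) a -> Fin n -> ℕ
  link h k us i = 𝟙 (F h k Fin.≟ first us i) * sat h (path# us i)

  -- Exactly one guess of the vertices and of the end agrees with the table. A function of the walk
  -- thus becomes a sum over guesses, whose constraints `sat-count` can count.
  Ʃ-link : ∀ h k a (φ : Vec (Fin n) a -> Fin n -> ℕ) ->
   Ʃ[ us ← vecs V a ] Ʃ[ i ← V ] (link h k us i * φ us i) ≡ φ (path h k a) (vertex h k a)
  Ʃ-link h k zero φ = tr (+0 _) (tr (Ʃ≡ V (λ i -> ap (_* φ [] i) (*1 (𝟙 (F h k Fin.≟ i))))) (Ʃ-allFin-δ (F h k) (φ [])))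
  Ʃ-link h k (suc a) φ = begin _ ≡⟨ Ʃ-vecs-suc V a _ ⟩
   _ ≡⟨ Ʃ≡ V (λ u -> Ʃ≡ (vecs V a) λ us -> tr (Ʃ≡ V λ i -> *-assoc (𝟙 (F h k Fin.≟ u)) _ _) (Ʃ-*ˡ (𝟙 (F h k Fin.≟ u)) V _)) ⟩
   _ ≡⟨ Ʃ≡ V (λ u -> Ʃ-*ˡ (𝟙 (F h k Fin.≟ u)) (vecs V a) _) ⟩
   _ ≡⟨ Ʃ-allFin-δ (F h k) _ ⟩
   _ ≡⟨ Ʃ-link h (nx (F h k)) a (λ us -> φ (F h k ∷ us)) ⟩ _ ∎
   where open ≡R

  ∈-path⁺ : ∀ h k {a} j -> j < a -> vertex h k j ∈ toList (path h k a)
  ∈-path⁺ h k {suc a} zero _ = here refl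
  ∈-path⁺ h k {suc a} (suc j) (s≤s j<a) = there (∈-path⁺ h (nx (F h k)) j j<a)

  wt : Fin K -> ℕ
  wt k = Ʃ[ x ← V ] 𝟙 (nx x Fin.≟ k)

  weight : List (Fin n) -> ℕ
  weight xs = Ʃ[ x ← xs ] wt (nx x)

  -- The number of pairs of vertices with the same successor key.
  pairs : ℕ
  pairs = weight V

  open DecUnique (Fin._≟_ {K}) public using (unique?)

  clash : List (Fin K) -> ℕ
  clash ks = 1 ∸ 𝟙 (unique? ks)

  Ʃ-toList : ∀ (χ : Fin n -> ℕ) N -> n * Ʃ[ us ← vecs V N ] Ʃ[ x ← toList us ] χ x ≡ n ^ N * (N * Ʃ V χ)
  Ʃ-toList χ zero = tr (*-zeroʳ n) refl
  Ʃ-toList χ (suc N) = begin _ ≡⟨ ap (n *_) (Ʃ-vecs-suc V N _) ⟩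
   _ ≡⟨ ap (n *_) (Ʃ≡ V λ u -> Ʃ-+ (vecs V N) _ _) ⟩
   _ ≡⟨ ap (n *_) (Ʃ-+ V _ _) ⟩
   _ ≡⟨ ap₂ (λ a b -> n * (a + b)) (Ʃ≡ V λ u -> tr (Ʃ-const (vecs V N) _) (ap (_* χ u) lengthN)) (Ʃ-Fin n R) ⟩
   _ ≡⟨ ap (λ a -> n * (a + n * R)) (Ʃ-*ˡ (n ^ N) V _) ⟩
   _ ≡⟨ ap (λ a -> n * (n ^ N * Ʃ V χ + a)) (Ʃ-toList χ N) ⟩
   _ ≡⟨ alg n (n ^ N) (Ʃ V χ) N ⟩ _ ∎
   where
   open ≡R
   R = Ʃ[ us ← vecs V N ] Ʃ[ x ← toList us ] χ x
   lengthN : length (vecs V N) ≡ n ^ N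
   lengthN = tr (length-vecs V N) (ap (_^ N) length-V)
   alg : ∀ n a p N -> n * (a * p + a * (N * p)) ≡ n * a * (suc N * p)
   alg = ring

  Ʃ-weight : ∀ N -> n * Ʃ[ us ← vecs V N ] weight (toList us) ≡ n ^ N * (N * pairs)
  Ʃ-weight = Ʃ-toList (wt ∘ nx)

  wts : List (Fin K) -> ℕ
  wts ks = Ʃ[ k ← ks ] wt k

  -- A uniformly random sequence of N vertices rarely repeats a key or meets
  -- one of the given keys.
  Ʃ-clash : ∀ N ks -> Unique ks ->
   n * n * Ʃ[ us ← vecs V N ] clash (map nx (toList us) ++ ks) ≤ n ^ N * (N * N * pairs + N * n * wts ks)
  Ʃ-clash zero ks u = ⊑ (leq (tr (ap (λ c -> n * n * (1 ∸ c + 0)) (𝟙-yes (unique? ks) u)) (*-zeroʳ (n * n)))) z≤n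
  Ʃ-clash (suc N) ks u = begin _ ≡⟨ ap (n * n *_) (tr (Ʃ-vecs-suc V N _) (Ʃ⇆ V (vecs V N) _)) ⟩
   _ ≤⟨ *ʳ (n * n) (Ʃ≤ (vecs V N) new) ⟩
   _ ≡⟨ ap (n * n *_) (tr (Ʃ-+ (vecs V N) _ _) (ap₂ _+_ (Ʃ-*ˡ n (vecs V N) _) (tr (Ʃ-+ (vecs V N) _ _)
     (ap (S +_) (tr (Ʃ-const (vecs V N) (wts ks)) (ap (_* wts ks) lengthN)))))) ⟩
   _ ≡⟨ alg n B S (n ^ N * wts ks) ⟩
   _ ≤⟨ +ˡ _ (+≤ (*ʳ n (Ʃ-clash N ks u)) (leq (ap (n *_) (Ʃ-weight N)))) ⟩
   -- Slack that completes `N² + N` to `(N + 1)²`.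
   _ ≤⟨ m≤m+n _ (n ^ suc N * (suc N * pairs)) ⟩
   _ ≡⟨ collect n (n ^ N) N pairs (wts ks) ⟩ _ ∎
   where
   open ≤R
   B = Ʃ[ us ← vecs V N ] clash (map nx (toList us) ++ ks)
   S = Ʃ[ us ← vecs V N ] weight (toList us)
   lengthN : length (vecs V N) ≡ n ^ N
   lengthN = tr (length-vecs V N) (ap (_^ N) length-V)
   alg : ∀ n B S w -> n * n * (n * B + (S + w)) ≡ n * (n * n * B) + n * (n * S) + n * n * w
   alg = ring
   collect : ∀ n a N p w -> n * (a * (N * N * p + N * n * w)) + n * (a * (N * p)) + n * n * (a * w) + n * a * (suc N * p) ≡
    n * a * (suc N * suc N * p + suc N * n * w)
   collect = ring
   hit : Fin K -> List (Fin K) -> ℕ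
   hit k js = Ʃ[ j ← js ] 𝟙 (k Fin.≟ j)
   clash-∷ : ∀ k js -> clash (k ∷ js) ≤ clash js + hit k js
   clash-∷ k js = cases (unique? (k ∷ js)) (unique? js) (0 <? hit k js)
    where
    cases : (d : Dec (Unique (k ∷ js))) (e : Dec (Unique js)) -> Dec (0 < hit k js) -> 1 ∸ 𝟙 d ≤ (1 ∸ 𝟙 e) + hit k js
    cases (yes _) e _ = z≤n
    cases (no _) (no _) _ = m≤m+n 1 _
    cases (no _) (yes _) (yes pos) = pos
    cases (no ¬u) (yes uj) (no ¬pos) = refute
     (All.tabulate (λ {j} j∈ k≡j -> ¬pos (⊑ (leq (sym (𝟙-yes (k Fin.≟ j) k≡j))) (term≤Ʃ (λ j -> 𝟙 (k Fin.≟ j)) j∈))) ∷ uj) ¬u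
   Ʃ-hit : ∀ js -> Ʃ[ u ← V ] hit (nx u) js ≡ wts js
   Ʃ-hit js = Ʃ⇆ V js _
   wts-map : ∀ xs -> wts (map nx xs) ≡ weight xs
   wts-map xs = Ʃ-map nx xs wt
   new : ∀ us -> Ʃ[ u ← V ] clash (nx u ∷ map nx (toList us) ++ ks) ≤ n * clash (map nx (toList us) ++ ks) + (weight (toList us) + wts ks)
   new us = begin _ ≤⟨ Ʃ≤ V (λ u -> clash-∷ (nx u) js) ⟩
    _ ≡⟨ Ʃ-+ V _ _ ⟩
    _ ≡⟨ ap₂ _+_ (Ʃ-Fin n (clash js)) (tr (Ʃ-hit js) (tr (Ʃ-++ (map nx (toList us)) ks wt) (ap (_+ wts ks) (wts-map (toList us))))) ⟩ _ ∎
    where js = map nx (toList us) ++ ks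

-- Residues, arcs and arithmetic progressions.

mod-unique : ∀ M .{{_ : NonZero M}} {x : ℤ} {r : ℕ} q -> r < M -> x ≡ ι r ℤ.+ q ℤ.* ι M -> x ℤ.%ℕ M ≡ r
mod-unique M {x} {r} q r<M eq = ℤ.+-injective (ℤ.i-j≡0⇒i≡j (ι r') (ι r) (tr diff (tr (ap (ℤ._* ι M) k≡0) refl)))
 where
 r' = x ℤ.%ℕ M
 q' = x ℤ./ℕ M
 k = q ℤ.- q'
 alg : ∀ r r' q q' M -> r ℤ.+ q ℤ.* M ≡ r' ℤ.+ q' ℤ.* M -> r' ℤ.- r ≡ (q ℤ.- q') ℤ.* M
 alg r r' q q' M e = begin _ ≡⟨ one r r' q q' M ⟩
  _ ≡⟨ ap (λ z -> z ℤ.- r ℤ.- q' ℤ.* M) (sym e) ⟩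
  _ ≡⟨ two r q q' M ⟩ _ ∎
  where
  open ≡R
  one : ∀ r r' q q' M -> r' ℤ.- r ≡ (r' ℤ.+ q' ℤ.* M) ℤ.- r ℤ.- q' ℤ.* M
  one = ℤ-Solver.solve-∀
  two : ∀ r q q' M -> (r ℤ.+ q ℤ.* M) ℤ.- r ℤ.- q' ℤ.* M ≡ (q ℤ.- q') ℤ.* M
  two = ℤ-Solver.solve-∀
 diff : ι r' ℤ.- ι r ≡ k ℤ.* ι M
 diff = alg (ι r) (ι r') q q' (ι M) (tr (sym eq) (ℤ.a≡a%ℕn+[a/ℕn]*n x M))
 -- Both remainders lie below `M`, so the multiple of `M` by which they differ can only be 0.
 small : ℤ.∣ k ∣ * M < 1 * M
 small = begin-strict
  _ ≡⟨ sym (ℤ.abs-* k (ι M)) ⟩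
  _ ≡⟨ ap ℤ.∣_∣ (sym diff) ⟩
  _ ≡⟨ ap ℤ.∣_∣ (ℤ.m-n≡m⊖n r' r) ⟩
  _ ≤⟨ ℤ.∣m⊝n∣≤m⊔n r' r ⟩
  _ <⟨ ⊔-lub (ℤ.n%ℕd<d x M) r<M ⟩
  M ≡⟨ sym (*-identityˡ M) ⟩
  1 * M ∎
  where open ≤R
 k≡0 : k ≡ ι 0
 k≡0 = ℤ.∣i∣≡0⇒i≡0 (n<1⇒n≡0 (*-cancelʳ-< M ℤ.∣ k ∣ 1 small))

module _ (M : ℕ) .{{_ : NonZero M}} where

 Periodic : (ℤ -> ℕ) -> Set
 Periodic ψ = ∀ x -> ψ (x ℤ.+ ι M) ≡ ψ x

 %ℕ-periodic : ∀ x -> (x ℤ.+ ι M) ℤ.%ℕ M ≡ x ℤ.%ℕ M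
 %ℕ-periodic x = mod-unique M (x ℤ./ℕ M ℤ.+ ℤ.1ℤ) (ℤ.n%ℕd<d x M)
  (tr (ap (ℤ._+ ι M) (ℤ.a≡a%ℕn+[a/ℕn]*n x M)) (alg (ι (x ℤ.%ℕ M)) (x ℤ./ℕ M) (ι M)))
  where
  alg : ∀ r q M -> r ℤ.+ q ℤ.* M ℤ.+ M ≡ r ℤ.+ (q ℤ.+ ℤ.1ℤ) ℤ.* M
  alg = ℤ-Solver.solve-∀

 periodic-* : ∀ {ψ} -> Periodic ψ -> ∀ i x -> ψ (x ℤ.+ ι (i * M)) ≡ ψ x
 periodic-* {ψ} per zero x = ap ψ (ℤ.+-identityʳ x)
 periodic-* {ψ} per (suc i) x = tr (ap ψ (tr (ap (ℤ._+_ x) (ℤ.+-comm (ι M) (ι (i * M)))) (sym (ℤ.+-assoc x (ι (i * M)) (ι M)))))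
  (tr (per _) (periodic-* per i x))

 periodic-multiple : ∀ {ψ} -> Periodic ψ -> ∀ D y -> ψ (y ℤ.+ D ℤ.* ι M) ≡ ψ y
 periodic-multiple {ψ} per (ι i) y = tr (ap (λ z -> ψ (y ℤ.+ z)) (sym (ℤ.pos-* i M))) (periodic-* per i y)
 periodic-multiple {ψ} per -[1+ i ] y = sym (tr (ap ψ (back y (ι suc i) (ι M)))
  (tr (ap (λ z -> ψ (y ℤ.+ -[1+ i ] ℤ.* ι M ℤ.+ z)) (sym (ℤ.pos-* (suc i) M))) (periodic-* per (suc i) _)))
  where
  back : ∀ y i M -> y ≡ y ℤ.+ (ℤ.- i) ℤ.* M ℤ.+ i ℤ.* M
  back = ℤ-Solver.solve-∀

 Ʃ-shift-ℤ : ∀ {ψ} -> Periodic ψ -> ∀ t -> Ʃ< M (λ x -> ψ (ι x ℤ.+ t)) ≡ Ʃ< M (ψ ∘ ι_)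
 Ʃ-shift-ℤ {ψ} per (ι k) = tr (Ʃ≡ (upTo M) (λ x -> ap ψ (ℤ.+-comm (ι x) (ι k))))
  (Ʃ<-shift M (ψ ∘ ι_) (λ x -> tr (ap ψ (ℤ.+-comm (ι M) (ι x))) (per (ι x))) k)
 Ʃ-shift-ℤ {ψ} per t@(-[1+ k ]) = sym (begin _ ≡⟨ Ʃ≡ (upTo M) (λ x -> ap ψ (cancel (ι x) (ι suc k))) ⟩
  _ ≡⟨ Ʃ<-shift M (λ x -> ψ (ι x ℤ.+ t)) (λ x -> tr (ap ψ (swap (ι M) (ι x) t)) (per _)) (suc k) ⟩ _ ∎)
  where
  open ≡R
  cancel : ∀ x k -> x ≡ k ℤ.+ x ℤ.- k
  cancel = ℤ-Solver.solve-∀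
  swap : ∀ m x t -> m ℤ.+ x ℤ.+ t ≡ x ℤ.+ t ℤ.+ m
  swap = ℤ-Solver.solve-∀

 arc : (lo : ℤ) (len : ℕ) -> ℤ -> ℕ
 arc lo len y = 𝟙 ((y ℤ.- lo) ℤ.%ℕ M <? len)

 arc-periodic : ∀ lo len -> Periodic (arc lo len)
 arc-periodic lo len x = ap (λ r -> 𝟙 (r <? len)) (tr (ap (ℤ._%ℕ M) (swap x (ι M) lo)) (%ℕ-periodic (x ℤ.- lo)))
  where
  swap : ∀ x m lo -> x ℤ.+ m ℤ.- lo ≡ x ℤ.- lo ℤ.+ m
  swap = ℤ-Solver.solve-∀

 -- The representative `r` need not be reduced: reduction only makes it smaller. Membership in an
 -- arc can therefore be shown from any small representative.
 %ℕ-≤ : ∀ {x} r q -> x ≡ ι r ℤ.+ q ℤ.* ι M -> x ℤ.%ℕ M ≤ r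
 %ℕ-≤ {x} r q eq = subst (_≤ r) (sym (mod-unique M (ι (r / M) ℤ.+ q) (m%n<n r M) (tr eq
  (tr (ap (λ z -> z ℤ.+ q ℤ.* ι M) (tr (ap ι_ (m≡m%n+[m/n]*n r M)) (tr (ℤ.pos-+ (r % M) _) (ap (ℤ._+_ (ι (r % M))) (ℤ.pos-* (r / M) M)))))
   (alg (ι (r % M)) (ι (r / M)) q (ι M)))))) (m%n≤m r M)
  where
  alg : ∀ a b q M -> a ℤ.+ b ℤ.* M ℤ.+ q ℤ.* M ≡ a ℤ.+ (b ℤ.+ q) ℤ.* M
  alg = ℤ-Solver.solve-∀

 arc-size : ∀ lo len t -> Ʃ< M (λ x -> arc lo len (ι x ℤ.+ t)) ≤ len
 arc-size lo len t = begin _ ≡⟨ Ʃ-shift-ℤ (arc-periodic lo len) t ⟩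
  _ ≡⟨ Ʃ-shift-ℤ {ψ} (λ x -> ap (λ r -> 𝟙 (r <? len)) (%ℕ-periodic x)) (ℤ.- lo) ⟩
  _ ≤⟨ Ʃ<-mono M (λ x x<M -> leq (ap (λ r -> 𝟙 (r <? len)) (m<n⇒m%n≡m x<M))) ⟩
  _ ≤⟨ count M len ⟩
  len ∎
  where
  open ≤R
  ψ : ℤ -> ℕ
  ψ y = 𝟙 (y ℤ.%ℕ M <? len)
  count : ∀ k len -> Ʃ< k (λ x -> 𝟙 (x <? len)) ≤ len
  count zero len = z≤n
  count (suc k) zero = leq (Ʃ-0 (upTo (suc k)))
  count (suc k) (suc len) = begin _ ≡⟨ Ʃ<-suc k (λ x -> 𝟙 (x <? suc len)) ⟩
   _ ≤⟨ s≤s (Ʃ≤ (upTo k) (λ x -> 𝟙-mono (suc x <? suc len) (x <? len) s≤s⁻¹)) ⟩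
   _ ≤⟨ s≤s (count k len) ⟩ _ ∎

 -- An arithmetic progression with difference d and M terms wraps around d
 -- times; thickening each of its points to d consecutive ones covers every
 -- residue exactly d times.
 progression : ∀ lo len c d .{{_ : NonZero d}} -> Ʃ< M (λ a -> arc lo len (c ℤ.+ ι d ℤ.* ι a)) ≤ len + d
 progression lo len c d = /ˡ d (begin _ ≡⟨ Ʃ-*ˡ d (upTo M) _ ⟨
  _ ≡⟨ Ʃ≡ (upTo M) (λ a -> sym (Ʃ<-const d _)) ⟩
  _ ≤⟨ Ʃ≤ (upTo M) (λ a -> Ʃ<-mono d (λ r r<d -> thicken a r r<d)) ⟩
  _ ≡⟨ Ʃ<-* M d (λ x -> arc lo (len + d) (ι x ℤ.+ c)) ⟨
  _ ≡⟨ ap (λ k -> Ʃ< k (λ x -> arc lo (len + d) (ι x ℤ.+ c))) (*-comm M d) ⟩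
  _ ≡⟨ Ʃ<-* d M _ ⟩
  _ ≡⟨ Ʃ≡ (upTo d) (λ i -> Ʃ≡ (upTo M) (λ x -> unwrap i x)) ⟩
  _ ≡⟨ Ʃ<-const d _ ⟩
  _ ≤⟨ *ʳ d (arc-size lo (len + d) c) ⟩ _ ∎)
  where
  open ≤R
  unwrap : ∀ i x -> arc lo (len + d) (ι (i * M + x) ℤ.+ c) ≡ arc lo (len + d) (ι x ℤ.+ c)
  unwrap i x = tr (ap (arc lo (len + d)) (tr (ap (ℤ._+ c) (ℤ.pos-+ (i * M) x)) (swap (ι (i * M)) (ι x) c)))
   (periodic-* (arc-periodic lo (len + d)) i (ι x ℤ.+ c))
   where
   swap : ∀ i x c -> i ℤ.+ x ℤ.+ c ≡ x ℤ.+ c ℤ.+ i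
   swap = ℤ-Solver.solve-∀
  thicken : ∀ a r -> r < d -> arc lo len (c ℤ.+ ι d ℤ.* ι a) ≤ arc lo (len + d) (ι (a * d + r) ℤ.+ c)
  thicken a r r<d = 𝟙-mono (_ <? len) (_ <? len + d) λ δ<len ->
   ≤< (%ℕ-≤ (δ + r) q (tr (ap (λ z -> z ℤ.+ c ℤ.- lo) (tr (ℤ.pos-+ (a * d) r) (ap (ℤ._+ ι r) (ℤ.pos-* a d))))
    (tr (swap (ι a) (ι d) (ι r) c lo) (tr (ap (ℤ._+ ι r) (ℤ.a≡a%ℕn+[a/ℕn]*n y M)) (swap' (ι δ) (q ℤ.* ι M) (ι r))))))
    (+-mono-<-≤ δ<len (<⇒≤ r<d))
   where
   y = c ℤ.+ ι d ℤ.* ι a ℤ.- lo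
   δ = y ℤ.%ℕ M
   q = y ℤ./ℕ M
   swap : ∀ a d r c lo -> a ℤ.* d ℤ.+ r ℤ.+ c ℤ.- lo ≡ c ℤ.+ d ℤ.* a ℤ.- lo ℤ.+ r
   swap = ℤ-Solver.solve-∀
   swap' : ∀ δ q r -> δ ℤ.+ q ℤ.+ r ≡ δ ℤ.+ r ℤ.+ q
   swap' = ℤ-Solver.solve-∀

 -- Negation carries the arc from `lo` to `lo + len - 1` to the one from `1 - lo - len` to `- lo`.
 -- It reduces negative differences of progressions to positive ones.
 arc-reflect : ∀ lo len y -> arc lo len y ≤ arc (ι 1 ℤ.- lo ℤ.- ι len) len (ℤ.- y)
 arc-reflect lo len y = 𝟙-mono (_ <? len) (_ <? len) λ δ<len ->
  ≤< (%ℕ-≤ (len ∸ suc δ) (ℤ.- q) (tr (swap y lo (ι len)) (tr (ap (λ z -> ι len ℤ.- ι 1 ℤ.- z) (ℤ.a≡a%ℕn+[a/ℕn]*n (y ℤ.- lo) M))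
   (tr (swap' (ι len) (ι δ) q (ι M)) (ap (ℤ._+ ℤ.- q ℤ.* ι M) (tr (ℤ.m-n≡m⊖n len (suc δ)) (ℤ.⊖-≥ δ<len)))))))
   (∸-monoʳ-< (s≤s z≤n) δ<len)
  where
  δ = (y ℤ.- lo) ℤ.%ℕ M
  q = (y ℤ.- lo) ℤ./ℕ M
  swap : ∀ y lo len -> ℤ.- y ℤ.- (ι 1 ℤ.- lo ℤ.- len) ≡ len ℤ.- ι 1 ℤ.- (y ℤ.- lo)
  swap = ℤ-Solver.solve-∀
  swap' : ∀ len δ q M -> len ℤ.- ι 1 ℤ.- (δ ℤ.+ q ℤ.* M) ≡ len ℤ.- (ι 1 ℤ.+ δ) ℤ.+ ℤ.- q ℤ.* M
  swap' = ℤ-Solver.solve-∀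

 progression-ℤ : ∀ lo len c D -> D ≢ ι 0 -> Ʃ< M (λ a -> arc lo len (c ℤ.+ D ℤ.* ι a)) ≤ len + ℤ.∣ D ∣
 progression-ℤ lo len c (ι zero) D≢0 = refute refl D≢0
 progression-ℤ lo len c (ι suc d) _ = progression lo len c (suc d)
 progression-ℤ lo len c (-[1+ d ]) _ = ⊑
  (Ʃ≤ (upTo M) (λ a -> ⊑ (arc-reflect lo len (c ℤ.+ -[1+ d ] ℤ.* ι a)) (leq (ap (arc (ι 1 ℤ.- lo ℤ.- ι len) len) (neg c (ι suc d) (ι a))))))
  (progression (ι 1 ℤ.- lo ℤ.- ι len) len (ℤ.- c) (suc d))
  where
  neg : ∀ c d a -> ℤ.- (c ℤ.+ (ℤ.- d) ℤ.* a) ≡ ℤ.- c ℤ.+ d ℤ.* a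
  neg = ℤ-Solver.solve-∀

 -- Integer polynomials and conditions on their values.

 Coeffs : ℕ -> Set
 Coeffs = Vec ℤ

 eval : ∀ {d} -> Coeffs d -> ℤ -> ℤ
 eval [] x = ι 0
 eval (b ∷ bs) x = b ℤ.+ x ℤ.* eval bs x

 -- The constant coefficient is summed innermost: once the higher ones are fixed, it merely shifts
 -- the value at a given point, which is what `Ʃ-divide` exploits.
 ƩCoeffs : ∀ d -> (Coeffs d -> ℕ) -> ℕ
 ƩCoeffs zero Φ = Φ []
 ƩCoeffs (suc d) Φ = ƩCoeffs d (λ bs -> Ʃ< M (λ b -> Φ (ι b ∷ bs)))

 ƩCoeffs-mono : ∀ d {Φ Ψ : Coeffs d -> ℕ} -> (∀ bs -> Φ bs ≤ Ψ bs) -> ƩCoeffs d Φ ≤ ƩCoeffs d Ψ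
 ƩCoeffs-mono zero le = le []
 ƩCoeffs-mono (suc d) le = ƩCoeffs-mono d (λ bs -> Ʃ≤ (upTo M) (λ b -> le (ι b ∷ bs)))

 ƩCoeffs-cong : ∀ d {Φ Ψ : Coeffs d -> ℕ} -> (∀ bs -> Φ bs ≡ Ψ bs) -> ƩCoeffs d Φ ≡ ƩCoeffs d Ψ
 ƩCoeffs-cong d eq = ≤-antisym (ƩCoeffs-mono d (λ bs -> leq (eq bs)))
  (ƩCoeffs-mono d (λ bs -> leq (sym (eq bs))))

 ƩCoeffs-swap : ∀ d {A : Set} (xs : List A) (Φ : A -> Coeffs d -> ℕ) ->
  ƩCoeffs d (λ bs -> Ʃ[ x ← xs ] Φ x bs) ≡ Ʃ[ x ← xs ] ƩCoeffs d (Φ x)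
 ƩCoeffs-swap zero xs Φ = refl
 ƩCoeffs-swap (suc d) xs Φ = tr (ƩCoeffs-cong d (λ bs -> Ʃ⇆ (upTo M) xs (λ b x -> Φ x (ι b ∷ bs))))
  (ƩCoeffs-swap d xs (λ x bs -> Ʃ< M (λ b -> Φ x (ι b ∷ bs))))

 ƩCoeffs-*ˡ : ∀ d c (Φ : Coeffs d -> ℕ) -> ƩCoeffs d (λ bs -> c * Φ bs) ≡ c * ƩCoeffs d Φ
 ƩCoeffs-*ˡ zero c Φ = refl
 ƩCoeffs-*ˡ (suc d) c Φ = tr (ƩCoeffs-cong d (λ bs -> Ʃ-*ˡ c (upTo M) _)) (ƩCoeffs-*ˡ d c _)

 ƩCoeffs-const : ∀ d c -> ƩCoeffs d (λ _ -> c) ≡ M ^ d * c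
 ƩCoeffs-const zero c = sym (*-identityˡ c)
 ƩCoeffs-const (suc d) c = tr (ƩCoeffs-cong d (λ _ -> Ʃ<-const M c)) (tr (ƩCoeffs-const d (M * c)) (alg (M ^ d) M c))
  where
  alg : ∀ a b c -> a * (b * c) ≡ b * a * c
  alg = ring

 -- Division by X − v: the value at v and the quotient.
 divide : ∀ {d} -> Coeffs (suc d) -> ℤ -> ℤ × Coeffs d
 divide {zero} (b ∷ []) v = b , []
 divide {suc d} (b ∷ bs) v = b ℤ.+ v ℤ.* proj₁ (divide bs v) , proj₁ (divide bs v) ∷ proj₂ (divide bs v)

 eval-divide : ∀ {d} (bs : Coeffs (suc d)) v x ->
  eval bs x ≡ proj₁ (divide bs v) ℤ.+ (x ℤ.- v) ℤ.* eval (proj₂ (divide bs v)) x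
 eval-divide {zero} (b ∷ []) v x = const b v x
  where
  const : ∀ b v x -> b ℤ.+ x ℤ.* ι 0 ≡ b ℤ.+ (x ℤ.- v) ℤ.* ι 0
  const = ℤ-Solver.solve-∀
 eval-divide {suc d} (b ∷ bs) v x =
  tr (ap (λ y -> b ℤ.+ x ℤ.* y) (eval-divide bs v x))
   (horner b v x (proj₁ (divide bs v)) (eval (proj₂ (divide bs v)) x))
  where
  horner : ∀ b v x e q -> b ℤ.+ x ℤ.* (e ℤ.+ (x ℤ.- v) ℤ.* q) ≡ b ℤ.+ v ℤ.* e ℤ.+ (x ℤ.- v) ℤ.* (e ℤ.+ x ℤ.* q)
  horner = ℤ-Solver.solve-∀

 -- Coefficients are integers and not residues, so that division leaves exact identities.
 -- Periodicity in each coefficient replaces passing to residues modulo `M`.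
 PeriodicIn : ∀ d -> (Coeffs d -> ℕ) -> Set
 PeriodicIn zero Φ = ⊤
 PeriodicIn (suc d) Φ = (∀ bs -> Periodic (λ b -> Φ (b ∷ bs))) × (∀ b -> PeriodicIn d (λ bs -> Φ (b ∷ bs)))

 periodicIn-Ʃ : ∀ d (Φ : ℕ -> Coeffs d -> ℕ) -> (∀ b -> PeriodicIn d (Φ b)) -> PeriodicIn d (λ bs -> Ʃ< M (λ b -> Φ b bs))
 periodicIn-Ʃ zero Φ per = tt
 periodicIn-Ʃ (suc d) Φ per = (λ bs x -> Ʃ≡ (upTo M) (λ b -> proj₁ (per b) bs x)) ,
  (λ b -> periodicIn-Ʃ d (λ c bs -> Φ c (b ∷ bs)) (λ c -> proj₂ (per c) b))

 -- For fixed higher coefficients the value at `v` is the constant coefficient shifted by `v` times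
 -- the next value, and periodicity absorbs the shift. The value at a point and the quotient are
 -- thus distributed like independent uniform coefficients.
 Ʃ-divide : ∀ d (Φ : Coeffs (suc d) -> ℕ) -> PeriodicIn (suc d) Φ -> ∀ v ->
  ƩCoeffs (suc d) (λ bs -> Φ (proj₁ (divide bs v) ∷ proj₂ (divide bs v))) ≡ ƩCoeffs (suc d) Φ
 Ʃ-divide zero Φ per v = refl
 Ʃ-divide (suc d) Φ (per , pers) v = begin _ ≡⟨ ƩCoeffs-cong (suc d) (λ bs -> Ʃ-shift-ℤ (per (e bs ∷ q bs)) (v ℤ.* e bs)) ⟩
  _ ≡⟨ Ʃ-divide d (λ bs -> Ʃ< M (λ b -> Φ (ι b ∷ bs))) (periodicIn-Ʃ (suc d) (λ b bs -> Φ (ι b ∷ bs)) (λ b -> pers (ι b))) v ⟩ _ ∎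
  where
  open ≡R
  e : Coeffs (suc d) -> ℤ
  e bs = proj₁ (divide bs v)
  q : Coeffs (suc d) -> Coeffs d
  q bs = proj₂ (divide bs v)

 -- A condition on one value of the polynomial, affine in that value so that the form survives
 -- division: `offset` and `scalar` change, `point` and `target` stay.
 record Row : Set where
  constructor row
  field offset scalar point target : ℤ

 open Row

 module _ (len m : ℕ) where

  satisfies : ∀ {d} -> Coeffs d -> Row -> ℕ
  satisfies bs r = arc (target r) len (offset r ℤ.+ scalar r ℤ.* eval bs (point r))

  holdAll : ∀ {d} -> Coeffs d -> List Row -> ℕ
  holdAll bs [] = 1
  holdAll bs (r ∷ rs) = satisfies bs r * holdAll bs rs

  -- After `k` divisions the scalar is a product of `k` differences of distinct points below `m`.
  Small : ℕ -> Row -> Set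
  Small k r = scalar r ≢ ι 0 × ℤ.∣ scalar r ∣ ≤ m ^ k × (∃ λ κ -> κ < m × point r ≡ ι κ)

  _#_ : Row -> Row -> Set
  r # r' = point r ≢ point r'

  -- What remains of the condition r′ on a polynomial once its value at
  -- the point of r is known to be e.
  quotient : Row -> ℤ -> Row -> Row
  quotient r e r' = row (offset r' ℤ.+ scalar r' ℤ.* e) (scalar r' ℤ.* (point r' ℤ.- point r)) (point r') (target r')

  holds-point : ∀ {d} r (bs : Coeffs (suc d)) ->
   satisfies bs r ≡ arc (target r) len (offset r ℤ.+ scalar r ℤ.* proj₁ (divide bs (point r)))
  holds-point r bs = ap (λ y -> arc (target r) len (offset r ℤ.+ scalar r ℤ.* y))
   (tr (eval-divide bs (point r) (point r)) (cancel (proj₁ (divide bs (point r))) (point r) (eval (proj₂ (divide bs (point r))) (point r))))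
   where
   cancel : ∀ e v q -> e ℤ.+ (v ℤ.- v) ℤ.* q ≡ e
   cancel = ℤ-Solver.solve-∀

  holdAll-quotient : ∀ {d} r (bs : Coeffs (suc d)) rs ->
   holdAll bs rs ≡ holdAll (proj₂ (divide bs (point r))) (map (quotient r (proj₁ (divide bs (point r)))) rs)
  holdAll-quotient r bs [] = refl
  holdAll-quotient r bs (r' ∷ rs) = ap₂ _*_
   (ap (arc (target r') len) (tr (ap (λ y -> offset r' ℤ.+ scalar r' ℤ.* y) (eval-divide bs (point r) (point r')))
    (expand (offset r') (scalar r') (point r') (point r) (proj₁ (divide bs (point r))) (eval (proj₂ (divide bs (point r))) (point r')))))
   (holdAll-quotient r bs rs)
   where
   expand : ∀ c D x v e q -> c ℤ.+ D ℤ.* (e ℤ.+ (x ℤ.- v) ℤ.* q) ≡ c ℤ.+ D ℤ.* e ℤ.+ D ℤ.* (x ℤ.- v) ℤ.* q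
   expand = ℤ-Solver.solve-∀

  eval-periodic : ∀ d x (ψ : ℤ -> ℕ) -> Periodic ψ -> ∀ c D -> PeriodicIn d (λ bs -> ψ (c ℤ.+ D ℤ.* eval bs x))
  eval-periodic zero x ψ per c D = tt
  eval-periodic (suc d) x ψ per c D = (λ bs b -> tr (ap ψ (expand c D b (ι M) (x ℤ.* eval bs x))) (periodic-multiple per D _)) ,
   (λ b -> periodicIn-cong d (λ bs -> ap ψ (expand' c D b x (eval bs x))) (eval-periodic d x ψ per (c ℤ.+ D ℤ.* b) (D ℤ.* x)))
   where
   expand : ∀ c D b M y -> c ℤ.+ D ℤ.* (b ℤ.+ M ℤ.+ y) ≡ c ℤ.+ D ℤ.* (b ℤ.+ y) ℤ.+ D ℤ.* M
   expand = ℤ-Solver.solve-∀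
   expand' : ∀ c D b x y -> c ℤ.+ D ℤ.* b ℤ.+ D ℤ.* x ℤ.* y ≡ c ℤ.+ D ℤ.* (b ℤ.+ x ℤ.* y)
   expand' = ℤ-Solver.solve-∀
   periodicIn-cong : ∀ d {Φ Ψ : Coeffs d -> ℕ} -> (∀ bs -> Φ bs ≡ Ψ bs) -> PeriodicIn d Φ -> PeriodicIn d Ψ
   periodicIn-cong zero eq per = tt
   periodicIn-cong (suc d) eq (per , pers) =
    (λ bs b -> tr (sym (eq _)) (tr (per bs b) (eq _))) , (λ b -> periodicIn-cong d (λ bs -> eq (b ∷ bs)) (pers b))

  periodicIn-* : ∀ d (Φ Ψ : Coeffs d -> ℕ) -> PeriodicIn d Φ -> PeriodicIn d Ψ -> PeriodicIn d (λ bs -> Φ bs * Ψ bs)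
  periodicIn-* zero _ _ _ _ = tt
  periodicIn-* (suc d) Φ Ψ (p , ps) (q , qs) =
   (λ bs b -> ap₂ _*_ (p bs b) (q bs b)) , (λ b -> periodicIn-* d (λ bs -> Φ (b ∷ bs)) (λ bs -> Ψ (b ∷ bs)) (ps b) (qs b))

  holdAll-periodic : ∀ d rs -> PeriodicIn d (λ bs -> holdAll bs rs)
  holdAll-periodic zero rs = tt
  holdAll-periodic (suc d) [] = (λ _ _ -> refl) , λ b -> periodic-1 d
   where
   periodic-1 : ∀ d -> PeriodicIn d (λ _ -> 1)
   periodic-1 zero = tt
   periodic-1 (suc d) = (λ _ _ -> refl) , λ _ -> periodic-1 d
  holdAll-periodic (suc d) (r ∷ rs) = periodicIn-* (suc d) (λ bs -> satisfies bs r) (λ bs -> holdAll bs rs)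
   (eval-periodic (suc d) (point r) (arc (target r) len) (arc-periodic (target r) len) (offset r) (scalar r))
   (holdAll-periodic (suc d) rs)

  holdAll-quotient-periodic : ∀ {d} r rs (q : Coeffs d) -> Periodic (λ e -> holdAll q (map (quotient r e) rs))
  holdAll-quotient-periodic r [] q e = refl
  holdAll-quotient-periodic r (r' ∷ rs) q e = ap₂ _*_
   (tr (ap (arc (target r') len) (expand (offset r') (scalar r') e (ι M) (y r')))
    (periodic-multiple (arc-periodic (target r') len) (scalar r') (offset r' ℤ.+ scalar r' ℤ.* e ℤ.+ y r')))
   (holdAll-quotient-periodic r rs q e)
   where
   y : Row -> ℤ
   y r' = scalar r' ℤ.* (point r' ℤ.- point r) ℤ.* eval q (point r')
   expand : ∀ c D e M y -> c ℤ.+ D ℤ.* (e ℤ.+ M) ℤ.+ y ≡ c ℤ.+ D ℤ.* e ℤ.+ y ℤ.+ D ℤ.* M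
   expand = ℤ-Solver.solve-∀

  quotient-small : ∀ {k r r'} e -> Small k r -> Small k r' -> r # r' -> Small (suc k) (quotient r e r')
  quotient-small {k} {r} {r'} e (_ , _ , κ , κ<m , refl) (D≢0 , ∣D∣≤ , κ' , κ'<m , refl) κ≢κ' =
   (λ eq -> [ D≢0 , (λ v≡ -> κ≢κ' (sym (ℤ.i-j≡0⇒i≡j (ι κ') (ι κ) v≡))) ]′ (ℤ.i*j≡0⇒i≡0∨j≡0 (scalar r') eq)) ,
   (begin _ ≡⟨ ℤ.abs-* (scalar r') _ ⟩
    ℤ.∣ scalar r' ∣ * ℤ.∣ ι κ' ℤ.- ι κ ∣ ≤⟨ *≤ ∣D∣≤ (begin _ ≡⟨ ap ℤ.∣_∣ (ℤ.m-n≡m⊖n κ' κ) ⟩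
     _ ≤⟨ ℤ.∣m⊝n∣≤m⊔n κ' κ ⟩
     _ ≤⟨ ⊔-lub (<⇒≤ κ'<m) (<⇒≤ κ<m) ⟩
     m ∎) ⟩
    m ^ k * m ≡⟨ *-comm (m ^ k) m ⟩
    m ^ suc k ∎) ,
   κ' , κ'<m , refl
   where open ≤R

  module _ .{{_ : NonZero m}} (degree : ℕ) where

   Limit : ℕ
   Limit = len + m ^ degree

   -- The first row leaves at most `Limit` choices for the value at its point. The quotient has one
   -- coefficient fewer, and the other rows become conditions on it. No inverse modulo `M` is taken;
   -- the price is that scalars grow up to `m ^ degree`, which enters `Limit`.
   count-rows : ∀ k d rs -> k + length rs ≤ suc degree -> length rs ≤ d -> All (Small k) rs -> AllPairs _#_ rs ->
    ƩCoeffs d (λ bs -> holdAll bs rs) * M ^ length rs ≤ Limit ^ length rs * M ^ d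
   count-rows k d [] _ _ _ _ = leq (tr (*1 _) (tr (ƩCoeffs-const d 1) (tr (*1 (M ^ d)) (sym (*-identityˡ (M ^ d))))))
   count-rows k (suc d) (r ∷ rs) k+≤ (s≤s len≤) (small ∷ smalls) (#s ∷ ##) = begin _ ≡⟨ ap (_* (M * M ^ length rs)) (tr (ƩCoeffs-cong (suc d) split) (Ʃ-divide d Φ Φ-periodic (point r))) ⟩
    _ ≡⟨ ap (_* (M * M ^ length rs)) (ƩCoeffs-swap d (upTo M) (λ e q -> Φ (ι e ∷ q))) ⟩
    _ ≡⟨ ap (_* (M * M ^ length rs)) (Ʃ≡ (upTo M) (λ e -> ƩCoeffs-*ˡ d (τ e) _)) ⟩
    _ ≡⟨ alg (Ʃ< M λ e -> τ e * ƩCoeffs d λ q -> holdAll q (rest e)) M (M ^ length rs) ⟩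
    _ ≡⟨ ap (M *_) (sym (Ʃ-*ʳ (M ^ length rs) (upTo M) _)) ⟩
    _ ≤⟨ *ʳ M (Ʃ≤ (upTo M) (λ e -> ⊑ (leq (*-assoc (τ e) _ _)) (*ʳ (τ e) (ih e)))) ⟩
    _ ≡⟨ ap (M *_) (Ʃ-*ʳ (Limit ^ length rs * M ^ d) (upTo M) τ) ⟩
    _ ≤⟨ *ʳ M (*ˡ _ (⊑ (progression-ℤ (target r) len (offset r) (scalar r) (proj₁ small))
      (+ʳ len (⊑ (proj₁ (proj₂ small)) (^-monoʳ-≤ m k≤))))) ⟩
    _ ≡⟨ alg' M Limit (Limit ^ length rs) (M ^ d) ⟩ _ ∎
    where
    open ≤R
    k≤ : k ≤ degree
    k≤ = s≤s⁻¹ (⊑ (leq (+-comm 1 k)) (⊑ (+ʳ k (s≤s z≤n)) k+≤))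
    τ : ℕ -> ℕ
    τ e = arc (target r) len (offset r ℤ.+ scalar r ℤ.* ι e)
    rest : ℕ -> List Row
    rest e = map (quotient r (ι e)) rs
    Φ : Coeffs (suc d) -> ℕ
    Φ (e ∷ q) = arc (target r) len (offset r ℤ.+ scalar r ℤ.* e) * holdAll q (map (quotient r e) rs)
    Φ-periodic : PeriodicIn (suc d) Φ
    Φ-periodic = (λ q e -> ap₂ _*_
     (tr (ap (arc (target r) len) (expand (offset r) (scalar r) e (ι M))) (periodic-multiple (arc-periodic (target r) len) (scalar r) (offset r ℤ.+ scalar r ℤ.* e)))
     (holdAll-quotient-periodic r rs q e)) ,
     (λ e -> periodicIn-* d (λ _ -> arc (target r) len (offset r ℤ.+ scalar r ℤ.* e)) (λ q -> holdAll q (map (quotient r e) rs)) (periodic-const d _) (holdAll-periodic d (map (quotient r e) rs)))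
     where
     expand : ∀ c D e M -> c ℤ.+ D ℤ.* (e ℤ.+ M) ≡ c ℤ.+ D ℤ.* e ℤ.+ D ℤ.* M
     expand = ℤ-Solver.solve-∀
     periodic-const : ∀ d c -> PeriodicIn d (λ _ -> c)
     periodic-const zero c = tt
     periodic-const (suc d) c = (λ _ _ -> refl) , λ _ -> periodic-const d c
    split : ∀ bs -> satisfies bs r * holdAll bs rs ≡ Φ (proj₁ (divide bs (point r)) ∷ proj₂ (divide bs (point r)))
    split bs = ap₂ _*_ (holds-point r bs) (holdAll-quotient r bs rs)
    smalls' : ∀ e rs -> All (Small k) rs -> All (r #_) rs -> All (Small (suc k)) (map (quotient r (ι e)) rs)
    smalls' e [] [] [] = []
    smalls' e (x ∷ xs) (s ∷ ss) (p ∷ ps) = quotient-small {k} {r} {x} (ι e) small s p ∷ smalls' e xs ss ps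
    ih : ∀ e -> ƩCoeffs d (λ q -> holdAll q (rest e)) * M ^ length rs ≤ Limit ^ length rs * M ^ d
    ih e = subst (λ l -> ƩCoeffs d (λ q -> holdAll q (rest e)) * M ^ l ≤ Limit ^ l * M ^ d) (List.length-map (quotient r (ι e)) rs)
     (count-rows (suc k) d (rest e)
      (subst (_≤ suc degree) (tr (+-suc k (length rs)) (ap (λ l -> suc (k + l)) (sym (List.length-map (quotient r (ι e)) rs)))) k+≤)
      (subst (_≤ d) (sym (List.length-map (quotient r (ι e)) rs)) len≤)
      (smalls' e rs smalls #s) (AllPairs.map⁺ ##))
    alg : ∀ a b c -> a * (b * c) ≡ b * (a * c)
    alg = ring
    alg' : ∀ a b c d -> a * (b * (c * d)) ≡ b * c * (a * d)
    alg' = ring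

-- Almost independence of the polynomial hash.

poly : ∀ {d} -> Vec ℕ d -> ℕ -> ℕ
poly [] x = 0
poly (b ∷ bs) x = b + x * poly bs x

module _ (n M m : ℕ) .{{_ : NonZero n}} .{{_ : NonZero M}} .{{_ : NonZero m}} where

 -- Scaling to the leading part of the residue, instead of reducing it modulo `n`, makes the
 -- preimage of each hash value an arc.
 hash : ∀ {d} -> Vec ℕ d -> ℕ -> ℕ
 hash α v = poly α v % M * n / M

 hits : ∀ {d} -> Vec ℕ d -> List (ℕ × ℕ) -> ℕ
 hits α [] = 1
 hits α ((v , t) ∷ cs) = 𝟙 (hash α v ≟ t) * hits α cs

 -- Each prescribed hash value is a row whose arc has length `M / n + 2`. The factor 2 per condition
 -- pays for rounding and for the scalars, thanks to the size of `M`.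
 hash-independent : ∀ degree -> (2 + m ^ degree) * n ≤ M -> ∀ cs -> length cs ≤ suc degree ->
  All (λ (v , _) -> v < m) cs -> AllPairs (λ (v , _) (v' , _) -> v ≢ v') cs ->
  Ʃ[ α ← vecs (upTo M) (suc degree) ] hits α cs * n ^ length cs ≤ 2 ^ length cs * M ^ suc degree
 hash-independent degree M-large cs len≤ keys< keys# = /ʳ _ _ (M ^ length cs) {{m^n≢0 M (length cs)}} (begin _ ≡⟨ alg S (n ^ length cs) (M ^ length cs) ⟩
  _ ≤⟨ *ˡ (n ^ length cs) (*ˡ (M ^ length cs) (Ʃ≤ (vecs (upTo M) (suc degree)) (λ α -> hits≤ α cs))) ⟩
  _ ≡⟨ ap (λ z -> z * M ^ length cs * n ^ length cs) (Ʃ-vecs (suc degree) Φ) ⟩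
  _ ≤⟨ *ˡ (n ^ length cs) rows-bound ⟩
  _ ≡⟨ alg (Lim ^ length cs) (M ^ suc degree) (n ^ length cs) ⟩
  _ ≡⟨ ap (_* M ^ suc degree) (sym (^-distribʳ-* (length cs) Lim n)) ⟩
  _ ≤⟨ *ˡ (M ^ suc degree) (^-monoˡ-≤ (length cs) Lim*n≤) ⟩
  _ ≡⟨ ap (_* M ^ suc degree) (^-distribʳ-* (length cs) 2 M) ⟩
  _ ≡⟨ alg (2 ^ length cs) (M ^ length cs) (M ^ suc degree) ⟩ _ ∎)
  where
  open ≤R
  alg : ∀ a b c -> a * b * c ≡ a * c * b
  alg = ring
  ^-distribʳ-* : ∀ k a b -> (a * b) ^ k ≡ a ^ k * b ^ k
  ^-distribʳ-* zero a b = refl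
  ^-distribʳ-* (suc k) a b = tr (ap (a * b *_) (^-distribʳ-* k a b)) (swap a b (a ^ k) (b ^ k))
   where
   swap : ∀ a b c d -> a * b * (c * d) ≡ a * c * (b * d)
   swap = ring
  -- Rounding `M / n` and `t * M / n` down costs one each.
  len = M / n + 2
  Lim = Limit M len m degree
  S = Ʃ[ α ← vecs (upTo M) (suc degree) ] hits α cs
  Lim*n≤ : Lim * n ≤ 2 * M
  Lim*n≤ = begin _ ≡⟨ distrib (M / n) (m ^ degree) n ⟩
   _ ≤⟨ +≤ (m/n*n≤m M n) M-large ⟩
   M + M ≡⟨ ap (λ z -> M + z) (sym (+0 M)) ⟩
   2 * M ∎
   where
   distrib : ∀ a b n -> (a + 2 + b) * n ≡ a * n + (2 + b) * n
   distrib = ring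
  toRow : ℕ × ℕ -> Row M
  toRow (v , t) = row (ι 0) (ι 1) (ι v) (ι (t * M / n))
  rows : List (Row M)
  rows = map toRow cs
  Φ : Coeffs M (suc degree) -> ℕ
  Φ bs = holdAll M len m bs rows
  Ʃ-vecs : ∀ d (Φ : Coeffs M d -> ℕ) -> Ʃ[ α ← vecs (upTo M) d ] Φ (Vec.map ℤ.+_ α) ≡ ƩCoeffs M d Φ
  Ʃ-vecs zero Φ = +0 _
  Ʃ-vecs (suc d) Φ = tr (Ʃ-vecs-suc (upTo M) d _) (tr (Ʃ⇆ (upTo M) (vecs (upTo M) d) _)
   (Ʃ-vecs d (λ bs -> Ʃ< M (λ b -> Φ (ι b ∷ bs)))))
  eval-poly : ∀ {d} (α : Vec ℕ d) v -> eval M (Vec.map ℤ.+_ α) (ι v) ≡ ι poly α v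
  eval-poly [] v = refl
  eval-poly (b ∷ α) v = ap (ℤ._+_ (ι b)) (tr (ap (ℤ._*_ (ι v)) (eval-poly α v)) (sym (ℤ.pos-* v (poly α v))))
  hit≤ : ∀ (α : Vec ℕ (suc degree)) v t -> 𝟙 (hash α v ≟ t) ≤ satisfies M len m (Vec.map ℤ.+_ α) (toRow (v , t))
  hit≤ α v t = ⊑ (𝟙-mono (hash α v ≟ t) ((ι y ℤ.- ι lo) ℤ.%ℕ M <? len) inside)
   (leq (ap (arc M (ι lo) len) (sym (tr (simp (eval M (Vec.map ℤ.+_ α) (ι v))) (eval-poly α v)))))
   where
   lo = t * M / n
   y = poly α v
   simp : ∀ e -> ι 0 ℤ.+ ι 1 ℤ.* e ≡ e
   simp = ℤ-Solver.solve-∀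
   inside : hash α v ≡ t -> (ι y ℤ.- ι lo) ℤ.%ℕ M < len
   inside eq = ≤< (%ℕ-≤ M (y % M ∸ lo) (ι (y / M)) split) close
    where
    lo≤ : lo ≤ y % M
    lo≤ = /ʳ lo (y % M) n (⊑ (m/n*n≤m (t * M) n) (⊑ (leq (ap (_* M) (sym eq))) (m/n*n≤m (y % M * n) M)))
    split : ι y ℤ.- ι lo ≡ ι (y % M ∸ lo) ℤ.+ ι (y / M) ℤ.* ι M
    split = tr (ap (λ z -> z ℤ.- ι lo) (tr (ap ι_ (m≡m%n+[m/n]*n y M)) (tr (ℤ.pos-+ (y % M) _) (ap (ℤ._+_ (ι (y % M))) (ℤ.pos-* (y / M) M)))))
     (tr (swap (ι (y % M)) (ι (y / M) ℤ.* ι M) (ι lo)) (ap (ℤ._+ ι (y / M) ℤ.* ι M) (tr (ℤ.m-n≡m⊖n (y % M) lo) (ℤ.⊖-≥ lo≤))))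
     where
     swap : ∀ a b c -> a ℤ.+ b ℤ.- c ≡ a ℤ.- c ℤ.+ b
     swap = ℤ-Solver.solve-∀
    close : y % M ∸ lo < len
    close = ≤< (∸-monoˡ-≤ lo y≤) (subst (_< len) (sym (m+n∸n≡m (suc (M / n)) lo)) (leq (sym (+-comm (M / n) 2))))
     where
     *n< : ∀ a -> a < suc (a / n) * n
     *n< a = subst (_< suc (a / n) * n) (sym (m≡m%n+[m/n]*n a n)) (+-monoˡ-< (a / n * n) (m%n<n a n))
     y*n< : y % M * n < suc t * M
     y*n< = subst (y % M * n <_) (ap (λ k -> suc k * M) eq)
      (subst (_< suc (hash α v) * M) (sym (m≡m%n+[m/n]*n (y % M * n) M)) (+-monoˡ-< (hash α v * M) (m%n<n (y % M * n) M)))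
     y≤ : y % M ≤ suc (M / n) + lo
     y≤ = s≤s⁻¹ (*-cancelʳ-< n (y % M) (suc (suc (M / n) + lo)) (begin-strict
      _ <⟨ y*n< ⟩
      _ ≤⟨ +≤ (<⇒≤ (*n< M)) (<⇒≤ (*n< (t * M))) ⟩
      _ ≡⟨ sym (*-distribʳ-+ n (suc (M / n)) (suc lo)) ⟩
      _ ≡⟨ ap (_* n) (+-suc (suc (M / n)) lo) ⟩ _ ∎))
  hits≤ : ∀ (α : Vec ℕ (suc degree)) cs -> hits α cs ≤ holdAll M len m (Vec.map ℤ.+_ α) (map toRow cs)
  hits≤ α [] = rfl≤
  hits≤ α ((v , t) ∷ cs) = *≤ (hit≤ α v t) (hits≤ α cs)
  small : ∀ cs -> All (λ (v , _) -> v < m) cs -> All (Small M len m 0) (map toRow cs)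
  small [] [] = []
  small (c ∷ cs) (lt ∷ lts) = ((λ ()) , rfl≤ , proj₁ c , lt , refl) ∷ small cs lts
  rows-bound : ƩCoeffs M (suc degree) Φ * M ^ length cs ≤ Lim ^ length cs * M ^ suc degree
  rows-bound = subst (λ l -> ƩCoeffs M (suc degree) Φ * M ^ l ≤ Lim ^ l * M ^ suc degree) (List.length-map toRow cs)
   (count-rows M len m degree 0 (suc degree) rows
    (subst (_≤ suc degree) (sym (List.length-map toRow cs)) len≤) (subst (_≤ suc degree) (sym (List.length-map toRow cs)) len≤)
    (small cs keys<) (AllPairs.map⁺ (AllPairs.map (λ v≢ eq -> v≢ (ℤ.+-injective eq)) keys#)))

-- The first moment of a meeting.

∏ : ∀ {A : Set} -> List A -> (A -> ℕ) -> ℕ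
∏ [] φ = 1
∏ (x ∷ xs) φ = φ x * ∏ xs φ

∏≤1 : ∀ {A : Set} (xs : List A) {φ} -> (∀ x -> φ x ≤ 1) -> ∏ xs φ ≤ 1
∏≤1 [] le = rfl≤
∏≤1 (x ∷ xs) le = *≤ (le x) (∏≤1 xs le)

∏>0 : ∀ {A : Set} (xs : List A) {φ} -> 0 < ∏ xs φ -> ∀ {x} -> x ∈ xs -> 0 < φ x
∏>0 (x ∷ xs) {φ} pos (here refl) = *>0ˡ (φ x) pos
∏>0 (x ∷ xs) {φ} pos (there y∈) = ∏>0 xs (*>0ʳ (φ x) pos) y∈

union-bound : ∀ {A : Set} (xs : List A) {φ} -> (∀ x -> φ x ≤ 1) -> 1 ≤ ∏ xs φ + Ʃ[ x ← xs ] (1 ∸ φ x)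
union-bound [] le = rfl≤
union-bound (x ∷ xs) {φ} le with φ x | le x
... | zero | _ = s≤s z≤n
... | suc zero | _ = ⊑ (union-bound xs le) (leq (ap (_+ Ʃ[ x ← xs ] (1 ∸ φ x)) (sym (+0 _))))
... | suc (suc _) | s≤s ()

Ʃ-pull : ∀ {A : Set} (xs : List A) c φ -> Ʃ[ x ← xs ] (φ x * c) ≡ Ʃ xs φ * c
Ʃ-pull xs c φ = Ʃ-*ʳ c xs φ

-- `P` and `Q` hold the vertices of the common value `v*` that stand for positions of the first and
-- of the second list. `D c x` says that walks with offset `c` stop at `x`, and `Conf c e x` that
-- `x` competes for the slot of `e`. Both relations stay abstract, since the moments see only the
-- numbers `Δ` and `bkt`. Each part of a meeting has fewer than `ℓ` steps, and `κ` bounds the weight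
-- of its vertices.
record Scene : Set1 where
 field
  n m M : ℕ
  {{n≢0}} : NonZero n
  {{m≢0}} : NonZero m
  {{M≢0}} : NonZero M
  z : Fin n -> Fin m
  v* : Fin m
  P Q : Fin n -> Set
  P? : ∀ x -> Dec (P x)
  Q? : ∀ x -> Dec (Q x)
  P⇒ : ∀ {x} -> P x -> z x ≡ v*
  Q⇒ : ∀ {x} -> Q x -> z x ≡ v*
  P∩Q : ∀ {x} -> P x -> ¬ Q x
  D : Fin n -> Fin n -> Set
  D? : ∀ c x -> Dec (D c x)
  Conf : Fin n -> Fin n -> Fin n -> Set
  Conf? : ∀ c e x -> Dec (Conf c e x)
  Δ bkt ℓ κ : ℕ
  ƩD-x : ∀ c -> Ʃ[ x ← V ] 𝟙 (D? c x) ≡ Δ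
  ƩD-c : ∀ x -> Ʃ[ c ← V ] 𝟙 (D? c x) ≡ Δ
  ƩConf : ∀ c e -> Ʃ[ x ← V ] 𝟙 (Conf? c e x) ≤ bkt
  M-large : (2 + m ^ 3) * n ≤ M

 T : ℕ
 T = 2 * ℓ

record Stage : Set1 where
 field
  scene : Scene
  S : ℕ
  g : Fin (Scene.m scene) -> ℕ

module Once (stage : Stage) where

 open Stage stage
 open Scene scene hiding (M)

 -- The starting vertices are table entries under `S` extra keys, so that starts and `h` form one
 -- uniform table. They are random by themselves and not shifted.
 sh : Fin (S + m) -> ℕ
 sh k = [ (λ _ -> 0) , g ]′ (splitAt S k)

 nx : Fin n -> Fin (S + m)
 nx u = S ↑ʳ z u

 open Walks sh nx public

 src : Fin S -> Fin (S + m)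
 src k = k ↑ˡ m

 v̂ : Fin (S + m)
 v̂ = S ↑ʳ v*

 ∣P∣ ∣Q∣ f : ℕ
 ∣P∣ = Ʃ[ x ← V ] 𝟙 (P? x)
 ∣Q∣ = Ʃ[ x ← V ] 𝟙 (Q? x)
 f = wt v̂

 source≢value : ∀ k v -> src k ≢ S ↑ʳ v
 source≢value k v eq = refute (tr (sym (Fin.splitAt-↑ˡ S k m)) (tr (ap (splitAt S) eq) (Fin.splitAt-↑ʳ S m v))) λ ()

 wt-source : ∀ k -> wt (src k) ≡ 0
 wt-source k = tr (Ʃ≡ V (λ x -> 𝟙-no (nx x Fin.≟ src k) (λ eq -> source≢value k (z x) (sym eq)))) (Ʃ-0 (V {n}))

 -- Without intermediate vertices nothing is tested, not even the ends: a walk may begin at a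
 -- stopping vertex. The number of tests is then at most three times the number of vertices, and the
 -- bound on early stops becomes 0 for `ℓ = 1`, where `n` may be too small for any other.
 tested : List (Fin n) -> Fin n -> Fin n -> List (Fin n)
 tested [] i j = []
 tested ys@(_ ∷ _) i j = i ∷ j ∷ ys

 stays : Fin n -> List (Fin n) -> ℕ
 stays c xs = 𝟙 (All.all? (λ x -> ¬? (D? c x)) xs)

 light : List (Fin n) -> ℕ
 light ys = 𝟙 (weight ys ≤? κ)

 module Pair (k k' : Fin S) where

  base : List (Fin (S + m))
  base = src k ∷ src k' ∷ v̂ ∷ []

  keys : List (Fin n) -> List (Fin (S + m))
  keys ys = map nx ys ++ base

  wts-keys : ∀ ys -> wts (keys ys) ≡ weight ys + f
  wts-keys ys = tr (Ʃ-++ (map nx ys) base wt) (ap₂ _+_ (Ʃ-map nx ys wt)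
   (tr (ap₂ (λ a b -> a + (b + (f + 0))) (wt-source k) (wt-source k')) (+0 f)))

  targets : Fin n -> Fin n -> Fin n -> Fin n -> ℕ
  targets c i j e = 𝟙 (P? i) * (𝟙 (Q? j) * 𝟙 (D? c e))

  ok : Fin n -> List (Fin n) -> Fin n -> Fin n -> Fin n -> ℕ
  ok c ys i j e = 𝟙 (unique? (keys ys)) * (stays c (tested ys i j) * light ys) * targets c i j e

  -- The walk from source k″ keeps away from the keys ks and never enters
  -- the bucket of e.
  clear : Fin n -> List (Fin (S + m)) -> Fin n -> Fin S -> ∀ {t} -> Vec (Fin n) t -> Fin n -> ℕ
  clear c ks e k'' ds d = 𝟙 (unique? (map nx (toList ds) ++ src k'' ∷ ks)) * 𝟙 (All.all? (λ x -> ¬? (Conf? c e x)) (d ∷ toList ds))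

  undisturbed : Table -> Fin n -> List (Fin (S + m)) -> Fin n -> Fin S -> ℕ
  undisturbed h c ks e k'' with k'' Fin.≟ k | k'' Fin.≟ k'
  ... | no _ | no _ = clear c ks e k'' (path h (src k'') T) (vertex h (src k'') T)
  ... | _ | _ = 1

  alone : Table -> Fin n -> List (Fin (S + m)) -> Fin n -> ℕ
  alone h c ks e = ∏ (allFin S) (undisturbed h c ks e)

  trail : Table -> (a b t : ℕ) -> List (Fin n)
  trail h a b t = toList (path h (src k) a) ++ toList (path h (src k') b) ++ toList (path h v̂ t)

  -- Path k reaches P after a steps and path k′ reaches Q after b steps, the
  -- common continuation is stopped after t further steps, and nothing
  -- interferes.
  event : Fin n -> (a b t : ℕ) -> Table -> ℕ
  event c a b t h = ok c (trail h a b t) (vertex h (src k) a) (vertex h (src k') b) (vertex h v̂ t) *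
   alone h c (keys (trail h a b t)) (vertex h v̂ t)

 module _ (k k' : Fin S) where

  open Pair k k'

  module Lower (a b t : ℕ) (k≢k' : k ≢ k') where

   L : ℕ
   L = a + (b + t)

   seqs : List (Vec (Fin n) L)
   seqs = vecs V L

   length-seqs : length seqs ≡ n ^ L
   length-seqs = tr (length-vecs V L) (ap (_^ L) length-V)

   unique-base : Unique base
   unique-base = ((λ eq -> k≢k' (Fin.↑ˡ-injective m k k' eq)) ∷ source≢value k v* ∷ []) ∷ (source≢value k' v* ∷ []) ∷ [] ∷ []

   Ʃtargets : ∀ c -> Ʃ[ i ← V ] Ʃ[ j ← V ] Ʃ[ e ← V ] targets c i j e ≡ ∣P∣ * (∣Q∣ * Δ)
   Ʃtargets c = tr (Ʃ≡ V λ i -> tr (Ʃ≡ V λ j -> tr (Ʃ-*ˡ (𝟙 (P? i)) V _) (ap (𝟙 (P? i) *_) (Ʃ-*ˡ (𝟙 (Q? j)) V _))) (Ʃ-*ˡ (𝟙 (P? i)) V _))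
    (tr (Ʃ-pull V _ (𝟙 ∘ P?)) (ap (∣P∣ *_) (tr (Ʃ-pull V _ (𝟙 ∘ Q?)) (ap (∣Q∣ *_) (ƩD-x c)))))

   -- The weight of all guesses whose ends are as required. Each defect below is measured against
   -- it.
   goal : ℕ
   goal = n ^ suc L * (∣P∣ * (∣Q∣ * Δ))

   ƩƩ : (Fin n -> Fin n -> Fin n -> Fin n -> Vec (Fin n) L -> ℕ) -> ℕ
   ƩƩ φ = Ʃ[ c ← V ] Ʃ[ i ← V ] Ʃ[ j ← V ] Ʃ[ e ← V ] Ʃ[ y ← seqs ] φ c i j e y

   ƩƩ-mono : ∀ {φ ψ} -> (∀ c i j e y -> φ c i j e y ≤ ψ c i j e y) -> ƩƩ φ ≤ ƩƩ ψ
   ƩƩ-mono le = Ʃ≤ V λ c -> Ʃ≤ V λ i -> Ʃ≤ V λ j -> Ʃ≤ V λ e -> Ʃ≤ seqs λ y -> le c i j e y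

   ƩƩ-+ : ∀ φ ψ -> ƩƩ (λ c i j e y -> φ c i j e y + ψ c i j e y) ≡ ƩƩ φ + ƩƩ ψ
   ƩƩ-+ φ ψ = tr (Ʃ≡ V λ c -> tr (Ʃ≡ V λ i -> tr (Ʃ≡ V λ j -> tr (Ʃ≡ V λ e -> Ʃ-+ seqs _ _) (Ʃ-+ V _ _)) (Ʃ-+ V _ _)) (Ʃ-+ V _ _)) (Ʃ-+ V _ _)

   ƩƩ-targets : ∀ (ψ : Vec (Fin n) L -> ℕ) -> ƩƩ (λ c i j e y -> targets c i j e * ψ y) ≡ n * (∣P∣ * (∣Q∣ * Δ)) * Ʃ seqs ψ
   ƩƩ-targets ψ = begin _ ≡⟨ (Ʃ≡ V λ c -> tr (Ʃ≡ V λ i -> tr (Ʃ≡ V λ j -> tr (Ʃ≡ V λ e -> Ʃ-*ˡ (targets c i j e) seqs ψ) (Ʃ-pull V _ _)) (Ʃ-pull V _ _)) (Ʃ-pull V _ _)) ⟩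
    _ ≡⟨ Ʃ≡ V (λ c -> ap (_* Ʃ seqs ψ) (Ʃtargets c)) ⟩
    _ ≡⟨ Ʃ-Fin n _ ⟩
    _ ≡⟨ *-assoc n _ _ ⟨
    _ ∎
    where open ≡R

   ƩƩ-targets-1 : ƩƩ (λ c i j e y -> targets c i j e) ≡ goal
   ƩƩ-targets-1 = tr (Ʃ≡ V λ c -> Ʃ≡ V λ i -> Ʃ≡ V λ j -> Ʃ≡ V λ e -> Ʃ≡ seqs λ y -> sym (*1 (targets c i j e)))
    (tr (ƩƩ-targets (λ _ -> 1)) (tr (ap (n * (∣P∣ * (∣Q∣ * Δ)) *_) (tr (Ʃ-const seqs 1) (tr (*1 _) length-seqs)))
     (alg n (n ^ L) (∣P∣ * (∣Q∣ * Δ)))))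
    where
    alg : ∀ n a p -> n * p * a ≡ n * a * p
    alg = ring

   module _ (few-clashes : 8 * (L * L * pairs + L * n * f) ≤ n * n)
    (few-stops : 24 * (L * Δ) ≤ n)
    (few-heavy : 8 * (L * pairs) ≤ n * suc κ) where

    private
     M : ℕ
     M = n * (∣P∣ * (∣Q∣ * Δ))

    bad-clash : 8 * ƩƩ (λ c i j e y -> targets c i j e * clash (keys (toList y))) ≤ goal
    bad-clash = /ˡ n (/ˡ n (begin _ ≡⟨ ap (λ s -> n * (n * (8 * s))) (ƩƩ-targets (λ y -> clash (keys (toList y)))) ⟩
     _ ≡⟨ alg n M X ⟩
     _ ≤⟨ *ʳ (8 * M) (Ʃ-clash L base unique-base) ⟩
     _ ≡⟨ ap (λ w -> 8 * M * (n ^ L * (L * L * pairs + L * n * w))) (wts-keys []) ⟩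
     _ ≡⟨ alg' M (n ^ L) (L * L * pairs + L * n * f) ⟩
     _ ≤⟨ *ʳ (M * n ^ L) few-clashes ⟩
     _ ≡⟨ alg'' n (∣P∣ * (∣Q∣ * Δ)) (n ^ L) ⟩ _ ∎))
     where
     open ≤R
     X = Ʃ[ y ← seqs ] clash (keys (toList y))
     alg : ∀ n M X -> n * (n * (8 * (M * X))) ≡ 8 * M * (n * n * X)
     alg = ring
     alg' : ∀ M a c -> 8 * M * (a * c) ≡ M * a * (8 * c)
     alg' = ring
     alg'' : ∀ n p a -> n * p * a * (n * n) ≡ n * (n * (n * a * p))
     alg'' = ring

    bad-heavy : 8 * ƩƩ (λ c i j e y -> targets c i j e * (1 ∸ light (toList y))) ≤ goal
    bad-heavy = /ˡ n (/ˡ (suc κ) (begin _ ≡⟨ ap (λ s -> suc κ * (n * (8 * s))) (ƩƩ-targets (λ y -> 1 ∸ light (toList y))) ⟩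
     _ ≡⟨ alg (suc κ) n M X ⟩
     _ ≡⟨ ap (λ s -> 8 * M * (n * s)) (sym (Ʃ-pull seqs (suc κ) _)) ⟩
     _ ≤⟨ *ʳ (8 * M) (*ʳ n (Ʃ≤ seqs (λ y -> markov (toList y)))) ⟩
     _ ≡⟨ ap (8 * M *_) (Ʃ-weight L) ⟩
     _ ≡⟨ alg' M (n ^ L) (L * pairs) ⟩
     _ ≤⟨ *ʳ (M * n ^ L) few-heavy ⟩
     _ ≡⟨ alg'' n (∣P∣ * (∣Q∣ * Δ)) (n ^ L) (suc κ) ⟩ _ ∎))
     where
     open ≤R
     X = Ʃ[ y ← seqs ] (1 ∸ light (toList y))
     markov : ∀ ys -> (1 ∸ light ys) * suc κ ≤ weight ys
     markov ys = go (weight ys ≤? κ)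
      where
      go : (d : Dec (weight ys ≤ κ)) -> (1 ∸ 𝟙 d) * suc κ ≤ weight ys
      go (yes _) = z≤n
      go (no ≰) = ⊑ (leq (+0 _)) (≰⇒> ≰)
     alg : ∀ s n M X -> s * (n * (8 * (M * X))) ≡ 8 * M * (n * (X * s))
     alg = ring
     alg' : ∀ M a c -> 8 * M * (a * c) ≡ M * a * (8 * c)
     alg' = ring
     alg'' : ∀ n p a s -> n * p * a * (n * s) ≡ s * (n * (n * a * p))
     alg'' = ring

    -- The end `e` is free, so summing over it first yields the same factor `Δ` for every offset
    -- `c`. Only then are the tested vertices averaged over `c`, each contributing `Δ` once more.
    bad-stop : 8 * ƩƩ (λ c i j e y -> targets c i j e * (1 ∸ stays c (tested (toList y) i j))) ≤ goal
    bad-stop = begin _ ≤⟨ *ʳ 8 (ƩƩ-mono (λ c i j e y -> *ʳ (targets c i j e) (stops c (tested (toList y) i j)))) ⟩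
     _ ≡⟨ ap (8 *_) swap ⟩
     _ ≤⟨ *ʳ 8 (Ʃ≤ V λ i -> Ʃ≤ V λ j -> Ʃ≤ seqs λ y -> *ʳ (𝟙 (P? i) * 𝟙 (Q? j)) (*ʳ Δ (few y i j))) ⟩
     _ ≡⟨ ap (8 *_) total ⟩
     _ ≡⟨ alg (n ^ L) ∣P∣ ∣Q∣ Δ L ⟩
     _ ≤⟨ *ʳ (n ^ L * (∣P∣ * (∣Q∣ * Δ))) few-stops ⟩
     _ ≡⟨ alg' (n ^ L) (∣P∣ * (∣Q∣ * Δ)) n ⟩
     goal ∎
     where
     open ≤R
     visits : Fin n -> List (Fin n) -> ℕ
     visits c xs = Ʃ[ x ← xs ] 𝟙 (D? c x)
     stops : ∀ c xs -> 1 ∸ stays c xs ≤ visits c xs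
     stops c xs = go (All.all? (λ x -> ¬? (D? c x)) xs) (0 <? visits c xs)
      where
      go : (d : Dec (All (λ x -> ¬ D c x) xs)) -> Dec (0 < visits c xs) -> 1 ∸ 𝟙 d ≤ visits c xs
      go (yes _) _ = z≤n
      go (no _) (yes pos) = pos
      go (no ¬a) (no ¬pos) = refute (All.tabulate (λ {x} x∈ Dx -> ¬pos (⊑ (leq (sym (𝟙-yes (D? c x) Dx))) (term≤Ʃ (λ x -> 𝟙 (D? c x)) x∈)))) ¬a
     Ʃhits : ∀ xs -> Ʃ[ c ← V ] visits c xs ≡ length xs * Δ
     Ʃhits xs = tr (Ʃ⇆ V xs _) (tr (Ʃ≡ xs ƩD-c) (Ʃ-const xs Δ))
     length-tested : ∀ ys i j -> length (tested ys i j) ≤ 3 * length ys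
     length-tested [] i j = z≤n
     length-tested (y ∷ ys) i j = ⊑ (m≤m+n _ _) (leq (alg'' (length ys)))
      where
      alg'' : ∀ l -> suc (suc (suc l)) + 2 * l ≡ 3 * suc l
      alg'' = ring
     few : ∀ (y : Vec (Fin n) L) i j -> Ʃ[ c ← V ] visits c (tested (toList y) i j) ≤ 3 * L * Δ
     few y i j = ⊑ (leq (Ʃhits (tested (toList y) i j))) (*ˡ Δ (subst (λ l -> length (tested (toList y) i j) ≤ 3 * l) (Vec.length-toList y) (length-tested (toList y) i j)))
     swap : ƩƩ (λ c i j e y -> targets c i j e * visits c (tested (toList y) i j)) ≡
      Ʃ[ i ← V ] Ʃ[ j ← V ] Ʃ[ y ← seqs ] (𝟙 (P? i) * 𝟙 (Q? j) * (Δ * Ʃ[ c ← V ] visits c (tested (toList y) i j)))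
     swap = tr (Ʃ⇆ V V _) (Ʃ≡ V λ i -> tr (Ʃ⇆ V V _) (Ʃ≡ V λ j -> tr (Ʃ≡ V λ c -> Ʃ⇆ V seqs _) (tr (Ʃ⇆ V seqs _) (Ʃ≡ seqs λ y ->
      tr (Ʃ≡ V λ c -> tr (Ʃ≡ V λ e -> pull (𝟙 (P? i)) (𝟙 (Q? j)) (𝟙 (D? c e)) (H c y i j)) (tr (Ʃ-pull V _ _) (ap (_* (𝟙 (P? i) * 𝟙 (Q? j) * H c y i j)) (ƩD-x c))))
      (tr (Ʃ≡ V λ c -> pull' Δ (𝟙 (P? i) * 𝟙 (Q? j)) (H c y i j)) (tr (Ʃ-*ˡ (𝟙 (P? i) * 𝟙 (Q? j)) V _) (ap (𝟙 (P? i) * 𝟙 (Q? j) *_) (Ʃ-*ˡ Δ V _))))))))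
      where
      H : Fin n -> Vec (Fin n) L -> Fin n -> Fin n -> ℕ
      H c y i j = visits c (tested (toList y) i j)
      pull : ∀ p q d h -> p * (q * d) * h ≡ d * (p * q * h)
      pull = ring
      pull' : ∀ Δ p h -> Δ * (p * h) ≡ p * (Δ * h)
      pull' = ring
     total : Ʃ[ i ← V ] Ʃ[ j ← V ] Ʃ[ y ← seqs ] (𝟙 (P? i) * 𝟙 (Q? j) * (Δ * (3 * L * Δ))) ≡ n ^ L * (∣P∣ * ∣Q∣) * (Δ * (3 * L * Δ))
     total = tr (Ʃ≡ V λ i -> tr (Ʃ≡ V λ j -> tr (Ʃ-const seqs _) (tr (ap (_* (𝟙 (P? i) * 𝟙 (Q? j) * (Δ * (3 * L * Δ)))) length-seqs) (pull (n ^ L) (𝟙 (P? i)) (𝟙 (Q? j)) (Δ * (3 * L * Δ)))))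
      (tr (Ʃ-pull V _ (𝟙 ∘ Q?)) (pull' ∣Q∣ (n ^ L) (𝟙 (P? i)) (Δ * (3 * L * Δ))))) (tr (Ʃ-pull V _ (𝟙 ∘ P?)) (pull'' ∣P∣ (n ^ L) ∣Q∣ (Δ * (3 * L * Δ))))
      where
      pull : ∀ a p q r -> a * (p * q * r) ≡ q * (a * p * r)
      pull = ring
      pull' : ∀ q a p r -> q * (a * p * r) ≡ p * (a * q * r)
      pull' = ring
      pull'' : ∀ p a q r -> p * (a * q * r) ≡ a * (p * q) * r
      pull'' = ring
     alg : ∀ a p q d l -> 8 * (a * (p * q) * (d * (3 * l * d))) ≡ a * (p * (q * d)) * (24 * (l * d))
     alg = ring
     alg' : ∀ a p n -> a * p * n ≡ n * a * p
     alg' = ring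

    -- Each of the three defects removes at most one eighth, so five eighths remain, hence at least
    -- one half.
    many-ok : goal ≤ 2 * ƩƩ (λ c i j e y -> ok c (toList y) i j e)
    many-ok = finish goal (ƩƩ OK) (ƩƩ B1) (ƩƩ B2) (ƩƩ B3) (begin
     goal ≡⟨ sym ƩƩ-targets-1 ⟩
     _ ≤⟨ ƩƩ-mono split ⟩
     _ ≡⟨ tr (ƩƩ-+ OK _) (ap (ƩƩ OK +_) (tr (ƩƩ-+ B1 _) (ap (ƩƩ B1 +_) (ƩƩ-+ B2 B3)))) ⟩ _ ∎) bad-clash bad-stop bad-heavy
     where
     open ≤R
     OK B1 B2 B3 : Fin n -> Fin n -> Fin n -> Fin n -> Vec (Fin n) L -> ℕ
     OK c i j e y = ok c (toList y) i j e
     B1 c i j e y = targets c i j e * clash (keys (toList y))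
     B2 c i j e y = targets c i j e * (1 ∸ stays c (tested (toList y) i j))
     B3 c i j e y = targets c i j e * (1 ∸ light (toList y))
     three : ∀ {A B C : Set} (p : Dec A) (q : Dec B) (r : Dec C) ->
      1 ≤ 𝟙 p * (𝟙 q * 𝟙 r) + ((1 ∸ 𝟙 p) + ((1 ∸ 𝟙 q) + (1 ∸ 𝟙 r)))
     three (yes _) (yes _) (yes _) = rfl≤
     three (yes _) (yes _) (no _) = rfl≤
     three (yes _) (no _) _ = s≤s z≤n
     three (no _) _ _ = s≤s z≤n
     split : ∀ c i j e y -> targets c i j e ≤ OK c i j e y + (B1 c i j e y + (B2 c i j e y + B3 c i j e y))
     split c i j e y = ⊑ (leq (sym (*1 τ))) (⊑ (*ʳ τ (three (unique? (keys (toList y))) (All.all? (λ x -> ¬? (D? c x)) (tested (toList y) i j)) (weight (toList y) ≤? κ)))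
      (leq (distrib τ (𝟙 (unique? (keys (toList y))) * (stays c (tested (toList y) i j) * light (toList y))) (clash (keys (toList y))) (1 ∸ stays c (tested (toList y) i j)) (1 ∸ light (toList y)))))
      where
      τ = targets c i j e
      distrib : ∀ t a b c d -> t * (a + (b + (c + d))) ≡ a * t + (t * b + (t * c + t * d))
      distrib = ring
     finish : ∀ g o x y z -> g ≤ o + (x + (y + z)) -> 8 * x ≤ g -> 8 * y ≤ g -> 8 * z ≤ g -> g ≤ 2 * o
     finish g o x y z le lx ly lz = /ˡ 5 (+-cancelˡ-≤ (3 * g) _ _ (begin _ ≡⟨ sym (*-distribʳ-+ g 3 5) ⟩
      8 * g ≤⟨ *ʳ 8 le ⟩
      _ ≡⟨ expand o x y z ⟩
      _ ≤⟨ +ʳ (8 * o) (+≤ lx (+≤ ly lz)) ⟩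
      _ ≤⟨ m≤m+n _ (2 * o) ⟩
      _ ≡⟨ collect o g ⟩ _ ∎))
      where
      expand : ∀ o x y z -> 8 * (o + (x + (y + z))) ≡ 8 * o + (8 * x + (8 * y + 8 * z))
      expand = ring
      collect : ∀ o g -> 8 * o + (g + (g + g)) + 2 * o ≡ 3 * g + 5 * (2 * o)
      collect = ring

   -- The constraints that describe the three walks.
   system : Vec (Fin n) a -> Fin n -> Vec (Fin n) b -> Fin n -> Vec (Fin n) t -> Fin n -> Consts
   system us i ws j cs e = path# us i ++ path# ws j ++ path# cs e ++
    (src k , first us i) ∷ (src k' , first ws j) ∷ (v̂ , first cs e) ∷ []

   joined : Vec (Fin n) a -> Vec (Fin n) b -> Vec (Fin n) t -> List (Fin n)
   joined us ws cs = toList us ++ toList ws ++ toList cs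

   keys-system : ∀ us i ws j cs e -> map proj₁ (system us i ws j cs e) ≡ keys (joined us ws cs)
   keys-system us i ws j cs e = begin _ ≡⟨ tr (List.map-++ proj₁ (path# us i) _) (ap₂ _++_ (keys-followed us i) (tr (List.map-++ proj₁ (path# ws j) _) (ap₂ _++_ (keys-followed ws j) (tr (List.map-++ proj₁ (path# cs e) _) (ap (_++ base) (keys-followed cs e)))))) ⟩
    _ ≡⟨ tr (ap (map nx (toList us) ++_) (sym (List.++-assoc (map nx (toList ws)) _ base))) (sym (List.++-assoc (map nx (toList us)) _ base)) ⟩
    _ ≡⟨ ap (_++ base) (sym (tr (List.map-++ nx (toList us) _) (ap (map nx (toList us) ++_) (List.map-++ nx (toList ws) _)))) ⟩ _ ∎
    where open ≡R

   length-system : ∀ us i ws j cs e -> length (system us i ws j cs e) ≡ L + 3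
   length-system us i ws j cs e = tr (List.length-++ (path# us i)) (tr (ap₂ _+_ (length-followed us i)
    (tr (List.length-++ (path# ws j)) (ap₂ _+_ (length-followed ws j) (tr (List.length-++ (path# cs e)) (ap (_+ 3) (length-followed cs e))))))
    (alg a b t))
    where
    alg : ∀ a b t -> a + (b + (t + 3)) ≡ a + (b + t) + 3
    alg = ring

   sat-system : ∀ h us i ws j cs e -> link h (src k) us i * (link h (src k') ws j * link h v̂ cs e) ≡ sat h (system us i ws j cs e)
   sat-system h us i ws j cs e = sym (tr (sat-++ h (path# us i) _) (tr (ap (sat h (path# us i) *_) (tr (sat-++ h (path# ws j) _)
    (ap (sat h (path# ws j) *_) (sat-++ h (path# cs e) _))))
    (alg (sat h (path# us i)) (sat h (path# ws j)) (sat h (path# cs e)) (𝟙 (F h (src k) Fin.≟ first us i)) (𝟙 (F h (src k') Fin.≟ first ws j)) (𝟙 (F h v̂ Fin.≟ first cs e)))))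
    where
    alg : ∀ u w c x y z -> u * (w * (c * (x * (y * (z * 1))))) ≡ x * u * (y * w * (z * c))
    alg = ring

   module _ (quiet : 2 * ((S ∸ 2) * (T * T * pairs + T * n * (κ + f) + suc T * n * bkt)) ≤ n * n) where

    β : ℕ
    β = T * T * pairs + T * n * (κ + f) + suc T * n * bkt

    module _ (c e : Fin n) (cs : Consts) (ys : List (Fin n)) (keys≡ : map proj₁ cs ≡ keys ys)
     (unique-keys : Unique (keys ys)) (light-ys : weight ys ≤ κ) where

     N : ℕ
     N = length cs

     fit : Table -> Fin S -> ℕ
     fit h k'' = clear c (keys ys) e k'' (path h (src k'') T) (vertex h (src k'') T)

     clear≤1 : ∀ k'' {t} (ds : Vec (Fin n) t) d -> clear c (keys ys) e k'' ds d ≤ 1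
     clear≤1 k'' ds d = *≤ (𝟙≤1 (unique? (map nx (toList ds) ++ src k'' ∷ keys ys))) (𝟙≤1 (All.all? (λ x -> ¬? (Conf? c e x)) (d ∷ toList ds)))

     sats : ℕ
     sats = Ʃ[ h ← tables ] sat h cs

     -- Given the constraints of the pair, another walk is a uniform sequence of vertices as long as
     -- its keys are new. Enumerating its vertices counts exactly the tables in which it is clear.
     module Intruder (k'' : Fin S) (k''≢k : k'' ≢ k) (k''≢k' : k'' ≢ k') where

      clearAt : Vec (Fin n) T -> Fin n -> ℕ
      clearAt = clear c (keys ys) e k''

      unique-source : Unique (src k'' ∷ keys ys)
      unique-source = All.tabulate (λ {κ} κ∈ eq -> source∉ (subst (_∈ keys ys) (sym eq) κ∈)) ∷ unique-keys
       where
       source∉ : src k'' ∉ keys ys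
       source∉ source∈ with Mem.∈-++⁻ (map nx ys) source∈
       ... | inj₁ ∈map = let x , _ , eq = Mem.∈-map⁻ nx ∈map in source≢value k'' (z x) eq
       ... | inj₂ (here eq) = k''≢k (Fin.↑ˡ-injective m k'' k eq)
       ... | inj₂ (there (here eq)) = k''≢k' (Fin.↑ˡ-injective m k'' k' eq)
       ... | inj₂ (there (there (here eq))) = source≢value k'' v* eq

      bads clears : ℕ
      bads = Ʃ[ ds ← vecs V T ] Ʃ[ d ← V ] (1 ∸ clearAt ds d)
      clears = Ʃ[ ds ← vecs V T ] Ʃ[ d ← V ] clearAt ds d

      bads+clears : bads + clears ≡ n ^ suc T
      bads+clears = tr (sym (tr (Ʃ≡ (vecs V T) λ ds -> Ʃ-+ V _ _) (Ʃ-+ (vecs V T) _ _)))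
       (tr (Ʃ≡ (vecs V T) λ ds -> tr (Ʃ≡ V λ d -> m∸n+n≡m (clear≤1 k'' ds d)) (tr (Ʃ-Fin n 1) (*1 n)))
        (tr (Ʃ-const (vecs V T) n) (tr (ap (_* n) (tr (length-vecs V T) (ap (_^ T) length-V))) (*-comm (n ^ T) n))))

      bads≤ : n * n * bads ≤ n ^ suc T * β
      bads≤ = begin _ ≤⟨ *ʳ (n * n) (Ʃ≤ (vecs V T) λ ds -> Ʃ≤ V λ d -> spoil ds d) ⟩
       _ ≡⟨ ap (n * n *_) (Ʃ≡ (vecs V T) λ ds -> tr (Ʃ-+ V _ _) (ap₂ _+_ (Ʃ-Fin n (clash' ds)) (tr (Ʃ-+ V _ _) (ap₂ _+_ (Ʃ≡ V λ d -> +0 _) (Ʃ-Fin n (confs (toList ds))))))) ⟩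
       _ ≡⟨ ap (n * n *_) (tr (Ʃ-+ (vecs V T) _ _) (ap₂ _+_ (Ʃ-*ˡ n (vecs V T) _) (tr (Ʃ-+ (vecs V T) _ _) (ap₂ _+_ (tr (Ʃ-const (vecs V T) χ) (ap (_* χ) (tr (length-vecs V T) (ap (_^ T) length-V)))) (tr (Ʃ-*ˡ n (vecs V T) _) (Ʃ-toList (𝟙 ∘ Conf? c e) T)))))) ⟩
       _ ≡⟨ alg n clashes (n ^ T) χ T ⟩
       _ ≤⟨ +≤ (*ʳ n (⊑ (Ʃ-clash T (src k'' ∷ keys ys) unique-source) (*ʳ (n ^ T) (+ʳ (T * T * pairs) (*ʳ (T * n) wts≤)))))
         (*ʳ n (*ʳ (n ^ T) (*ʳ (suc T * n) (ƩConf c e)))) ⟩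
       _ ≡⟨ collect n (n ^ T) (T * T * pairs + T * n * (κ + f)) (suc T * n * bkt) ⟩ _ ∎
       where
       open ≤R
       χ = Ʃ[ x ← V ] 𝟙 (Conf? c e x)
       confs : List (Fin n) -> ℕ
       confs xs = Ʃ[ x ← xs ] 𝟙 (Conf? c e x)
       clash' : Vec (Fin n) T -> ℕ
       clash' ds = clash (map nx (toList ds) ++ src k'' ∷ keys ys)
       clashes = Ʃ (vecs V T) clash'
       wts≤ : wts (src k'' ∷ keys ys) ≤ κ + f
       wts≤ = ⊑ (leq (ap₂ _+_ (wt-source k'') (wts-keys ys))) (+ˡ f light-ys)
       alg : ∀ n C a χ T -> n * n * (n * C + (a * χ + a * (T * χ))) ≡ n * (n * n * C) + n * (a * (suc T * n * χ))
       alg = ring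
       collect : ∀ n a x y -> n * (a * x) + n * (a * y) ≡ n * a * (x + y)
       collect = ring
       spoil : ∀ ds d -> 1 ∸ clearAt ds d ≤ clash' ds + (confs (d ∷ []) + confs (toList ds))
       spoil ds d = go (unique? (map nx (toList ds) ++ src k'' ∷ keys ys)) (All.all? (λ x -> ¬? (Conf? c e x)) (d ∷ toList ds))
        (0 <? confs (d ∷ []) + confs (toList ds))
        where
        go : (p : Dec (Unique (map nx (toList ds) ++ src k'' ∷ keys ys))) (q : Dec (All (λ x -> ¬ Conf c e x) (d ∷ toList ds))) ->
         Dec (0 < confs (d ∷ []) + confs (toList ds)) -> 1 ∸ 𝟙 p * 𝟙 q ≤ (1 ∸ 𝟙 p) + (confs (d ∷ []) + confs (toList ds))
        go (no _) q _ = m≤m+n 1 _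
        go (yes _) (yes _) _ = z≤n
        go (yes _) (no _) (yes pos) = pos
        go (yes _) (no ¬a) (no ¬pos) = refute (All.tabulate (λ {x} x∈ Cx -> ¬pos (⊑ (leq (sym (𝟙-yes (Conf? c e x) Cx)))
         (⊑ (term≤Ʃ (λ x -> 𝟙 (Conf? c e x)) x∈) (leq (ap (_+ confs (toList ds)) (sym (+0 (𝟙 (Conf? c e d))))))))) ) ¬a

      fits : n ^ suc T * (n ^ N * Ʃ[ h ← tables ] (sat h cs * fit h k'')) ≡ n ^ (S + m) * clears
      fits = begin _ ≡⟨ ap (λ s -> n ^ suc T * (n ^ N * s)) (Ʃ≡ tables λ h -> tr (ap (sat h cs *_) (sym (Ʃ-link h (src k'') T clearAt)))
         (tr (sym (Ʃ-*ˡ (sat h cs) (vecs V T) _)) (Ʃ≡ (vecs V T) λ ds -> sym (Ʃ-*ˡ (sat h cs) V _)))) ⟩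
       _ ≡⟨ ap (λ s -> n ^ suc T * (n ^ N * s)) (tr (Ʃ⇆ tables (vecs V T) _) (Ʃ≡ (vecs V T) λ ds -> Ʃ⇆ tables V _)) ⟩
       _ ≡⟨ sym (tr (Ʃ≡ (vecs V T) λ ds -> Ʃ-*ˡ (n ^ suc T * n ^ N) V _) (tr (Ʃ-*ˡ (n ^ suc T * n ^ N) (vecs V T) _) (*-assoc (n ^ suc T) _ _))) ⟩
       _ ≡⟨ Ʃ≡ (vecs V T) (λ ds -> Ʃ≡ V λ d -> each ds d) ⟩
       _ ≡⟨ tr (Ʃ≡ (vecs V T) λ ds -> Ʃ-*ˡ (n ^ (S + m)) V _) (Ʃ-*ˡ (n ^ (S + m)) (vecs V T) _) ⟩ _ ∎
       where
       open ≡R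
       each : ∀ ds d -> n ^ suc T * n ^ N * Ʃ[ h ← tables ] (sat h cs * (link h (src k'') ds d * clearAt ds d)) ≡ n ^ (S + m) * clearAt ds d
       each ds d = go (unique? (map nx (toList ds) ++ src k'' ∷ keys ys)) (𝟙 (All.all? (λ x -> ¬? (Conf? c e x)) (d ∷ toList ds)))
        where
        extended : Consts
        extended = path# ds d ++ (src k'' , first ds d) ∷ cs
        keys-extended : map proj₁ extended ≡ map nx (toList ds) ++ src k'' ∷ keys ys
        keys-extended = tr (List.map-++ proj₁ (path# ds d) _) (ap₂ _++_ (keys-followed ds d) (ap (src k'' ∷_) keys≡))
        length-extended : length extended ≡ suc T + N
        length-extended = tr (List.length-++ (path# ds d)) (tr (ap (_+ suc N) (length-followed ds d)) (+-suc T N))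
        sat-extended : ∀ h -> sat h cs * link h (src k'') ds d ≡ sat h extended
        sat-extended h = tr (alg (sat h cs) (𝟙 (F h (src k'') Fin.≟ first ds d)) (sat h (path# ds d))) (sym (sat-++ h (path# ds d) _))
         where
         alg : ∀ a b c -> a * (b * c) ≡ c * (b * a)
         alg = ring
        go : (p : Dec (Unique (map nx (toList ds) ++ src k'' ∷ keys ys))) (q : ℕ) ->
         n ^ suc T * n ^ N * Ʃ[ h ← tables ] (sat h cs * (link h (src k'') ds d * (𝟙 p * q))) ≡ n ^ (S + m) * (𝟙 p * q)
        go (no _) q = tr (ap (n ^ suc T * n ^ N *_) (tr (Ʃ≡ tables λ h -> tr (ap (sat h cs *_) (*-zeroʳ (link h (src k'') ds d))) (*-zeroʳ (sat h cs))) (Ʃ-0 tables)))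
         (tr (*-zeroʳ (n ^ suc T * n ^ N)) (sym (*-zeroʳ (n ^ (S + m)))))
        go (yes u) q = tr (ap (n ^ suc T * n ^ N *_) (tr (Ʃ≡ tables λ h -> tr (sym (*-assoc (sat h cs) _ _)) (ap (_* (1 * q)) (sat-extended h))) (Ʃ-pull tables (1 * q) _)))
         (tr (sym (*-assoc (n ^ suc T * n ^ N) _ (1 * q))) (ap (_* (1 * q))
          (tr (ap (_* Ʃ[ h ← tables ] sat h extended) (tr (sym (^-distribˡ-+-* n (suc T) N)) (ap (n ^_) (sym length-extended))))
           (sat-count extended (subst Unique (sym keys-extended) u)))))

      -- A path that repeats a key is not a system of independent constraints. The disturbed tables
      -- are therefore counted as the complement of the clear ones.
      unfit : n * n * (n ^ N * Ʃ[ h ← tables ] (sat h cs * (1 ∸ fit h k''))) ≤ n ^ (S + m) * β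
      unfit = /ˡ (n ^ suc T) {{m^n≢0 n (suc T)}} (begin _ ≡⟨ alg (n ^ suc T) (n * n) (n ^ N * X) ⟩
       _ ≡⟨ ap (n * n *_) (+-cancelʳ-≡ (n ^ (S + m) * clears) _ _ balance) ⟩
       _ ≡⟨ alg (n * n) (n ^ (S + m)) bads ⟩
       _ ≤⟨ *ʳ (n ^ (S + m)) bads≤ ⟩
       _ ≡⟨ alg (n ^ (S + m)) (n ^ suc T) β ⟩ _ ∎)
       where
       open ≤R
       X = Ʃ[ h ← tables ] (sat h cs * (1 ∸ fit h k''))
       alg : ∀ a b c -> a * (b * c) ≡ b * (a * c)
       alg = ring
       balance : n ^ suc T * (n ^ N * X) + n ^ (S + m) * clears ≡ n ^ (S + m) * bads + n ^ (S + m) * clears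
       balance = begin-equality
        _ ≡⟨ ap (n ^ suc T * (n ^ N * X) +_) (sym fits) ⟩
        _ ≡⟨ tr (sym (*-distribˡ-+ (n ^ suc T) _ _)) (ap (n ^ suc T *_) (sym (*-distribˡ-+ (n ^ N) X _))) ⟩
        _ ≡⟨ ap (λ s -> n ^ suc T * (n ^ N * s)) (tr (sym (Ʃ-+ tables _ _)) (Ʃ≡ tables λ h ->
          tr (sym (*-distribˡ-+ (sat h cs) _ _)) (tr (ap (sat h cs *_) (m∸n+n≡m (clear≤1 k'' (path h (src k'') T) _))) (*1 _)))) ⟩
        _ ≡⟨ ap (n ^ suc T *_) (sat-count cs (subst Unique (sym keys≡) unique-keys)) ⟩
        _ ≡⟨ *-comm (n ^ suc T) _ ⟩
        _ ≡⟨ tr (ap (n ^ (S + m) *_) (sym bads+clears)) (*-distribˡ-+ (n ^ (S + m)) bads clears) ⟩ _ ∎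

     undisturbed≤1 : ∀ h k'' -> undisturbed h c (keys ys) e k'' ≤ 1
     undisturbed≤1 h k'' with k'' Fin.≟ k | k'' Fin.≟ k'
     ... | no _ | no _ = clear≤1 k'' (path h (src k'') T) _
     ... | no _ | yes _ = rfl≤
     ... | yes _ | no _ = rfl≤
     ... | yes _ | yes _ = rfl≤

     other : Fin S -> ℕ
     other k'' = 1 ∸ (𝟙 (k Fin.≟ k'') + 𝟙 (k' Fin.≟ k''))

     Ʃother : Ʃ (allFin S) other ≡ S ∸ 2
     Ʃother = tr (sym (m+n∸n≡m (Ʃ (allFin S) other) 2)) (ap (_∸ 2) (begin _ ≡⟨ ap₂ (λ x y -> Ʃ (allFin S) other + (x + y)) (sym (count k)) (sym (count k')) ⟩
      _ ≡⟨ ap (Ʃ (allFin S) other +_) (sym (Ʃ-+ (allFin S) _ _)) ⟩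
      _ ≡⟨ sym (Ʃ-+ (allFin S) _ _) ⟩
      _ ≡⟨ Ʃ≡ (allFin S) (λ k'' -> m∸n+n≡m (atMost (k Fin.≟ k'') (k' Fin.≟ k''))) ⟩
      _ ≡⟨ tr (Ʃ-Fin S 1) (*1 S) ⟩
      S ∎))
      where
      open ≡R
      count : ∀ k -> Ʃ[ k'' ← allFin S ] 𝟙 (k Fin.≟ k'') ≡ 1
      count k = tr (Ʃ≡ (allFin S) λ k'' -> sym (*1 _)) (Ʃ-allFin-δ k (λ _ -> 1))
      atMost : ∀ {k''} (p : Dec (k ≡ k'')) (q : Dec (k' ≡ k'')) -> 𝟙 p + 𝟙 q ≤ 1
      atMost (yes p) (yes q) = refute (tr p (sym q)) k≢k'
      atMost (yes _) (no _) = rfl≤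
      atMost (no _) (yes _) = rfl≤
      atMost (no _) (no _) = z≤n

     disturbed : ∀ k'' -> n * n * (n ^ N * Ʃ[ h ← tables ] (sat h cs * (1 ∸ undisturbed h c (keys ys) e k''))) ≤ other k'' * (n ^ (S + m) * β)
     disturbed k'' with k'' Fin.≟ k | k'' Fin.≟ k'
     ... | no k''≢k | no k''≢k' = ⊑ (Intruder.unfit k'' k''≢k k''≢k')
      (leq (sym (tr (ap (_* (n ^ (S + m) * β)) (ap₂ (λ x y -> 1 ∸ (x + y)) (𝟙-no (k Fin.≟ k'') (k''≢k ∘ sym)) (𝟙-no (k' Fin.≟ k'') (k''≢k' ∘ sym)))) (*-identityˡ _))))
     ... | no _ | yes _ = ⊑ (leq nothing-lost) z≤n
      where
      nothing-lost : n * n * (n ^ N * Ʃ[ h ← tables ] (sat h cs * 0)) ≡ 0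
      nothing-lost = tr (ap (λ s -> n * n * (n ^ N * s)) (tr (Ʃ≡ tables λ h -> *-zeroʳ (sat h cs)) (Ʃ-0 tables))) (tr (ap (n * n *_) (*-zeroʳ (n ^ N))) (*-zeroʳ (n * n)))
     ... | yes _ | d = ⊑ (leq (nothing-lost d)) z≤n
      where
      nothing-lost : (d : Dec (k'' ≡ k')) -> n * n * (n ^ N * Ʃ[ h ← tables ] (sat h cs * 0)) ≡ 0
      nothing-lost _ = tr (ap (λ s -> n * n * (n ^ N * s)) (tr (Ʃ≡ tables λ h -> *-zeroʳ (sat h cs)) (Ʃ-0 tables))) (tr (ap (n * n *_) (*-zeroʳ (n ^ N))) (*-zeroʳ (n * n)))

     -- A union bound over the `S - 2` other walks; by `quiet` it loses at most half of the tables
     -- that satisfy the constraints.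
     mostly-alone : n ^ (S + m) ≤ 2 * (n ^ N * Ʃ[ h ← tables ] (sat h cs * alone h c (keys ys) e))
     mostly-alone = finish (n ^ (S + m)) (n ^ N * A) (n ^ N * B) split (/ˡ (n * n) {{m*n≢0 n n}} (begin _ ≡⟨ alg (n * n) (n ^ N * B) ⟩
      _ ≡⟨ ap (λ s -> 2 * s) (sym (tr (Ʃ-*ˡ (n * n) (allFin S) _) (ap (n * n *_) (Ʃ-*ˡ (n ^ N) (allFin S) _)))) ⟩
      _ ≤⟨ *ʳ 2 (Ʃ≤ (allFin S) disturbed) ⟩
      _ ≡⟨ ap (2 *_) (tr (Ʃ-pull (allFin S) _ other) (ap (_* (n ^ (S + m) * β)) Ʃother)) ⟩
      _ ≡⟨ alg' (S ∸ 2) (n ^ (S + m)) β ⟩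
      _ ≤⟨ *ʳ (n ^ (S + m)) quiet ⟩
      _ ≡⟨ *-comm (n ^ (S + m)) (n * n) ⟩ _ ∎))
      where
      open ≤R
      A = Ʃ[ h ← tables ] (sat h cs * alone h c (keys ys) e)
      B = Ʃ[ k'' ← allFin S ] Ʃ[ h ← tables ] (sat h cs * (1 ∸ undisturbed h c (keys ys) e k''))
      alg : ∀ a b -> a * (2 * b) ≡ 2 * (a * b)
      alg = ring
      alg' : ∀ s a b -> 2 * (s * (a * b)) ≡ a * (2 * (s * b))
      alg' = ring
      split : n ^ (S + m) ≤ n ^ N * A + n ^ N * B
      split = begin _ ≡⟨ sym (sat-count cs (subst Unique (sym keys≡) unique-keys)) ⟩
       _ ≤⟨ *ʳ (n ^ N) (Ʃ≤ tables λ h -> ⊑ (leq (sym (*1 (sat h cs))))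
        (⊑ (*ʳ (sat h cs) (union-bound (allFin S) (undisturbed≤1 h))) (leq (*-distribˡ-+ (sat h cs) _ _)))) ⟩
       _ ≡⟨ ap (n ^ N *_) (tr (Ʃ-+ tables _ _) (ap (A +_) (tr (Ʃ≡ tables λ h -> sym (Ʃ-*ˡ (sat h cs) (allFin S) _)) (Ʃ⇆ tables (allFin S) _)))) ⟩
       _ ≡⟨ *-distribˡ-+ (n ^ N) A B ⟩ _ ∎
      finish : ∀ H a b -> H ≤ a + b -> 2 * b ≤ H -> H ≤ 2 * a
      finish H a b le lb = +-cancelʳ-≤ H H (2 * a) (begin
       H + H ≡⟨ ap (H +_) (sym (+0 H)) ⟩
       2 * H ≤⟨ *ʳ 2 le ⟩
       _ ≡⟨ *-distribˡ-+ 2 a b ⟩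
       _ ≤⟨ +ʳ (2 * a) lb ⟩ _ ∎)

    E : (Vec (Fin n) a -> Fin n -> Vec (Fin n) b -> Fin n -> Vec (Fin n) t -> Fin n -> ℕ) -> ℕ
    E φ = Ʃ[ us ← vecs V a ] Ʃ[ i ← V ] Ʃ[ ws ← vecs V b ] Ʃ[ j ← V ] Ʃ[ cs ← vecs V t ] Ʃ[ e ← V ] φ us i ws j cs e

    E-cong : ∀ {φ ψ} -> (∀ us i ws j cs e -> φ us i ws j cs e ≡ ψ us i ws j cs e) -> E φ ≡ E ψ
    E-cong eq = Ʃ≡ (vecs V a) λ us -> Ʃ≡ V λ i -> Ʃ≡ (vecs V b) λ ws -> Ʃ≡ V λ j -> Ʃ≡ (vecs V t) λ cs -> Ʃ≡ V λ e -> eq us i ws j cs e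

    E-mono : ∀ {φ ψ} -> (∀ us i ws j cs e -> φ us i ws j cs e ≤ ψ us i ws j cs e) -> E φ ≤ E ψ
    E-mono le = Ʃ≤ (vecs V a) λ us -> Ʃ≤ V λ i -> Ʃ≤ (vecs V b) λ ws -> Ʃ≤ V λ j -> Ʃ≤ (vecs V t) λ cs -> Ʃ≤ V λ e -> le us i ws j cs e

    E-*ˡ : ∀ x φ -> E (λ us i ws j cs e -> x * φ us i ws j cs e) ≡ x * E φ
    E-*ˡ x φ = tr (Ʃ≡ (vecs V a) λ us -> tr (Ʃ≡ V λ i -> tr (Ʃ≡ (vecs V b) λ ws -> tr (Ʃ≡ V λ j -> tr (Ʃ≡ (vecs V t) λ cs -> Ʃ-*ˡ x V _)
     (Ʃ-*ˡ x (vecs V t) _)) (Ʃ-*ˡ x V _)) (Ʃ-*ˡ x (vecs V b) _)) (Ʃ-*ˡ x V _)) (Ʃ-*ˡ x (vecs V a) _)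

    E-swap : ∀ {A : Set} (xs : List A) (φ : A -> Vec (Fin n) a -> Fin n -> Vec (Fin n) b -> Fin n -> Vec (Fin n) t -> Fin n -> ℕ) -> Ʃ[ x ← xs ] E (φ x) ≡ E (λ us i ws j cs e -> Ʃ[ x ← xs ] φ x us i ws j cs e)
    E-swap xs φ = tr (Ʃ⇆ xs (vecs V a) _) (Ʃ≡ (vecs V a) λ us -> tr (Ʃ⇆ xs V _) (Ʃ≡ V λ i -> tr (Ʃ⇆ xs (vecs V b) _) (Ʃ≡ (vecs V b) λ ws ->
     tr (Ʃ⇆ xs V _) (Ʃ≡ V λ j -> tr (Ʃ⇆ xs (vecs V t) _) (Ʃ≡ (vecs V t) λ cs -> Ʃ⇆ xs V _)))))

    E-joined : ∀ (φ : List (Fin n) -> Fin n -> Fin n -> Fin n -> ℕ) -> E (λ us i ws j cs e -> φ (joined us ws cs) i j e) ≡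
     Ʃ[ i ← V ] Ʃ[ j ← V ] Ʃ[ e ← V ] Ʃ[ y ← seqs ] φ (toList y) i j e
    E-joined φ = begin _ ≡⟨ Ʃ⇆ (vecs V a) V _ ⟩
     _ ≡⟨ Ʃ≡ V (λ i -> tr (Ʃ≡ (vecs V a) λ us -> Ʃ⇆ (vecs V b) V _) (Ʃ⇆ (vecs V a) V _)) ⟩
     _ ≡⟨ Ʃ≡ V (λ i -> Ʃ≡ V λ j -> tr (Ʃ≡ (vecs V a) λ us -> tr (Ʃ≡ (vecs V b) λ ws -> Ʃ⇆ (vecs V t) V _) (Ʃ⇆ (vecs V b) V _)) (Ʃ⇆ (vecs V a) V _)) ⟩
     _ ≡⟨ Ʃ≡ V (λ i -> Ʃ≡ V λ j -> Ʃ≡ V λ e -> sym (tr (Ʃ-vecs-++ V a (b + t) _) (Ʃ≡ (vecs V a) λ us -> tr (Ʃ-vecs-++ V b t _)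
       (Ʃ≡ (vecs V b) λ ws -> Ʃ≡ (vecs V t) λ cs -> ap (λ ys -> φ ys i j e) (tr (Vec.toList-++ us (ws Vec.++ cs)) (ap (toList us ++_) (Vec.toList-++ ws cs))))))) ⟩ _ ∎
     where open ≡R

    event-expand : ∀ c h -> event c a b t h ≡
     E (λ us i ws j cs e -> sat h (system us i ws j cs e) * (ok c (joined us ws cs) i j e * alone h c (keys (joined us ws cs)) e))
    event-expand c h = sym (begin _ ≡⟨ E-cong (λ us i ws j cs e -> tr (ap (_* Ψ us i ws j cs e) (sym (sat-system h us i ws j cs e))) (assoc (link h (src k) us i) (link h (src k') ws j) (link h v̂ cs e) (Ψ us i ws j cs e))) ⟩
     _ ≡⟨ (Ʃ≡ (vecs V a) λ us -> Ʃ≡ V λ i -> tr (Ʃ≡ (vecs V b) λ ws -> tr (Ʃ≡ V λ j -> tr (Ʃ≡ (vecs V t) λ cs -> Ʃ-*ˡ (link h (src k) us i) V _) (Ʃ-*ˡ (link h (src k) us i) (vecs V t) _)) (Ʃ-*ˡ (link h (src k) us i) V _)) (Ʃ-*ˡ (link h (src k) us i) (vecs V b) _)) ⟩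
     _ ≡⟨ Ʃ-link h (src k) a _ ⟩
     _ ≡⟨ (Ʃ≡ (vecs V b) λ ws -> Ʃ≡ V λ j -> tr (Ʃ≡ (vecs V t) λ cs -> Ʃ-*ˡ (link h (src k') ws j) V _) (Ʃ-*ˡ (link h (src k') ws j) (vecs V t) _)) ⟩
     _ ≡⟨ Ʃ-link h (src k') b _ ⟩
     _ ≡⟨ Ʃ-link h v̂ t _ ⟩ _ ∎)
     where
     open ≡R
     Ψ : Vec (Fin n) a -> Fin n -> Vec (Fin n) b -> Fin n -> Vec (Fin n) t -> Fin n -> ℕ
     Ψ us i ws j cs e = ok c (joined us ws cs) i j e * alone h c (keys (joined us ws cs)) e
     pa = path h (src k) a
     va = vertex h (src k) a
     assoc : ∀ x y z w -> x * (y * z) * w ≡ x * (y * (z * w))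
     assoc = ring

    seq-bound : ∀ c us i ws j cs e -> n ^ (S + m) * ok c (joined us ws cs) i j e ≤
     2 * n ^ (L + 3) * Ʃ[ h ← tables ] (sat h (system us i ws j cs e) * (ok c (joined us ws cs) i j e * alone h c (keys (joined us ws cs)) e))
    seq-bound c us i ws j cs e = go (unique? (keys ys)) (weight ys ≤? κ) (stays c (tested ys i j)) (targets c i j e)
     where
     ys = joined us ws cs
     A : Table -> ℕ
     A h = sat h (system us i ws j cs e) * alone h c (keys ys) e
     go : (p : Dec (Unique (keys ys))) (q : Dec (weight ys ≤ κ)) (s τ : ℕ) -> n ^ (S + m) * (𝟙 p * (s * 𝟙 q) * τ) ≤
      2 * n ^ (L + 3) * Ʃ[ h ← tables ] (sat h (system us i ws j cs e) * (𝟙 p * (s * 𝟙 q) * τ * alone h c (keys ys) e))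
     go (no _) q s τ = ⊑ (leq (*-zeroʳ (n ^ (S + m)))) z≤n
     go (yes _) (no _) s τ = ⊑ (leq (tr (ap (λ x -> n ^ (S + m) * ((x + 0) * τ)) (*-zeroʳ s)) (*-zeroʳ (n ^ (S + m))))) z≤n
     go (yes u) (yes l) s τ = begin _ ≤⟨ *ˡ o (mostly-alone c e (system us i ws j cs e) ys (keys-system us i ws j cs e) u l) ⟩
      _ ≡⟨ ap (λ l -> 2 * (n ^ l * Ʃ tables A) * o) (length-system us i ws j cs e) ⟩
      _ ≡⟨ alg (n ^ (L + 3)) (Ʃ tables A) o ⟩
      _ ≡⟨ ap (2 * n ^ (L + 3) *_) (tr (sym (Ʃ-pull tables o A)) (Ʃ≡ tables λ h -> alg' (sat h (system us i ws j cs e)) (alone h c (keys ys) e) o)) ⟩ _ ∎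
      where
      open ≤R
      o = 1 * (s * 1) * τ
      alg : ∀ a b c -> 2 * (a * b) * c ≡ 2 * a * (b * c)
      alg = ring
      alg' : ∀ a b c -> a * b * c ≡ a * (c * b)
      alg' = ring

    -- As a probability over `c` and `h`: at least a quarter of `∣P∣ ∣Q∣ Δ / n³`, the value for
    -- three independent uniform ends. One half is lost to `many-ok` and one to `mostly-alone`; the
    -- factors `n ^ L` of guesses and of constraints cancel.
    first-moment : 8 * (L * L * pairs + L * n * f) ≤ n * n -> 24 * (L * Δ) ≤ n -> 8 * (L * pairs) ≤ n * suc κ ->
     n ^ (S + m) * (n * (∣P∣ * (∣Q∣ * Δ))) ≤ 4 * (n * (n * n)) * Ʃ[ c ← V ] Ʃ[ h ← tables ] event c a b t h
    first-moment h1 h2 h3 = /ˡ (n ^ L) {{m^n≢0 n L}} (begin _ ≡⟨ alg (n ^ L) (n ^ (S + m)) n (∣P∣ * (∣Q∣ * Δ)) ⟩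
     _ ≤⟨ *ʳ (n ^ (S + m)) (many-ok h1 h2 h3) ⟩
     _ ≡⟨ ap (λ s -> n ^ (S + m) * (2 * s)) (Ʃ≡ V λ c -> sym (E-joined (ok c))) ⟩
     _ ≡⟨ tr (alg' (n ^ (S + m)) _) (ap (2 *_) (tr (sym (Ʃ-*ˡ (n ^ (S + m)) V _)) (Ʃ≡ V λ c -> sym (E-*ˡ (n ^ (S + m)) _)))) ⟩
     _ ≤⟨ *ʳ 2 (Ʃ≤ V λ c -> E-mono (seq-bound c)) ⟩
     _ ≡⟨ ap (2 *_) (tr (Ʃ≡ V λ c -> tr (E-*ˡ (2 * n ^ (L + 3)) _) (ap (2 * n ^ (L + 3) *_) (sym (E-swap tables (λ h us i ws j cs e -> sat h (system us i ws j cs e) * (ok c (joined us ws cs) i j e * alone h c (keys (joined us ws cs)) e)))))) (Ʃ-*ˡ (2 * n ^ (L + 3)) V _)) ⟩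
     _ ≡⟨ ap (λ s -> 2 * (2 * n ^ (L + 3) * s)) (Ʃ≡ V λ c -> Ʃ≡ tables λ h -> sym (event-expand c h)) ⟩
     _ ≡⟨ ap (λ x -> 2 * (2 * x * Ʃ[ c ← V ] Ʃ[ h ← tables ] event c a b t h)) (^-distribˡ-+-* n L 3) ⟩
     _ ≡⟨ alg'' (n ^ L) n (Ʃ[ c ← V ] Ʃ[ h ← tables ] event c a b t h) ⟩ _ ∎)
     where
     open ≤R
     alg : ∀ l k n x -> l * (k * (n * x)) ≡ k * (n * l * x)
     alg = ring
     alg' : ∀ k x -> k * (2 * x) ≡ 2 * (k * x)
     alg' = ring
     alg'' : ∀ l n x -> 2 * (2 * (l * (n * (n * (n * 1)))) * x) ≡ l * (4 * (n * (n * n)) * x)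
     alg'' = ring

 -- Meetings and their uniqueness.

 vertex-+ : ∀ h κ1 a {κ2} -> nx (vertex h κ1 a) ≡ κ2 -> ∀ j -> vertex h κ1 (a + suc j) ≡ vertex h κ2 j
 vertex-+ h κ1 zero refl j = refl
 vertex-+ h κ1 (suc a) eq j = vertex-+ h (nx (F h κ1)) a eq j

 unique-++-≢ : ∀ {A : Set} (xs : List A) {ys x y} -> Unique (xs ++ ys) -> x ∈ xs -> y ∈ ys -> x ≢ y
 unique-++-≢ (x ∷ xs) (x∉ ∷ u) (here refl) y∈ eq = All.lookup x∉ (Mem.∈-++⁺ʳ xs y∈) eq
 unique-++-≢ (x ∷ xs) (x∉ ∷ u) (there x∈) y∈ eq = unique-++-≢ xs u x∈ y∈ eq

 record Meeting (c : Fin n) (h : Table) (k k' : Fin S) (a b t : ℕ) : Set where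
  open Pair k k'
  xs : List (Fin n)
  xs = trail h a b t
  i : Fin n
  i = vertex h (src k) a
  j : Fin n
  j = vertex h (src k') b
  e : Fin n
  e = vertex h v̂ t
  field
   distinct : Unique (keys xs)
   unstopped : All (λ x -> ¬ D c x) (tested xs i j)
   lightly : weight xs ≤ κ
   i∈P : P i
   j∈Q : Q j
   e∈D : D c e
   apart : ∀ k'' -> k'' ≢ k -> k'' ≢ k' ->
    Unique (map nx (toList (path h (src k'') T)) ++ src k'' ∷ keys xs) ×
    All (λ x -> ¬ Conf c e x) (vertex h (src k'') T ∷ toList (path h (src k'') T))

 meeting : ∀ c h k k' a b t -> 0 < Pair.event k k' c a b t h -> Meeting c h k k' a b t
 meeting c h k k' a b t pos = record
  { distinct = 𝟙>0 (unique? (keys xs)) (*>0ˡ (𝟙 (unique? (keys xs))) ok1)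
  ; unstopped = 𝟙>0 (All.all? (λ x -> ¬? (D? c x)) (tested xs i j)) (*>0ˡ (stays c (tested xs i j)) ok3)
  ; lightly = 𝟙>0 (weight xs ≤? κ) (*>0ʳ (stays c (tested xs i j)) ok3)
  ; i∈P = 𝟙>0 (P? i) (*>0ˡ (𝟙 (P? i)) ok2)
  ; j∈Q = 𝟙>0 (Q? j) (*>0ˡ (𝟙 (Q? j)) (*>0ʳ (𝟙 (P? i)) ok2))
  ; e∈D = 𝟙>0 (D? c e) (*>0ʳ (𝟙 (Q? j)) (*>0ʳ (𝟙 (P? i)) ok2))
  ; apart = apart
  }
  where
  open Pair k k'
  xs = trail h a b t
  i = vertex h (src k) a
  j = vertex h (src k') b
  e = vertex h v̂ t
  ok>0 : 0 < ok c xs i j e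
  ok>0 = *>0ˡ (ok c xs i j e) pos
  ok1 = *>0ˡ (𝟙 (unique? (keys xs)) * (stays c (tested xs i j) * light xs)) ok>0
  ok2 = *>0ʳ (𝟙 (unique? (keys xs)) * (stays c (tested xs i j) * light xs)) ok>0
  ok3 = *>0ʳ (𝟙 (unique? (keys xs))) ok1
  apart : ∀ k'' -> k'' ≢ k -> k'' ≢ k' -> _
  apart k'' k''≢k k''≢k' with k'' Fin.≟ k | k'' Fin.≟ k' | ∏>0 (allFin S) {undisturbed h c (keys xs) e} (*>0ʳ (ok c xs i j e) pos) (Mem.∈-allFin k'')
  ... | yes eq | _ | _ = refute eq k''≢k
  ... | no _ | yes eq | _ = refute eq k''≢k'
  ... | no _ | no _ | p = 𝟙>0 (unique? ks) (*>0ˡ (𝟙 (unique? ks)) p) , 𝟙>0 (All.all? (λ x -> ¬? (Conf? c e x)) ds) (*>0ʳ (𝟙 (unique? ks)) p)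
   where
   ks = map nx (toList (path h (src k'') T)) ++ src k'' ∷ keys xs
   ds = vertex h (src k'') T ∷ toList (path h (src k'') T)

 event≤1 : ∀ c h k k' a b t -> Pair.event k k' c a b t h ≤ 1
 event≤1 c h k k' a b t = *≤
  (*≤ (*≤ (𝟙≤1 (unique? (keys xs))) (*≤ (𝟙≤1 (All.all? (λ x -> ¬? (D? c x)) (tested xs i j))) (𝟙≤1 (weight xs ≤? κ))))
   (*≤ (𝟙≤1 (P? i)) (*≤ (𝟙≤1 (Q? j)) (𝟙≤1 (D? c e)))))
  (∏≤1 (allFin S) undisturbed≤1)
  where
  open Pair k k'
  xs = trail h a b t
  i = vertex h (src k) a
  j = vertex h (src k') b
  e = vertex h v̂ t
  undisturbed≤1 : ∀ k'' -> undisturbed h c (keys xs) e k'' ≤ 1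
  undisturbed≤1 k'' with k'' Fin.≟ k | k'' Fin.≟ k'
  ... | no _ | no _ = *≤ (𝟙≤1 (unique? (map nx (toList (path h (src k'') T)) ++ src k'' ∷ keys xs))) (𝟙≤1 (All.all? (λ x -> ¬? (Conf? c e x)) (vertex h (src k'') T ∷ toList (path h (src k'') T))))
  ... | no _ | yes _ = rfl≤
  ... | yes _ | no _ = rfl≤
  ... | yes _ | yes _ = rfl≤

 module Effects
  {c h k k' a b t} (M : Meeting c h k k' a b t) where

  open Pair k k'
  open Meeting M

  i⇒v̂ : nx i ≡ v̂
  i⇒v̂ = ap (S ↑ʳ_) (P⇒ i∈P)

  j⇒v̂ : nx j ≡ v̂
  j⇒v̂ = ap (S ↑ʳ_) (Q⇒ j∈Q)

  ∈A : ∀ {x} -> x ∈ toList (path h (src k) a) -> x ∈ xs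
  ∈A = Mem.∈-++⁺ˡ

  ∈B : ∀ {x} -> x ∈ toList (path h (src k') b) -> x ∈ xs
  ∈B = Mem.∈-++⁺ʳ (toList (path h (src k) a)) ∘ Mem.∈-++⁺ˡ

  ∈T : ∀ {x} -> x ∈ toList (path h v̂ t) -> x ∈ xs
  ∈T = Mem.∈-++⁺ʳ (toList (path h (src k) a)) ∘ Mem.∈-++⁺ʳ (toList (path h (src k') b))

  before-v̂ : ∀ {x} -> x ∈ xs -> nx x ≢ v̂
  before-v̂ x∈ = unique-++-≢ (map nx xs) distinct (Mem.∈-map⁺ nx x∈) (there (there (here refl)))

  ∉D : ∀ {x} -> x ∈ xs -> ¬ D c x
  ∉D {x} x∈ = go xs x∈ unstopped
   where
   go : ∀ ys -> x ∈ ys -> All (λ x -> ¬ D c x) (tested ys i j) -> ¬ D c x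
   go ys@(_ ∷ _) x∈ (_ ∷ _ ∷ all) = All.lookup all x∈

  ends∉D : ∀ {x} -> x ∈ xs -> ¬ D c i × ¬ D c j
  ends∉D {x} x∈ = go xs x∈ unstopped
   where
   go : ∀ ys -> x ∈ ys -> All (λ x -> ¬ D c x) (tested ys i j) -> ¬ D c i × ¬ D c j
   go ys@(_ ∷ _) x∈ (p ∷ q ∷ _) = p , q

  avoids-v̂ : ∀ k'' -> k'' ≢ k -> k'' ≢ k' -> ∀ s -> s < T -> nx (vertex h (src k'') s) ≢ v̂
  avoids-v̂ k'' ≢k ≢k' s s<T = unique-++-≢ (map nx (toList (path h (src k'') T))) (proj₁ (apart k'' ≢k ≢k'))
   (Mem.∈-map⁺ nx (∈-path⁺ h (src k'') s s<T)) (there (Mem.∈-++⁺ʳ (map nx xs) (there (there (here refl)))))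

  avoids-bucket : ∀ k'' -> k'' ≢ k -> k'' ≢ k' -> ∀ s -> s ≤ T -> ¬ Conf c e (vertex h (src k'') s)
  avoids-bucket k'' ≢k ≢k' s s≤T with m≤n⇒m<n∨m≡n s≤T | proj₂ (apart k'' ≢k ≢k')
  ... | inj₁ s<T | _ ∷ all = All.lookup all (∈-path⁺ h (src k'') s s<T)
  ... | inj₂ refl | p ∷ _ = p

  A-steps : ∀ s -> 0 < s -> s ≤ a -> ¬ D c (vertex h (src k) s)
  A-steps s 0<s s≤a with m≤n⇒m<n∨m≡n s≤a
  ... | inj₁ s<a = ∉D (∈A (∈-path⁺ h (src k) s s<a))
  ... | inj₂ refl = proj₁ (ends∉D (∈A (∈-path⁺ h (src k) 0 0<s)))

  B-steps : ∀ s -> 0 < s -> s ≤ b -> ¬ D c (vertex h (src k') s)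
  B-steps s 0<s s≤b with m≤n⇒m<n∨m≡n s≤b
  ... | inj₁ s<b = ∉D (∈B (∈-path⁺ h (src k') s s<b))
  ... | inj₂ refl = proj₂ (ends∉D (∈B (∈-path⁺ h (src k') 0 0<s)))

  T-steps : ∀ s -> s < t -> ¬ D c (vertex h v̂ s)
  T-steps s s<t = ∉D (∈T (∈-path⁺ h v̂ s s<t))

 -- No walk outside the pair of a meeting arrives at `v*`, so two meetings involve the same pair,
 -- and the order of the indices tells which walk is which. First arrivals at `v*` then fix `a` and
 -- `b`, and the first stop fixes `t`.
 module Unique-Meeting
  {c h k1 k1' k2 k2' a1 b1 t1 a2 b2 t2} (k1< : toℕ k1 < toℕ k1') (k2< : toℕ k2 < toℕ k2') (a2<T : a2 < T) (b2<T : b2 < T)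
  (M1 : Meeting c h k1 k1' a1 b1 t1) (M2 : Meeting c h k2 k2' a2 b2 t2) where

  k2∈ : k2 ≡ k1 ⊎ k2 ≡ k1'
  k2∈ with k2 Fin.≟ k1 | k2 Fin.≟ k1'
  ... | yes eq | _ = inj₁ eq
  ... | no _ | yes eq = inj₂ eq
  ... | no p | no q = refute (Effects.i⇒v̂ M2) (Effects.avoids-v̂ M1 k2 p q a2 a2<T)

  k2'∈ : k2' ≡ k1 ⊎ k2' ≡ k1'
  k2'∈ with k2' Fin.≟ k1 | k2' Fin.≟ k1'
  ... | yes eq | _ = inj₁ eq
  ... | no _ | yes eq = inj₂ eq
  ... | no p | no q = refute (Effects.j⇒v̂ M2) (Effects.avoids-v̂ M1 k2' p q b2 b2<T)

  same-pair : k1 ≡ k2 × k1' ≡ k2'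
  same-pair with k2∈ | k2'∈
  ... | inj₁ p | inj₂ q = sym p , sym q
  ... | inj₁ refl | inj₁ refl = refute k2< (<-irrefl refl)
  ... | inj₂ refl | inj₂ refl = refute k2< (<-irrefl refl)
  ... | inj₂ refl | inj₁ refl = refute k2< (<-asym k1<)

  same-steps : a1 ≡ a2 × b1 ≡ b2 × t1 ≡ t2
  same-steps with same-pair
  ... | refl , refl = trichotomy a1 a2 (λ lt -> (Effects.before-v̂ M2) (Effects.∈A M2 (∈-path⁺ h (src k1) a1 lt)) (Effects.i⇒v̂ M1)) (λ lt -> (Effects.before-v̂ M1) (Effects.∈A M1 (∈-path⁺ h (src k1) a2 lt)) (Effects.i⇒v̂ M2)) ,
   trichotomy b1 b2 (λ lt -> (Effects.before-v̂ M2) (Effects.∈B M2 (∈-path⁺ h (src k1') b1 lt)) (Effects.j⇒v̂ M1)) (λ lt -> (Effects.before-v̂ M1) (Effects.∈B M1 (∈-path⁺ h (src k1') b2 lt)) (Effects.j⇒v̂ M2)) ,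
   trichotomy t1 t2 (λ lt -> (Effects.T-steps M2) t1 lt (Meeting.e∈D M1)) (λ lt -> (Effects.T-steps M1) t2 lt (Meeting.e∈D M2))
   where
   trichotomy : ∀ x y -> ¬ x < y -> ¬ y < x -> x ≡ y
   trichotomy x y ≮ ≯ = ≤-antisym (≮⇒≥ ≯) (≮⇒≥ ≮)

-- Walks whose last keys are fresh.

module _ {n K : ℕ} .{{_ : NonZero n}} (sh : Fin K -> ℕ) (nx : Fin n -> Fin K) where

 open Walks sh nx

 key : Table -> Fin K -> ℕ -> Fin K
 key h k zero = k
 key h k (suc j) = nx (F h (key h k j))

 key-suc : ∀ h k j -> key h k (suc j) ≡ key h (nx (F h k)) j
 key-suc h k zero = refl
 key-suc h k (suc j) = ap (nx ∘ F h) (key-suc h k j)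

 vertex-key : ∀ h k j -> vertex h k j ≡ F h (key h k j)
 vertex-key h k zero = refl
 vertex-key h k (suc j) = tr (vertex-key h (nx (F h k)) j) (ap (F h) (sym (key-suc h k j)))

 key-update : ∀ h k q x J -> All (q ≢_) (applyUpTo (key h k) J) -> ∀ j -> j ≤ J -> key (h [ q ]≔ x) k j ≡ key h k j
 key-update h k q x J q∉ zero _ = refl
 key-update h k q x J q∉ (suc j) j<J = ap nx (tr (ap (F (h [ q ]≔ x)) (key-update h k q x J q∉ j (<⇒≤ j<J)))
  (F-update h q x (key h k j) (λ eq -> All.applyUpTo⁻ (key h k) J q∉ j<J (sym eq))))

 key∈ : ∀ h k {a} j -> j < a -> key h k (suc j) ∈ map nx (toList (path h k a))
 key∈ h k {a} j j<a = subst (_∈ map nx (toList (path h k a))) (ap nx (vertex-key h k j)) (Mem.∈-map⁺ nx (∈-path⁺ h k j j<a))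

 keys-distinct : ∀ h k a -> All (k ≢_) (map nx (toList (path h k a))) -> Unique (map nx (toList (path h k a))) ->
  ∀ {i j} -> i < j -> j ≤ a -> key h k i ≢ key h k j
 keys-distinct h k a k∉ u {zero} {suc j} _ j<a = All.lookup k∉ (key∈ h k j j<a)
 keys-distinct h k (suc a) k∉ (x∉ ∷ u) {suc i} {suc j} (s≤s i<j) (s≤s j≤a) eq =
  keys-distinct h (nx (F h k)) a x∉ u i<j j≤a (tr (sym (key-suc h k i)) (tr eq (key-suc h k j)))

 -- Two walks whose last keys are fresh: not used before by either walk nor
 -- by the constraints R.
 module Fresh (R : Consts) (kA kB : Fin K) (r r' : ℕ) where

  qA qB : Table -> Fin K
  qA h = key h kA r
  qB h = key h kB r'

  usedA usedB : Table -> List (Fin K)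
  usedA h = applyUpTo (key h kA) r ++ applyUpTo (key h kB) (suc r') ++ map proj₁ R
  usedB h = applyUpTo (key h kA) (suc r) ++ applyUpTo (key h kB) r' ++ map proj₁ R

  FreshEnds : Table -> Set
  FreshEnds h = 0 < sat h R × All (qA h ≢_) (usedA h) × All (qB h ≢_) (usedB h)

  freshEnds? : ∀ h -> Dec (FreshEnds h)
  freshEnds? h = (0 <? sat h R) ×-dec (All.all? (λ k -> ¬? (qA h Fin.≟ k)) (usedA h) ×-dec All.all? (λ k -> ¬? (qB h Fin.≟ k)) (usedB h))

  private
   split : ∀ {A : Set} {P : A -> Set} xs ys {zs} -> All P (xs ++ ys ++ zs) -> All P xs × All P ys × All P zs
   split xs ys all = let p , q = All.++⁻ xs all in p , All.++⁻ ys q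

   restrict : ∀ {A : Set} {P : A -> Set} (f : ℕ -> A) J -> All P (applyUpTo f (suc J)) -> All P (applyUpTo f J)
   restrict f J all = All.applyUpTo⁺₁ f J (λ i<J -> All.applyUpTo⁻ f (suc J) all (m≤n⇒m≤1+n i<J))

   last : ∀ {A : Set} {P : A -> Set} (f : ℕ -> A) J -> All P (applyUpTo f (suc J)) -> P (f J)
   last f J all = All.applyUpTo⁻ f (suc J) all rfl≤

   applyUpTo-cong : ∀ {A : Set} {f g : ℕ -> A} J -> (∀ j -> j < J -> f j ≡ g j) -> applyUpTo f J ≡ applyUpTo g J
   applyUpTo-cong zero eq = refl
   applyUpTo-cong (suc J) eq = ap₂ _∷_ (eq 0 (s≤s z≤n)) (applyUpTo-cong J (λ j j<J -> eq (suc j) (s≤s j<J)))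

   module Update {h} q (x : Fin n) (∉A : All (q ≢_) (applyUpTo (key h kA) r)) (∉B : All (q ≢_) (applyUpTo (key h kB) r')) (∉R : All (q ≢_) (map proj₁ R)) where

    h' : Table
    h' = h [ q ]≔ x

    A≡ : ∀ j -> j ≤ r -> key h' kA j ≡ key h kA j
    A≡ = key-update h kA q x r ∉A

    B≡ : ∀ j -> j ≤ r' -> key h' kB j ≡ key h kB j
    B≡ = key-update h kB q x r' ∉B

    fresh : FreshEnds h -> FreshEnds h'
    fresh (s , a , b) = subst (0 <_) (sym (sat-update h q x R ∉R)) s ,
     subst₂ (λ k ks -> All (k ≢_) ks) (sym (A≡ r rfl≤)) (sym (ap₂ _++_ (applyUpTo-cong r (λ j j<r -> A≡ j (<⇒≤ j<r)))
      (ap (_++ map proj₁ R) (applyUpTo-cong (suc r') (λ j j≤ -> B≡ j (s≤s⁻¹ j≤)))))) a ,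
     subst₂ (λ k ks -> All (k ≢_) ks) (sym (B≡ r' rfl≤)) (sym (ap₂ _++_ (applyUpTo-cong (suc r) (λ j j≤ -> A≡ j (s≤s⁻¹ j≤)))
      (ap (_++ map proj₁ R) (applyUpTo-cong r' (λ j j<r -> B≡ j (<⇒≤ j<r)))))) b

  -- The two last keys depend on the table, but not on the entries stored under them. These entries
  -- can thus be resampled one after the other, which makes both ends uniform.
  fresh-ends : ∀ (X Y : Fin n -> ℕ) ->
   n * (n * Ʃ[ h ← tables ] (𝟙 (freshEnds? h) * (X (F h (qA h)) * Y (F h (qB h))))) ≤ Ʃ V X * (Ʃ V Y * Ʃ[ h ← tables ] sat h R)
  fresh-ends X Y = begin _ ≡⟨ ap (n *_) (tr (ap (_* Ʃ[ h ← tables ] (𝟙 (freshEnds? h) * (X (F h (qA h)) * Y (F h (qB h))))) (sym length-V))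
     (adaptive-resample V freshEnds? qA (λ h x -> X (shift (sh (qA h)) x) * Y (F h (qB h))) invA)) ⟩
   _ ≡⟨ ap (n *_) (Ʃ≡ tables λ h -> ap (𝟙 (freshEnds? h) *_) (tr (Ʃ-*ʳ (Y (F h (qB h))) V _) (ap (_* Y (F h (qB h))) (Ʃ-shift (sh (qA h)) X)))) ⟩
   _ ≡⟨ tr (ap (_* Ʃ[ h ← tables ] (𝟙 (freshEnds? h) * (Ʃ V X * Y (F h (qB h))))) (sym length-V))
     (adaptive-resample V freshEnds? qB (λ h x -> Ʃ V X * Y (shift (sh (qB h)) x)) invB) ⟩
   _ ≤⟨ Ʃ≤ tables (λ h -> ⊑ (leq (ap (𝟙 (freshEnds? h) *_) (tr (Ʃ-*ˡ (Ʃ V X) V _) (ap (Ʃ V X *_) (Ʃ-shift (sh (qB h)) Y)))))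
     (*ˡ (Ʃ V X * Ʃ V Y) (𝟙≤sat h))) ⟩
   _ ≡⟨ tr (Ʃ-*ʳ (Ʃ V X * Ʃ V Y) tables _) (alg (Ʃ[ h ← tables ] sat h R) (Ʃ V X) (Ʃ V Y)) ⟩ _ ∎
   where
   open ≤R
   alg : ∀ a b c -> a * (b * c) ≡ b * (c * a)
   alg = ring
   𝟙≤sat : ∀ h -> 𝟙 (freshEnds? h) ≤ sat h R
   𝟙≤sat h = go (freshEnds? h)
    where
    go : (d : Dec (FreshEnds h)) -> 𝟙 d ≤ sat h R
    go (yes (s , _)) = s
    go (no _) = z≤n
   invA : ∀ h x -> FreshEnds h -> FreshEnds (h [ qA h ]≔ x) × qA (h [ qA h ]≔ x) ≡ qA h ×
    (∀ y -> X (shift (sh (qA (h [ qA h ]≔ x))) y) * Y (F (h [ qA h ]≔ x) (qB (h [ qA h ]≔ x))) ≡ X (shift (sh (qA h)) y) * Y (F h (qB h)))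
   invA h x G@(s , a , b) =
    let ∉A , ∉B , ∉R = split (applyUpTo (key h kA) r) (applyUpTo (key h kB) (suc r')) a
        module U = Update (qA h) x ∉A (restrict (key h kB) r' ∉B) ∉R
    in U.fresh G , U.A≡ r rfl≤ , λ y -> ap₂ (λ k w -> X (shift (sh k) y) * Y w) (U.A≡ r rfl≤)
     (tr (ap (F U.h') (U.B≡ r' rfl≤)) (F-update h (qA h) x (qB h) (last (key h kB) r' ∉B ∘ sym)))
   invB : ∀ h x -> FreshEnds h -> FreshEnds (h [ qB h ]≔ x) × qB (h [ qB h ]≔ x) ≡ qB h ×
    (∀ y -> Ʃ V X * Y (shift (sh (qB (h [ qB h ]≔ x))) y) ≡ Ʃ V X * Y (shift (sh (qB h)) y))
   invB h x G@(s , a , b) =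
    let ∉A , ∉B , ∉R = split (applyUpTo (key h kA) (suc r)) (applyUpTo (key h kB) r') b
        module U = Update (qB h) x (restrict (key h kA) r ∉A) ∉B ∉R
    in U.fresh G , U.B≡ r' rfl≤ , λ y -> ap (λ k -> Ʃ V X * Y (shift (sh k) y)) (U.B≡ r' rfl≤)

-- The second moment over the table.

module Twice (scene : Scene) where

 open Scene scene using (n; m; M; n≢0; m≢0; M≢0; z; v*; P; Q; P?; Q?; P⇒; Q⇒; P∩Q; κ; M-large)

 Seed : Set
 Seed = Vec ℕ 4

 seeds : List Seed
 seeds = vecs (upTo M) 4

 hshift : Seed -> Fin m -> ℕ
 hshift α v = hash n M m α (toℕ v)

 value : Fin m -> Fin (2 + m)
 value v = suc (suc v)

 nx : Fin n -> Fin (2 + m)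
 nx u = value (z u)

 sh : Seed -> Fin (2 + m) -> ℕ
 sh α zero = 0
 sh α (suc zero) = 0
 sh α (suc (suc v)) = hshift α v

 module W (α : Seed) = Walks (sh α) nx

 -- Constraints on the table itself, before any shift.
 module Raw = Walks {K = m} (λ _ -> 0) z

 open Raw using () renaming (Consts to RawConstraints; tables to fns) public

 v̂ : Fin (2 + m)
 v̂ = suc (suc v*)

 base : List (Fin (2 + m))
 base = zero ∷ suc zero ∷ v̂ ∷ []

 trail2 : Seed -> Vec (Fin n) (2 + m) -> ℕ -> ℕ -> List (Fin n)
 trail2 α h a b = toList (W.path α h zero a) ++ toList (W.path α h (suc zero) b)

 valid : List (Fin n) -> Fin n -> Fin n -> ℕ
 valid ys i j = 𝟙 (Raw.unique? (map z ys ++ v* ∷ [])) * 𝟙 (Raw.weight ys ≤? κ) * (𝟙 (P? i) * 𝟙 (Q? j))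

 -- Forgets the common continuation, the stop and all other walks. What remains bounds a meeting
 -- from above and needs two starting vertices only.
 reach : Seed -> ℕ -> ℕ -> Vec (Fin n) (2 + m) -> ℕ
 reach α a b h = valid (trail2 α h a b) (W.vertex α h zero a) (W.vertex α h (suc zero) b)

 ∣P∣ ∣Q∣ : ℕ
 ∣P∣ = Ʃ[ x ← V ] 𝟙 (P? x)
 ∣Q∣ = Ʃ[ x ← V ] 𝟙 (Q? x)

 shift-0 : ∀ (x : Fin n) -> shift 0 x ≡ x
 shift-0 x = Fin.toℕ-injective (tr (toℕ-shift 0 x) (tr (ap (_% n) (+0 (toℕ x))) (m<n⇒m%n≡m (Fin.toℕ<n x))))

 -- `R` is what a first pair of walks, under a hash of its own, has revealed about `h`. That pair
 -- ends on arrival at `v*`, so the entry of `v*` is not among its constraints.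
 module Given (R : RawConstraints) (R-unique : Unique (map proj₁ R)) (R≢v* : All (v* ≢_) (map proj₁ R)) where

  -- Where a known entry of `h` leads under the hash of the second pair.
  β : Seed -> Fin m × Fin n -> Fin n
  β α (v , c) = shift (hshift α v) c

  stepping : (Fin n -> ℕ) -> Seed -> Fin n -> ℕ
  stepping χ α u = Ʃ[ ρ ← R ] (𝟙 (z u Fin.≟ proj₁ ρ) * χ (β α ρ))

  -- Two known entries in a row: `ρ'` leads to the key of `ρ`, which leads to `χ`. Only the hash
  -- makes this unlikely.
  closing : (Fin n -> ℕ) -> Seed -> ℕ
  closing χ α = Ʃ[ ρ ← R ] Ʃ[ ρ' ← R ] (χ (β α ρ) * 𝟙 (z (β α ρ') Fin.≟ proj₁ ρ))

  -- The ways in which a walk can reach χ after a steps: its last key is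
  -- fresh, or that key is one of R and the one before it is fresh, or both
  -- are among R.
  options : (Fin n -> ℕ) -> Seed -> ℕ -> List (ℕ × (Fin n -> ℕ))
  options χ α a = (a , χ) ∷ (a ∸ 1 , stepping χ α) ∷ (0 , λ _ -> closing χ α) ∷ []

  side : (Fin n -> ℕ) -> Seed -> ℕ
  side χ α = Ʃ V χ + (Ʃ V (stepping χ α) + n * closing χ α)

  Ʃoptions : ∀ χ α a -> Ʃ[ o ← options χ α a ] Ʃ V (proj₂ o) ≡ side χ α
  Ʃoptions χ α a = ap (λ s -> Ʃ V χ + (Ʃ V (stepping χ α) + s)) (tr (+0 _) (Ʃ-Fin n (closing χ α)))

  module _ (α : Seed) where

   open W α

   R̂ : Consts
   R̂ = map (λ ρ -> value (proj₁ ρ) , β α ρ) R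

   R̂-keys : map proj₁ R̂ ≡ map value (map proj₁ R)
   R̂-keys = tr (sym (List.map-∘ R)) (List.map-∘ R)

   sat-R̂ : ∀ u w h -> sat (u ∷ w ∷ h) R̂ ≡ Raw.sat h R
   sat-R̂ u w h = go R
    where
    go : ∀ R -> sat (u ∷ w ∷ h) (map (λ ρ -> value (proj₁ ρ) , β α ρ) R) ≡ Raw.sat h R
    go [] = refl
    go ((v , c) ∷ R) = ap₂ _*_ (𝟙-cong (shift (hshift α v) (lookup h v) Fin.≟ β α (v , c)) (shift 0 (lookup h v) Fin.≟ c)
     (λ eq -> tr (shift-0 _) (tr (sym (unshift-shift (hshift α v) (lookup h v))) (tr (ap (unshift (hshift α v)) eq) (unshift-shift (hshift α v) c))))
     (λ eq -> ap (shift (hshift α v)) (tr (sym (shift-0 _)) eq))) (go R)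

   module _ (h : Table) (satR : 0 < sat h R̂) where

    F-R : ∀ {ρ} -> ρ ∈ R -> F h (value (proj₁ ρ)) ≡ β α ρ
    F-R = go R satR
     where
     go : ∀ R {ρ} -> 0 < sat h (map (λ ρ -> value (proj₁ ρ) , β α ρ) R) -> ρ ∈ R -> F h (value (proj₁ ρ)) ≡ β α ρ
     go (ρ ∷ R) s (here refl) = 𝟙>0 (F h (value (proj₁ ρ)) Fin.≟ β α ρ) (*>0ˡ (𝟙 (F h (value (proj₁ ρ)) Fin.≟ β α ρ)) s)
     go (ρ ∷ R) s (there ρ∈) = go R (*>0ʳ (𝟙 (F h (value (proj₁ ρ)) Fin.≟ β α ρ)) s) ρ∈

    fresh? : ∀ k -> (∃ λ ρ -> ρ ∈ R × k ≡ value (proj₁ ρ)) ⊎ All (k ≢_) (map proj₁ R̂)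
    fresh? k with Any.any? (λ ρ -> k Fin.≟ value (proj₁ ρ)) R
    ... | yes any = let ρ , ρ∈ , eq = find any in inj₁ (ρ , ρ∈ , eq)
    ... | no ¬any = inj₂ (subst (All (k ≢_)) (List.map-∘ R) (All.map⁺ (All.¬Any⇒All¬ R ¬any)))

    option : ∀ (χ : Fin n -> ℕ) k0 a -> All (k0 ≢_) (map value (map proj₁ R)) -> 0 < χ (vertex h k0 a) ->
     ∃ λ o -> o ∈ options χ α a × proj₁ o ≤ a × All (key (sh α) nx h k0 (proj₁ o) ≢_) (map proj₁ R̂) × 0 < proj₂ o (F h (key (sh α) nx h k0 (proj₁ o)))
    option χ k0 a k0∉ pos with fresh? (key (sh α) nx h k0 a)
    ... | inj₂ fresh = _ , here refl , rfl≤ , fresh , subst (λ x -> 0 < χ x) (vertex-key (sh α) nx h k0 a) pos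
    option χ k0 zero k0∉ pos | inj₁ (ρ , ρ∈ , eq) = refute eq (All.lookup k0∉ (Mem.∈-map⁺ value (Mem.∈-map⁺ proj₁ ρ∈)))
    option χ k0 (suc r) k0∉ pos | inj₁ (ρ , ρ∈ , eq) = previous (fresh? (key (sh α) nx h k0 r))
     where
     u = F h (key (sh α) nx h k0 r)
     zu : z u ≡ proj₁ ρ
     zu = Fin.suc-injective (Fin.suc-injective eq)
     hit : 0 < χ (β α ρ)
     hit = subst (λ x -> 0 < χ x) (tr (vertex-key (sh α) nx h k0 (suc r)) (tr (ap (F h) eq) (F-R ρ∈))) pos
     pos-* : ∀ {a b} -> 0 < a -> 0 < b -> 0 < a * b
     pos-* p q = *≤ p q
     previous : _ -> ∃ λ o -> o ∈ options χ α (suc r) × proj₁ o ≤ suc r × All (key (sh α) nx h k0 (proj₁ o) ≢_) (map proj₁ R̂) × 0 < proj₂ o (F h (key (sh α) nx h k0 (proj₁ o)))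
     previous (inj₂ fresh) = _ , there (here refl) , n≤1+n r , fresh ,
      ⊑ (pos-* (leq (sym (𝟙-yes (z u Fin.≟ proj₁ ρ) zu))) hit) (term≤Ʃ (λ ρ -> 𝟙 (z u Fin.≟ proj₁ ρ) * χ (β α ρ)) ρ∈)
     -- The source key is never among the known ones, so it stands in for the missing fresh end; the
     -- function attached to this option is constant.
     previous (inj₁ (ρ' , ρ'∈ , eq')) = _ , there (there (here refl)) , z≤n , subst (All (k0 ≢_)) (sym R̂-keys) k0∉ ,
      ⊑ (pos-* hit (leq (sym (𝟙-yes (z (β α ρ') Fin.≟ proj₁ ρ) (tr (ap z (sym (tr (ap (F h) eq') (F-R ρ'∈)))) zu)))))
       (⊑ (term≤Ʃ (λ ρ' -> χ (β α ρ) * 𝟙 (z (β α ρ') Fin.≟ proj₁ ρ)) ρ'∈) (term≤Ʃ (λ ρ -> Ʃ[ ρ' ← R ] (χ (β α ρ) * 𝟙 (z (β α ρ') Fin.≟ proj₁ ρ))) ρ∈))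

   suc²≢ : ∀ xs -> All (zero ≢_) (map value xs) × All (suc zero ≢_) (map value xs)
   suc²≢ xs = All.map⁺ (All.universal (λ _ ()) xs) , All.map⁺ (All.universal (λ _ ()) xs)

   module _ (a b : ℕ) where

    freshTerm : (ℕ × (Fin n -> ℕ)) -> (ℕ × (Fin n -> ℕ)) -> Table -> ℕ
    freshTerm (r , X) (r' , Y) h = 𝟙 (Fresh.freshEnds? (sh α) nx R̂ zero (suc zero) r r' h) *
     (X (F h (key (sh α) nx h zero r)) * Y (F h (key (sh α) nx h (suc zero) r')))

    -- All keys of a valid pair of walks are distinct, so a key outside `R` near the end of a walk
    -- is fresh in the sense of `FreshEnds`. Each walk thus contributes one of its options.
    reach≤ : ∀ h -> sat h R̂ * reach α a b h ≤ Ʃ[ o ← options (𝟙 ∘ P?) α a ] Ʃ[ o' ← options (𝟙 ∘ Q?) α b ] freshTerm o o' h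
    reach≤ h with 0 <? sat h R̂ * reach α a b h
    ... | no ≤0 = ⊑ (≮⇒≥ ≤0) z≤n
    ... | yes pos = ⊑ ≤1 found
     where
     ys = trail2 α h a b
     i = vertex h zero a
     j = vertex h (suc zero) b
     satR : 0 < sat h R̂
     satR = *>0ˡ (sat h R̂) pos
     val : 0 < valid ys i j
     val = *>0ʳ (sat h R̂) pos
     ends = *>0ʳ (𝟙 (Raw.unique? (map z ys ++ v* ∷ [])) * 𝟙 (Raw.weight ys ≤? κ)) val
     uniq : Unique (map z ys ++ v* ∷ [])
     uniq = 𝟙>0 (Raw.unique? (map z ys ++ v* ∷ [])) (*>0ˡ (𝟙 (Raw.unique? (map z ys ++ v* ∷ []))) (*>0ˡ (𝟙 (Raw.unique? (map z ys ++ v* ∷ [])) * 𝟙 (Raw.weight ys ≤? κ)) val))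
     sat≤1 : ∀ cs -> sat h cs ≤ 1
     sat≤1 [] = rfl≤
     sat≤1 ((k , y) ∷ cs) = *≤ (𝟙≤1 (F h k Fin.≟ y)) (sat≤1 cs)
     ≤1 : sat h R̂ * reach α a b h ≤ 1
     ≤1 = *≤ (sat≤1 R̂) (*≤ (*≤ (𝟙≤1 (Raw.unique? (map z ys ++ v* ∷ []))) (𝟙≤1 (Raw.weight ys ≤? κ))) (*≤ (𝟙≤1 (P? i)) (𝟙≤1 (Q? j))))
     us ws : List (Fin n)
     us = toList (path h zero a)
     ws = toList (path h (suc zero) b)
     uniq-nx : Unique (map nx us ++ map nx ws)
     uniq-nx = subst Unique (tr (sym (List.map-∘ ys)) (List.map-++ nx us ws)) (AllPairs.map⁺ (AllPairs.map (λ z≢ eq -> z≢ (Fin.suc-injective (Fin.suc-injective eq))) (prefix (map z ys) uniq)))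
      where
      prefix : ∀ xs {ys : List (Fin m)} -> Unique (xs ++ ys) -> Unique xs
      prefix [] _ = []
      prefix (x ∷ xs) (x∉ ∷ u) = All.++⁻ˡ xs x∉ ∷ prefix xs u
     uniqA : Unique (map nx us)
     uniqA = go (map nx us) uniq-nx
      where
      go : ∀ xs {ys : List (Fin (2 + m))} -> Unique (xs ++ ys) -> Unique xs
      go [] _ = []
      go (x ∷ xs) (x∉ ∷ u) = All.++⁻ˡ xs x∉ ∷ go xs u
     uniqB : Unique (map nx ws)
     uniqB = go (map nx us) uniq-nx
      where
      go : ∀ xs {ys : List (Fin (2 + m))} -> Unique (xs ++ ys) -> Unique ys
      go [] u = u
      go (x ∷ xs) (_ ∷ u) = go xs u
     key' = key (sh α) nx h
     A# : ∀ {s t} -> s < t -> t ≤ a -> key' zero s ≢ key' zero t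
     A# = keys-distinct (sh α) nx h zero a (subst (All (zero ≢_)) (sym (List.map-∘ us)) (proj₁ (suc²≢ (map z us)))) uniqA
     B# : ∀ {s t} -> s < t -> t ≤ b -> key' (suc zero) s ≢ key' (suc zero) t
     B# = keys-distinct (sh α) nx h (suc zero) b (subst (All (suc zero ≢_)) (sym (List.map-∘ ws)) (proj₂ (suc²≢ (map z ws)))) uniqB
     AB# : ∀ s t -> s ≤ a -> t ≤ b -> key' zero s ≢ key' (suc zero) t
     AB# zero zero _ _ ()
     AB# zero (suc t) _ _ ()
     AB# (suc s) zero _ _ ()
     AB# (suc s) (suc t) s<a t<b = apart (map nx us) uniq-nx (key∈ (sh α) nx h zero s s<a) (key∈ (sh α) nx h (suc zero) t t<b)
      where
      apart : ∀ xs {ys x y} -> Unique (xs ++ ys) -> x ∈ xs -> y ∈ ys -> x ≢ y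
      apart (x ∷ xs) (x∉ ∷ u) (here refl) y∈ eq = All.lookup x∉ (Mem.∈-++⁺ʳ xs y∈) eq
      apart (x ∷ xs) (x∉ ∷ u) (there x∈) y∈ eq = apart xs u x∈ y∈ eq
     found : 1 ≤ Ʃ[ o ← options (𝟙 ∘ P?) α a ] Ʃ[ o' ← options (𝟙 ∘ Q?) α b ] freshTerm o o' h
     found =
      let oA , oA∈ , rA≤ , freshA , posA = option h satR (𝟙 ∘ P?) zero a (proj₁ (suc²≢ (map proj₁ R))) (*>0ˡ (𝟙 (P? i)) ends)
          oB , oB∈ , rB≤ , freshB , posB = option h satR (𝟙 ∘ Q?) (suc zero) b (proj₂ (suc²≢ (map proj₁ R))) (*>0ʳ (𝟙 (P? i)) ends)
          rA = proj₁ oA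
          rB = proj₁ oB
          G : Fresh.FreshEnds (sh α) nx R̂ zero (suc zero) rA rB h
          G = satR ,
           All.++⁺ (All.applyUpTo⁺₁ (key' zero) rA (λ s< eq -> A# s< rA≤ (sym eq)))
            (All.++⁺ (All.applyUpTo⁺₁ (key' (suc zero)) (suc rB) (λ {s} s< -> AB# rA s rA≤ (⊑ (s≤s⁻¹ s<) rB≤))) freshA) ,
           All.++⁺ (All.applyUpTo⁺₁ (key' zero) (suc rA) (λ {s} s< eq -> AB# s rB (⊑ (s≤s⁻¹ s<) rA≤) rB≤ (sym eq)))
            (All.++⁺ (All.applyUpTo⁺₁ (key' (suc zero)) rB (λ s< eq -> B# s< rB≤ (sym eq))) freshB)
      in ⊑ (*≤ (leq (sym (𝟙-yes (Fresh.freshEnds? (sh α) nx R̂ zero (suc zero) rA rB h) G))) (*≤ posA posB))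
       (⊑ (term≤Ʃ (λ o' -> freshTerm oA o' h) oB∈) (term≤Ʃ (λ o -> Ʃ[ o' ← options (𝟙 ∘ Q?) α b ] freshTerm o o' h) oA∈))

    Ʃtables : ∀ (φ : Table -> ℕ) -> Ʃ tables φ ≡ Ʃ[ u ← V ] Ʃ[ w ← V ] Ʃ[ h ← fns ] φ (u ∷ w ∷ h)
    Ʃtables φ = tr (Ʃ-vecs-suc V (suc m) φ) (Ʃ≡ V λ u -> Ʃ-vecs-suc V m (φ ∘ (u ∷_)))

    walks≤ : Ʃ[ u ← V ] Ʃ[ w ← V ] Ʃ[ h ← fns ] (Raw.sat h R * reach α a b (u ∷ w ∷ h)) ≤
     side (𝟙 ∘ P?) α * (side (𝟙 ∘ Q?) α * Ʃ[ h ← fns ] Raw.sat h R)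
    walks≤ = /ˡ n (/ˡ n (begin _ ≡⟨ ap (λ s -> n * (n * s)) (tr (Ʃ≡ V λ u -> Ʃ≡ V λ w -> Ʃ≡ fns λ h -> ap (_* reach α a b (u ∷ w ∷ h)) (sym (sat-R̂ u w h))) (sym (Ʃtables (λ h -> sat h R̂ * reach α a b h)))) ⟩
     _ ≤⟨ *ʳ n (*ʳ n (Ʃ≤ tables reach≤)) ⟩
     _ ≡⟨ ap (λ s -> n * (n * s)) (tr (Ʃ⇆ tables (options (𝟙 ∘ P?) α a) (λ h o -> Ʃ[ o' ← options (𝟙 ∘ Q?) α b ] freshTerm o o' h)) (Ʃ≡ (options (𝟙 ∘ P?) α a) λ o -> Ʃ⇆ tables (options (𝟙 ∘ Q?) α b) (λ h o' -> freshTerm o o' h))) ⟩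
     _ ≡⟨ tr (ap (n *_) (pull (λ o o' -> Ʃ tables (freshTerm o o')))) (pull (λ o o' -> n * Ʃ tables (freshTerm o o'))) ⟩
     _ ≤⟨ Ʃ≤ (options (𝟙 ∘ P?) α a) (λ o -> Ʃ≤ (options (𝟙 ∘ Q?) α b) λ o' -> Fresh.fresh-ends (sh α) nx R̂ zero (suc zero) (proj₁ o) (proj₁ o') (proj₂ o) (proj₂ o')) ⟩
     _ ≡⟨ tr (Ʃ≡ (options (𝟙 ∘ P?) α a) λ o -> tr (Ʃ-*ˡ (total o) (options (𝟙 ∘ Q?) α b) (λ o' -> total o' * H)) (ap (total o *_) (tr (Ʃ-*ʳ H (options (𝟙 ∘ Q?) α b) total) (ap (_* H) (Ʃoptions (𝟙 ∘ Q?) α b)))))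
       (tr (Ʃ-*ʳ (side (𝟙 ∘ Q?) α * H) (options (𝟙 ∘ P?) α a) total) (ap (_* (side (𝟙 ∘ Q?) α * H)) (Ʃoptions (𝟙 ∘ P?) α a))) ⟩
     _ ≡⟨ ap (λ s -> side (𝟙 ∘ P?) α * (side (𝟙 ∘ Q?) α * s)) (tr (Ʃtables (λ h -> sat h R̂)) (tr (Ʃ≡ V λ u -> tr (Ʃ≡ V λ w -> Ʃ≡ fns λ h -> sat-R̂ u w h) (Ʃ-Fin n _)) (Ʃ-Fin n _))) ⟩
     _ ≡⟨ alg (side (𝟙 ∘ P?) α) (side (𝟙 ∘ Q?) α) n (Ʃ[ h ← fns ] Raw.sat h R) ⟩ _ ∎))
     where
     open ≤R
     H = Ʃ[ h ← tables ] sat h R̂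
     pull : ∀ (φ : ℕ × (Fin n -> ℕ) -> ℕ × (Fin n -> ℕ) -> ℕ) -> n * Ʃ[ o ← options (𝟙 ∘ P?) α a ] Ʃ[ o' ← options (𝟙 ∘ Q?) α b ] φ o o' ≡
      Ʃ[ o ← options (𝟙 ∘ P?) α a ] Ʃ[ o' ← options (𝟙 ∘ Q?) α b ] (n * φ o o')
     pull φ = sym (tr (Ʃ≡ (options (𝟙 ∘ P?) α a) λ o -> Ʃ-*ˡ n (options (𝟙 ∘ Q?) α b) (φ o)) (Ʃ-*ˡ n (options (𝟙 ∘ P?) α a) (λ o -> Ʃ[ o' ← options (𝟙 ∘ Q?) α b ] φ o o')))
     total : ℕ × (Fin n -> ℕ) -> ℕ
     total o = Ʃ V (proj₂ o)
     alg : ∀ a b n s -> a * (b * (n * (n * s))) ≡ n * (n * (a * (b * s)))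
     alg = ring

  -- A condition χ on where the function β leads from one of the pairs.
  Condition : Set
  Condition = (Fin m × Fin n) × (Fin n -> ℕ)

  holds : Seed -> List Condition -> ℕ
  holds α [] = 1
  holds α ((ρ , χ) ∷ cs) = χ (β α ρ) * holds α cs

  volume : List Condition -> ℕ
  volume [] = 1
  volume ((ρ , χ) ∷ cs) = Ʃ V χ * volume cs

  vertexOf : Condition -> Fin m
  vertexOf ((v , _) , _) = v

  Apart : Condition -> Condition -> Set
  Apart c c' = vertexOf c ≢ vertexOf c'

  hash<n : ∀ (α : Seed) v -> hash n M m α v < n
  hash<n α v = *-cancelʳ-< M _ n (≤< (m/n*n≤m _ M) (≤< (leq (*-comm _ n)) (*-monoʳ-< n (m%n<n _ M))))

  -- To prescribe where a known entry leads is to prescribe one hash value.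
  β-hash : ∀ α v c x -> 𝟙 (β α (v , c) Fin.≟ x) ≤ 𝟙 (hash n M m α (toℕ v) ≟ toℕ (unshift (toℕ c) x))
  β-hash α v c x = 𝟙-mono (β α (v , c) Fin.≟ x) (hash n M m α (toℕ v) ≟ toℕ (unshift (toℕ c) x)) λ eq ->
   tr (sym (Fin.toℕ-fromℕ< lt)) (ap toℕ (tr (sym (unshift-shift (toℕ c) s)) (ap (unshift (toℕ c)) (tr (Fin.toℕ-injective
    (tr (toℕ-shift (toℕ c) s) (tr (ap (_% n) (tr (ap (_+ toℕ c) (Fin.toℕ-fromℕ< lt)) (+-comm _ (toℕ c)))) (sym (toℕ-shift (hshift α v) c))))) eq))))
   where
   lt = hash<n α (toℕ v)
   s = Fin.fromℕ< lt

  -- Conditions are traded one by one for prescribed hash values collected in `ks`, by summing over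
  -- where each entry leads. The bound on the total keeps the final list within reach of
  -- `hash-independent`.
  holds-hits : ∀ cs ks -> AllPairs Apart cs -> All (λ c -> All (λ κ -> toℕ (vertexOf c) ≢ proj₁ κ) ks) cs ->
   All (λ κ -> proj₁ κ < m) ks -> AllPairs (λ κ κ' -> proj₁ κ ≢ proj₁ κ') ks -> length cs + length ks ≤ 4 ->
   Ʃ[ α ← seeds ] (holds α cs * hits n M m α ks) * n ^ (length cs + length ks) ≤ volume cs * (2 ^ (length cs + length ks) * M ^ 4)
  holds-hits [] ks _ _ ks< ks# len≤ = begin _ ≡⟨ ap (_* n ^ length ks) (Ʃ≡ seeds λ α -> *-identityˡ _) ⟩
   _ ≤⟨ hash-independent n M m 3 M-large ks len≤ ks< ks# ⟩
   _ ≡⟨ sym (*-identityˡ _) ⟩ _ ∎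
   where open ≤R
  holds-hits (((v , c) , χ) ∷ cs) ks (c# ∷ cs#) (ck ∷ csk) ks< ks# len≤ = begin _ ≤⟨ *ˡ N (Ʃ≤ seeds λ α -> ⊑ (leq (expand α)) (Ʃ≤ V λ x -> *ʳ (χ x) (⊑ (*ˡ _ (β-hash α v c x)) (leq (swap (𝟙 (hash n M m α (toℕ v) ≟ t x)) (holds α cs) (hits n M m α ks)))))) ⟩
   _ ≡⟨ ap (_* N) (tr (Ʃ⇆ seeds V _) (Ʃ≡ V λ x -> Ʃ-*ˡ (χ x) seeds _)) ⟩
   _ ≡⟨ tr (sym (Ʃ-*ʳ N V _)) (Ʃ≡ V λ x -> *-assoc (χ x) _ N) ⟩
   _ ≤⟨ Ʃ≤ V (λ x -> *ʳ (χ x) (ih x)) ⟩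
   _ ≡⟨ tr (Ʃ-*ʳ _ V χ) (sym (*-assoc (Ʃ V χ) (volume cs) _)) ⟩ _ ∎
   where
   open ≤R
   N = n ^ suc (length cs + length ks)
   t : Fin n -> ℕ
   t x = toℕ (unshift (toℕ c) x)
   swap : ∀ a b c -> a * (b * c) ≡ b * (a * c)
   swap = ring
   expand : ∀ α -> χ (β α (v , c)) * holds α cs * hits n M m α ks ≡ Ʃ[ x ← V ] (χ x * (𝟙 (β α (v , c) Fin.≟ x) * (holds α cs * hits n M m α ks)))
   expand α = tr (*-assoc (χ (β α (v , c))) _ _) (sym (tr (Ʃ≡ V λ x -> swap (χ x) (𝟙 (β α (v , c) Fin.≟ x)) _) (Ʃ-allFin-δ (β α (v , c)) (λ x -> χ x * (holds α cs * hits n M m α ks)))))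
   ih : ∀ x -> Ʃ[ α ← seeds ] (holds α cs * hits n M m α ((toℕ v , t x) ∷ ks)) * N ≤ volume cs * (2 ^ suc (length cs + length ks) * M ^ 4)
   ih x = subst (λ l -> Ʃ[ α ← seeds ] (holds α cs * hits n M m α ((toℕ v , t x) ∷ ks)) * n ^ l ≤ volume cs * (2 ^ l * M ^ 4)) (+-suc (length cs) (length ks))
    (holds-hits cs ((toℕ v , t x) ∷ ks) cs# (All.zipWith (λ (v≢ , k≢) -> (λ eq -> v≢ (sym (Fin.toℕ-injective eq))) ∷ k≢) (c# , csk))
     (Fin.toℕ<n v ∷ ks<) (ck ∷ ks#) (subst (_≤ 4) (sym (+-suc (length cs) (length ks))) len≤))

  -- Conditions on one and the same key are not independent. By `apart` such products vanish, so
  -- distinct keys may be assumed.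
  holds≤ : ∀ cs -> length cs ≤ 4 -> (∀ α -> 0 < holds α cs -> AllPairs Apart cs) ->
   Ʃ[ α ← seeds ] holds α cs * n ^ length cs ≤ 2 ^ length cs * volume cs * M ^ 4
  holds≤ cs len≤ apart with AllPairs.allPairs? (λ c c' -> ¬? (vertexOf c Fin.≟ vertexOf c')) cs
  ... | yes cs# = begin _ ≡⟨ ap₂ _*_ (Ʃ≡ seeds λ α -> sym (*1 _)) (ap (n ^_) (sym (+0 (length cs)))) ⟩
   _ ≤⟨ holds-hits cs [] cs# (All.universal (λ _ -> []) cs) [] [] (subst (_≤ 4) (sym (+0 _)) len≤) ⟩
   _ ≡⟨ ap (λ l -> volume cs * (2 ^ l * M ^ 4)) (+0 (length cs)) ⟩
   _ ≡⟨ alg (volume cs) (2 ^ length cs) (M ^ 4) ⟩ _ ∎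
   where
   open ≤R
   alg : ∀ a b c -> a * (b * c) ≡ b * a * c
   alg = ring
  ... | no ¬cs# = ⊑ (leq (ap (_* n ^ length cs) (tr (Ʃ≡ seeds λ α -> n≤0⇒n≡0 (≮⇒≥ (λ pos -> ¬cs# (apart α pos)))) (Ʃ-0 seeds)))) z≤n

  wt : Fin m -> ℕ
  wt = Raw.wt

  weightR : ℕ
  weightR = Ʃ[ ρ ← R ] wt (proj₁ ρ)

  toward : Fin m -> Fin n -> ℕ
  toward v x = 𝟙 (z x Fin.≟ v)

  -- A summand of `side`, as a coefficient times a product of conditions. `scale` supplies the
  -- missing factors `n`, so that terms with different numbers of conditions are measured against
  -- the same `n * n`.
  record Term : Set where
   constructor term
   field
    coefficient scale : ℕ
    conds : List Condition

  open Term

  terms : (Fin n -> ℕ) -> List Term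
  terms χ = term (Ʃ V χ) (n * n) [] ∷
   map (λ ρ -> term (wt (proj₁ ρ)) n ((ρ , χ) ∷ [])) R ++
   cartesianProductWith (λ ρ ρ' -> term n 1 ((ρ , χ) ∷ (ρ' , toward (proj₁ ρ)) ∷ [])) R R

  Ʃterms : ∀ χ (φ : Term -> ℕ) -> Ʃ (terms χ) φ ≡ φ (term (Ʃ V χ) (n * n) []) +
   (Ʃ[ ρ ← R ] φ (term (wt (proj₁ ρ)) n ((ρ , χ) ∷ [])) + Ʃ[ ρ ← R ] Ʃ[ ρ' ← R ] φ (term n 1 ((ρ , χ) ∷ (ρ' , toward (proj₁ ρ)) ∷ [])))
  Ʃterms χ φ = ap (φ (term (Ʃ V χ) (n * n) []) +_) (tr (Ʃ-++ (map (λ ρ -> term (wt (proj₁ ρ)) n ((ρ , χ) ∷ [])) R) _ φ)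
   (ap₂ _+_ (Ʃ-map _ R φ) (Ʃ-⊗ _ R R φ)))

  amount : Seed -> Term -> ℕ
  amount α τ = coefficient τ * holds α (conds τ)

  side-terms : ∀ χ α -> side χ α ≡ Ʃ (terms χ) (amount α)
  side-terms χ α = sym (tr (Ʃterms χ (amount α)) (ap₂ _+_ (*1 (Ʃ V χ)) (ap₂ _+_
   (tr (Ʃ≡ R λ ρ -> tr (ap (wt (proj₁ ρ) *_) (*1 (χ (β α ρ)))) (sym (Ʃ-*ʳ (χ (β α ρ)) V (λ u -> 𝟙 (z u Fin.≟ proj₁ ρ)))))
    (sym (Ʃ⇆ V R (λ u ρ -> 𝟙 (z u Fin.≟ proj₁ ρ) * χ (β α ρ)))))
   (tr (Ʃ≡ R λ ρ -> tr (Ʃ≡ R λ ρ' -> ap (λ y -> n * (χ (β α ρ) * y)) (*1 (toward (proj₁ ρ) (β α ρ'))))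
    (Ʃ-*ˡ n R (λ ρ' -> χ (β α ρ) * toward (proj₁ ρ) (β α ρ')))) (Ʃ-*ˡ n R (λ ρ -> Ʃ[ ρ' ← R ] (χ (β α ρ) * toward (proj₁ ρ) (β α ρ'))))))))

  bound : Term -> ℕ
  bound τ = coefficient τ * (scale τ * (2 ^ length (conds τ) * volume (conds τ)))

  Ʃbound : ∀ χ -> Ʃ (terms χ) bound ≡ Ʃ V χ * (n * (n + 2 * weightR + 4 * length R * weightR))
  Ʃbound χ = tr (Ʃterms χ bound) (tr (ap (bound (term (Ʃ V χ) (n * n) []) +_) (ap₂ _+_
   (tr (Ʃ≡ R λ ρ -> one (wt (proj₁ ρ)) n (Ʃ V χ)) (Ʃ-*ʳ (n * (2 * Ʃ V χ)) R (wt ∘ proj₁)))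
   (tr (Ʃ≡ R λ ρ -> tr (Ʃ-const R _) (two (length R) n (Ʃ V χ) (wt (proj₁ ρ)))) (Ʃ-*ʳ (length R * n * (4 * Ʃ V χ)) R (wt ∘ proj₁)))))
   (collect n (Ʃ V χ) weightR (length R)))
   where
   one : ∀ w n x -> w * (n * (2 * (x * 1))) ≡ w * (n * (2 * x))
   one = ring
   two : ∀ r n x w -> r * (n * (1 * (4 * (x * (w * 1))))) ≡ w * (r * n * (4 * x))
   two = ring
   collect : ∀ n x w r -> x * (n * n * (1 * 1)) + (w * (n * (2 * x)) + w * (r * n * (4 * x))) ≡ x * (n * (n + 2 * w + 4 * r * w))
   collect = ring

  Scaled : Term -> Set
  Scaled τ = n ^ length (conds τ) * scale τ ≡ n * n

  Compatible : Term -> Term -> Set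
  Compatible τ τ' = length (conds τ ++ conds τ') ≤ 4 × (∀ α -> 0 < holds α (conds τ ++ conds τ') -> AllPairs Apart (conds τ ++ conds τ'))

  holds-++ : ∀ α cs ds -> holds α (cs ++ ds) ≡ holds α cs * holds α ds
  holds-++ α [] ds = sym (+0 _)
  holds-++ α ((ρ , χ) ∷ cs) ds = tr (ap (χ (β α ρ) *_) (holds-++ α cs ds)) (sym (*-assoc (χ (β α ρ)) _ _))

  volume-++ : ∀ cs ds -> volume (cs ++ ds) ≡ volume cs * volume ds
  volume-++ [] ds = sym (+0 _)
  volume-++ ((ρ , χ) ∷ cs) ds = tr (ap (Ʃ V χ *_) (volume-++ cs ds)) (sym (*-assoc (Ʃ V χ) _ _))

  product≤ : ∀ τ τ' -> Scaled τ -> Scaled τ' -> Compatible τ τ' ->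
   n * n * (n * n) * Ʃ[ α ← seeds ] (amount α τ * amount α τ') ≤ bound τ * bound τ' * M ^ 4
  product≤ τ τ' sc sc' (len≤ , apart) = begin _ ≡⟨ ap₂ (λ x y -> x * y * Ʃ[ α ← seeds ] (amount α τ * amount α τ')) (sym sc) (sym sc') ⟩
   _ ≡⟨ ap (n ^ l * s * (n ^ l' * s') *_) (tr (Ʃ≡ seeds λ α -> tr (alg c (holds α cs) c' (holds α cs')) (ap (c * c' *_) (sym (holds-++ α cs cs')))) (Ʃ-*ˡ (c * c') seeds _)) ⟩
   _ ≡⟨ alg' (n ^ l) s (n ^ l') s' c c' _ ⟩
   _ ≡⟨ ap (λ x -> c * c' * (s * s') * (Ʃ[ α ← seeds ] holds α (cs ++ cs') * x)) (tr (sym (^-distribˡ-+-* n l l')) (ap (n ^_) (sym (List.length-++ cs)))) ⟩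
   _ ≤⟨ *ʳ (c * c' * (s * s')) (holds≤ (cs ++ cs') len≤ apart) ⟩
   _ ≡⟨ ap₂ (λ x y -> c * c' * (s * s') * (x * y * M ^ 4)) (tr (ap (2 ^_) (List.length-++ cs)) (^-distribˡ-+-* 2 l l')) (volume-++ cs cs') ⟩
   _ ≡⟨ alg'' c c' s s' (2 ^ l) (2 ^ l') (volume cs) (volume cs') (M ^ 4) ⟩ _ ∎
   where
   open ≤R
   c = coefficient τ ; c' = coefficient τ' ; s = scale τ ; s' = scale τ'
   cs = conds τ ; cs' = conds τ' ; l = length cs ; l' = length cs'
   alg : ∀ c h c' h' -> c * h * (c' * h') ≡ c * c' * (h * h')
   alg = ring
   alg' : ∀ a s b s' c c' x -> a * s * (b * s') * (c * c' * x) ≡ c * c' * (s * s') * (x * (a * b))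
   alg' = ring
   alg'' : ∀ c c' s s' t t' v v' M -> c * c' * (s * s') * (t * t' * (v * v') * M) ≡ c * (s * (t * v)) * (c' * (s' * (t' * v'))) * M
   alg'' = ring

  scaled : ∀ χ {τ} -> τ ∈ terms χ -> Scaled τ
  scaled χ (here refl) = *-identityˡ (n * n)
  scaled χ (there τ∈) with Mem.∈-++⁻ (map (λ ρ -> term (wt (proj₁ ρ)) n ((ρ , χ) ∷ [])) R) τ∈
  ... | inj₁ τ∈' with Mem.∈-map⁻ _ τ∈'
  ... | ρ , _ , refl = ap (_* n) (*1 n)
  scaled χ (there τ∈) | inj₂ τ∈' with Mem.∈-cartesianProductWith⁻ _ R R τ∈'
  ... | ρ , ρ' , _ , _ , refl = tr (*1 _) (ap (n *_) (*1 n))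

  pair-unique : ∀ {ρ ρ'} -> ρ ∈ R -> ρ' ∈ R -> proj₁ ρ ≡ proj₁ ρ' -> ρ ≡ ρ'
  pair-unique = go R R-unique
   where
   go : ∀ R {ρ ρ'} -> Unique (map proj₁ R) -> ρ ∈ R -> ρ' ∈ R -> proj₁ ρ ≡ proj₁ ρ' -> ρ ≡ ρ'
   go (_ ∷ R) _ (here refl) (here refl) eq = refl
   go (_ ∷ R) (new ∷ _) (here refl) (there ρ'∈) eq = refute eq (All.lookup new (Mem.∈-map⁺ proj₁ ρ'∈))
   go (_ ∷ R) (new ∷ _) (there ρ∈) (here refl) eq = refute (sym eq) (All.lookup new (Mem.∈-map⁺ proj₁ ρ∈))
   go (_ ∷ R) (_ ∷ u) (there ρ∈) (there ρ'∈) eq = go R u ρ∈ ρ'∈ eq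

  module _ (α : Seed) {ρ ρ' : Fin m × Fin n} (ρ∈ : ρ ∈ R) (ρ'∈ : ρ' ∈ R) where

   private
    same : proj₁ ρ ≡ proj₁ ρ' -> β α ρ ≡ β α ρ'
    same = ap (β α) ∘ pair-unique ρ∈ ρ'∈

   P#Q : 0 < 𝟙 (P? (β α ρ)) -> 0 < 𝟙 (Q? (β α ρ')) -> proj₁ ρ ≢ proj₁ ρ'
   P#Q p q eq = P∩Q (𝟙>0 (P? (β α ρ)) p) (subst Q (sym (same eq)) (𝟙>0 (Q? (β α ρ')) q))

   v*#toward : ∀ {ρ''} -> ρ'' ∈ R -> z (β α ρ) ≡ v* -> 0 < toward (proj₁ ρ'') (β α ρ') -> proj₁ ρ ≢ proj₁ ρ'
   v*#toward {ρ''} ρ''∈ z≡ pos eq = All.lookup R≢v* (Mem.∈-map⁺ proj₁ ρ''∈)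
    (tr (sym z≡) (tr (ap z (same eq)) (𝟙>0 (z (β α ρ') Fin.≟ proj₁ ρ'') pos)))

   toward# : ∀ {v v'} -> v ≢ v' -> 0 < toward v (β α ρ) -> 0 < toward v' (β α ρ') -> proj₁ ρ ≢ proj₁ ρ'
   toward# {v} {v'} v≢v' p p' eq = v≢v' (tr (sym (𝟙>0 (z (β α ρ) Fin.≟ v) p)) (tr (ap z (same eq)) (𝟙>0 (z (β α ρ') Fin.≟ v') p')))

  Shape : (Fin n -> ℕ) -> List Condition -> Set
  Shape χ cs = cs ≡ [] ⊎ (∃ λ ρ -> ρ ∈ R × cs ≡ (ρ , χ) ∷ []) ⊎ (∃ λ ρ -> ∃ λ ρ' -> ρ ∈ R × ρ' ∈ R × cs ≡ (ρ , χ) ∷ (ρ' , toward (proj₁ ρ)) ∷ [])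

  shape : ∀ χ {τ} -> τ ∈ terms χ -> Shape χ (conds τ)
  shape χ (here refl) = inj₁ refl
  shape χ (there τ∈) with Mem.∈-++⁻ (map (λ ρ -> term (wt (proj₁ ρ)) n ((ρ , χ) ∷ [])) R) τ∈
  ... | inj₁ τ∈' with Mem.∈-map⁻ _ τ∈'
  ... | ρ , ρ∈ , refl = inj₂ (inj₁ (ρ , ρ∈ , refl))
  shape χ (there τ∈) | inj₂ τ∈' with Mem.∈-cartesianProductWith⁻ _ R R τ∈'
  ... | ρ , ρ' , ρ∈ , ρ'∈ , refl = inj₂ (inj₂ (ρ , ρ' , ρ∈ , ρ'∈ , refl))

  -- Two conditions on the same pair contradict each other: no vertex lies in
  -- both P and Q or has two successors.
  compat : ∀ {cs ds} -> Shape (𝟙 ∘ P?) cs -> Shape (𝟙 ∘ Q?) ds ->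
   length (cs ++ ds) ≤ 4 × (∀ α -> 0 < holds α (cs ++ ds) -> AllPairs Apart (cs ++ ds))
  compat (inj₁ refl) (inj₁ refl) = z≤n , λ α _ -> []
  compat (inj₁ refl) (inj₂ (inj₁ (ρ , _ , refl))) = s≤s z≤n , λ α _ -> [] ∷ []
  compat (inj₁ refl) (inj₂ (inj₂ (ρ , ρ' , ρ∈ , ρ'∈ , refl))) = s≤s (s≤s z≤n) , λ α pos ->
   let q = *>0ˡ (𝟙 (Q? (β α ρ))) pos ; t = *>0ˡ (toward (proj₁ ρ) (β α ρ')) (*>0ʳ (𝟙 (Q? (β α ρ))) pos)
   in (v*#toward α ρ∈ ρ'∈ ρ∈ (Q⇒ (𝟙>0 (Q? _) q)) t ∷ []) ∷ [] ∷ []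
  compat (inj₂ (inj₁ (ρ , _ , refl))) (inj₁ refl) = s≤s z≤n , λ α _ -> [] ∷ []
  compat (inj₂ (inj₂ (ρ , ρ' , ρ∈ , ρ'∈ , refl))) (inj₁ refl) = s≤s (s≤s z≤n) , λ α pos ->
   let p = *>0ˡ (𝟙 (P? (β α ρ))) pos ; t = *>0ˡ (toward (proj₁ ρ) (β α ρ')) (*>0ʳ (𝟙 (P? (β α ρ))) pos)
   in (v*#toward α ρ∈ ρ'∈ ρ∈ (P⇒ (𝟙>0 (P? _) p)) t ∷ []) ∷ [] ∷ []
  compat (inj₂ (inj₁ (ρ1 , ρ1∈ , refl))) (inj₂ (inj₁ (ρ3 , ρ3∈ , refl))) = s≤s (s≤s z≤n) , λ α pos ->
   (P#Q α ρ1∈ ρ3∈ (*>0ˡ (𝟙 (P? (β α ρ1))) pos) (*>0ˡ (𝟙 (Q? (β α ρ3))) (*>0ʳ (𝟙 (P? (β α ρ1))) pos)) ∷ []) ∷ [] ∷ []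
  compat (inj₂ (inj₁ (ρ1 , ρ1∈ , refl))) (inj₂ (inj₂ (ρ3 , ρ4 , ρ3∈ , ρ4∈ , refl))) = s≤s (s≤s (s≤s z≤n)) , λ α pos ->
   let p = *>0ˡ (𝟙 (P? (β α ρ1))) pos ; pos1 = *>0ʳ (𝟙 (P? (β α ρ1))) pos
       q = *>0ˡ (𝟙 (Q? (β α ρ3))) pos1 ; t = *>0ˡ (toward (proj₁ ρ3) (β α ρ4)) (*>0ʳ (𝟙 (Q? (β α ρ3))) pos1)
   in (P#Q α ρ1∈ ρ3∈ p q ∷ v*#toward α ρ1∈ ρ4∈ ρ3∈ (P⇒ (𝟙>0 (P? _) p)) t ∷ []) ∷ (v*#toward α ρ3∈ ρ4∈ ρ3∈ (Q⇒ (𝟙>0 (Q? _) q)) t ∷ []) ∷ [] ∷ []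
  compat (inj₂ (inj₂ (ρ1 , ρ2 , ρ1∈ , ρ2∈ , refl))) (inj₂ (inj₁ (ρ3 , ρ3∈ , refl))) = s≤s (s≤s (s≤s z≤n)) , λ α pos ->
   let p = *>0ˡ (𝟙 (P? (β α ρ1))) pos ; pos1 = *>0ʳ (𝟙 (P? (β α ρ1))) pos
       t = *>0ˡ (toward (proj₁ ρ1) (β α ρ2)) pos1 ; q = *>0ˡ (𝟙 (Q? (β α ρ3))) (*>0ʳ (toward (proj₁ ρ1) (β α ρ2)) pos1)
   in (v*#toward α ρ1∈ ρ2∈ ρ1∈ (P⇒ (𝟙>0 (P? _) p)) t ∷ P#Q α ρ1∈ ρ3∈ p q ∷ []) ∷
    ((v*#toward α ρ3∈ ρ2∈ ρ1∈ (Q⇒ (𝟙>0 (Q? _) q)) t ∘ sym) ∷ []) ∷ [] ∷ []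
  compat (inj₂ (inj₂ (ρ1 , ρ2 , ρ1∈ , ρ2∈ , refl))) (inj₂ (inj₂ (ρ3 , ρ4 , ρ3∈ , ρ4∈ , refl))) = rfl≤ , λ α pos ->
   let p = *>0ˡ (𝟙 (P? (β α ρ1))) pos ; pos1 = *>0ʳ (𝟙 (P? (β α ρ1))) pos
       t = *>0ˡ (toward (proj₁ ρ1) (β α ρ2)) pos1 ; pos2 = *>0ʳ (toward (proj₁ ρ1) (β α ρ2)) pos1
       q = *>0ˡ (𝟙 (Q? (β α ρ3))) pos2 ; t' = *>0ˡ (toward (proj₁ ρ3) (β α ρ4)) (*>0ʳ (𝟙 (Q? (β α ρ3))) pos2)
       zp = P⇒ (𝟙>0 (P? _) p) ; zq = Q⇒ (𝟙>0 (Q? _) q)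
   in (v*#toward α ρ1∈ ρ2∈ ρ1∈ zp t ∷ P#Q α ρ1∈ ρ3∈ p q ∷ v*#toward α ρ1∈ ρ4∈ ρ3∈ zp t' ∷ []) ∷
    ((v*#toward α ρ3∈ ρ2∈ ρ1∈ zq t ∘ sym) ∷ toward# α ρ2∈ ρ4∈ (P#Q α ρ1∈ ρ3∈ p q) t t' ∷ []) ∷
    (v*#toward α ρ3∈ ρ4∈ ρ3∈ zq t' ∷ []) ∷ [] ∷ []

  -- The known entries cost each side at most the factor `1 + (2 + 4 |R|) weightR / n`, which
  -- lightness of the first pair keeps bounded.
  Ʃsides : n * n * (n * n) * Ʃ[ α ← seeds ] (side (𝟙 ∘ P?) α * side (𝟙 ∘ Q?) α) ≤
   ∣P∣ * (n * (n + 2 * weightR + 4 * length R * weightR)) * (∣Q∣ * (n * (n + 2 * weightR + 4 * length R * weightR))) * M ^ 4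
  Ʃsides = begin _ ≡⟨ ap (N *_) (tr (Ʃ≡ seeds λ α -> tr (ap₂ _*_ (side-terms (𝟙 ∘ P?) α) (side-terms (𝟙 ∘ Q?) α)) (Ʃ-*-Ʃ TP TQ (amount α) (amount α)))
     (tr (Ʃ⇆ seeds TP (λ α τ -> Ʃ[ τ' ← TQ ] (amount α τ * amount α τ'))) (Ʃ≡ TP λ τ -> Ʃ⇆ seeds TQ (λ α τ' -> amount α τ * amount α τ')))) ⟩
   _ ≡⟨ sym (tr (Ʃ≡ TP λ τ -> Ʃ-*ˡ N TQ (λ τ' -> Ʃ[ α ← seeds ] (amount α τ * amount α τ'))) (Ʃ-*ˡ N TP (λ τ -> Ʃ[ τ' ← TQ ] Ʃ[ α ← seeds ] (amount α τ * amount α τ')))) ⟩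
   _ ≤⟨ Ʃ-mono-∈ TP (λ τ τ∈ -> Ʃ-mono-∈ TQ λ τ' τ'∈ -> product≤ τ τ' (scaled (𝟙 ∘ P?) τ∈) (scaled (𝟙 ∘ Q?) τ'∈) (compat (shape (𝟙 ∘ P?) τ∈) (shape (𝟙 ∘ Q?) τ'∈))) ⟩
   _ ≡⟨ tr (Ʃ≡ TP λ τ -> Ʃ-*ʳ (M ^ 4) TQ (λ τ' -> bound τ * bound τ')) (tr (Ʃ-*ʳ (M ^ 4) TP (λ τ -> Ʃ[ τ' ← TQ ] (bound τ * bound τ'))) (ap (_* M ^ 4) (sym (Ʃ-*-Ʃ TP TQ bound bound)))) ⟩
   _ ≡⟨ ap₂ (λ x y -> x * y * M ^ 4) (Ʃbound (𝟙 ∘ P?)) (Ʃbound (𝟙 ∘ Q?)) ⟩ _ ∎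
   where
   open ≤R
   N = n * n * (n * n)
   TP = terms (𝟙 ∘ P?)
   TQ = terms (𝟙 ∘ Q?)

 walksFrom : Seed -> ℕ -> ℕ -> Vec (Fin n) m -> ℕ
 walksFrom α a b h = Ʃ[ u ← V ] Ʃ[ w ← V ] reach α a b (u ∷ w ∷ h)

 module _ (C a b a' b' : ℕ) (enough : (2 + 4 * (a + b)) * κ ≤ C * n) where

  Θ : Vec (Fin n) m -> ℕ
  Θ h = Ʃ[ α' ← seeds ] walksFrom α' a' b' h

  B : ℕ
  B = ∣P∣ * ∣Q∣ * (suc C * suc C) * M ^ 4 * n ^ m

  module _ (α : Seed) where

   open W α

   -- The walk as constraints on `h` itself: its own hash is removed, so that an independent one can
   -- be applied to the same entries.
   raw : ∀ {k} -> Vec (Fin n) k -> Fin n -> RawConstraints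
   raw [] i = []
   raw (u ∷ us) i = (z u , unshift (hshift α (z u)) (first us i)) ∷ raw us i

   sat-raw : ∀ {k} u w h (us : Vec (Fin n) k) i -> sat (u ∷ w ∷ h) (path# us i) ≡ Raw.sat h (raw us i)
   sat-raw u w h [] i = refl
   sat-raw u w h (x ∷ us) i = ap₂ _*_ (tr (shift-≟ (hshift α (z x)) (lookup h (z x)) (first us i))
    (𝟙-cong (unshift (hshift α (z x)) (first us i) Fin.≟ lookup h (z x)) (shift 0 (lookup h (z x)) Fin.≟ unshift (hshift α (z x)) (first us i))
     (λ eq -> tr (shift-0 _) (sym eq)) (λ eq -> sym (tr (sym (shift-0 _)) eq)))) (sat-raw u w h us i)

   keys-raw : ∀ {k} (us : Vec (Fin n) k) i -> map proj₁ (raw us i) ≡ map z (toList us)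
   keys-raw [] i = refl
   keys-raw (u ∷ us) i = ap (z u ∷_) (keys-raw us i)

   consts : Vec (Fin n) a -> Fin n -> Vec (Fin n) b -> Fin n -> RawConstraints
   consts us i ws j = raw us i ++ raw ws j

   E : (Vec (Fin n) a -> Fin n -> Vec (Fin n) b -> Fin n -> ℕ) -> ℕ
   E φ = Ʃ[ us ← vecs V a ] Ʃ[ i ← V ] Ʃ[ ws ← vecs V b ] Ʃ[ j ← V ] φ us i ws j

   E-cong : ∀ {φ ψ} -> (∀ us i ws j -> φ us i ws j ≡ ψ us i ws j) -> E φ ≡ E ψ
   E-cong eq = Ʃ≡ (vecs V a) λ us -> Ʃ≡ V λ i -> Ʃ≡ (vecs V b) λ ws -> Ʃ≡ V λ j -> eq us i ws j

   E-*ʳ : ∀ x φ -> E (λ us i ws j -> φ us i ws j * x) ≡ E φ * x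
   E-*ʳ x φ = tr (Ʃ≡ (vecs V a) λ us -> tr (Ʃ≡ V λ i -> tr (Ʃ≡ (vecs V b) λ ws -> Ʃ-*ʳ x V (φ us i ws)) (Ʃ-*ʳ x (vecs V b) _)) (Ʃ-*ʳ x V _)) (Ʃ-*ʳ x (vecs V a) _)

   E-swap : ∀ {A : Set} (xs : List A) (φ : A -> Vec (Fin n) a -> Fin n -> Vec (Fin n) b -> Fin n -> ℕ) ->
    Ʃ[ x ← xs ] E (φ x) ≡ E (λ us i ws j -> Ʃ[ x ← xs ] φ x us i ws j)
   E-swap xs φ = tr (Ʃ⇆ xs (vecs V a) _) (Ʃ≡ (vecs V a) λ us -> tr (Ʃ⇆ xs (V {n}) (λ x i -> Ʃ[ ws ← vecs V b ] Ʃ[ j ← V ] φ x us i ws j))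
    (Ʃ≡ (V {n}) λ i -> tr (Ʃ⇆ xs (vecs V b) _) (Ʃ≡ (vecs V b) λ ws -> Ʃ⇆ xs (V {n}) (λ x j -> φ x us i ws j))))

   valid' : Vec (Fin n) a -> Fin n -> Vec (Fin n) b -> Fin n -> ℕ
   valid' us i ws j = valid (toList us ++ toList ws) i j

   reach-expand : ∀ h -> reach α a b h ≡ E (λ us i ws j -> link h zero us i * (link h (suc zero) ws j * valid' us i ws j))
   reach-expand h = sym (tr (Ʃ≡ (vecs V a) λ us -> Ʃ≡ V λ i -> tr (Ʃ≡ (vecs V b) λ ws -> Ʃ-*ˡ (link h zero us i) V _) (Ʃ-*ˡ (link h zero us i) (vecs V b) _))
    (tr (Ʃ-link h zero a (λ us i -> Ʃ[ ws ← vecs V b ] Ʃ[ j ← V ] (link h (suc zero) ws j * valid' us i ws j)))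
     (Ʃ-link h (suc zero) b (valid' (path h zero a) (vertex h zero a)))))

   walks-expand : ∀ h -> walksFrom α a b h ≡ E (λ us i ws j -> Raw.sat h (consts us i ws j) * valid' us i ws j)
   walks-expand h = begin _ ≡⟨ Ʃ≡ V (λ u -> tr (Ʃ≡ V λ w -> reach-expand (u ∷ w ∷ h)) (E-swap V (λ w us i ws j -> link (u ∷ w ∷ h) zero us i * (link (u ∷ w ∷ h) (suc zero) ws j * valid' us i ws j)))) ⟩
    _ ≡⟨ E-swap V (λ u us i ws j -> Ʃ[ w ← V ] (link (u ∷ w ∷ h) zero us i * (link (u ∷ w ∷ h) (suc zero) ws j * valid' us i ws j))) ⟩
    _ ≡⟨ E-cong starts ⟩ _ ∎
    where
    open ≡R
    once : ∀ (y : Fin n) c -> Ʃ[ u ← V ] (𝟙 (shift 0 u Fin.≟ y) * c) ≡ c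
    once y c = tr (Ʃ≡ V λ u -> ap (_* c) (shift-≟ 0 u y)) (Ʃ-allFin-δ (unshift 0 y) (λ _ -> c))
    starts : ∀ us i ws j -> Ʃ[ u ← V ] Ʃ[ w ← V ] (link (u ∷ w ∷ h) zero us i * (link (u ∷ w ∷ h) (suc zero) ws j * valid' us i ws j)) ≡ Raw.sat h (consts us i ws j) * valid' us i ws j
    starts us i ws j = tr (Ʃ≡ V λ u -> tr (Ʃ≡ V λ w -> tr (ap₂ (λ p q -> 𝟙 (shift 0 u Fin.≟ first us i) * p * (𝟙 (shift 0 w Fin.≟ first ws j) * q * valid' us i ws j)) (sat-raw u w h us i) (sat-raw u w h ws j))
     (alg (𝟙 (shift 0 u Fin.≟ first us i)) (Raw.sat h (raw us i)) (𝟙 (shift 0 w Fin.≟ first ws j)) (Raw.sat h (raw ws j)) (valid' us i ws j))) (once (first ws j) _))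
     (tr (once (first us i) _) (ap (_* valid' us i ws j) (sym (Raw.sat-++ h (raw us i) (raw ws j)))))
     where
     alg : ∀ a b c d e -> a * b * (c * d * e) ≡ c * (a * (b * d * e))
     alg = ring

   -- Conditioning on a light first pair raises the mean of the second by at most the constant
   -- factor `suc C * suc C`; `enough` is what turns `κ` into that constant.
   after : ∀ us i ws j -> valid' us i ws j * (n ^ (a + b) * Ʃ[ h ← fns ] (Raw.sat h (consts us i ws j) * Θ h)) ≤ valid' us i ws j * B
   after us i ws j with 0 <? valid' us i ws j
   ... | no ≤0 = ⊑ (leq (ap (_* (n ^ (a + b) * Ʃ[ h ← fns ] (Raw.sat h (consts us i ws j) * Θ h))) (n≤0⇒n≡0 (≮⇒≥ ≤0)))) z≤n
   ... | yes pos = *ʳ (valid' us i ws j) (/ˡ N {{m*n≢0 (n * n) (n * n) {{m*n≢0 n n}} {{m*n≢0 n n}}}} (begin _ ≡⟨ ap (λ s -> N * (n ^ (a + b) * s)) swap ⟩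
    _ ≤⟨ *ʳ N (*ʳ (n ^ (a + b)) (Ʃ≤ seeds λ α' -> (Given.walks≤ R R-unique R≢) α' a' b')) ⟩
    _ ≡⟨ ap (λ s -> N * (n ^ (a + b) * s)) (tr (Ʃ≡ seeds λ α' -> sym (*-assoc (sP α') (sQ α') H)) (Ʃ-*ʳ H seeds (λ α' -> sP α' * sQ α'))) ⟩
    _ ≡⟨ alg N (n ^ (a + b)) (Ʃ[ α' ← seeds ] (sP α' * sQ α')) H ⟩
    _ ≤⟨ *≤ (Given.Ʃsides R R-unique R≢) (leq (tr (ap (λ l -> n ^ l * H) (sym R-length)) (Raw.sat-count R R-unique))) ⟩
    _ ≤⟨ *ˡ (n ^ m) (*ˡ (M ^ 4) (*≤ (*ʳ ∣P∣ (*ʳ n D≤)) (*ʳ ∣Q∣ (*ʳ n D≤)))) ⟩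
    _ ≡⟨ alg' ∣P∣ ∣Q∣ n (suc C) (M ^ 4) (n ^ m) ⟩
    N * B ∎))
    where
    open ≤R
    N = n * n * (n * n)
    ys = toList us ++ toList ws
    R = consts us i ws j
    R-keys : map proj₁ R ≡ map z ys
    R-keys = tr (List.map-++ proj₁ (raw us i) _) (tr (ap₂ _++_ (keys-raw us i) (keys-raw ws j)) (sym (List.map-++ z (toList us) _)))
    R-length : length R ≡ a + b
    R-length = tr (sym (List.length-map proj₁ R)) (tr (ap length R-keys) (tr (List.length-map z ys)
     (tr (List.length-++ (toList us)) (ap₂ _+_ (Vec.length-toList us) (Vec.length-toList ws)))))
    uniq : Unique (map z ys ++ v* ∷ [])
    uniq = 𝟙>0 (Raw.unique? (map z ys ++ v* ∷ [])) (*>0ˡ (𝟙 (Raw.unique? (map z ys ++ v* ∷ []))) (*>0ˡ (𝟙 (Raw.unique? (map z ys ++ v* ∷ [])) * 𝟙 (Raw.weight ys ≤? κ)) pos))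
    light : Raw.weight ys ≤ κ
    light = 𝟙>0 (Raw.weight ys ≤? κ) (*>0ʳ (𝟙 (Raw.unique? (map z ys ++ v* ∷ []))) (*>0ˡ (𝟙 (Raw.unique? (map z ys ++ v* ∷ [])) * 𝟙 (Raw.weight ys ≤? κ)) pos))
    halves : ∀ xs -> Unique (xs ++ v* ∷ []) -> Unique xs × All (v* ≢_) xs
    halves [] _ = [] , []
    halves (x ∷ xs) (x∉ ∷ u) = let p , q = halves xs u in
     All.++⁻ˡ xs x∉ ∷ p , (λ eq -> All.lookup x∉ (Mem.∈-++⁺ʳ xs (here refl)) (sym eq)) ∷ q
    R-unique : Unique (map proj₁ R)
    R-unique = subst Unique (sym R-keys) (proj₁ (halves (map z ys) uniq))
    R≢ = (subst (All (v* ≢_)) (sym R-keys) (proj₂ (halves (map z ys) uniq)))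
    sP sQ : Seed -> ℕ
    sP = (Given.side R R-unique R≢) (𝟙 ∘ P?)
    sQ = (Given.side R R-unique R≢) (𝟙 ∘ Q?)
    H = Ʃ[ h ← fns ] Raw.sat h R
    D = n + 2 * (Given.weightR R R-unique R≢) + 4 * length R * (Given.weightR R R-unique R≢)
    weightR≡ : (Given.weightR R R-unique R≢) ≡ Raw.weight ys
    weightR≡ = tr (sym (Ʃ-map proj₁ R Raw.wt)) (tr (ap (λ ks -> Ʃ ks Raw.wt) R-keys) (Ʃ-map z ys Raw.wt))
    D≤ : D ≤ suc C * n
    D≤ = begin _ ≡⟨ ap₂ (λ w l -> n + 2 * w + 4 * l * w) weightR≡ R-length ⟩
     _ ≡⟨ collect n w (a + b) ⟩
     _ ≤⟨ +ʳ n (*ʳ (2 + 4 * (a + b)) light) ⟩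
     _ ≤⟨ +ʳ n enough ⟩ _ ∎
     where
     w = Raw.weight ys
     collect : ∀ n w l -> n + 2 * w + 4 * l * w ≡ n + (2 + 4 * l) * w
     collect = ring
    swap : Ʃ[ h ← fns ] (Raw.sat h R * Θ h) ≡ Ʃ[ α' ← seeds ] Ʃ[ u ← V ] Ʃ[ w ← V ] Ʃ[ h ← fns ] (Raw.sat h R * reach α' a' b' (u ∷ w ∷ h))
    swap = tr (Ʃ≡ fns λ h -> sym (tr (Ʃ≡ seeds λ α' -> tr (Ʃ≡ (V {n}) λ u -> Ʃ-*ˡ (Raw.sat h R) (V {n}) (λ w -> reach α' a' b' (u ∷ w ∷ h)))
     (Ʃ-*ˡ (Raw.sat h R) (V {n}) (λ u -> Ʃ[ w ← V ] reach α' a' b' (u ∷ w ∷ h)))) (Ʃ-*ˡ (Raw.sat h R) seeds _)))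
     (tr (Ʃ⇆ fns seeds _) (Ʃ≡ seeds λ α' -> tr (Ʃ⇆ fns (V {n}) (λ h u -> Ʃ[ w ← V ] (Raw.sat h R * reach α' a' b' (u ∷ w ∷ h))))
      (Ʃ≡ (V {n}) λ u -> Ʃ⇆ fns (V {n}) (λ h w -> Raw.sat h R * reach α' a' b' (u ∷ w ∷ h)))))
    alg : ∀ N x s H -> N * (x * (s * H)) ≡ N * s * (x * H)
    alg = ring
    alg' : ∀ p q n c M k -> p * (n * (c * n)) * (q * (n * (c * n))) * M * k ≡ n * n * (n * n) * (p * q * (c * c) * M * k)
    alg' = ring

   Ʃvalid : E valid' ≤ n ^ (a + b) * (∣P∣ * ∣Q∣)
   Ʃvalid = begin _ ≤⟨ (Ʃ≤ (vecs V a) λ us -> Ʃ≤ V λ i -> Ʃ≤ (vecs V b) λ ws -> Ʃ≤ V λ j -> ⊑ (*ˡ (𝟙 (P? i) * 𝟙 (Q? j))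
      (*≤ (𝟙≤1 (Raw.unique? (map z (toList us ++ toList ws) ++ v* ∷ []))) (𝟙≤1 (Raw.weight (toList us ++ toList ws) ≤? κ)))) (leq (*-identityˡ _))) ⟩
    _ ≡⟨ tr (Ʃ≡ (vecs V a) λ us -> tr (Ʃ≡ V λ i -> tr (Ʃ≡ (vecs V b) λ ws -> Ʃ-*ˡ (𝟙 (P? i)) V (𝟙 ∘ Q?)) (tr (Ʃ-const (vecs V b) _) (tr (ap (_* (𝟙 (P? i) * ∣Q∣)) (lengths b)) (swap (n ^ b) (𝟙 (P? i)) ∣Q∣))))
      (Ʃ-*ʳ (n ^ b * ∣Q∣) V (𝟙 ∘ P?))) (tr (Ʃ-const (vecs V a) _) (ap (_* (∣P∣ * (n ^ b * ∣Q∣))) (lengths a))) ⟩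
    _ ≡⟨ tr (alg (n ^ a) ∣P∣ (n ^ b) ∣Q∣) (ap (_* (∣P∣ * ∣Q∣)) (sym (^-distribˡ-+-* n a b))) ⟩ _ ∎
    where
    open ≤R
    lengths : ∀ k -> length (vecs (V {n}) k) ≡ n ^ k
    lengths k = tr (length-vecs V k) (ap (_^ k) length-V)
    swap : ∀ a b c -> a * (b * c) ≡ b * (a * c)
    swap = ring
    alg : ∀ a p b q -> a * (p * (b * q)) ≡ a * b * (p * q)
    alg = ring

   fixed-seed : Ʃ[ h ← fns ] (walksFrom α a b h * Θ h) ≤ ∣P∣ * ∣Q∣ * B
   fixed-seed = /ˡ (n ^ (a + b)) {{m^n≢0 n (a + b)}} (begin _ ≡⟨ ap (n ^ (a + b) *_) (tr (Ʃ≡ fns λ h -> tr (ap (_* Θ h) (walks-expand h)) (tr (sym (E-*ʳ (Θ h) _)) (E-cong λ us i ws j -> alg (Raw.sat h (consts us i ws j)) (valid' us i ws j) (Θ h))))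
      (tr (E-swap fns (λ h us i ws j -> valid' us i ws j * (Raw.sat h (consts us i ws j) * Θ h))) (E-cong λ us i ws j -> Ʃ-*ˡ (valid' us i ws j) fns _))) ⟩
    _ ≡⟨ tr (*-comm (n ^ (a + b)) _) (tr (sym (E-*ʳ (n ^ (a + b)) _)) (E-cong λ us i ws j -> alg' (valid' us i ws j) (Ʃ[ h ← fns ] (Raw.sat h (consts us i ws j) * Θ h)) (n ^ (a + b)))) ⟩
    _ ≤⟨ (Ʃ≤ (vecs V a) λ us -> Ʃ≤ V λ i -> Ʃ≤ (vecs V b) λ ws -> Ʃ≤ V λ j -> after us i ws j) ⟩
    _ ≡⟨ E-*ʳ B valid' ⟩
    _ ≤⟨ *ˡ B Ʃvalid ⟩
    _ ≡⟨ *-assoc (n ^ (a + b)) (∣P∣ * ∣Q∣) B ⟩ _ ∎)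
    where
    open ≤R
    alg : ∀ s v t -> s * v * t ≡ v * (s * t)
    alg = ring
    alg' : ∀ v s x -> v * s * x ≡ v * (x * s)
    alg' = ring

  second-moment : Ʃ[ α ← seeds ] Ʃ[ h ← fns ] (walksFrom α a b h * Θ h) ≤ M ^ 4 * (∣P∣ * ∣Q∣ * B)
  second-moment = ⊑ (Ʃ-≤-const seeds (∣P∣ * ∣Q∣ * B) fixed-seed)
   (leq (ap (_* (∣P∣ * ∣Q∣ * B)) (tr (length-vecs (upTo M) 4) (ap (_^ 4) (List.length-upTo M)))))

-- From two moments to a constant success probability.

bernoulli : ∀ A g R -> g ≤ A -> (A ∸ g) ^ R * (A + R * g) ≤ A ^ suc R
bernoulli A g zero g≤A = leq (tr (+0 _) (tr (+0 A) (sym (*1 A))))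
bernoulli A g (suc R) g≤A = begin _ ≡⟨ alg (A ∸ g) ((A ∸ g) ^ R) (A + suc R * g) ⟩
 _ ≤⟨ *ʳ ((A ∸ g) ^ R) inner ⟩
 _ ≡⟨ sym (*-assoc ((A ∸ g) ^ R) _ A) ⟩
 _ ≤⟨ *ˡ A (bernoulli A g R g≤A) ⟩
 _ ≡⟨ *-comm (A ^ suc R) A ⟩ _ ∎
 where
 open ≤R
 alg : ∀ a b c -> a * b * c ≡ b * (a * c)
 alg = ring
 inner : (A ∸ g) * (A + suc R * g) ≤ (A + R * g) * A
 inner = begin _ ≤⟨ m≤m+n _ (suc R * (g * g)) ⟩
  (A ∸ g) * (A + suc R * g) + suc R * (g * g) ≡⟨ +-cancelʳ-≡ (g * A) _ _ (begin-equality
   _ ≡⟨ collect (A ∸ g) g R A ⟩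
   _ ≡⟨ ap (_* (A + suc R * g)) (m∸n+n≡m g≤A) ⟩
   _ ≡⟨ expand A R g ⟩ _ ∎) ⟩
  (A + R * g) * A ∎
  where
  collect : ∀ d g R A -> d * (A + suc R * g) + suc R * (g * g) + g * A ≡ (d + g) * (A + suc R * g)
  collect = ring
  expand : ∀ A R g -> A * (A + suc R * g) ≡ (A + R * g) * A + g * A
  expand = ring

-- The tangent to 1 / (N + x) at N + x = Y.
tangent : ∀ N x Y T f .{{_ : NonZero N}} -> f * (N + x) ≤ N * T -> f * (Y * Y) + T * x * (2 * Y) ≤ T * (Y * Y) + T * x * (N + x)
tangent N x Y T f le = /ʳ _ _ (N + x) {{>-nonZero (⊑ (>-nonZero⁻¹ N) (m≤m+n N x))}} (begin _ ≡⟨ expand f Y T x (N + x) ⟩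
 _ ≤⟨ +≤ (*ˡ (Y * Y) le) (*ʳ (T * x) (square Y (N + x))) ⟩
 _ ≡⟨ collect N T Y x ⟩ _ ∎)
 where
 open ≤R
 expand : ∀ f Y T x s -> (f * (Y * Y) + T * x * (2 * Y)) * s ≡ f * s * (Y * Y) + T * x * (2 * Y * s)
 expand = ring
 collect : ∀ N T Y x -> N * T * (Y * Y) + T * x * (Y * Y + (N + x) * (N + x)) ≡ (T * (Y * Y) + T * x * (N + x)) * (N + x)
 collect = ring
 square : ∀ a b -> 2 * a * b ≤ a * a + b * b
 square a b with ≤-total a b
 ... | inj₁ a≤b = subst (λ b -> 2 * a * b ≤ a * a + b * b) (m+[n∸m]≡n a≤b) (lemma a (b ∸ a))
  where
  lemma : ∀ a d -> 2 * a * (a + d) ≤ a * a + (a + d) * (a + d)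
  lemma a d = ⊑ (m≤m+n _ (d * d)) (leq (eq a d))
   where
   eq : ∀ a d -> 2 * a * (a + d) + d * d ≡ a * a + (a + d) * (a + d)
   eq = ring
 ... | inj₂ b≤a = subst (λ a -> 2 * a * b ≤ a * a + b * b) (m+[n∸m]≡n b≤a) (lemma b (a ∸ b))
  where
  lemma : ∀ b d -> 2 * (b + d) * b ≤ (b + d) * (b + d) + b * b
  lemma b d = ⊑ (m≤m+n _ (d * d)) (leq (eq b d))
   where
   eq : ∀ b d -> 2 * (b + d) * b + d * d ≡ (b + d) * (b + d) + b * b
   eq = ring

-- Only the complete periods of length `n` are kept; the incomplete last one is dropped.
Ʃ-mod : ∀ n .{{_ : NonZero n}} M (φ : Fin n -> ℕ) -> M / n * Ʃ V φ ≤ Ʃ[ ρ ← upTo M ] φ (ρ mod n)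
Ʃ-mod n M φ = begin _ ≡⟨ Ʃ<-const (M / n) _ ⟨
 _ ≡⟨ Ʃ≡ (upTo (M / n)) (λ i -> tr (Ʃ≡ V λ x -> ap φ (sym (Fin.toℕ-injective (tr (Fin.toℕ-fromℕ< (m%n<n (i * n + toℕ x) n)) (period i x))))) (Ʃ-allFin n (λ j -> φ ((i * n + j) mod n)))) ⟩
 _ ≡⟨ Ʃ<-* (M / n) n (λ x -> φ (x mod n)) ⟨
 _ ≤⟨ m≤m+n _ _ ⟩
 _ ≡⟨ Ʃ<-+ (M / n * n) (M % n) (λ x -> φ (x mod n)) ⟨
 _ ≡⟨ ap (λ k -> Ʃ< k (λ x -> φ (x mod n))) (tr (+-comm (M / n * n) (M % n)) (sym (m≡m%n+[m/n]*n M n))) ⟩ _ ∎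
 where
 open ≤R
 period : ∀ i (x : Fin n) -> (i * n + toℕ x) % n ≡ toℕ x
 period i x = tr (ap (_% n) (+-comm (i * n) (toℕ x))) (tr ([m+kn]%n≡m%n (toℕ x) i n) (m<n⇒m%n≡m (Fin.toℕ<n x)))

Ʃ-vecs-mod : ∀ n .{{_ : NonZero n}} M k (φ : Vec (Fin n) k -> ℕ) ->
 (M / n) ^ k * Ʃ (vecs V k) φ ≤ Ʃ[ ρ ← vecs (upTo M) k ] φ (Vec.map (_mod n) ρ)
Ʃ-vecs-mod n M zero φ = leq (+0 _)
Ʃ-vecs-mod n M (suc k) φ = begin _ ≡⟨ ap (M / n * (M / n) ^ k *_) (Ʃ-vecs-suc V k φ) ⟩
 _ ≡⟨ tr (*-assoc (M / n) _ _) (ap (M / n *_) (sym (Ʃ-*ˡ ((M / n) ^ k) V _))) ⟩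
 _ ≤⟨ *ʳ (M / n) (Ʃ≤ V λ x -> Ʃ-vecs-mod n M k (φ ∘ (x ∷_))) ⟩
 _ ≤⟨ Ʃ-mod n M (λ x -> Ʃ[ ρ ← vecs (upTo M) k ] φ (x ∷ Vec.map (_mod n) ρ)) ⟩
 _ ≡⟨ Ʃ-vecs-suc (upTo M) k _ ⟨
 _ ∎
 where open ≤R

-- (1 − n / M) ^ k ≥ 1 / 2 as soon as 2 k n ≤ M.
^-mod-loss : ∀ n .{{_ : NonZero n}} M .{{_ : NonZero M}} k -> 2 * (k * n) ≤ M -> M ^ k ≤ 2 * (M / n * n) ^ k
^-mod-loss n M k le = /ʳ _ _ M (+-cancelʳ-≤ (M ^ k * M) _ _ (begin _ ≡⟨ ap (M ^ k * M +_) (sym (+0 _)) ⟩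
 _ ≤⟨ *ʳ 2 (bern k) ⟩
 _ ≡⟨ expand (r ^ k) M (M ^ k) (k * n) ⟩
 _ ≤⟨ +ʳ (2 * r ^ k * M) (*ʳ (M ^ k) le) ⟩ _ ∎))
 where
 open ≤R
 r = M / n * n
 M≤ : M ≤ r + n
 M≤ = ⊑ (leq (m≡m%n+[m/n]*n M n)) (⊑ (+ˡ r (<⇒≤ (m%n<n M n))) (leq (+-comm n r)))
 bern : ∀ k -> M ^ k * M ≤ r ^ k * M + M ^ k * (k * n)
 bern zero = leq (sym (+0 _))
 bern (suc k) = begin _ ≡⟨ *-assoc M (M ^ k) M ⟩
  _ ≤⟨ *ʳ M (bern k) ⟩
  _ ≡⟨ alg M (r ^ k) (M ^ k) (k * n) ⟩
  _ ≤⟨ +ˡ _ (*ˡ M (*ˡ (r ^ k) M≤)) ⟩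
  _ ≡⟨ alg' r n (r ^ k) M (M * M ^ k * (k * n)) ⟩
  _ ≤⟨ +ʳ (r * r ^ k * M) (+ˡ _ (*ˡ (n * M) (^-monoˡ-≤ k (m/n*n≤m M n)))) ⟩
  _ ≡⟨ collect r (r ^ k) M (M ^ k) n k ⟩ _ ∎
  where
  alg : ∀ M a b c -> M * (a * M + b * c) ≡ M * a * M + M * b * c
  alg = ring
  alg' : ∀ r n a M x -> (r + n) * a * M + x ≡ r * a * M + (a * (n * M) + x)
  alg' = ring
  collect : ∀ r a M b n k -> r * a * M + (b * (n * M) + M * b * (k * n)) ≡ r * a * M + M * b * (suc k * n)
  collect = ring
 expand : ∀ a M b c -> 2 * (a * M + b * c) ≡ 2 * a * M + b * (2 * c)
 expand = ring

*-distrib-^ : ∀ a b k -> (a * b) ^ k ≡ a ^ k * b ^ k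
*-distrib-^ a b zero = refl
*-distrib-^ a b (suc k) = tr (ap (a * b *_) (*-distrib-^ a b k)) (alg a b (a ^ k) (b ^ k))
 where
 alg : ∀ a b c d -> a * b * (c * d) ≡ a * c * (b * d)
 alg = ring

-- Averages the tangent inequality at Y = k N over h.
tangent-average : ∀ {H : Set} (hs : List H) (f X : H -> ℕ) N R T b E .{{_ : NonZero N}} .{{_ : NonZero b}} ->
 (∀ h -> f h * (N + R * X h) ≤ N * T) ->
 N * length hs ≤ b * (R * Ʃ hs X) ->
 R * R * Ʃ[ h ← hs ] (X h * X h) ≤ E * (N * N * length hs) ->
 let k = b * suc E in
 Ʃ hs f * (k * k) + T * length hs ≤ k * k * (T * length hs)
tangent-average {H} hs f X N R T b E bound first second = /ʳ _ _ (N * N) {{m*n≢0 N N}} (+-cancelʳ-≤ (T * (N * (k * Z)) + T * (N * Z) + T * (E * (N * N * L))) _ _ (begin _ ≡⟨ collect (Ʃ hs f) k T L N Z E ⟩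
 _ ≤⟨ +ʳ (Ʃ hs f * (k * N * (k * N))) (+ˡ (T * (N * Z)) (*ʳ T (*ʳ N (+ˡ (k * Z) (⊑ (*ʳ (suc E) first) (leq (grp b E Z))))))) ⟩
 _ ≡⟨ grp' (Ʃ hs f * (k * N * (k * N))) T N k R (Ʃ hs X) ⟩
 _ ≤⟨ +ˡ (T * (N * Z)) summed ⟩
 _ ≤⟨ +ˡ (T * (N * Z)) (+ʳ (T * (k * N * (k * N)) * L) (+ʳ (T * R * N * Ʃ hs X) (⊑ (leq (*-assoc T (R * R) _)) (*ʳ T second)))) ⟩
 _ ≤⟨ +≤ (+ʳ (T * (k * N * (k * N)) * L) (+ˡ (T * (E * (N * N * L))) (leq (grp'' T R N (Ʃ hs X))))) (*ʳ T (*ʳ N Z≤kZ)) ⟩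
 _ ≡⟨ collect' k T L N Z E ⟩ _ ∎))
 where
 open ≤R
 -- Of the gain `2 k Z`, one half outweighs `Z`. The other is at least `suc E` times `N * L`, which
 -- covers the second moment and leaves `N * L` as the margin.
 k = b * suc E
 L = length hs
 Z = R * Ʃ hs X
 Z≤kZ : Z ≤ k * Z
 Z≤kZ = m≤n*m Z k {{m*n≢0 b (suc E)}}
 summed : Ʃ hs f * (k * N * (k * N)) + T * R * (2 * (k * N)) * Ʃ hs X ≤ T * (k * N * (k * N)) * L + (T * R * N * Ʃ hs X + T * (R * R) * Ʃ[ h ← hs ] (X h * X h))
 summed = begin _ ≡⟨ ap₂ _+_ (sym (Ʃ-*ʳ (k * N * (k * N)) hs f)) (sym (Ʃ-*ˡ (T * R * (2 * (k * N))) hs X)) ⟩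
  _ ≡⟨ Ʃ-+ hs _ _ ⟨
  _ ≤⟨ Ʃ≤ hs (λ h -> ⊑ (leq (ap (f h * (k * N * (k * N)) +_) (left T R (k * N) (X h))))
    (⊑ (tangent N (R * X h) (k * N) T (f h) (bound h)) (leq (ap (T * (k * N * (k * N)) +_) (right T R N (X h)))))) ⟩
  _ ≡⟨ tr (Ʃ-+ hs _ _) (ap₂ _+_ (tr (Ʃ-const hs (T * (k * N * (k * N)))) (*-comm L (T * (k * N * (k * N))))) (tr (Ʃ-+ hs (λ h -> T * R * N * X h) (λ h -> T * (R * R) * (X h * X h))) (ap₂ _+_ (Ʃ-*ˡ (T * R * N) hs X) (Ʃ-*ˡ (T * (R * R)) hs (λ h -> X h * X h))))) ⟩ _ ∎
  where
  left : ∀ T R Y x -> T * R * (2 * Y) * x ≡ T * (R * x) * (2 * Y)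
  left = ring
  right : ∀ T R N x -> T * (R * x) * (N + R * x) ≡ T * R * N * x + T * (R * R) * (x * x)
  right = ring
 collect : ∀ f k T L N Z E -> (f * (k * k) + T * L) * (N * N) + (T * (N * (k * Z)) + T * (N * Z) + T * (E * (N * N * L))) ≡
  f * (k * N * (k * N)) + (T * (N * (suc E * (N * L) + k * Z)) + T * (N * Z))
 collect = ring
 collect' : ∀ k T L N Z E -> T * (k * N * (k * N)) * L + (T * (N * Z) + T * (E * (N * N * L))) + T * (N * (k * Z)) ≡
  k * k * (T * L) * (N * N) + (T * (N * (k * Z)) + T * (N * Z) + T * (E * (N * N * L)))
 collect' = ring
 grp : ∀ b E Z -> suc E * (b * Z) ≡ b * suc E * Z
 grp = ring
 grp' : ∀ x T N k R s -> x + (T * (N * (k * (R * s) + k * (R * s))) + T * (N * (R * s))) ≡ x + T * R * (2 * (k * N)) * s + T * (N * (R * s))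
 grp' = ring
 grp'' : ∀ T R N s -> T * R * N * s ≡ T * (N * (R * s))
 grp'' = ring

module Amplification {n m q : ℕ} .{{_ : NonZero n}} .{{_ : NonZero m}} (M : ℕ) .{{_ : NonZero M}}
 (luck : Vec ℕ 4 -> Fin n -> Vec (Fin n) (q + q + m) -> ℕ) (goodness≤1 : ∀ α c h -> luck α c h ≤ 1) where

 fns : List (Vec (Fin n) m)
 fns = vecs V m

 S starts : ℕ
 S = q + q
 starts = suc S

 -- The sizes of the two sample spaces of a round: all words below `M`, as a machine draws them, and
 -- the ideal one with exactly uniform offset and starts.
 A A' : ℕ
 A = M ^ 4 * M ^ starts
 A' = M ^ 4 * n ^ starts

 goodnessOf : Vec ℕ 4 -> Vec (Fin n) starts -> Vec (Fin n) m -> ℕ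
 goodnessOf α (c ∷ st) h = luck α c (st Vec.++ h)

 wins : Vec (Fin n) m -> ℕ
 wins h = Ʃ[ α ← vecs (upTo M) 4 ] Ʃ[ v ← vecs V starts ] goodnessOf α v h

 good : Vec (Fin n) m -> ℕ
 good h = Ʃ[ α ← vecs (upTo M) 4 ] Ʃ[ γ ← vecs (upTo M) starts ] goodnessOf α (Vec.map (_mod n) γ) h

 good≤A : ∀ h -> good h ≤ A
 good≤A h = begin _ ≤⟨ Ʃ≤ (vecs (upTo M) 4) (λ α -> ⊑ (Ʃ≤ (vecs (upTo M) starts) λ γ -> bounded α (Vec.map (_mod n) γ)) (leq (tr (Ʃ-const (vecs (upTo M) starts) 1) (*1 _)))) ⟩
  _ ≡⟨ tr (Ʃ-const (vecs (upTo M) 4) _) (ap₂ _*_ (count 4) (count starts)) ⟩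
  A ∎
  where
  open ≤R
  bounded : ∀ α v -> goodnessOf α v h ≤ 1
  bounded α (c ∷ st) = goodness≤1 α c _
  count : ∀ k -> length (vecs (upTo M) k) ≡ M ^ k
  count k = tr (length-vecs (upTo M) k) (ap (_^ k) (List.length-upTo M))

 successes≤good : 2 * (starts * n) ≤ M -> ∀ h -> A * wins h ≤ 2 * A' * good h
 successes≤good M-large h = begin _ ≡⟨ *-assoc (M ^ 4) (M ^ starts) _ ⟩
  _ ≤⟨ *ʳ (M ^ 4) (*ˡ (wins h) (⊑ (^-mod-loss n M starts M-large) (*ʳ 2 (leq (*-distrib-^ (M / n) n starts))))) ⟩
  _ ≡⟨ alg (M ^ 4) ((M / n) ^ starts) (n ^ starts) (wins h) ⟩
  _ ≡⟨ ap (2 * A' *_) (sym (Ʃ-*ˡ ((M / n) ^ starts) (vecs (upTo M) 4) _)) ⟩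
  _ ≤⟨ *ʳ (2 * A') (Ʃ≤ (vecs (upTo M) 4) λ α -> Ʃ-vecs-mod n M starts (λ v -> goodnessOf α v h)) ⟩ _ ∎
  where
  open ≤R
  alg : ∀ a b c x -> a * (2 * (b * c) * x) ≡ 2 * (a * c) * (b * x)
  alg = ring

 instance
  A≢0 : NonZero A
  A≢0 = m*n≢0 (M ^ 4) (M ^ starts) {{m^n≢0 M 4}} {{m^n≢0 M starts}}
  2A'≢0 : NonZero (2 * A')
  2A'≢0 = m*n≢0 2 A' {{_}} {{m*n≢0 (M ^ 4) (n ^ starts) {{m^n≢0 M 4}} {{m^n≢0 n starts}}}}

 -- By `first` the mean over `h` of the winning probability of a round has at least the order
 -- `w / n²`, and by `second` its mean square has at most the order of the square. About `n² / w`
 -- rounds therefore succeed with constant probability, although all of them share `h`.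
 amplify : ∀ C w c0 R .{{_ : NonZero c0}} .{{_ : NonZero w}} -> 2 * (starts * n) ≤ M -> n * n < R * (w * c0) -> w ≤ 2 * (n * n) ->
  w * (A' * n ^ m) ≤ 576 * (n * n) * Ʃ fns wins ->
  n * n * (n * n) * Ʃ[ h ← fns ] (wins h * wins h) ≤ w * w * (suc C * suc C) * (A' * A' * n ^ m) ->
  ∀ k -> 1152 * c0 * suc (9 * (suc C * suc C)) ≡ k ->
  Ʃ[ h ← fns ] ((A ∸ good h) ^ R) * (k * k) + A ^ R * n ^ m ≤ k * k * (A ^ R * n ^ m)
 amplify C w c0 R M-large R-large w-small first second _ refl = begin _ ≤⟨ +≤ (*ˡ (k * k) (⊑ (Ʃ≤ fns fewer) (leq (Ʃ-*ʳ (A ^ (R ∸ R0)) fns _)))) (leq (ap (_* n ^ m) power)) ⟩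
  _ ≡⟨ alg (Ʃ[ h ← fns ] ((A ∸ good h) ^ R0)) (A ^ (R ∸ R0)) (k * k) (A ^ R0) (n ^ m) ⟩
  _ ≤⟨ *ʳ (A ^ (R ∸ R0)) (subst (λ L -> Ʃ[ h ← fns ] ((A ∸ good h) ^ R0) * (k * k) + A ^ R0 * L ≤ k * k * (A ^ R0 * L)) length-functions
    (tangent-average fns (λ h -> (A ∸ good h) ^ R0) wins (2 * A') R0 (A ^ R0) (1152 * c0) (9 * (suc C * suc C)) {{2A'≢0}} {{m*n≢0 1152 c0}}
     pointwise (subst (λ L -> 2 * A' * L ≤ 1152 * c0 * (R0 * Ʃ fns wins)) (sym length-functions) first')
      (subst (λ L -> R0 * R0 * Ʃ[ h ← fns ] (wins h * wins h) ≤ 9 * (suc C * suc C) * (2 * A' * (2 * A') * L)) (sym length-functions) second'))) ⟩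
  _ ≡⟨ tr (alg' (A ^ (R ∸ R0)) (k * k) (A ^ R0) (n ^ m)) (ap (λ x -> k * k * (x * n ^ m)) (sym power)) ⟩ _ ∎
  where
  open ≤R
  k = 1152 * c0 * suc (9 * (suc C * suc C))
  instance
   wc0≢0 : NonZero (w * c0)
   wc0≢0 = m*n≢0 w c0
   n²≢0 : NonZero (n * n)
   n²≢0 = m*n≢0 n n
  -- Few enough rounds for the square of the expected number of successes to
  -- stay bounded.
  R0 = suc (n * n / (w * c0))
  R0≤R : R0 ≤ R
  R0≤R = m<n*o⇒m/o<n R-large
  power : A ^ R ≡ A ^ R0 * A ^ (R ∸ R0)
  power = tr (ap (A ^_) (sym (m+[n∸m]≡n R0≤R))) (^-distribˡ-+-* A R0 (R ∸ R0))
  length-functions : length fns ≡ n ^ m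
  length-functions = tr (length-vecs V m) (ap (_^ m) length-V)
  fewer : ∀ h -> (A ∸ good h) ^ R ≤ (A ∸ good h) ^ R0 * A ^ (R ∸ R0)
  fewer h = ⊑ (leq (tr (ap ((A ∸ good h) ^_) (sym (m+[n∸m]≡n R0≤R))) (^-distribˡ-+-* (A ∸ good h) R0 (R ∸ R0))))
   (*ʳ ((A ∸ good h) ^ R0) (^-monoˡ-≤ (R ∸ R0) (m∸n≤m A (good h))))
  -- `(1 - x) ^ R ≤ 1 / (1 + R x)` replaces the power by a convex function with a simple tangent.
  pointwise : ∀ h -> (A ∸ good h) ^ R0 * (2 * A' + R0 * wins h) ≤ 2 * A' * A ^ R0
  pointwise h = /ʳ _ _ A {{A≢0}} (begin _ ≡⟨ bern1 ((A ∸ good h) ^ R0) (2 * A') R0 (wins h) A ⟩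
   _ ≤⟨ *ʳ ((A ∸ good h) ^ R0) (+ʳ (2 * A' * A) (*ʳ R0 (successes≤good M-large h))) ⟩
   _ ≡⟨ bern2 ((A ∸ good h) ^ R0) (2 * A') R0 (good h) A ⟩
   _ ≤⟨ *ʳ (2 * A') (bernoulli A (good h) R0 (good≤A h)) ⟩
   _ ≡⟨ tr (ap (2 * A' *_) (*-comm A (A ^ R0))) (sym (*-assoc (2 * A') (A ^ R0) A)) ⟩ _ ∎)
   where
   bern1 : ∀ f a r x A -> f * (a + r * x) * A ≡ f * (a * A + r * (A * x))
   bern1 = ring
   bern2 : ∀ f a r x A -> f * (a * A + r * (a * x)) ≡ a * (f * (A + r * x))
   bern2 = ring
  n²< : n * n < R0 * (w * c0)
  n²< = ⊑ (leq (ap suc (m≡m%n+[m/n]*n (n * n) (w * c0)))) (+ˡ (n * n / (w * c0) * (w * c0)) (m%n<n (n * n) (w * c0)))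
  R0w≤ : R0 * w ≤ 3 * (n * n)
  R0w≤ = ⊑ (+≤ w-small (⊑ (*ʳ (n * n / (w * c0)) (m≤m*n w c0)) (m/n*n≤m (n * n) (w * c0)))) (leq (three (n * n)))
   where
   three : ∀ x -> 2 * x + x ≡ 3 * x
   three = ring
  first' : 2 * A' * n ^ m ≤ 1152 * c0 * (R0 * Ʃ fns wins)
  first' = /ˡ (n * n) (begin _ ≤⟨ *ˡ (2 * A' * n ^ m) (<⇒≤ n²<) ⟩
   _ ≡⟨ grp R0 w c0 A' (n ^ m) ⟩
   _ ≤⟨ *ʳ (2 * (R0 * c0)) first ⟩
   _ ≡⟨ grp' R0 c0 (n * n) (Ʃ fns wins) ⟩ _ ∎)
   where
   grp : ∀ R w c a x -> R * (w * c) * (2 * a * x) ≡ 2 * (R * c) * (w * (a * x))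
   grp = ring
   grp' : ∀ R c n s -> 2 * (R * c) * (576 * n * s) ≡ n * (1152 * c * (R * s))
   grp' = ring
  second' : R0 * R0 * Ʃ[ h ← fns ] (wins h * wins h) ≤ 9 * (suc C * suc C) * (2 * A' * (2 * A') * n ^ m)
  second' = /ˡ (n * n * (n * n)) {{m*n≢0 (n * n) (n * n)}} (begin _ ≡⟨ grp (n * n) R0 S2 ⟩
   _ ≤⟨ *ʳ (R0 * R0) second ⟩
   _ ≡⟨ grp' R0 w (suc C) A' (n ^ m) ⟩
   _ ≤⟨ *ˡ _ (*≤ R0w≤ R0w≤) ⟩
   _ ≤⟨ *ʳ (3 * (n * n) * (3 * (n * n))) (m≤n*m _ 4) ⟩
   _ ≡⟨ grp'' (n * n) (suc C) A' (n ^ m) ⟩ _ ∎)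
   where
   S2 = Ʃ[ h ← fns ] (wins h * wins h)
   grp : ∀ n r s -> n * n * (r * r * s) ≡ r * r * (n * n * s)
   grp = ring
   grp' : ∀ r w c a x -> r * r * (w * w * (c * c) * (a * a * x)) ≡ r * w * (r * w) * (c * c * (a * a * x))
   grp' = ring
   grp'' : ∀ n c a x -> 3 * n * (3 * n) * (4 * (c * c * (a * a * x))) ≡ n * n * (9 * (c * c) * (2 * a * (2 * a) * x))
   grp'' = ring
  alg : ∀ f b k a x -> f * b * k + a * b * x ≡ b * (f * k + a * x)
  alg = ring
  alg' : ∀ b k a x -> b * (k * (a * x)) ≡ k * (a * b * x)
  alg' = ring

-- Collisions of iterated steps.

iter : ∀ {A : Set} -> (A -> A) -> ℕ -> A -> A
iter f zero x = x
iter f (suc j) x = iter f j (f x)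

iter-+ : ∀ {A : Set} (f : A -> A) j k x -> iter f (j + k) x ≡ iter f k (iter f j x)
iter-+ f zero k x = refl
iter-+ f (suc j) k x = iter-+ f j k (f x)

-- Two of the first S walks meet through the same label and stop together at a
-- vertex whose table slot no other walk touches.
record Collision (S T Δ s : ℕ) .{{_ : NonZero s}} (start label step offset : ℕ -> ℕ) : Set where
 field
  k k' a b t : ℕ
  k<k' : k < k'
  k'<S : k' < S
  a-short : a + suc t ≤ T
  b-short : b + suc t ≤ T
  even : iter step a (start k) % 2 ≡ 0
  odd : iter step b (start k') % 2 ≡ 1
  meets : label (iter step a (start k)) ≡ label (iter step b (start k'))
  end : ℕ
  end≡ : iter step (a + suc t) (start k) ≡ end
  end≡' : iter step (b + suc t) (start k') ≡ end
  stops : offset end < Δ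
  goes-on : ∀ j -> 0 < j -> j < a + suc t -> Δ ≤ offset (iter step j (start k))
  goes-on' : ∀ j -> 0 < j -> j < b + suc t -> Δ ≤ offset (iter step j (start k'))
  apart : ∀ k'' -> k'' < S -> k'' ≢ k -> k'' ≢ k' -> ∀ j -> j ≤ T -> offset (iter step j (start k'')) < Δ ->
   offset (iter step j (start k'')) % s ≢ offset end % s

-- Frequencies, slots and stopping intervals.

entry-lookup : ∀ {k l} (z : Vec (Fin k) l) (i : Fin l) -> entry z (toℕ i) ≡ toℕ (lookup z i)
entry-lookup {l = l} z i with toℕ i <? l
... | yes i<l = ap (toℕ ∘ lookup z) (Fin.fromℕ<-toℕ i i<l)
... | no i≮l = refute (Fin.toℕ<n i) i≮l

freq≡Ʃ : ∀ {m n} (v : Fin m) (x : Vec (Fin m) n) -> freq v x ≡ Ʃ[ i ← allFin n ] 𝟙 (lookup x i Fin.≟ v)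
freq≡Ʃ v [] = refl
freq≡Ʃ {n = suc n} v (u ∷ x) = tr (head (v Fin.≟ u)) (sym (Ʃ-allFin-suc n (λ i -> 𝟙 (lookup (u ∷ x) i Fin.≟ v))))
 where
 head : (d : Dec (v ≡ u)) -> (if does d then suc else id) (freq v x) ≡ 𝟙 (u Fin.≟ v) + Ʃ[ i ← allFin n ] 𝟙 (lookup x i Fin.≟ v)
 head (yes eq) = ap₂ _+_ (sym (𝟙-yes (u Fin.≟ v) (sym eq))) (freq≡Ʃ v x)
 head (no ≢) = ap₂ _+_ (sym (𝟙-no (u Fin.≟ v) (≢ ∘ sym))) (freq≡Ʃ v x)

sumSquaredFreqs≡Ʃ : ∀ {m n} (x y : Vec (Fin m) n) -> sumSquaredFreqs x y ≡ Ʃ[ v ← allFin m ] (freq v x ^ 2 + freq v y ^ 2)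
sumSquaredFreqs≡Ʃ {m} x y = go (allFin m)
 where
 go : ∀ vs -> sum (map (λ v -> freq v x ^ 2 + freq v y ^ 2) vs) ≡ Ʃ[ v ← vs ] (freq v x ^ 2 + freq v y ^ 2)
 go [] = refl
 go (v ∷ vs) = ap ((freq v x ^ 2 + freq v y ^ 2) +_) (go vs)

Ʃ-freq : ∀ {m n} (x : Vec (Fin m) n) -> Ʃ[ v ← allFin m ] freq v x ≡ n
Ʃ-freq {m} {n} x = begin _ ≡⟨ Ʃ≡ (allFin m) (λ v -> freq≡Ʃ v x) ⟩
 _ ≡⟨ Ʃ⇆ (allFin m) (allFin n) _ ⟩
 _ ≡⟨ Ʃ≡ (allFin n) (λ i -> tr (Ʃ≡ (allFin m) λ v -> sym (*1 _)) (Ʃ-allFin-δ (lookup x i) (λ _ -> 1))) ⟩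
 _ ≡⟨ tr (Ʃ-Fin n 1) (*1 n) ⟩
 n ∎
 where open ≡R

m≤m^2 : ∀ m -> m ≤ m ^ 2
m≤m^2 zero = z≤n
m≤m^2 (suc m) = m≤m*n (suc m) (suc m * 1)

-- A frequency is at most its square, and the frequencies of each list add up to `n`. The resulting
-- `2 n ≤ p` later keeps `s` and `ℓ` below `n`.
2n≤sumSquaredFreqs : ∀ {m n} (x y : Vec (Fin m) n) -> n * 2 ≤ sumSquaredFreqs x y
2n≤sumSquaredFreqs {m} {n} x y = begin
 n * 2 ≡⟨ tr (*-comm n 2) (ap (n +_) (+0 n)) ⟩
 n + n ≡⟨ ap₂ _+_ (sym (Ʃ-freq x)) (sym (Ʃ-freq y)) ⟩
 _ ≤⟨ +≤ (Ʃ≤ (allFin m) λ v -> m≤m^2 (freq v x)) (Ʃ≤ (allFin m) λ v -> m≤m^2 (freq v y)) ⟩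
 _ ≡⟨ Ʃ-+ (allFin m) (λ v -> freq v x ^ 2) (λ v -> freq v y ^ 2) ⟨
 _ ≡⟨ sumSquaredFreqs≡Ʃ x y ⟨
 _ ∎
 where open ≤R

-- `suc (Δ / s)` blocks of length `s` cover the range, and each block meets a residue class at most
-- once.
residues : ∀ s .{{_ : NonZero s}} r Δ -> Ʃ[ y ← upTo Δ ] 𝟙 (y % s ≟ r) ≤ suc (Δ / s)
residues s r Δ = begin _ ≤⟨ m≤m+n _ _ ⟩
 _ ≡⟨ Ʃ<-+ Δ (suc (Δ / s) * s ∸ Δ) φ ⟨
 _ ≡⟨ ap (λ k -> Ʃ< k φ) (m+[n∸m]≡n Δ≤) ⟩
 _ ≡⟨ Ʃ<-* (suc (Δ / s)) s φ ⟩
 _ ≤⟨ Ʃ≤ (upTo (suc (Δ / s))) once ⟩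
 _ ≡⟨ tr (Ʃ<-const (suc (Δ / s)) 1) (*1 _) ⟩ _ ∎
 where
 open ≤R
 φ : ℕ -> ℕ
 φ y = 𝟙 (y % s ≟ r)
 Δ≤ : Δ ≤ suc (Δ / s) * s
 Δ≤ = ⊑ (leq (m≡m%n+[m/n]*n Δ s)) (+ˡ (Δ / s * s) (<⇒≤ (m%n<n Δ s)))
 once : ∀ i -> Ʃ< s (λ j -> φ (i * s + j)) ≤ 1
 once i with r <? s
 ... | yes r<s = leq (begin-equality
  _ ≡⟨ Ʃ<-cong s (λ j j<s -> 𝟙-cong ((i * s + j) % s ≟ r) (r ≟ j) (λ eq -> tr (sym eq) (reduce j j<s)) (λ eq -> tr (reduce j j<s) (sym eq))) ⟩
  _ ≡⟨ Ʃ-allFin s (λ j -> 𝟙 (r ≟ j)) ⟨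
  _ ≡⟨ Ʃ≡ (allFin s) (λ j -> tr (𝟙-cong (r ≟ toℕ j) (fromℕ< r<s Fin.≟ j) (λ eq -> Fin.toℕ-injective (tr (Fin.toℕ-fromℕ< r<s) eq)) (λ eq -> tr (sym (Fin.toℕ-fromℕ< r<s)) (ap toℕ eq))) (sym (*1 _))) ⟩
  _ ≡⟨ Ʃ-allFin-δ (fromℕ< r<s) (λ _ -> 1) ⟩
  1 ∎)
  where
  reduce : ∀ j -> j < s -> (i * s + j) % s ≡ j
  reduce j j<s = tr (ap (_% s) (+-comm (i * s) j)) (tr ([m+kn]%n≡m%n j i s) (m<n⇒m%n≡m j<s))
 ... | no r≮s = ⊑ (leq (tr (Ʃ≡ (upTo s) λ j -> 𝟙-no ((i * s + j) % s ≟ r) (λ eq -> r≮s (subst (_< s) eq (m%n<n (i * s + j) s)))) (Ʃ-0 (upTo s)))) z≤n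

module Offsets (n s Δ : ℕ) .{{_ : NonZero n}} .{{_ : NonZero s}} (Δ≤n : Δ ≤ n) where

 D : Fin n -> Fin n -> Set
 D c x = (toℕ x + toℕ c) % n < Δ

 D? : ∀ c x -> Dec (D c x)
 D? c x = (toℕ x + toℕ c) % n <? Δ

 Conf : Fin n -> Fin n -> Fin n -> Set
 Conf c e x = D c x × (toℕ x + toℕ c) % n % s ≡ (toℕ e + toℕ c) % n % s

 Conf? : ∀ c e x -> Dec (Conf c e x)
 Conf? c e x = D? c x ×-dec ((toℕ x + toℕ c) % n % s ≟ (toℕ e + toℕ c) % n % s)

 below : (φ : ℕ -> ℕ) -> (∀ y -> Δ ≤ y -> φ y ≡ 0) -> Ʃ< n φ ≡ Ʃ< Δ φ
 below φ zero-above = begin _ ≡⟨ ap (λ k -> Ʃ< k φ) (sym (m+[n∸m]≡n Δ≤n)) ⟩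
  _ ≡⟨ Ʃ<-+ Δ (n ∸ Δ) φ ⟩
  _ ≡⟨ ap (Ʃ< Δ φ +_) (tr (Ʃ≡ (upTo (n ∸ Δ)) λ y -> zero-above (Δ + y) (m≤m+n Δ y)) (Ʃ-0 (upTo (n ∸ Δ)))) ⟩
  _ ≡⟨ +0 _ ⟩ _ ∎
  where open ≡R

 shifted : ∀ c (φ : ℕ -> ℕ) -> (∀ y -> Δ ≤ y -> φ y ≡ 0) -> Ʃ[ x ← V {n} ] φ ((toℕ x + c) % n) ≡ Ʃ< Δ φ
 shifted c φ zero-above = tr (Ʃ≡ (V {n}) λ x -> ap φ (sym (toℕ-shift c x)))
  (tr (Ʃ-shift c (φ ∘ toℕ)) (tr (Ʃ-allFin n φ) (below φ zero-above)))

 ƩD-x : ∀ c -> Ʃ[ x ← V ] 𝟙 (D? c x) ≡ Δ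
 ƩD-x c = tr (shifted (toℕ c) (λ y -> 𝟙 (y <? Δ)) (λ y Δ≤y -> 𝟙-no (y <? Δ) (≤⇒≯ Δ≤y)))
  (tr (Ʃ<-cong Δ (λ y y<Δ -> 𝟙-yes (y <? Δ) y<Δ)) (tr (Ʃ<-const Δ 1) (*1 Δ)))

 ƩD-c : ∀ x -> Ʃ[ c ← V ] 𝟙 (D? c x) ≡ Δ
 ƩD-c x = tr (Ʃ≡ V λ c -> 𝟙-cong (D? c x) (D? x c) (subst (λ k -> k % n < Δ) (+-comm (toℕ x) (toℕ c))) (subst (λ k -> k % n < Δ) (+-comm (toℕ c) (toℕ x)))) (ƩD-x x)

 ƩConf : ∀ c e -> Ʃ[ x ← V ] 𝟙 (Conf? c e x) ≤ suc (Δ / s)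
 ƩConf c e = ⊑ (leq (shifted (toℕ c) φ (λ y Δ≤y -> 𝟙-no ((y <? Δ) ×-dec (y % s ≟ r)) (≤⇒≯ Δ≤y ∘ proj₁))))
  (⊑ (Ʃ<-mono Δ (λ y _ -> 𝟙-mono ((y <? Δ) ×-dec (y % s ≟ r)) (y % s ≟ r) proj₂)) (residues s r Δ))
  where
  r = (toℕ e + toℕ c) % n % s
  φ : ℕ -> ℕ
  φ y = 𝟙 ((y <? Δ) ×-dec (y % s ≟ r))

-- The interface between the analysis and the program: a set of lucky choices on which a collision
-- certainly exists, together with the bound on the average probability that `R` rounds all miss it.
record Sampler (n m q M ℓ Δ s R k : ℕ) .{{_ : NonZero n}} .{{_ : NonZero m}} .{{_ : NonZero M}} .{{_ : NonZero s}} (label : ℕ -> ℕ) : Set where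
 field
  luck : Vec ℕ 4 -> Fin n -> Vec (Fin n) (q + q + m) -> ℕ
  goodness≤1 : ∀ α c h -> luck α c h ≤ 1

 open Amplification {n} {m} {q} M luck goodness≤1 public using (A; good; goodnessOf)

 field
  amplified : Ʃ[ h ← vecs V m ] ((A ∸ good h) ^ R) * (k * k) + A ^ R * n ^ m ≤ k * k * (A ^ R * n ^ m)
  collision : ∀ α (h : Vec (Fin n) m) c (st : Vec (Fin n) (q + q)) (start : ℕ -> ℕ) -> (∀ κ -> start (toℕ κ) ≡ toℕ (lookup st κ)) ->
   0 < luck α c (st Vec.++ h) ->
   Collision (q + q) (2 * ℓ) Δ s start label (λ u -> (entry h (label u) + hash n M m α (label u)) % n) (λ u -> (u + toℕ c) % n)

-- Meetings among the 2 q walks of a round.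

module Block (scene : Scene) (q : ℕ) where

 open Scene scene

 Seed : Set
 Seed = Twice.Seed scene

 seeds : List Seed
 seeds = Twice.seeds scene

 hshift : Seed -> Fin m -> ℕ
 hshift = Twice.hshift scene

 ∣P∣ ∣Q∣ : ℕ
 ∣P∣ = Twice.∣P∣ scene
 ∣Q∣ = Twice.∣Q∣ scene

 fns : List (Vec (Fin n) m)
 fns = Twice.fns scene

 S : ℕ
 S = q + q

 stage : Seed -> Stage
 stage α = record { scene = scene ; S = S ; g = hshift α }

 Index : Set
 Index = Fin q × (Fin q × (ℕ × (ℕ × ℕ)))

 indices : List Index
 indices = cartesianProduct (allFin q) (cartesianProduct (allFin q) (cartesianProduct (upTo ℓ) (cartesianProduct (upTo ℓ) (upTo ℓ))))

 -- Walks of the first half are to arrive in `P` and those of the second half in `Q`. This gives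
 -- each pair the order that `Unique-Meeting` relies on.
 left right : Fin q -> Fin S
 left k = k ↑ˡ q
 right k = q ↑ʳ k

 left<right : ∀ k k' -> toℕ (left k) < toℕ (right k')
 left<right k k' = subst₂ _<_ (sym (Fin.toℕ-↑ˡ k q)) (sym (Fin.toℕ-↑ʳ q k')) (<≤ (Fin.toℕ<n k) (m≤m+n q (toℕ k')))

 left≢right : ∀ k k' -> left k ≢ right k'
 left≢right k k' eq = <-irrefl (ap toℕ eq) (left<right k k')

 Table : Set
 Table = Vec (Fin n) (S + m)

 eventAt : Seed -> Fin n -> Table -> Index -> ℕ
 eventAt α c h (k , k' , a , b , t) = Once.Pair.event (stage α) (left k) (right k') c a b t h

 luck : Seed -> Fin n -> Table -> ℕ
 luck α c h = Ʃ indices (eventAt α c h)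

 ∈-indices : ∀ {k k' a b t} -> (k , k' , a , b , t) ∈ indices -> a < ℓ × b < ℓ × t < ℓ
 ∈-indices i∈ =
  let _ , i1 = Mem.∈-cartesianProduct⁻ (allFin q) _ i∈
      _ , i2 = Mem.∈-cartesianProduct⁻ (allFin q) _ i1
      a∈ , i3 = Mem.∈-cartesianProduct⁻ (upTo ℓ) _ i2
      b∈ , t∈ = Mem.∈-cartesianProduct⁻ (upTo ℓ) (upTo ℓ) i3
  in Mem.∈-upTo⁻ a∈ , Mem.∈-upTo⁻ b∈ , Mem.∈-upTo⁻ t∈

 ℓ≤T : ∀ {a} -> a < ℓ -> a < T
 ℓ≤T lt = ⊑ lt (m≤m+n ℓ _)

 goodness≤1 : ∀ α c h -> luck α c h ≤ 1
 goodness≤1 α c h = Ʃ≤1 indices (eventAt α c h) unique-indices (λ (k , k' , a , b , t) -> Once.event≤1 (stage α) c h (left k) (right k') a b t) exclusive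
  where
  unique-indices : Unique indices
  unique-indices = Unique.cartesianProduct⁺ (Unique.allFin⁺ q) (Unique.cartesianProduct⁺ (Unique.allFin⁺ q)
   (Unique.cartesianProduct⁺ (Unique.upTo⁺ ℓ) (Unique.cartesianProduct⁺ (Unique.upTo⁺ ℓ) (Unique.upTo⁺ ℓ))))
  exclusive : ∀ x y -> x ∈ indices -> y ∈ indices -> 0 < eventAt α c h x -> 0 < eventAt α c h y -> x ≡ y
  exclusive (k1 , k1' , a1 , b1 , t1) (k2 , k2' , a2 , b2 , t2) x∈ y∈ p1 p2 =
   let a2< , b2< , _ = ∈-indices y∈
       mt1 = Once.meeting (stage α) c h (left k1) (right k1') a1 b1 t1 p1
       mt2 = Once.meeting (stage α) c h (left k2) (right k2') a2 b2 t2 p2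
       k≡ , k'≡ = Once.Unique-Meeting.same-pair (stage α) (left<right k1 k1') (left<right k2 k2') (ℓ≤T a2<) (ℓ≤T b2<) mt1 mt2
       a≡ , b≡ , t≡ = Once.Unique-Meeting.same-steps (stage α) (left<right k1 k1') (left<right k2 k2') (ℓ≤T a2<) (ℓ≤T b2<) mt1 mt2
   in ap₂ _,_ (Fin.↑ˡ-injective q k1 k2 k≡) (ap₂ _,_ (Fin.↑ʳ-injective q k1' k2' k'≡) (ap₂ _,_ a≡ (ap₂ _,_ b≡ t≡)))

 Ʃindices : ∀ φ -> Ʃ indices φ ≡ Ʃ[ k ← allFin q ] Ʃ[ k' ← allFin q ] Ʃ[ a ← upTo ℓ ] Ʃ[ b ← upTo ℓ ] Ʃ[ t ← upTo ℓ ] φ (k , k' , a , b , t)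
 Ʃindices φ = tr (Ʃ-⊗ _,_ (allFin q) _ φ) (Ʃ≡ (allFin q) λ k -> tr (Ʃ-⊗ _,_ (allFin q) _ _) (Ʃ≡ (allFin q) λ k' ->
  tr (Ʃ-⊗ _,_ (upTo ℓ) _ _) (Ʃ≡ (upTo ℓ) λ a -> Ʃ-⊗ _,_ (upTo ℓ) (upTo ℓ) _)))

 length-indices : length indices ≡ q * (q * (ℓ * (ℓ * ℓ)))
 length-indices = tr (sym (tr (Ʃ-const indices 1) (*1 _))) (tr (Ʃindices (λ _ -> 1))
  (tr (Ʃ≡ (allFin q) λ _ -> tr (Ʃ≡ (allFin q) λ _ -> tr (Ʃ≡ (upTo ℓ) λ _ -> tr (Ʃ≡ (upTo ℓ) λ _ -> tr (Ʃ<-const ℓ 1) (*1 ℓ)) (Ʃ<-const ℓ ℓ)) (Ʃ<-const ℓ (ℓ * ℓ)))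
   (Ʃ-Fin q _)) (Ʃ-Fin q _)))

 wt≡ : ∀ α v -> Once.wt (stage α) (S ↑ʳ v) ≡ (Twice.Raw.wt scene) v
 wt≡ α v = Ʃ≡ V λ x -> 𝟙-cong (S ↑ʳ z x Fin.≟ S ↑ʳ v) (z x Fin.≟ v) (Fin.↑ʳ-injective S (z x) v) (ap (S ↑ʳ_))

 pairs≡ : ∀ α -> Once.pairs (stage α) ≡ (Twice.Raw.pairs scene)
 pairs≡ α = Ʃ≡ V (λ x -> wt≡ α (z x))

 -- `w / n²` would be the expected number of arrivals of pairs in `P` and `Q` if all vertices were
 -- independent: `q * q` pairs, `ℓ * ℓ` pairs of times and `∣P∣ * ∣Q∣` pairs of ends.
 f w : ℕ
 f = (Twice.Raw.wt scene) v*
 w = q * q * (ℓ * ℓ) * (∣P∣ * ∣Q∣)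

 starts : ℕ
 starts = suc S

 A A' : ℕ
 A = M ^ 4 * M ^ starts
 A' = M ^ 4 * n ^ starts

 wins : Vec (Fin n) m -> ℕ
 wins h = Ʃ[ α ← seeds ] Ʃ[ c ← V ] Ʃ[ st ← vecs V S ] luck α c (st Vec.++ h)

 length-seeds : length seeds ≡ M ^ 4
 length-seeds = tr (length-vecs (upTo M) 4) (ap (_^ 4) (List.length-upTo M))

 Ʃsuccesses : Ʃ fns wins ≡ Ʃ[ α ← seeds ] Ʃ[ c ← V ] Ʃ[ h ← vecs V (S + m) ] luck α c h
 Ʃsuccesses = tr (Ʃ⇆ fns seeds _) (Ʃ≡ seeds λ α -> tr (Ʃ⇆ fns (V {n}) (λ h c -> Ʃ[ st ← vecs V S ] luck α c (st Vec.++ h)))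
  (Ʃ≡ (V {n}) λ c -> tr (Ʃ⇆ fns (vecs V S) _) (sym (Ʃ-vecs-++ V S m (luck α c)))))

 -- Identifies walks through the combined table of starts and `h` with the iteration on numbers that
 -- a machine performs.
 module Runs (α : Seed) (h : Vec (Fin n) m) (c : Fin n) (st : Vec (Fin n) S)
  (label : ℕ -> ℕ) (label-toℕ : ∀ u -> label (toℕ u) ≡ toℕ (z u)) (start : ℕ -> ℕ) (starts≡ : ∀ κ -> start (toℕ κ) ≡ toℕ (lookup st κ))
  (s : ℕ) .{{_ : NonZero s}} (P⇒even : ∀ {u} -> P u -> toℕ u % 2 ≡ 0) (Q⇒odd : ∀ {u} -> Q u -> toℕ u % 2 ≡ 1)
  (D⇒ : ∀ {c u} -> D c u -> (toℕ u + toℕ c) % n < Δ) (D⇐ : ∀ {c u} -> (toℕ u + toℕ c) % n < Δ -> D c u)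
  (Conf⇐ : ∀ {c e u} -> (toℕ u + toℕ c) % n < Δ -> (toℕ u + toℕ c) % n % s ≡ (toℕ e + toℕ c) % n % s -> Conf c e u) where

  step : ℕ -> ℕ
  step u = (entry h (label u) + hash n M m α (label u)) % n

  offset : ℕ -> ℕ
  offset u = (u + toℕ c) % n

  ĥ : Vec (Fin n) (S + m)
  ĥ = st Vec.++ h

  F-step : ∀ u -> toℕ (Once.F (stage α) ĥ (Once.nx (stage α) u)) ≡ step (toℕ u)
  F-step u = begin _ ≡⟨ toℕ-shift (Once.sh (stage α) (Once.nx (stage α) u)) (lookup ĥ (Once.nx (stage α) u)) ⟩
   _ ≡⟨ ap₂ (λ a b -> (toℕ a + b) % n) (Vec.lookup-++ʳ st h (z u)) (ap [ (λ _ -> 0) , (Twice.hshift scene) α ]′ (Fin.splitAt-↑ʳ S m (z u))) ⟩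
   _ ≡⟨ ap (λ v -> (v + hash n M m α (toℕ (z u))) % n) (entry-lookup h (z u)) ⟨
   _ ≡⟨ ap (λ v -> (entry h v + hash n M m α v) % n) (label-toℕ u) ⟨
   _ ∎
   where open ≡R

  vertex-iter : ∀ κ {u} -> toℕ (Once.F (stage α) ĥ κ) ≡ u -> ∀ j -> toℕ (Once.vertex (stage α) ĥ κ j) ≡ iter step j u
  vertex-iter κ eq zero = eq
  vertex-iter κ eq (suc j) = vertex-iter (Once.nx (stage α) (Once.F (stage α) ĥ κ)) (tr (F-step (Once.F (stage α) ĥ κ)) (ap step eq)) j

  vertex-source : ∀ κ j -> toℕ (Once.vertex (stage α) ĥ (Once.src (stage α) κ) j) ≡ iter step j (start (toℕ κ))
  vertex-source κ = vertex-iter (Once.src (stage α) κ) (begin _ ≡⟨ toℕ-shift (Once.sh (stage α) (Once.src (stage α) κ)) (lookup ĥ (Once.src (stage α) κ)) ⟩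
   _ ≡⟨ ap₂ (λ a b -> (toℕ a + b) % n) (Vec.lookup-++ˡ st h κ) (ap [ (λ _ -> 0) , (Twice.hshift scene) α ]′ (Fin.splitAt-↑ˡ S κ m)) ⟩
   _ ≡⟨ tr (ap (_% n) (+0 _)) (m<n⇒m%n≡m (Fin.toℕ<n (lookup st κ))) ⟩
   _ ≡⟨ starts≡ κ ⟨
   _ ∎)
   where open ≡R

  module _ {k k' : Fin S} {a b t : ℕ} (k<k' : toℕ k < toℕ k') (a<ℓ : a < ℓ) (b<ℓ : b < ℓ) (t<ℓ : t < ℓ) (Mt : (Once.Meeting (stage α)) c ĥ k k' a b t) where

   open Once.Meeting Mt

   meeting-collision : Collision S (2 * ℓ) Δ s start label step offset
   meeting-collision = record
    { k = toℕ k
    ; k' = toℕ k'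
    ; a = a
    ; b = b
    ; t = t
    ; k<k' = k<k'
    ; k'<S = Fin.toℕ<n k'
    ; a-short = short a<ℓ t<ℓ
    ; b-short = short b<ℓ t<ℓ
    ; even = subst (λ u -> u % 2 ≡ 0) (vertex-source k a) (P⇒even i∈P)
    ; odd = subst (λ u -> u % 2 ≡ 1) (vertex-source k' b) (Q⇒odd j∈Q)
    ; meets = tr (ap label (sym (vertex-source k a))) (tr (label-toℕ i) (tr (ap toℕ (tr (P⇒ i∈P) (sym (Q⇒ j∈Q)))) (tr (sym (label-toℕ j)) (ap label (vertex-source k' b)))))
    ; end = toℕ e
    ; end≡ = tr (sym (vertex-source k (a + suc t))) (ap toℕ (Once.vertex-+ (stage α) ĥ (Once.src (stage α) k) a (Once.Effects.i⇒v̂ (stage α) Mt) t))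
    ; end≡' = tr (sym (vertex-source k' (b + suc t))) (ap toℕ (Once.vertex-+ (stage α) ĥ (Once.src (stage α) k') b (Once.Effects.j⇒v̂ (stage α) Mt) t))
    ; stops = D⇒ e∈D
    ; goes-on = going k a (Once.Effects.i⇒v̂ (stage α) Mt) (Once.Effects.A-steps (stage α) Mt)
    ; goes-on' = going k' b (Once.Effects.j⇒v̂ (stage α) Mt) (Once.Effects.B-steps (stage α) Mt)
    ; apart = λ k'' k''< ≢k ≢k' j j≤T stop same -> (Once.Effects.avoids-bucket (stage α) Mt) (fromℕ< k''<) (λ eq -> ≢k (tr (sym (Fin.toℕ-fromℕ< k''<)) (ap toℕ eq))) (λ eq -> ≢k' (tr (sym (Fin.toℕ-fromℕ< k''<)) (ap toℕ eq))) j j≤T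
     (let eq = tr (vertex-source (fromℕ< k''<) j) (ap (iter step j ∘ start) (Fin.toℕ-fromℕ< k''<))
      in Conf⇐ (subst (λ u -> offset u < Δ) (sym eq) stop) (tr (ap (λ u -> offset u % s) eq) same))
    }
    where
    short : ∀ {a t} -> a < ℓ -> t < ℓ -> a + suc t ≤ 2 * ℓ
    short a< t< = ⊑ (+≤ (<⇒≤ a<) t<) (leq (ap (ℓ +_) (sym (+0 ℓ))))
    going : ∀ κ a -> (Once.nx (stage α)) (Once.vertex (stage α) ĥ (Once.src (stage α) κ) a) ≡ (Once.v̂ (stage α)) -> (∀ j -> 0 < j -> j ≤ a -> ¬ D c (Once.vertex (stage α) ĥ (Once.src (stage α) κ) j)) ->
     ∀ j -> 0 < j -> j < a + suc t -> Δ ≤ offset (iter step j (start (toℕ κ)))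
    going κ a eq before j 0<j j< = subst (λ u -> Δ ≤ offset u) (vertex-source κ j) (≮⇒≥ (stays ∘ D⇐))
     where
     stays : ¬ D c (Once.vertex (stage α) ĥ (Once.src (stage α) κ) j)
     stays with j ≤? a
     ... | yes j≤a = before j 0<j j≤a
     ... | no j≰a = subst (λ u -> ¬ D c u) (tr (sym (Once.vertex-+ (stage α) ĥ (Once.src (stage α) κ) a eq (j ∸ suc a))) (ap (Once.vertex (stage α) ĥ (Once.src (stage α) κ)) j≡)) (Once.Effects.T-steps (stage α) Mt (j ∸ suc a) j∸<t)
      where
      j≡ : a + suc (j ∸ suc a) ≡ j
      j≡ = tr (+-suc a _) (m+[n∸m]≡n (≰⇒> j≰a))
      j∸<t : j ∸ suc a < t
      j∸<t = +-cancelˡ-< (suc a) _ _ (subst₂ _<_ (sym (m+[n∸m]≡n (≰⇒> j≰a))) (+-suc a t) j<)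

  collision : 0 < luck α c ĥ -> Collision S (2 * ℓ) Δ s start label step offset
  collision pos =
   let (k , k' , a , b , t) , i∈ , p = Ʃ>0⇒∃ indices (eventAt α c ĥ) pos
       a<ℓ , b<ℓ , t<ℓ = ∈-indices i∈
   in meeting-collision (left<right k k') a<ℓ b<ℓ t<ℓ (Once.meeting (stage α) c ĥ (left k) (right k') a b t p)

 module Moments (C : ℕ) (1≤ℓ : 1 ≤ ℓ)
  (clashes : ∀ L -> L ≤ 3 * (ℓ ∸ 1) -> 8 * (L * L * (Twice.Raw.pairs scene) + L * n * f) ≤ n * n)
  (stops : 24 * (3 * (ℓ ∸ 1) * Δ) ≤ n)
  (heavy : 8 * (3 * (ℓ ∸ 1) * (Twice.Raw.pairs scene)) ≤ n * suc κ)
  (quiet : 2 * ((S ∸ 2) * (T * T * (Twice.Raw.pairs scene) + T * n * (κ + f) + suc T * n * bkt)) ≤ n * n)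
  (dense : n ≤ 144 * (ℓ * Δ))
  (enough : (2 + 4 * (2 * (ℓ ∸ 1))) * κ ≤ C * n) where

  below : ∀ {a} -> a < ℓ -> a ≤ ℓ ∸ 1
  below a<ℓ = ∸-monoˡ-≤ 1 a<ℓ

  event-mean : ∀ α i -> i ∈ indices -> n ^ (S + m) * (n * (∣P∣ * (∣Q∣ * Δ))) ≤ 4 * (n * (n * n)) * Ʃ[ c ← V ] Ʃ[ h ← vecs V (S + m) ] eventAt α c h i
  event-mean α (k , k' , a , b , t) i∈ =
   Once.Lower.first-moment (stage α) (left k) (right k') a b t (left≢right k k')
    (subst₂ (λ w x -> 2 * ((S ∸ 2) * (T * T * w + T * n * (κ + x) + suc T * n * bkt)) ≤ n * n) (sym (pairs≡ α)) (sym (wt≡ α v*)) quiet)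
    (subst₂ (λ w x -> 8 * (L * L * w + L * n * x) ≤ n * n) (sym (pairs≡ α)) (sym (wt≡ α v*)) (clashes L L≤))
    (⊑ (*ʳ 24 (*ˡ Δ L≤)) stops)
    (subst (λ w -> 8 * (L * w) ≤ n * suc κ) (sym (pairs≡ α)) (⊑ (*ʳ 8 (*ˡ (Twice.Raw.pairs scene) L≤)) heavy))
   where
   L = a + (b + t)
   L≤ : L ≤ 3 * (ℓ ∸ 1)
   L≤ = let a< , b< , t< = ∈-indices i∈ in
    ⊑ (+≤ (below a<) (+≤ (below b<) (below t<))) (leq (ap (λ x -> (ℓ ∸ 1) + ((ℓ ∸ 1) + x)) (sym (+0 (ℓ ∸ 1)))))

  -- Stopping at one given time has probability of order `Δ / n` only; the sum over all `t` below
  -- `ℓ` is bounded below by `dense`. The constant 576 is 4 from `first-moment` times 144.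
  first : w * (A' * n ^ m) ≤ 576 * (n * n) * Ʃ fns wins
  first = /ˡ n (begin _ ≡⟨ alg n q ℓ (∣P∣ * ∣Q∣) (M ^ 4) (n ^ S) (n ^ m) ⟩
   _ ≤⟨ *ʳ (M ^ 4) (*ʳ (q * (q * (ℓ * ℓ))) (*ʳ (n ^ S * n ^ m) (*ʳ n (*ʳ (∣P∣ * ∣Q∣) dense)))) ⟩
   _ ≡⟨ alg' (M ^ 4) q ℓ (n ^ S * n ^ m) n ∣P∣ ∣Q∣ Δ ⟩
   _ ≡⟨ ap (λ y -> 144 * (M ^ 4 * y)) count ⟩
   _ ≡⟨ ap (144 *_) (tr (ap (_* (length indices * E)) (sym length-seeds)) (tr (sym (Ʃ-const seeds _)) (Ʃ≡ seeds λ α -> sym (Ʃ-const indices E)))) ⟩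
   _ ≤⟨ *ʳ 144 (Ʃ≤ seeds λ α -> Ʃ-mono-∈ indices (event-mean α)) ⟩
   _ ≡⟨ ap (144 *_) (tr (Ʃ≡ seeds λ α -> tr (Ʃ-*ˡ (4 * (n * (n * n))) indices _) (ap (4 * (n * (n * n)) *_) (gather α))) (Ʃ-*ˡ (4 * (n * (n * n))) seeds _)) ⟩
   _ ≡⟨ ap (λ x -> 144 * (4 * (n * (n * n)) * x)) (sym Ʃsuccesses) ⟩
   _ ≡⟨ alg'' n (Ʃ fns wins) ⟩ _ ∎)
   where
   open ≤R
   E = n ^ (S + m) * (n * (∣P∣ * (∣Q∣ * Δ)))
   count : q * (q * (ℓ * (ℓ * ℓ))) * (n ^ S * n ^ m * (n * (∣P∣ * (∣Q∣ * Δ)))) ≡ length indices * E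
   count = ap₂ (λ l k -> l * (k * (n * (∣P∣ * (∣Q∣ * Δ))))) (sym length-indices) (sym (^-distribˡ-+-* n S m))
   gather : ∀ α -> Ʃ[ i ← indices ] Ʃ[ c ← V ] Ʃ[ h ← vecs V (S + m) ] eventAt α c h i ≡ Ʃ[ c ← V ] Ʃ[ h ← vecs V (S + m) ] luck α c h
   gather α = tr (Ʃ⇆ indices (V {n}) (λ i c -> Ʃ[ h ← vecs V (S + m) ] eventAt α c h i)) (Ʃ≡ (V {n}) λ c -> Ʃ⇆ indices (vecs V (S + m)) _)
   alg : ∀ n q l x M s k -> n * (q * q * (l * l) * x * (M * (n * s) * k)) ≡ M * (q * (q * (l * l)) * (s * k * (n * (x * n))))
   alg = ring
   alg' : ∀ M q l x n a b d -> M * (q * (q * (l * l)) * (x * (n * (a * b * (144 * (l * d)))))) ≡ 144 * (M * (q * (q * (l * (l * l))) * (x * (n * (a * (b * d))))))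
   alg' = ring
   alg'' : ∀ n x -> 144 * (4 * (n * (n * n)) * x) ≡ n * (576 * (n * n) * x)
   alg'' = ring

  -- The two walks of a meeting, seen in the table that starts with their
  -- two starting vertices only.
  module Transfer (α : Seed) (st : Vec (Fin n) S) (h : Vec (Fin n) m) (k k' : Fin S) where

   ĥ : Table
   ĥ = st Vec.++ h

   h2 : Vec (Fin n) (2 + m)
   h2 = lookup st k ∷ lookup st k' ∷ h

   F-value : ∀ v -> (Once.F (stage α)) ĥ (S ↑ʳ v) ≡ (Twice.W.F scene α) h2 (Twice.value scene v)
   F-value v = ap₂ shift (ap [ (λ _ -> 0) , hshift α ]′ (Fin.splitAt-↑ʳ S m v)) (Vec.lookup-++ʳ st h v)

   F-source : ∀ κ -> (Once.F (stage α)) ĥ (Once.src (stage α) κ) ≡ shift 0 (lookup st κ)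
   F-source κ = ap₂ shift (ap [ (λ _ -> 0) , hshift α ]′ (Fin.splitAt-↑ˡ S κ m)) (Vec.lookup-++ˡ st h κ)

   path-value : ∀ v a -> (Once.path (stage α)) ĥ (S ↑ʳ v) a ≡ (Twice.W.path scene α) h2 (Twice.value scene v) a × (Once.vertex (stage α)) ĥ (S ↑ʳ v) a ≡ (Twice.W.vertex scene α) h2 (Twice.value scene v) a
   path-value v zero = refl , F-value v
   path-value v (suc a) with (Once.F (stage α)) ĥ (S ↑ʳ v) | F-value v
   ... | _ | refl = let p , e = path-value (z (Twice.W.F scene α h2 (Twice.value scene v))) a in ap (_ ∷_) p , e

   path-source : ∀ κ κ2 -> (Twice.W.F scene α) h2 κ2 ≡ shift 0 (lookup st κ) -> ∀ a ->
    (Once.path (stage α)) ĥ (Once.src (stage α) κ) a ≡ (Twice.W.path scene α) h2 κ2 a × (Once.vertex (stage α)) ĥ (Once.src (stage α) κ) a ≡ (Twice.W.vertex scene α) h2 κ2 a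
   path-source κ κ2 eq zero = refl , tr (F-source κ) (sym eq)
   path-source κ κ2 eq (suc a) with (Once.F (stage α)) ĥ (Once.src (stage α) κ) | tr (F-source κ) (sym eq)
   ... | _ | refl = let p , e = path-value (z (Twice.W.F scene α h2 κ2)) a in ap (_ ∷_) p , e

   meeting⇒reach : ∀ {c a b t} -> (Once.Meeting (stage α)) c ĥ k k' a b t -> 0 < (Twice.reach scene) α a b h2
   meeting⇒reach {c} {a} {b} {t} Mt =
    let pA , vA = path-source k zero refl a
        pB , vB = path-source k' (suc zero) refl b
        ys = toList (Twice.W.path scene α h2 zero a) ++ toList (Twice.W.path scene α h2 (suc zero) b)
        xs≡ = ap₂ (λ u w -> toList u ++ toList w) pA pB
        uniq = shorten (toList (Once.path (stage α) ĥ (Once.src (stage α) k) a)) (toList (Once.path (stage α) ĥ (Once.src (stage α) k') b)) (toList (Once.path (stage α) ĥ (Once.v̂ (stage α)) t)) distinct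
        light = ⊑ (⊑ (leq (Ʃ≡ ys' λ x -> sym (wt≡ α (z x)))) (subst (Once.weight (stage α) ys' ≤_) (sym (weight-++ (toList (Once.path (stage α) ĥ (Once.src (stage α) k) a)) (toList (Once.path (stage α) ĥ (Once.src (stage α) k') b)) (toList (Once.path (stage α) ĥ (Once.v̂ (stage α)) t)))) (m≤m+n _ _))) lightly
    in subst (λ ys -> 0 < (Twice.valid scene) ys (Twice.W.vertex scene α h2 zero a) (Twice.W.vertex scene α h2 (suc zero) b)) xs≡
     (*≤ (*≤ (leq (sym (𝟙-yes (Twice.Raw.unique? scene (map z ys' ++ v* ∷ [])) uniq))) (leq (sym (𝟙-yes (Twice.Raw.weight scene ys' ≤? κ) light))))
      (*≤ (leq (sym (𝟙-yes (P? _) (subst P vA i∈P)))) (leq (sym (𝟙-yes (Q? _) (subst Q vB j∈Q))))))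
    where
    open Once.Meeting Mt
    ys' = toList (Once.path (stage α) ĥ (Once.src (stage α) k) a) ++ toList (Once.path (stage α) ĥ (Once.src (stage α) k') b)
    weight-++ : ∀ us ws cs -> (Once.weight (stage α)) (us ++ ws ++ cs) ≡ (Once.weight (stage α)) (us ++ ws) + (Once.weight (stage α)) cs
    weight-++ us ws cs = tr (ap (Once.weight (stage α)) (sym (List.++-assoc us ws cs))) (Ʃ-++ (us ++ ws) cs _)
    shorten : ∀ us ws cs -> Unique (map (Once.nx (stage α)) (us ++ ws ++ cs) ++ (Once.src (stage α)) k ∷ (Once.src (stage α)) k' ∷ (Once.v̂ (stage α)) ∷ []) -> Unique (map z (us ++ ws) ++ v* ∷ [])
    shorten us ws cs u = drop (map z (us ++ ws)) (map z cs) (AllPairs.map (λ ≢ eq -> ≢ (ap (S ↑ʳ_) eq)) (AllPairs.map⁻ (subst Unique keys≡ (remove (map (Once.nx (stage α)) (us ++ ws ++ cs)) u))))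
     where
     remove : ∀ xs {s s' v : Fin (S + m)} -> Unique (xs ++ s ∷ s' ∷ v ∷ []) -> Unique (xs ++ v ∷ [])
     remove [] (_ ∷ _ ∷ u) = u
     remove (x ∷ xs) (x∉ ∷ u) = All.++⁺ (All.++⁻ˡ xs x∉) (All.lookup x∉ (Mem.∈-++⁺ʳ xs (there (there (here')))) ∷ []) ∷ remove xs u
      where
      open import Data.List.Relation.Unary.Any using (here; there)
      here' : ∀ {A : Set} {v : A} {vs} -> v ∈ v ∷ vs
      here' = here refl
     keys≡ : map (Once.nx (stage α)) (us ++ ws ++ cs) ++ (Once.v̂ (stage α)) ∷ [] ≡ map (S ↑ʳ_) (map z (us ++ ws) ++ map z cs ++ v* ∷ [])
     keys≡ = tr (ap (_++ (Once.v̂ (stage α)) ∷ []) (tr (List.map-∘ (us ++ ws ++ cs)) (ap (map (S ↑ʳ_)) (tr (ap (map z) (sym (List.++-assoc us ws cs))) (List.map-++ z (us ++ ws) cs)))))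
      (tr (sym (List.map-++ (S ↑ʳ_) (map z (us ++ ws) ++ map z cs) (v* ∷ []))) (ap (map (S ↑ʳ_)) (List.++-assoc (map z (us ++ ws)) (map z cs) (v* ∷ []))))
     drop : ∀ xs ys {zs : List (Fin m)} -> Unique (xs ++ ys ++ zs) -> Unique (xs ++ zs)
     drop [] ys u = tail ys u
      where
      tail : ∀ ys {zs : List (Fin m)} -> Unique (ys ++ zs) -> Unique zs
      tail [] u = u
      tail (_ ∷ ys) (_ ∷ u) = tail ys u
     drop (x ∷ xs) ys (x∉ ∷ u) = All.++⁺ (All.++⁻ˡ xs x∉) (All.++⁻ʳ ys (All.++⁻ʳ xs x∉)) ∷ drop xs ys u

  walks : ℕ -> ℕ -> Vec (Fin n) m -> ℕ
  walks a b h = Ʃ[ α ← seeds ] (Twice.walksFrom scene) α a b h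

  reached : Vec (Fin n) m -> ℕ
  reached h = Ʃ[ a ← upTo ℓ ] Ʃ[ b ← upTo ℓ ] walks a b h

  -- The left side is at most 1, so a single witness on the right suffices. In particular the sum
  -- over `t` disappears without a factor `ℓ`.
  goodness≤ : ∀ α c st h -> luck α c (st Vec.++ h) ≤
   Ʃ[ k ← allFin q ] Ʃ[ k' ← allFin q ] Ʃ[ a ← upTo ℓ ] Ʃ[ b ← upTo ℓ ] (Twice.reach scene) α a b (lookup st (left k) ∷ lookup st (right k') ∷ h)
  goodness≤ α c st h with 0 <? luck α c (st Vec.++ h)
  ... | no ≤0 = ⊑ (≮⇒≥ ≤0) z≤n
  ... | yes pos =
   let (k , k' , a , b , t) , i∈ , p = Ʃ>0⇒∃ indices (eventAt α c (st Vec.++ h)) pos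
       a< , b< , _ = ∈-indices i∈
   in ⊑ (goodness≤1 α c (st Vec.++ h)) (⊑ (Transfer.meeting⇒reach α st h (left k) (right k') (Once.meeting (stage α) c (st Vec.++ h) (left k) (right k') a b t p))
    (⊑ (term≤Ʃ (λ b -> (Twice.reach scene) α a b (lookup st (left k) ∷ lookup st (right k') ∷ h)) (Mem.∈-upTo⁺ b<))
    (⊑ (term≤Ʃ (λ a -> Ʃ[ b ← upTo ℓ ] (Twice.reach scene) α a b (lookup st (left k) ∷ lookup st (right k') ∷ h)) (Mem.∈-upTo⁺ a<))
    (⊑ (term≤Ʃ (λ k' -> Ʃ[ a ← upTo ℓ ] Ʃ[ b ← upTo ℓ ] (Twice.reach scene) α a b (lookup st (left k) ∷ lookup st (right k') ∷ h)) (Mem.∈-allFin k'))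
     (term≤Ʃ (λ k -> Ʃ[ k' ← allFin q ] Ʃ[ a ← upTo ℓ ] Ʃ[ b ← upTo ℓ ] (Twice.reach scene) α a b (lookup st (left k) ∷ lookup st (right k') ∷ h)) (Mem.∈-allFin k))))))

  two-entries : ∀ (φ : Fin n -> Fin n -> ℕ) {k k' : Fin S} -> k ≢ k' ->
   n * (n * Ʃ[ st ← vecs V S ] φ (lookup st k) (lookup st k')) ≡ n ^ S * Ʃ[ u ← V ] Ʃ[ x ← V ] φ u x
  two-entries φ {k} {k'} k≢k' = begin _ ≡⟨ ap (n *_) (tr (ap (_* Ʃ[ st ← vecs V S ] φ (lookup st k) (lookup st k')) (sym length-V)) (resample V k (λ st u -> φ u (lookup st k')) (λ st a u -> ap (φ u) (Vec.lookup∘updateAt′ k' k (k≢k' ∘ sym) st)))) ⟩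
   _ ≡⟨ tr (ap (_* Ʃ[ st ← vecs V S ] Ʃ[ u ← V ] φ u (lookup st k')) (sym length-V)) (resample V k' (λ _ x -> Ʃ[ u ← V ] φ u x) (λ _ _ _ -> refl)) ⟩
   _ ≡⟨ tr (Ʃ-const (vecs V S) _) (ap₂ _*_ (tr (length-vecs V S) (ap (_^ S) length-V)) (Ʃ⇆ V V (λ x u -> φ u x))) ⟩ _ ∎
   where open ≡R

  successes≤ : ∀ h -> n * n * wins h ≤ n ^ starts * (q * q * reached h)
  successes≤ h = begin _ ≤⟨ *ʳ (n * n) (Ʃ≤ seeds λ α -> Ʃ≤ V λ c -> Ʃ≤ (vecs V S) λ st -> goodness≤ α c st h) ⟩
   _ ≡⟨ ap (n * n *_) (tr (Ʃ≡ seeds λ α -> tr (Ʃ-Fin n _) (ap (n *_) (inside α))) (Ʃ-*ˡ n seeds _)) ⟩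
   _ ≡⟨ tr (alg n _) (ap (n *_) (tr (sym (Ʃ-*ˡ (n * n) seeds _)) (Ʃ≡ seeds λ α -> distribute α))) ⟩
   _ ≡⟨ ap (n *_) (Ʃ≡ seeds λ α -> Ʃ≡ (allFin q) λ k -> Ʃ≡ (allFin q) λ k' -> Ʃ≡ (upTo ℓ) λ a -> Ʃ≡ (upTo ℓ) λ b ->
     tr (*-assoc n n _) (two-entries (λ u x -> (Twice.reach scene) α a b (u ∷ x ∷ h)) (left≢right k k'))) ⟩
   _ ≡⟨ ap (n *_) (tr (Ʃ≡ seeds λ α -> tr (Ʃ-Fin q _) (tr (ap (q *_) (Ʃ-Fin q _)) (tr (sym (*-assoc q q _)) (ap (q * q *_)
     (tr (Ʃ≡ (upTo ℓ) λ a -> Ʃ-*ˡ (n ^ S) (upTo ℓ) (λ b -> (Twice.walksFrom scene) α a b h)) (Ʃ-*ˡ (n ^ S) (upTo ℓ) (λ a -> Ʃ[ b ← upTo ℓ ] (Twice.walksFrom scene) α a b h)))))))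
     (tr (Ʃ-*ˡ (q * q) seeds _) (ap (q * q *_) (Ʃ-*ˡ (n ^ S) seeds _)))) ⟩
   _ ≡⟨ ap (λ x -> n * (q * q * (n ^ S * x))) (tr (Ʃ⇆ seeds (upTo ℓ) (λ α a -> Ʃ[ b ← upTo ℓ ] (Twice.walksFrom scene) α a b h)) (Ʃ≡ (upTo ℓ) λ a -> Ʃ⇆ seeds (upTo ℓ) (λ α b -> (Twice.walksFrom scene) α a b h))) ⟩
   _ ≡⟨ alg' n (q * q) (n ^ S) (reached h) ⟩ _ ∎
   where
   open ≤R
   R : Seed -> ℕ -> ℕ -> Fin q -> Fin q -> Vec (Fin n) S -> ℕ
   R α a b k k' st = (Twice.reach scene) α a b (lookup st (left k) ∷ lookup st (right k') ∷ h)
   inside : ∀ α -> Ʃ[ st ← vecs V S ] Ʃ[ k ← allFin q ] Ʃ[ k' ← allFin q ] Ʃ[ a ← upTo ℓ ] Ʃ[ b ← upTo ℓ ] R α a b k k' st ≡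
    Ʃ[ k ← allFin q ] Ʃ[ k' ← allFin q ] Ʃ[ a ← upTo ℓ ] Ʃ[ b ← upTo ℓ ] Ʃ[ st ← vecs V S ] R α a b k k' st
   inside α = tr (Ʃ⇆ (vecs V S) (allFin q) _) (Ʃ≡ (allFin q) λ k -> tr (Ʃ⇆ (vecs V S) (allFin q) _) (Ʃ≡ (allFin q) λ k' ->
    tr (Ʃ⇆ (vecs V S) (upTo ℓ) (λ st a -> Ʃ[ b ← upTo ℓ ] R α a b k k' st)) (Ʃ≡ (upTo ℓ) λ a -> Ʃ⇆ (vecs V S) (upTo ℓ) (λ st b -> R α a b k k' st))))
   distribute : ∀ α -> n * n * Ʃ[ k ← allFin q ] Ʃ[ k' ← allFin q ] Ʃ[ a ← upTo ℓ ] Ʃ[ b ← upTo ℓ ] Ʃ[ st ← vecs V S ] R α a b k k' st ≡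
    Ʃ[ k ← allFin q ] Ʃ[ k' ← allFin q ] Ʃ[ a ← upTo ℓ ] Ʃ[ b ← upTo ℓ ] (n * n * Ʃ[ st ← vecs V S ] R α a b k k' st)
   distribute α = sym (tr (Ʃ≡ (allFin q) λ k -> tr (Ʃ≡ (allFin q) λ k' -> tr (Ʃ≡ (upTo ℓ) λ a -> Ʃ-*ˡ (n * n) (upTo ℓ) (λ b -> Ʃ[ st ← vecs V S ] R α a b k k' st))
    (Ʃ-*ˡ (n * n) (upTo ℓ) (λ a -> Ʃ[ b ← upTo ℓ ] Ʃ[ st ← vecs V S ] R α a b k k' st))) (Ʃ-*ˡ (n * n) (allFin q) _)) (Ʃ-*ˡ (n * n) (allFin q) _))
   alg : ∀ n x -> n * n * (n * x) ≡ n * (n * n * x)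
   alg = ring
   alg' : ∀ n q s j -> n * (q * (s * j)) ≡ n * s * (q * j)
   alg' = ring

  B : ℕ
  B = ∣P∣ * ∣Q∣ * (suc C * suc C) * M ^ 4 * n ^ m

  Ʃreached² : Ʃ[ h ← fns ] (reached h * reached h) ≤ ℓ * (ℓ * (ℓ * (ℓ * (M ^ 4 * (∣P∣ * ∣Q∣ * B)))))
  Ʃreached² = begin _ ≡⟨ Ʃ≡ fns (λ h -> tr (Ʃ-*-Ʃ (upTo ℓ) (upTo ℓ) (λ a -> Ʃ[ b ← upTo ℓ ] walks a b h) (λ a -> Ʃ[ b ← upTo ℓ ] walks a b h))
     (Ʃ≡ (upTo ℓ) λ a -> Ʃ≡ (upTo ℓ) λ a' -> Ʃ-*-Ʃ (upTo ℓ) (upTo ℓ) (λ b -> walks a b h) (λ b -> walks a' b h))) ⟩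
   _ ≡⟨ tr (Ʃ⇆ fns (upTo ℓ) (λ h a -> Ʃ[ a' ← upTo ℓ ] Ʃ[ b ← upTo ℓ ] Ʃ[ b' ← upTo ℓ ] (walks a b h * walks a' b' h))) (Ʃ≡ (upTo ℓ) λ a ->
     tr (Ʃ⇆ fns (upTo ℓ) (λ h a' -> Ʃ[ b ← upTo ℓ ] Ʃ[ b' ← upTo ℓ ] (walks a b h * walks a' b' h))) (Ʃ≡ (upTo ℓ) λ a' ->
     tr (Ʃ⇆ fns (upTo ℓ) (λ h b -> Ʃ[ b' ← upTo ℓ ] (walks a b h * walks a' b' h))) (Ʃ≡ (upTo ℓ) λ b -> Ʃ⇆ fns (upTo ℓ) (λ h b' -> walks a b h * walks a' b' h)))) ⟩
   _ ≤⟨ Ʃ<-mono ℓ (λ a a< -> Ʃ<-mono ℓ λ a' _ -> Ʃ<-mono ℓ λ b b< -> Ʃ<-mono ℓ λ b' _ -> each a b a' b' a< b<) ⟩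
   _ ≡⟨ tr (Ʃ≡ (upTo ℓ) λ _ -> tr (Ʃ≡ (upTo ℓ) λ _ -> tr (Ʃ≡ (upTo ℓ) λ _ -> Ʃ<-const ℓ X) (Ʃ<-const ℓ (ℓ * X))) (Ʃ<-const ℓ (ℓ * (ℓ * X)))) (Ʃ<-const ℓ (ℓ * (ℓ * (ℓ * X)))) ⟩ _ ∎
   where
   open ≤R
   X = M ^ 4 * (∣P∣ * ∣Q∣ * B)
   each : ∀ a b a' b' -> a < ℓ -> b < ℓ -> Ʃ[ h ← fns ] (walks a b h * walks a' b' h) ≤ X
   each a b a' b' a< b< = ⊑ (leq (tr (Ʃ≡ fns λ h -> sym (Ʃ-*ʳ (walks a' b' h) seeds (λ α -> (Twice.walksFrom scene) α a b h))) (Ʃ⇆ fns seeds _)))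
    (Twice.second-moment scene C a b a' b' (⊑ (*ˡ κ (+ʳ 2 (*ʳ 4 (⊑ (+≤ (below a<) (below b<)) (leq (ap ((ℓ ∸ 1) +_) (sym (+0 (ℓ ∸ 1))))))))) enough))

  second : n * n * (n * n) * Ʃ[ h ← fns ] (wins h * wins h) ≤ w * w * (suc C * suc C) * (A' * A' * n ^ m)
  second = begin _ ≡⟨ tr (sym (Ʃ-*ˡ (n * n * (n * n)) fns _)) (Ʃ≡ fns λ h -> alg (n * n) (wins h)) ⟩
   _ ≤⟨ Ʃ≤ fns (λ h -> *≤ (successes≤ h) (successes≤ h)) ⟩
   _ ≡⟨ tr (Ʃ≡ fns λ h -> alg' (n ^ starts) (q * q) (reached h)) (Ʃ-*ˡ (n ^ starts * n ^ starts * (q * q * (q * q))) fns _) ⟩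
   _ ≤⟨ *ʳ (n ^ starts * n ^ starts * (q * q * (q * q))) Ʃreached² ⟩
   _ ≡⟨ alg'' (n ^ starts) q ℓ (M ^ 4) (∣P∣ * ∣Q∣) (suc C) (n ^ m) ⟩ _ ∎
   where
   open ≤R
   alg : ∀ n s -> n * n * (s * s) ≡ n * s * (n * s)
   alg = ring
   alg' : ∀ s q j -> s * (q * j) * (s * (q * j)) ≡ s * s * (q * q) * (j * j)
   alg' = ring
   alg'' : ∀ s q l M x c k -> s * s * (q * q * (q * q)) * (l * (l * (l * (l * (M * (x * (x * (c * c) * M * k))))))) ≡
    q * q * (l * l) * x * (q * q * (l * l) * x) * (c * c) * (M * s * (M * s) * k)
   alg'' = ring

  sampler : ∀ c0 R k s .{{_ : NonZero c0}} .{{_ : NonZero s}} .{{_ : NonZero w}} (label : ℕ -> ℕ) -> (∀ u -> label (toℕ u) ≡ toℕ (z u)) ->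
   (∀ {u} -> P u -> toℕ u % 2 ≡ 0) -> (∀ {u} -> Q u -> toℕ u % 2 ≡ 1) ->
   (∀ {c u} -> D c u -> (toℕ u + toℕ c) % n < Δ) -> (∀ {c u} -> (toℕ u + toℕ c) % n < Δ -> D c u) ->
   (∀ {c e u} -> (toℕ u + toℕ c) % n < Δ -> (toℕ u + toℕ c) % n % s ≡ (toℕ e + toℕ c) % n % s -> Conf c e u) ->
   2 * (starts * n) ≤ M -> n * n < R * (w * c0) -> w ≤ 2 * (n * n) -> 1152 * c0 * suc (9 * (suc C * suc C)) ≡ k ->
   Sampler n m q M ℓ Δ s R k label
  sampler c0 R k s label label-toℕ P⇒even Q⇒odd D⇒ D⇐ Conf⇐ M-large' R-large w-small k≡ = record
   { luck = luck
   ; goodness≤1 = goodness≤1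
   ; amplified = Am.amplify C w c0 R M-large' R-large w-small
    (subst (λ Σ -> w * (A' * n ^ m) ≤ 576 * (n * n) * Σ) (Ʃ≡ fns grp) first)
    (subst (λ Σ -> n * n * (n * n) * Σ ≤ w * w * (suc C * suc C) * (A' * A' * n ^ m)) (Ʃ≡ fns λ h -> ap₂ _*_ (grp h) (grp h)) second) k k≡
   ; collision = λ α h c st start starts≡ -> Runs.collision α h c st label label-toℕ start starts≡ s P⇒even Q⇒odd D⇒ D⇐ Conf⇐
   }
   where
   module Am = Amplification {n} {m} {q} M luck goodness≤1
   grp : ∀ h -> wins h ≡ Am.wins h
   grp h = Ʃ≡ seeds λ α -> sym (Ʃ-vecs-suc V S (λ v -> Am.goodnessOf α v h))

-- Labels of the vertices.

module Labelling {n m : ℕ} .{{_ : NonZero n}} (x y : Vec (Fin m) n) (g1 g2 : ℕ) where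

 z : Fin n -> Fin m
 z u = if toℕ u % 2 ≡ᵇ 0 then lookup x (shift g1 u) else lookup y (shift g2 u)

 label : ℕ -> ℕ
 label u = if u % 2 ≡ᵇ 0 then entry x ((u + g1) % n) else entry y ((u + g2) % n)

 label-toℕ : ∀ u -> label (toℕ u) ≡ toℕ (z u)
 label-toℕ u with toℕ u % 2 ≡ᵇ 0
 ... | true = tr (ap (entry x) (sym (toℕ-shift g1 u))) (entry-lookup x (shift g1 u))
 ... | false = tr (ap (entry y) (sym (toℕ-shift g2 u))) (entry-lookup y (shift g2 u))

 module Raw = Walks {K = m} (λ _ -> 0) z

 wt≤freq : ∀ v -> Raw.wt v ≤ freq v x + freq v y
 wt≤freq v = begin _ ≤⟨ Ʃ≤ V either ⟩
  _ ≡⟨ Ʃ-+ V _ _ ⟩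
  _ ≡⟨ ap₂ _+_ (tr (Ʃ-shift g1 (λ u -> 𝟙 (lookup x u Fin.≟ v))) (sym (freq≡Ʃ v x))) (tr (Ʃ-shift g2 (λ u -> 𝟙 (lookup y u Fin.≟ v))) (sym (freq≡Ʃ v y))) ⟩ _ ∎
  where
  open ≤R
  either : ∀ u -> 𝟙 (z u Fin.≟ v) ≤ 𝟙 (lookup x (shift g1 u) Fin.≟ v) + 𝟙 (lookup y (shift g2 u) Fin.≟ v)
  either u with toℕ u % 2 ≡ᵇ 0
  ... | true = m≤m+n _ _
  ... | false = m≤n+m _ _

 square-+ : ∀ a b -> (a + b) * (a + b) ≤ (a ^ 2 + b ^ 2) * 2
 square-+ a b with ≤-total a b
 ... | inj₁ a≤b = subst (λ b -> (a + b) * (a + b) ≤ (a ^ 2 + b ^ 2) * 2) (m+[n∸m]≡n a≤b) (lemma a (b ∸ a))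
  where
  lemma : ∀ a d -> (a + (a + d)) * (a + (a + d)) ≤ (a ^ 2 + (a + d) ^ 2) * 2
  lemma a d = ⊑ (m≤m+n _ (d * d)) (leq (eq a d))
   where
   eq : ∀ a d -> (a + (a + d)) * (a + (a + d)) + d * d ≡ (a * (a * 1) + (a + d) * ((a + d) * 1)) * 2
   eq = ring
 ... | inj₂ b≤a = subst (λ a -> (a + b) * (a + b) ≤ (a ^ 2 + b ^ 2) * 2) (m+[n∸m]≡n b≤a) (lemma b (a ∸ b))
  where
  lemma : ∀ b d -> (b + d + b) * (b + d + b) ≤ ((b + d) ^ 2 + b ^ 2) * 2
  lemma b d = ⊑ (m≤m+n _ (d * d)) (leq (eq b d))
   where
   eq : ∀ b d -> (b + d + b) * (b + d + b) + d * d ≡ ((b + d) * ((b + d) * 1) + b * (b * 1)) * 2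
   eq = ring

 by-value : ∀ (φ : Fin m -> ℕ) -> Ʃ[ u ← V ] φ (z u) ≡ Ʃ[ v ← allFin m ] (Raw.wt v * φ v)
 by-value φ = begin _ ≡⟨ Ʃ≡ V (λ u -> sym (Ʃ-allFin-δ (z u) φ)) ⟩
  _ ≡⟨ Ʃ⇆ V (allFin m) _ ⟩
  _ ≡⟨ Ʃ≡ (allFin m) (λ v -> Ʃ-*ʳ (φ v) V _) ⟩ _ ∎
  where open ≡R

 -- `Raw.pairs` is the sum of the squared weights of the values, a weight is at most the sum of two
 -- frequencies, and `(a + b)² ≤ 2 (a² + b²)`.
 pairs≤ : Raw.pairs ≤ sumSquaredFreqs x y * 2
 pairs≤ = begin _ ≡⟨ by-value Raw.wt ⟩
  _ ≤⟨ Ʃ≤ (allFin m) (λ v -> ⊑ (*≤ (wt≤freq v) (wt≤freq v)) (square-+ (freq v x) (freq v y))) ⟩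
  _ ≡⟨ Ʃ-*ʳ 2 (allFin m) (λ v -> freq v x ^ 2 + freq v y ^ 2) ⟩
  _ ≡⟨ ap (_* 2) (sumSquaredFreqs≡Ʃ x y) ⟨
  _ ∎
  where open ≤R

 wt²≤pairs : ∀ v -> Raw.wt v * Raw.wt v ≤ Raw.pairs
 wt²≤pairs v = ⊑ (term≤Ʃ (λ v -> Raw.wt v * Raw.wt v) (Mem.∈-allFin v)) (leq (sym (by-value Raw.wt)))

 module Ends (v* : Fin m) where

  P Q : Fin n -> Set
  P u = toℕ u % 2 ≡ 0 × z u ≡ v*
  Q u = toℕ u % 2 ≡ 1 × z u ≡ v*

  P? : ∀ u -> Dec (P u)
  P? u = (toℕ u % 2 ≟ 0) ×-dec (z u Fin.≟ v*)

  Q? : ∀ u -> Dec (Q u)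
  Q? u = (toℕ u % 2 ≟ 1) ×-dec (z u Fin.≟ v*)

-- The numerical conditions.

square-cancel-≤ : ∀ a b -> a * a ≤ b * b -> a ≤ b
square-cancel-≤ a b le with a ≤? b
... | yes a≤b = a≤b
... | no a≰b = refute (*-mono-< (≰⇒> a≰b) (≰⇒> a≰b)) (≤⇒≯ le)

-- The alternatives `ℓ ≡ 1` and `q ≡ 1` are the ends of the two searches, where the upper bounds may
-- fail. The critical estimates are then trivial: with `ℓ ≡ 1` no vertices precede the ends, and
-- with `q ≡ 1` there is no third walk.
record Quantities : Set where
 field
  n s p ℓ q f pairs a b : ℕ
  {{n≢0}} : NonZero n
  {{s≢0}} : NonZero s
  {{ℓ≢0}} : NonZero ℓ
  {{q≢0}} : NonZero q
  sp≤ : s * p ≤ n * n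
  n≤ : n * 2 ≤ p
  ℓ≤ : ℓ ≡ 1 ⊎ s * p * (ℓ * ℓ) * 8192 ≤ n * n
  ℓ≥ : n * n < s * p * (suc ℓ * suc ℓ) * 8192
  q≤ : q ≡ 1 ⊎ f * q * 512 ≤ s
  q≥ : s ≤ f * q * 2048
  f²≤ : f * f ≤ pairs
  pairs≤ : pairs ≤ p * 2
  1≤a : 1 ≤ a
  1≤b : 1 ≤ b
  a+b : a + b ≡ f

module Numeric (quantities : Quantities) where

 open Quantities quantities
 open ≤R

 instance
  144ℓ≢0 : NonZero (ℓ * 144)
  144ℓ≢0 = m*n≢0 ℓ 144

 -- 144 is twice the `24 * 3` of `stops`, which leaves half of `n` for the rounding of `Δ`. 48 is
 -- the `8 * 3 * 2` of the Markov bound `heavy`.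
 Δ bkt κ w R : ℕ
 Δ = suc (n / (ℓ * 144))
 bkt = suc (Δ / s)
 κ = p * ℓ * 48 / n
 w = q * q * (ℓ * ℓ) * (a * b)
 R = suc (p / q)

 1≤ℓ : 1 ≤ ℓ
 1≤ℓ = >-nonZero⁻¹ ℓ

 1≤f : 1 ≤ f
 1≤f = ⊑ 1≤a (⊑ (m≤m+n a b) (leq a+b))

 n≤p : n ≤ p
 n≤p = ⊑ (m≤m*n n 2) n≤

 spℓ²≤ : s * p * (ℓ * ℓ) ≤ n * n
 spℓ²≤ = [ (λ eq -> ⊑ (leq (tr (ap (λ l -> s * p * (l * l)) eq) (*1 _))) sp≤) , ⊑ (m≤m*n _ 8192) ]′ ℓ≤

 pℓ²≤ : p * (ℓ * ℓ) ≤ n * n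
 pℓ²≤ = ⊑ (⊑ (m≤n*m _ s) (leq (sym (*-assoc s p (ℓ * ℓ))))) spℓ²≤

 s≤p : s ≤ p
 s≤p = /ʳ s p p {{>-nonZero (⊑ (>-nonZero⁻¹ n) n≤p)}} (⊑ sp≤ (*≤ n≤p n≤p))

 sℓ≤n : s * ℓ ≤ n
 sℓ≤n = square-cancel-≤ (s * ℓ) n (begin _ ≡⟨ alg s ℓ ⟩
  _ ≤⟨ *ˡ (ℓ * ℓ) (*ʳ s s≤p) ⟩
  _ ≤⟨ spℓ²≤ ⟩
  n * n ∎)
  where
  alg : ∀ s l -> s * l * (s * l) ≡ s * s * (l * l)
  alg = ring

 ℓ≤n : ℓ ≤ n
 ℓ≤n = ⊑ (m≤n*m ℓ s) sℓ≤n

 pℓ²-small : s * p * (ℓ * ℓ) * 8192 ≤ n * n -> p * (ℓ * ℓ) * 8192 ≤ n * n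
 pℓ²-small le = ⊑ (*ˡ 8192 (⊑ (m≤n*m _ s) (leq (sym (*-assoc s p (ℓ * ℓ)))))) le

 ℓ-small : s * p * (ℓ * ℓ) * 8192 ≤ n * n -> ℓ * 144 ≤ n
 ℓ-small le = /ˡ n (begin _ ≤⟨ *≤ n≤p (*≤ (m≤m*n ℓ ℓ) 144≤) ⟩
  _ ≡⟨ *-assoc p (ℓ * ℓ) 8192 ⟨
  _ ≤⟨ pℓ²-small le ⟩
  n * n ∎)
  where
  144≤ : 144 ≤ 8192
  144≤ = m≤m+n 144 8048

 -- The origin of 8192: it is `2 * 64 * 64`, with the 2 from `f² ≤ 2 p`.
 fℓ-small : s * p * (ℓ * ℓ) * 8192 ≤ n * n -> ℓ * f * 64 ≤ n
 fℓ-small le = square-cancel-≤ _ n (begin _ ≡⟨ alg ℓ f 64 ⟩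
  _ ≤⟨ *ˡ (64 * 64) (*ˡ (ℓ * ℓ) (⊑ f²≤ pairs≤)) ⟩
  _ ≡⟨ alg' p (ℓ * ℓ) 2 (64 * 64) ⟩
  _ ≤⟨ pℓ²-small le ⟩
  n * n ∎)
  where
  alg : ∀ l f k -> l * f * k * (l * f * k) ≡ f * f * (l * l) * (k * k)
  alg = ring
  alg' : ∀ p l c k -> p * c * l * k ≡ p * l * (c * k)
  alg' = ring

 ℓ∸1 : ℓ ≡ 1 -> ℓ ∸ 1 ≡ 0
 ℓ∸1 = ap (_∸ 1)

 clashes : ∀ L -> L ≤ 3 * (ℓ ∸ 1) -> 8 * (L * L * pairs + L * n * f) ≤ n * n
 clashes L L≤ = [ (λ eq -> subst (λ L -> 8 * (L * L * pairs + L * n * f) ≤ n * n) (sym (n≤0⇒n≡0 (subst (λ l -> L ≤ 3 * l) (ℓ∸1 eq) L≤))) z≤n) , large ]′ ℓ≤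
  where
  L≤3ℓ : L ≤ 3 * ℓ
  L≤3ℓ = ⊑ L≤ (*ʳ 3 (m∸n≤m ℓ 1))
  9216≤ : 144 * 64 ≤ 2 * 8192
  9216≤ = m≤m+n 9216 7168
  alg : ∀ l p n f k -> 8 * (3 * l * (3 * l) * (p * 2) + 3 * l * n * f) * k ≡ 144 * k * (p * (l * l)) + 24 * n * (l * f * k)
  alg = ring
  alg' : ∀ a b x -> a * b * x ≡ a * (x * b)
  alg' = ring
  collect : ∀ n -> 2 * (n * n) + 24 * n * n + 38 * (n * n) ≡ n * n * 64
  collect = ring
  large : s * p * (ℓ * ℓ) * 8192 ≤ n * n -> 8 * (L * L * pairs + L * n * f) ≤ n * n
  large le = /ʳ _ _ 64 (begin _ ≤⟨ *ˡ 64 (*ʳ 8 (+≤ (*≤ (*≤ L≤3ℓ L≤3ℓ) pairs≤) (*ˡ f (*ˡ n L≤3ℓ)))) ⟩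
   _ ≡⟨ alg ℓ p n f 64 ⟩
   _ ≤⟨ +≤ (⊑ (*ˡ (p * (ℓ * ℓ)) 9216≤) (⊑ (leq (alg' 2 8192 (p * (ℓ * ℓ)))) (*ʳ 2 (pℓ²-small le)))) (*ʳ (24 * n) (fℓ-small le)) ⟩
   _ ≤⟨ m≤m+n _ (38 * (n * n)) ⟩
   _ ≡⟨ collect n ⟩ _ ∎)

 ℓΔ : n / (ℓ * 144) * (ℓ * 144) ≤ n
 ℓΔ = m/n*n≤m n (ℓ * 144)

 stops : 24 * (3 * (ℓ ∸ 1) * Δ) ≤ n
 stops = [ (λ eq -> subst (λ l -> 24 * (3 * l * Δ) ≤ n) (sym (ℓ∸1 eq)) z≤n) , large ]′ ℓ≤
  where
  alg : ∀ l d -> 24 * (3 * l * suc d) * 2 ≡ d * (l * 144) + l * 144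
  alg = ring
  large : s * p * (ℓ * ℓ) * 8192 ≤ n * n -> 24 * (3 * (ℓ ∸ 1) * Δ) ≤ n
  large le = /ʳ _ _ 2 (begin _ ≤⟨ *ˡ 2 (*ʳ 24 (*ˡ Δ (*ʳ 3 (m∸n≤m ℓ 1)))) ⟩
   _ ≡⟨ alg ℓ (n / (ℓ * 144)) ⟩
   _ ≤⟨ +≤ ℓΔ (ℓ-small le) ⟩
   n + n ≡⟨ tr (ap (n +_) (sym (+0 n))) (*-comm 2 n) ⟩
   n * 2 ∎)

 heavy : 8 * (3 * (ℓ ∸ 1) * pairs) ≤ n * suc κ
 heavy = begin _ ≤⟨ *ʳ 8 (*≤ (*ʳ 3 (m∸n≤m ℓ 1)) pairs≤) ⟩
  _ ≡⟨ alg ℓ p ⟩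
  _ ≡⟨ m≡m%n+[m/n]*n (p * ℓ * 48) n ⟩
  _ ≤⟨ +ˡ (κ * n) (<⇒≤ (m%n<n (p * ℓ * 48) n)) ⟩
  _ ≡⟨ *-comm (suc κ) n ⟩ _ ∎
  where
  alg : ∀ l p -> 8 * (3 * l * (p * 2)) ≡ p * l * 48
  alg = ring

 κn≤ : n * κ ≤ p * ℓ * 48
 κn≤ = ⊑ (leq (*-comm n κ)) (m/n*n≤m (p * ℓ * 48) n)

 dense : n ≤ 144 * (ℓ * Δ)
 dense = begin
  n ≡⟨ m≡m%n+[m/n]*n n (ℓ * 144) ⟩
  _ ≤⟨ +ˡ _ (<⇒≤ (m%n<n n (ℓ * 144))) ⟩
  _ ≡⟨ alg Δ ℓ 144 ⟩ _ ∎
  where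
  alg : ∀ d l k -> d * (l * k) ≡ k * (l * d)
  alg = ring

 -- `2 + 8 (ℓ - 1) ≤ 8 ℓ` meets `n κ ≤ 48 p ℓ` and `p ℓ² ≤ n²`, and 384 is `8 * 48`.
 enough : (2 + 4 * (2 * (ℓ ∸ 1))) * κ ≤ 384 * n
 enough = /ˡ n (begin _ ≤⟨ *ʳ n (*ˡ κ (⊑ (m≤n+m (2 + 4 * (2 * (ℓ ∸ 1))) 6) (⊑ (leq (eight (ℓ ∸ 1))) (*ʳ 8 (leq (m+[n∸m]≡n 1≤ℓ)))))) ⟩
  _ ≡⟨ alg n ℓ κ ⟩
  _ ≤⟨ *ʳ (8 * ℓ) κn≤ ⟩
  _ ≡⟨ alg' ℓ p ⟩
  _ ≤⟨ *ʳ 384 pℓ²≤ ⟩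
  _ ≡⟨ alg'' n 384 ⟩ _ ∎)
  where
  eight : ∀ l -> 6 + (2 + 4 * (2 * l)) ≡ 8 * (1 + l)
  eight = ring
  alg : ∀ n l k -> n * (8 * l * k) ≡ 8 * l * (n * k)
  alg = ring
  alg' : ∀ l p -> 8 * l * (p * l * 48) ≡ 384 * (p * (l * l))
  alg' = ring
  alg'' : ∀ n k -> k * (n * n) ≡ n * (k * n)
  alg'' = ring

 -- After multiplication by 512, the bound `f * q * 512 ≤ s` turns `q` into `s`. Then `s p ℓ² ≤ n²`,
 -- `s ℓ ≤ n` and `ℓ Δ ≤ 2 n` account for 416, 20 and 24 of the 512 parts of `n * n`.
 quiet : 2 * ((q + q ∸ 2) * (2 * ℓ * (2 * ℓ) * pairs + 2 * ℓ * n * (κ + f) + suc (2 * ℓ) * n * bkt)) ≤ n * n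
 quiet = [ (λ eq -> subst (λ S -> 2 * ((S ∸ 2) * (2 * ℓ * (2 * ℓ) * pairs + 2 * ℓ * n * (κ + f) + suc (2 * ℓ) * n * bkt)) ≤ n * n) (ap (λ q -> q + q) (sym eq)) z≤n) , large ]′ q≤
  where
  2ℓ+1≤ : suc (2 * ℓ) ≤ 3 * ℓ
  2ℓ+1≤ = +ˡ (2 * ℓ) 1≤ℓ
  q512≤ : f * q * 512 ≤ s -> q * 512 ≤ s
  q512≤ = ⊑ (*ˡ 512 (m≤n*m q f {{>-nonZero 1≤f}}))
  sbkt≤ : s * bkt ≤ Δ + s
  sbkt≤ = ⊑ (leq (tr (*-suc s (Δ / s)) (tr (+-comm s _) (ap (_+ s) (*-comm s (Δ / s)))))) (+ˡ s (m/n*n≤m Δ s))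
  ℓΔ≤ : ℓ * Δ ≤ n + n
  ℓΔ≤ = ⊑ (leq (tr (*-suc ℓ (n / (ℓ * 144))) (+-comm ℓ _)))
   (+≤ (⊑ (⊑ (m≤m*n _ 144) (leq (rearrangeℓ ℓ (n / (ℓ * 144)) 144))) ℓΔ) ℓ≤n)
   where
   rearrangeℓ : ∀ l d k -> l * d * k ≡ d * (l * k)
   rearrangeℓ = ring
  alg : ∀ q l p n κ f b k -> 2 * ((q + q) * (2 * l * (2 * l) * (p * 2) + 2 * l * n * (κ + f) + 3 * l * n * b)) * k ≡
   q * k * (32 * (p * (l * l)) + 8 * l * (n * κ)) + (8 * (l * n) * (f * q * k) + 12 * (l * n) * (q * k * b))
  alg = ring
  alg' : ∀ s p l n d -> s * (32 * (p * (l * l)) + 8 * l * (p * l * 48)) + (8 * (l * n) * s + 12 * (l * n) * (d + s)) ≡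
   416 * (s * p * (l * l)) + (20 * (n * (s * l)) + 12 * (n * (l * d)))
  alg' = ring
  collect : ∀ n -> 416 * (n * n) + (20 * (n * n) + 12 * (n * (n + n))) + 52 * (n * n) ≡ n * n * 512
  collect = ring
  large : f * q * 512 ≤ s -> 2 * ((q + q ∸ 2) * (2 * ℓ * (2 * ℓ) * pairs + 2 * ℓ * n * (κ + f) + suc (2 * ℓ) * n * bkt)) ≤ n * n
  large le = /ʳ _ _ 512 (begin _ ≤⟨ *ˡ 512 (*ʳ 2 (*≤ (m∸n≤m (q + q) 2) (+≤ (+ˡ (2 * ℓ * n * (κ + f)) (*ʳ (2 * ℓ * (2 * ℓ)) pairs≤)) (*ˡ bkt (*ˡ n 2ℓ+1≤))))) ⟩
   _ ≡⟨ alg q ℓ p n κ f bkt 512 ⟩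
   _ ≤⟨ +≤ (*≤ (q512≤ le) (+ʳ (32 * (p * (ℓ * ℓ))) (*ʳ (8 * ℓ) κn≤))) (+≤ (*ʳ (8 * (ℓ * n)) le) (*ʳ (12 * (ℓ * n)) (⊑ (*ˡ bkt (q512≤ le)) sbkt≤))) ⟩
   _ ≡⟨ alg' s p ℓ n Δ ⟩
   _ ≤⟨ +≤ (*ʳ 416 spℓ²≤) (+≤ (*ʳ 20 (*ʳ n sℓ≤n)) (*ʳ 12 (*ʳ n ℓΔ≤))) ⟩
   _ ≤⟨ m≤m+n _ (52 * (n * n)) ⟩
   _ ≡⟨ collect n ⟩ _ ∎)

 w≤ : w ≤ 2 * (n * n)
 w≤ = begin _ ≤⟨ *ʳ (q * q * (ℓ * ℓ)) (*≤ (⊑ (m≤m+n a b) (leq a+b)) (⊑ (m≤n+m b a) (leq a+b))) ⟩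
  _ ≤⟨ bound q≤ ⟩ _ ∎
  where
  bound : q ≡ 1 ⊎ f * q * 512 ≤ s -> q * q * (ℓ * ℓ) * (f * f) ≤ 2 * (n * n)
  bound (inj₁ eq) = begin _ ≡⟨ ap (λ q -> q * q * (ℓ * ℓ) * (f * f)) eq ⟩
   _ ≤⟨ *ʳ (1 * (ℓ * ℓ)) (⊑ f²≤ pairs≤) ⟩
   _ ≡⟨ alg ℓ p ⟩
   _ ≤⟨ *ʳ 2 pℓ²≤ ⟩ _ ∎
   where
   alg : ∀ l p -> 1 * (l * l) * (p * 2) ≡ 2 * (p * (l * l))
   alg = ring
  bound (inj₂ le) = begin _ ≡⟨ alg q ℓ f ⟩
   _ ≤⟨ *≤ (*ˡ ℓ fq≤) (*ˡ ℓ fq≤) ⟩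
   _ ≤⟨ *≤ sℓ≤n sℓ≤n ⟩
   n * n ≤⟨ m≤n*m (n * n) 2 ⟩ _ ∎
   where
   fq≤ : f * q ≤ s
   fq≤ = ⊑ (m≤m*n (f * q) 512) le
   alg : ∀ q l f -> q * q * (l * l) * (f * f) ≡ f * q * l * (f * q * l)
   alg = ring

 1≤w : 1 ≤ w
 1≤w = *≤ (*≤ (*≤ (>-nonZero⁻¹ q) (>-nonZero⁻¹ q)) (*≤ 1≤ℓ 1≤ℓ)) (*≤ 1≤a 1≤b)

 f≤2ab : f ≤ a * b * 2
 f≤2ab = ⊑ (leq (sym a+b)) (⊑ (+≤ (m≤m*n a b {{>-nonZero 1≤b}}) (m≤n*m b a {{>-nonZero 1≤a}})) (leq (double (a * b))))
  where
  double : ∀ x -> x + x ≡ x * 2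
  double = ring

 -- Collects the losses of the two searches: `ℓ + 1 ≤ 2 ℓ` gives 4, `q` falls short of `s / f` by at
 -- most 2048, and `f ≤ 2 a b` gives 2.
 R-large : n * n < R * (w * (8192 * 4 * 2048 * 2))
 R-large = begin-strict
  n * n <⟨ ℓ≥ ⟩
  _ ≤⟨ *ˡ 8192 (*ʳ (s * p) (*≤ ℓ+1≤ ℓ+1≤)) ⟩
  _ ≤⟨ *ˡ 8192 (*ˡ (ℓ * 2 * (ℓ * 2)) (*≤ (⊑ q≥ (*ˡ 2048 (*ˡ q f≤2ab))) (<⇒≤ p<))) ⟩
  _ ≡⟨ alg a b q R ℓ 2 2048 8192 ⟩ _ ∎
  where
  ℓ+1≤ : suc ℓ ≤ ℓ * 2
  ℓ+1≤ = ⊑ (+ˡ ℓ 1≤ℓ) (leq (tr (ap (ℓ +_) (sym (+0 ℓ))) (*-comm 2 ℓ)))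
  p< : p < R * q
  p< = ⊑ (leq (ap suc (m≡m%n+[m/n]*n p q))) (+ˡ (p / q * q) (m%n<n p q))
  alg : ∀ a b q r l t k j -> a * b * t * q * k * (r * q) * (l * t * (l * t)) * j ≡ r * (q * q * (l * l) * (a * b) * (j * (t * t) * k * t))
  alg = ring

-- The analysis applied to two lists.

module Instance {n m : ℕ} {{n≢0 : NonZero n}} {{m≢0 : NonZero m}} (x y : Vec (Fin m) n) (g1 g2 : ℕ)
 (s p ℓ q M C c0 : ℕ) {{s≢0 : NonZero s}} {{ℓ≢0 : NonZero ℓ}} {{q≢0 : NonZero q}} {{M≢0 : NonZero M}}
 (384≤C : 384 ≤ C) (c0≥ : 8192 * 4 * 2048 * 2 ≤ c0)
 (v* : Fin m) (M-large : (2 + m ^ 3) * n ≤ M) (M-large' : 2 * (suc (q + q) * n) ≤ M)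
 (freqs≤ : sumSquaredFreqs x y ≤ p) (sp≤ : s * p ≤ n * n)
 (ℓ≤ : ℓ ≡ 1 ⊎ s * p * (ℓ * ℓ) * 8192 ≤ n * n) (ℓ≥ : n * n < s * p * (suc ℓ * suc ℓ) * 8192) where

 open Labelling x y g1 g2

 open Ends v*

 f : ℕ
 f = Raw.wt v*

 ∣P∣+∣Q∣ : Ʃ[ u ← V ] 𝟙 (P? u) + Ʃ[ u ← V ] 𝟙 (Q? u) ≡ f
 ∣P∣+∣Q∣ = tr (sym (Ʃ-+ (V {n}) _ _)) (Ʃ≡ (V {n}) λ u -> split u (toℕ u % 2) refl (m%n<n (toℕ u) 2))
  where
  split : ∀ u r -> toℕ u % 2 ≡ r -> r < 2 -> 𝟙 (P? u) + 𝟙 (Q? u) ≡ 𝟙 (z u Fin.≟ v*)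
  split u 0 eq _ = tr (ap₂ _+_ (𝟙-cong (P? u) (z u Fin.≟ v*) proj₂ (eq ,_)) (𝟙-no (Q? u) λ (odd , _) -> refute (tr (sym eq) odd) λ ())) (+0 _)
  split u 1 eq _ = ap₂ _+_ (𝟙-no (P? u) λ (even , _) -> refute (tr (sym eq) even) λ ()) (𝟙-cong (Q? u) (z u Fin.≟ v*) proj₂ (eq ,_))
  split u (suc (suc r)) _ (s≤s (s≤s ()))

 n≤p : n * 2 ≤ p
 n≤p = ⊑ (2n≤sumSquaredFreqs x y) freqs≤

 -- n = 1 would force 2 ≤ p ≤ 1.
 2≤n : 2 ≤ n
 2≤n = /ʳ 2 n n (⊑ (leq (*-comm 2 n)) (⊑ n≤p (⊑ (m≤n*m p s) sp≤)))

 Δ bkt κ : ℕ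
 Δ = suc (_/_ n (ℓ * 144) {{m*n≢0 ℓ 144}})
 bkt = suc (Δ / s)
 κ = p * ℓ * 48 / n

 Δ≤n : Δ ≤ n
 Δ≤n = begin-strict
  _ ≤⟨ /-monoʳ-≤ n {{m*n≢0 ℓ 144}} (*≤ {1} {ℓ} {2} {144} (>-nonZero⁻¹ ℓ) (m≤m+n 2 142)) ⟩
  n / 2 <⟨ m/n<m n 2 (s≤s (s≤s z≤n)) ⟩
  n ∎
  where open ≤R

 open Offsets n s Δ Δ≤n

 disjoint : ∀ {u} -> P u -> ¬ Q u
 disjoint (even , _) (odd , _) = refute (tr (sym even) odd) λ ()

 scene : Scene
 scene = record
  { n = n ; m = m ; M = M ; n≢0 = n≢0 ; m≢0 = m≢0 ; M≢0 = M≢0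
  ; z = z ; v* = v* ; P? = P? ; Q? = Q? ; P⇒ = proj₂ ; Q⇒ = proj₂ ; P∩Q = disjoint
  ; D? = D? ; Conf? = Conf? ; Δ = Δ ; bkt = bkt ; ℓ = ℓ ; κ = κ
  ; ƩD-x = ƩD-x ; ƩD-c = ƩD-c ; ƩConf = ƩConf ; M-large = M-large }

 module _ (iP iQ : Fin n) (iP∈ : P iP) (iQ∈ : Q iQ)
  (q≤ : q ≡ 1 ⊎ f * q * 512 ≤ s) (q≥ : s ≤ f * q * 2048) where

  private
   ∣P∣ ∣Q∣ : ℕ
   ∣P∣ = Ʃ[ u ← V ] 𝟙 (P? u)
   ∣Q∣ = Ʃ[ u ← V ] 𝟙 (Q? u)
   1≤P : 1 ≤ ∣P∣
   1≤P = ⊑ (leq (sym (𝟙-yes (P? iP) iP∈))) (term≤Ʃ (λ u -> 𝟙 (P? u)) (Mem.∈-allFin iP))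
   1≤Q : 1 ≤ ∣Q∣
   1≤Q = ⊑ (leq (sym (𝟙-yes (Q? iQ) iQ∈))) (term≤Ʃ (λ u -> 𝟙 (Q? u)) (Mem.∈-allFin iQ))

   quantities : Quantities
   quantities = record
    { n = n ; s = s ; p = p ; ℓ = ℓ ; q = q ; f = f ; pairs = Raw.pairs ; a = ∣P∣ ; b = ∣Q∣
    ; n≢0 = n≢0 ; s≢0 = s≢0 ; ℓ≢0 = ℓ≢0 ; q≢0 = q≢0
    ; sp≤ = sp≤ ; n≤ = n≤p ; ℓ≤ = ℓ≤ ; ℓ≥ = ℓ≥ ; q≤ = q≤ ; q≥ = q≥ ; f²≤ = wt²≤pairs v*
    ; pairs≤ = ⊑ pairs≤ (*ˡ 2 freqs≤) ; 1≤a = 1≤P ; 1≤b = 1≤Q ; a+b = ∣P∣+∣Q∣ }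

  sampler : ∀ k -> 1152 * c0 * suc (9 * (suc C * suc C)) ≡ k -> Sampler n m q M ℓ Δ s (suc (p / q)) k label
  sampler k k≡ = Block.Moments.sampler scene q C
   (Numeric.1≤ℓ quantities) (Numeric.clashes quantities) (Numeric.stops quantities) (Numeric.heavy quantities) (Numeric.quiet quantities) (Numeric.dense quantities) (⊑ (Numeric.enough quantities) (*ˡ n 384≤C)) c0 (suc (p / q)) k s {{>-nonZero (⊑ (s≤s z≤n) c0≥)}} {{_}} {{>-nonZero (Numeric.1≤w quantities)}}
   label label-toℕ proj₁ proj₁ id id _,_ M-large' (<≤ (Numeric.R-large quantities) (*ʳ (suc (p / q)) (*ʳ (Numeric.w quantities) c0≥))) (Numeric.w≤ quantities) k≡

open import Defs using (⌈_√[_/_]⌉)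

-- Logarithms, searches and alignments.

n≤2^⌈log₂n⌉ : ∀ n -> n ≤ 2 ^ ⌈log₂ n ⌉
n≤2^⌈log₂n⌉ = <-rec (λ n -> n ≤ 2 ^ ⌈log₂ n ⌉) go
 where
 go : ∀ n -> (∀ {k} -> k < n -> k ≤ 2 ^ ⌈log₂ k ⌉) -> n ≤ 2 ^ ⌈log₂ n ⌉
 go 0 _ = z≤n
 go 1 _ = rfl≤
 go n@(suc (suc n-2)) rec = begin
  n ≡⟨ ⌊n/2⌋+⌈n/2⌉≡n n ⟨
  _ ≤⟨ +ˡ ⌈ n /2⌉ (⌊n/2⌋≤⌈n/2⌉ n) ⟩
  _ ≤⟨ +≤ half half ⟩
  _ ≡⟨ ap (2 ^ (l ∸ 1) +_) (+0 _) ⟨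
  _ ≡⟨ ap (2 ^_) (m+[n∸m]≡n (⌈log₂⌉-mono-≤ {2} {n} (s≤s (s≤s z≤n)))) ⟩
  2 ^ l ∎
  where
  open ≤R
  l = ⌈log₂ n ⌉
  half : ⌈ n /2⌉ ≤ 2 ^ (l ∸ 1)
  half = subst (λ e -> ⌈ n /2⌉ ≤ 2 ^ e) (⌈log₂⌈n/2⌉⌉≡⌈log₂n⌉∸1 n) (rec (⌈n/2⌉<n n-2))

2^-cancel-≤ : ∀ a b -> 2 ^ a ≤ 2 ^ b -> a ≤ b
2^-cancel-≤ a b le = ≮⇒≥ λ b<a -> <⇒≱ (^-monoʳ-< 2 rfl≤ b<a) le

⌈log₂^⌉ : ∀ n d -> ⌈log₂ n ^ d ⌉ ≤ d * ⌈log₂ n ⌉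
⌈log₂^⌉ n d = ⊑ (⌈log₂⌉-mono-≤ (^-monoˡ-≤ d (n≤2^⌈log₂n⌉ n))) (leq (tr (ap ⌈log₂_⌉ (^-*-assoc 2 ⌈log₂ n ⌉ d)) (tr (⌈log₂2^n⌉≡n (⌈log₂ n ⌉ * d)) (*-comm ⌈log₂ n ⌉ d))))

bitlength : ∀ X -> 1 ≤ X -> ∃ λ W -> X < 2 ^ W × 2 ^ W ≤ X + X
bitlength (suc zero) _ = 1 , rfl≤ , rfl≤
bitlength (suc X@(suc _)) _ with bitlength X (s≤s z≤n)
... | W , X< , ≤2X with m≤n⇒m<n∨m≡n X<
... | inj₁ lt = W , lt , ⊑ ≤2X (+≤ (n≤1+n X) (n≤1+n X))
... | inj₂ eq = suc W , ⊑ (⊑ (leq (ap suc eq)) (+ˡ (2 ^ W) (m^n>0 2 W))) (+ʳ (2 ^ W) (m≤m+n (2 ^ W) 0)) ,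
 leq (tr (ap (2 ^ W +_) (+0 (2 ^ W))) (ap₂ _+_ (sym eq) (sym eq)))

-- The greedy search for the largest ℓ with F ℓ ≤ b.
module Greedy (F : ℕ -> ℕ) (b : ℕ) where

 -- Free of branches, because the machine evaluates this very expression: the second summand is 1
 -- exactly if `F (1 + l) ≤ b`.
 grow : ℕ -> ℕ
 grow l = l + (1 ∸ (F (1 + l) ∸ b))

 Fits : ℕ -> Set
 Fits l = l ≡ 1 ⊎ F l ≤ b

 grow-step : ∀ l -> (F (suc l) ≤ b × grow l ≡ suc l) ⊎ (b < F (suc l) × grow l ≡ l)
 grow-step l with F (1 + l) ≤? b
 ... | yes le = inj₁ (le , tr (ap (λ d -> l + (1 ∸ d)) (m≤n⇒m∸n≡0 le)) (+-comm l 1))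
 ... | no ≰ = inj₂ (≰⇒> ≰ , tr (ap (l +_) (m≤n⇒m∸n≡0 (m<n⇒0<n∸m (≰⇒> ≰)))) (+0 l))

 fits : ∀ k l -> Fits l -> Fits (iter grow k l)
 fits zero l fl = fl
 fits (suc k) l fl with grow-step l
 ... | inj₁ (le , eq) = fits k (grow l) (inj₂ (subst (λ l -> F l ≤ b) (sym eq) le))
 ... | inj₂ (_ , eq) = subst (Fits ∘ iter grow k) (sym eq) (fits k l fl)

 increasing : ∀ k l -> l ≤ iter grow k l
 increasing zero l = rfl≤
 increasing (suc k) l = ⊑ (m≤m+n l _) (increasing k (grow l))

 stable : ∀ k l -> b < F (suc l) -> iter grow k l ≡ l
 stable zero l lt = refl
 stable (suc k) l lt with grow-step l
 ... | inj₁ (le , _) = refute le (<⇒≱ lt)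
 ... | inj₂ (_ , eq) = tr (ap (iter grow k) eq) (stable k l lt)

 maximal : ∀ k l -> b < F (suc (iter grow k l)) ⊎ iter grow k l ≡ l + k
 maximal zero l = inj₂ (sym (+0 l))
 maximal (suc k) l with grow-step l
 ... | inj₁ (_ , eq) = [ inj₁ , (λ e -> inj₂ (tr e (tr (ap (_+ k) eq) (sym (+-suc l k))))) ]′ (maximal k (grow l))
 ... | inj₂ (lt , eq) = inj₁ (subst (λ l -> b < F (suc l)) (sym (tr (ap (iter grow k) eq) (stable k l lt))) lt)

-- Halving s until f q · 512 ≤ s overshoots by at most a factor 3.
module Levels (f s : ℕ) (1≤f : 1 ≤ f) (1≤s : 1 ≤ s) where

 record Level : Set where
  field
   i q : ℕ
   reach : iter (_/ 2) i s ≡ q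
   0<q : 0 < q
   q≤s : q ≤ s
   fine : q ≡ 1 ⊎ f * q * 512 ≤ s
   coarse : s ≤ f * q * 2048

 search : ∀ fuel i q -> q ≤ fuel -> iter (_/ 2) i s ≡ q -> 0 < q -> q ≤ s -> s ≤ f * q * 2048 -> Level
 search zero i q q≤ reach 0<q = refute (⊑ 0<q q≤) λ ()
 search (suc fuel) i q q≤ reach 0<q q≤s coarse with f * q * 512 ≤? s
 ... | yes le = record { i = i ; reach = reach ; 0<q = 0<q ; q≤s = q≤s ; fine = inj₂ le ; coarse = coarse }
 ... | no ≰ with q | 0<q
 ... | suc zero | _ = record { i = i ; reach = reach ; 0<q = s≤s z≤n ; q≤s = q≤s ; fine = inj₁ refl ; coarse = coarse }
 ... | q@(suc (suc q-2)) | _ = search fuel (i + 1) (q / 2) (s≤s⁻¹ (⊑ smaller q≤)) (tr (iter-+ (_/ 2) i 1 s) (ap (_/ 2) reach)) 0<half (⊑ (<⇒≤ smaller) q≤s) coarse'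
  where
  smaller : q / 2 < q
  smaller = m/n<m q 2 rfl≤
  0<half : 0 < q / 2
  0<half = m≥n⇒m/n>0 {q} {2} (s≤s (s≤s z≤n))
  coarse' : s ≤ f * (q / 2) * 2048
  coarse' = begin
   s ≤⟨ <⇒≤ (≰⇒> ≰) ⟩
   _ ≤⟨ *ˡ 512 (*ʳ f (⊑ (leq (m≡m%n+[m/n]*n q 2)) (+ˡ (q / 2 * 2) (⊑ (s≤s⁻¹ (m%n<n q 2)) 0<half)))) ⟩
   _ ≡⟨ grp f (q / 2) 512 ⟩
   _ ≤⟨ *ʳ (f * (q / 2)) (m≤m+n 1536 512) ⟩ _ ∎
   where
   open ≤R
   grp : ∀ f h k -> f * (h + h * 2) * k ≡ f * h * (3 * k)
   grp = ring

 level : Level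
 level = search s 0 s rfl≤ refl 1≤s rfl≤ (⊑ (m≤n*m s f {{>-nonZero 1≤f}}) (m≤m*n (f * s) 2048))

even-alignment : ∀ n .{{_ : NonZero n}} i -> i < n -> ∃₂ λ u g -> u < n × u % 2 ≡ 0 × (u + g) % n ≡ i × g < 2
even-alignment n i i<n with i % 2 in eq | m%n<n i 2
... | 0 | _ = i , 0 , i<n , eq , tr (ap (_% n) (+0 i)) (m<n⇒m%n≡m i<n) , s≤s z≤n
even-alignment n zero i<n | 1 | _ = refute eq λ ()
even-alignment n (suc i) i<n | 1 | _ = i , 1 , <-trans (n<1+n i) i<n , even i eq , tr (ap (_% n) (+-comm i 1)) (m<n⇒m%n≡m i<n) , rfl≤
 where
 even : ∀ i -> suc i % 2 ≡ 1 -> i % 2 ≡ 0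
 even zero _ = refl
 even (suc zero) ()
 even (suc (suc i)) e = tr ([m+n]%n≡m%n' i) (even i (tr (sym ([m+n]%n≡m%n' (suc i))) e))
  where
  [m+n]%n≡m%n' : ∀ i -> suc (suc i) % 2 ≡ i % 2
  [m+n]%n≡m%n' i = tr (ap (_% 2) (+-comm 2 i)) ([m+n]%n≡m%n i 2)
... | suc (suc _) | s≤s (s≤s ())

-- Position 0 is the difficult one. For odd `n` the vertex `n - 1` is even, so the last odd vertex
-- lies two places before position 0; hence three rotations instead of two.
odd-alignment : ∀ n .{{_ : NonZero n}} -> 2 ≤ n -> ∀ j -> j < n -> ∃₂ λ u g -> u < n × u % 2 ≡ 1 × (u + g) % n ≡ j × g < 3
odd-alignment n 2≤n j j<n with j % 2 in eq | m%n<n j 2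
... | 1 | _ = j , 0 , j<n , eq , tr (ap (_% n) (+0 j)) (m<n⇒m%n≡m j<n) , s≤s z≤n
... | suc (suc _) | s≤s (s≤s ())
odd-alignment n 2≤n j@(suc (suc k)) j<n | 0 | _ = suc k , 1 , <-trans (n<1+n (suc k)) j<n , odd k (tr (sym (tr (ap (_% 2) (+-comm 2 k)) ([m+n]%n≡m%n k 2))) eq) , tr (ap (_% n) (+-comm (suc k) 1)) (m<n⇒m%n≡m j<n) , s≤s (s≤s z≤n)
 where
 odd : ∀ k -> k % 2 ≡ 0 -> suc k % 2 ≡ 1
 odd k e = tr (%-distribˡ-+ 1 k 2) (ap (λ r -> (1 + r) % 2) e)
odd-alignment n@(suc (suc n-2)) 2≤n zero j<n | 0 | _ with n % 2 in par | m%n<n n 2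
... | 0 | _ = suc n-2 , 1 , rfl≤ , tr (%-distribˡ-+ 1 n-2 2) (ap (λ r -> (1 + r) % 2) (tr (sym (tr (ap (_% 2) (+-comm 2 n-2)) ([m+n]%n≡m%n n-2 2))) par)) , tr (ap (_% n) (+-comm (suc n-2) 1)) (n%n≡0 n) , s≤s (s≤s z≤n)
... | 1 | _ = n-2 , 2 , <-trans (n<1+n n-2) (n<1+n (suc n-2)) , tr (sym (tr (ap (_% 2) (+-comm 2 n-2)) ([m+n]%n≡m%n n-2 2))) par , tr (ap (_% n) (+-comm n-2 2)) (n%n≡0 n) , rfl≤
... | suc (suc _) | s≤s (s≤s ())
odd-alignment (suc zero) (s≤s ()) zero j<n | 0 | _
odd-alignment n 2≤n (suc zero) j<n | 0 | _ = refute eq λ ()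

-- The right side counts the naturals below `n √(p / s)`, and every number below `r` is among them.
T≥ : ∀ n s p r .{{_ : NonZero s}} -> s * (r * r) ≤ n * n * p -> r ≤ n * n * p -> r ≤ ⌈ n √[ p / s ]⌉
T≥ n s p r small r≤ = begin
 r ≡⟨ tr (sym (*1 r)) (sym (Ʃ<-const r 1)) ⟩
 _ ≤⟨ Ʃ<-mono r (λ i i<r -> leq (sym (𝟙-yes (P? i) (below i i<r)))) ⟩
 _ ≤⟨ m≤m+n _ _ ⟩
 _ ≡⟨ Ʃ<-+ r (N ∸ r) (λ i -> 𝟙 (P? i)) ⟨
 _ ≡⟨ ap (λ k -> Ʃ< k (λ i -> 𝟙 (P? i))) (m+[n∸m]≡n (⊑ r≤ (leq (sym N≡)))) ⟩
 _ ≡⟨ filter-length P? (upTo N) ⟨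
 _ ∎
 where
 open ≤R
 N = n ^ 2 * p
 N≡ : N ≡ n * n * p
 N≡ = ap (λ k -> n * k * p) (*1 n)
 P? : ∀ r -> Dec (s * r ^ 2 < n ^ 2 * p)
 P? r = s * r ^ 2 <? n ^ 2 * p
 below : ∀ i -> i < r -> s * i ^ 2 < N
 below i i<r = <≤ (*-monoʳ-< s (subst₂ _<_ (ap (i *_) (sym (*1 i))) refl (*-mono-< i<r i<r))) (⊑ small (leq (sym N≡)))

-- (K − 1) / K with K − 1 = k.
ratio : ℕ -> ℚ
ratio k = ℤ.+ k ℚ./ suc k

ratio<1 : ∀ k -> ratio k ℚ.< 1ℚ
ratio<1 k = ℚ.toℚᵘ-cancel-< (ℚᵘ.<-respˡ-≃ (ℚᵘ.≃-sym (ℚ.toℚᵘ-fromℚᵘ (mkℚᵘ (ℤ.+ k) k))) (*<* (ℤ.≤-<-trans (ℤ.≤-reflexive (ℤ.*-identityʳ (ℤ.+ k))) (ℤ.<-≤-trans (ℤ.+<+ (n<1+n k)) (ℤ.≤-reflexive (sym (ℤ.*-identityˡ (ℤ.+ suc k))))))))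

≤ratio* : ∀ k a b -> a * suc k ≤ k * b -> (ℤ.+ a ℚ./ 1) ℚ.≤ ratio k ℚ.* (ℤ.+ b ℚ./ 1)
≤ratio* k a b le = ℚ.toℚᵘ-cancel-≤ (begin
 ℚ.toℚᵘ (ℤ.+ a ℚ./ 1) ≃⟨ ℚ.toℚᵘ-fromℚᵘ (mkℚᵘ (ℤ.+ a) 0) ⟩
 _ ≤⟨ *≤* ints ⟩
 mkℚᵘ (ℤ.+ k) k ℚᵘ.* mkℚᵘ (ℤ.+ b) 0 ≃⟨ ℚᵘ.*-cong (ℚ.toℚᵘ-fromℚᵘ (mkℚᵘ (ℤ.+ k) k)) (ℚ.toℚᵘ-fromℚᵘ (mkℚᵘ (ℤ.+ b) 0)) ⟨
 ℚ.toℚᵘ (ratio k) ℚᵘ.* ℚ.toℚᵘ (ℤ.+ b ℚ./ 1) ≃⟨ ℚ.toℚᵘ-homo-* (ratio k) (ℤ.+ b ℚ./ 1) ⟨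
 _ ∎)
 where
 open ℚᵘ.≤-Reasoning
 ints : ℤ.+ a ℤ.* ℤ.+ (suc k * 1) ℤ.≤ ℤ.+ k ℤ.* ℤ.+ b ℤ.* ℤ.+ 1
 ints = subst₂ ℤ._≤_ (tr (ap (λ c -> ℤ.+ (a * c)) (sym (*1 (suc k)))) (ℤ.pos-* a (suc k * 1))) (tr (ℤ.pos-* k b) (sym (ℤ.*-identityʳ _))) (ℤ.+≤+ le)

-- Arithmetic of the running time.

module Costs (u : ℕ) .{{_ : NonZero u}} where

 absorb : ∀ a b t .{{_ : NonZero t}} -> a + b * t ≤ (a + b) * t
 absorb a b t = ⊑ (+ˡ (b * t) (m≤m*n a t)) (leq (sym (*-distribʳ-+ t a b)))

 fillC searchC XC levelC alignC totalC : ℕ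
 fillC = 3 * u + 4 + (u + 4)
 searchC = 6 * u + 5 + (8 * u + 14)
 XC = 3 * u + 5 + (7 * fillC + 2 * searchC)
 levelC = 2 * u + 4 + 2 * XC
 alignC = 2 * u + 4 + levelC
 totalC = 3 * u + 5 + (2 * (u + 3) + 6 * alignC)

 module _ (n s p ℓ W : ℕ) .{{_ : NonZero p}} .{{_ : NonZero ℓ}} .{{_ : NonZero W}} (n≤p : n ≤ p) (s≤p : s ≤ p) where

  open ≤R

  -- The step counts of the parts of the program, with `u` for each straight command. In the final
  -- product, `p * ℓ` stands for the walks of a level, one `W` for the bits of a random word and the
  -- other for the number of levels.
  fill search X level align total : ℕ
  fill = u + (suc (W * (suc u + 3)) + (u + u))
  search = u + (suc (2 * ℓ * (u + 3)) + (u + (u + (u + (u + (u + suc (2 * ℓ * (u + (u + 1 + u) + 3))))))))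
  X = 3 * u + 5 + 7 * (fill + 3) + 2 * (search + 3)
  level = u + (suc ((s + p) * X) + u)
  align = u + (suc (W * (level + 3)) + u)
  total = u + (suc (n * (u + 3)) + (u + (suc (W * (u + 3)) + u))) + suc (6 * (align + 3)) + 1

  instance
   Wℓ≢0 : NonZero (W * ℓ)
   Wℓ≢0 = m*n≢0 W ℓ
   pWℓ≢0 : NonZero (p * (W * ℓ))
   pWℓ≢0 = m*n≢0 p (W * ℓ)
   WpWℓ≢0 : NonZero (W * (p * (W * ℓ)))
   WpWℓ≢0 = m*n≢0 W (p * (W * ℓ))

  fill≤ : fill + 3 ≤ fillC * W
  fill≤ = ⊑ (leq (eq u W)) (absorb (3 * u + 4) (u + 4) W)
   where
   eq : ∀ u W -> u + (suc (W * (suc u + 3)) + (u + u)) + 3 ≡ 3 * u + 4 + (u + 4) * W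
   eq = ring

  search≤ : search + 3 ≤ searchC * ℓ
  search≤ = ⊑ (leq (eq u ℓ)) (absorb (6 * u + 5) (8 * u + 14) ℓ)
   where
   eq : ∀ u l -> u + (suc (2 * l * (u + 3)) + (u + (u + (u + (u + (u + suc (2 * l * (u + (u + 1 + u) + 3)))))))) + 3 ≡ 6 * u + 5 + (8 * u + 14) * l
   eq = ring

  X≤ : X ≤ XC * (W * ℓ)
  X≤ = begin _ ≤⟨ +≤ (+ʳ (3 * u + 5) (*ʳ 7 (⊑ fill≤ (*ʳ fillC (m≤m*n W ℓ))))) (*ʳ 2 (⊑ search≤ (*ʳ searchC (m≤n*m ℓ W)))) ⟩
   _ ≡⟨ eq (3 * u + 5) fillC searchC (W * ℓ) ⟩
   _ ≤⟨ absorb (3 * u + 5) (7 * fillC + 2 * searchC) (W * ℓ) ⟩ _ ∎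
   where
   eq : ∀ a f s t -> a + 7 * (f * t) + 2 * (s * t) ≡ a + (7 * f + 2 * s) * t
   eq = ring

  level≤ : level + 3 ≤ levelC * (p * (W * ℓ))
  level≤ = begin _ ≤⟨ +ˡ 3 (+ʳ u (+ˡ u (s≤s (*≤ (+ˡ p s≤p) X≤)))) ⟩
   _ ≡⟨ eq u p XC (W * ℓ) ⟩
   _ ≤⟨ absorb (2 * u + 4) (2 * XC) (p * (W * ℓ)) ⟩ _ ∎
   where
   eq : ∀ u p x t -> u + (suc ((p + p) * (x * t)) + u) + 3 ≡ 2 * u + 4 + 2 * x * (p * t)
   eq = ring

  align≤ : align + 3 ≤ alignC * (W * (p * (W * ℓ)))
  align≤ = begin _ ≤⟨ +ˡ 3 (+ʳ u (+ˡ u (s≤s (*ʳ W level≤)))) ⟩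
   _ ≡⟨ eq u W levelC (p * (W * ℓ)) ⟩
   _ ≤⟨ absorb (2 * u + 4) levelC (W * (p * (W * ℓ))) ⟩ _ ∎
   where
   eq : ∀ u W x t -> u + (suc (W * (x * t)) + u) + 3 ≡ 2 * u + 4 + x * (W * t)
   eq = ring

  total≤ : total ≤ totalC * (W * (p * (W * ℓ)))
  total≤ = begin
   total ≡⟨ eq u n W align ⟩
   _ ≤⟨ +≤ (+≤ (n≤1+n (3 * u + 4)) (*ˡ (u + 3) (+≤ n≤ W≤))) (*ʳ 6 align≤) ⟩
   _ ≡⟨ eq' u Z alignC ⟩
   _ ≤⟨ absorb (3 * u + 5) (2 * (u + 3) + 6 * alignC) Z ⟩ _ ∎
   where
   Z = W * (p * (W * ℓ))
   n≤ : n ≤ Z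
   n≤ = ⊑ n≤p (⊑ (m≤m*n p (W * ℓ)) (m≤n*m (p * (W * ℓ)) W))
   W≤ : W ≤ Z
   W≤ = m≤m*n W (p * (W * ℓ))
   eq : ∀ u n W a -> u + (suc (n * (u + 3)) + (u + (suc (W * (u + 3)) + u))) + suc (6 * (a + 3)) + 1 ≡ 3 * u + 4 + (n + W) * (u + 3) + 6 * (a + 3)
   eq = ring
   eq' : ∀ u z a -> suc (3 * u + 4) + (z + z) * (u + 3) + 6 * (a * z) ≡ 3 * u + 5 + (2 * (u + 3) + 6 * a) * z
   eq' = ring

open import Defs
open import Data.Bool using (T; _∧_)

-- A small imperative language and its compilation.

data Exp : Set where
 lit : ℕ -> Exp
 reg : Addr -> Exp
 prm : Param -> Exp
 rd : ReadOnly -> Exp -> Exp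
 ld : Addr -> Exp -> Exp
 bin : Op -> Exp -> Exp -> Exp

infixr 5 _⨾_

data Cmd : Set where
 set : List (Addr × Exp) -> Cmd
 store : Addr -> Exp -> Exp -> Cmd
 flip : Addr -> Cmd
 when : Exp -> Cmd -> Cmd
 while : Addr -> Cmd -> Cmd
 _⨾_ : Cmd -> Cmd -> Cmd
 accept : Cmd

-- Cells below the first register hold intermediate results; cell 0 also
-- serves as the operand of unconditional jumps.
reg# firstCell : Addr
reg# = 16
firstCell = 64

-- The value is left in cell `d`, and nested expressions use the cells above. There is no copying
-- instruction, so a register is fetched by adding it to 0.
compE : Exp -> Addr -> List Instr
compE (lit c) d = const d c ∷ []
compE (reg a) d = const d 0 ∷ arith add d a d ∷ []
compE (prm q) d = param d q ∷ []
compE (rd r e) d = compE e d ++ read r d d ∷ []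
compE (ld b e) d = compE e d ++ const (suc d) b ∷ arith add d d (suc d) ∷ load d d ∷ []
compE (bin o e1 e2) d = compE e1 d ++ compE e2 (suc d) ++ arith o d d (suc d) ∷ []

costE : Exp -> ℕ
costE e = length (compE e 0)

compileSet : List (Addr × Exp) -> List Instr
compileSet [] = []
compileSet ((r , e) ∷ bs) = compE e 0 ++ const 1 0 ∷ arith add r 0 1 ∷ compileSet bs

compStore : Addr -> Exp -> Exp -> List Instr
compStore b e1 e2 = compE e1 0 ++ const 1 b ∷ arith add 0 0 1 ∷ compE e2 1 ++ store 0 1 ∷ []

-- Jump targets are absolute, so the length of a piece of code must be known before it is placed; by
-- `len-comp` it is independent of the label.
size : Cmd -> ℕ
size (set bs) = length (compileSet bs)
size (store b e1 e2) = length (compStore b e1 e2)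
size (flip r) = 1
size (when e c) = costE e + suc (size c)
size (while r c) = suc (size c + 2)
size (c1 ⨾ c2) = size c1 + size c2
size accept = 1

compile : Cmd -> Label -> List Instr
compile (set bs) l = compileSet bs
compile (store b e1 e2) l = compStore b e1 e2
compile (flip r) l = coin r ∷ []
compile (when e c) l = compE e 0 ++ jumpz 0 (l + size (when e c)) ∷ compile c (suc (l + costE e))
compile (while r c) l = jumpz r (l + size (while r c)) ∷ compile c (suc l) ++ const 0 0 ∷ jumpz 0 l ∷ []
compile (c1 ⨾ c2) l = compile c1 l ++ compile c2 (l + size c1)
compile accept l = halt true ∷ []

len-comp : ∀ c l -> length (compile c l) ≡ size c
len-comp (set bs) l = refl
len-comp (store b e1 e2) l = refl
len-comp (flip r) l = refl
len-comp (when e c) l = tr (List.length-++ (compE e 0)) (ap (λ k -> costE e + suc k) (len-comp c _))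
len-comp (while r c) l = ap suc (tr (List.length-++ (compile c (suc l))) (ap (_+ 2) (len-comp c _)))
len-comp (c1 ⨾ c2) l = tr (List.length-++ (compile c1 l)) (ap₂ _+_ (len-comp c1 l) (len-comp c2 _))
len-comp accept l = refl

-- Every cell holds at most X ^ cellDegree and every constant is less than
-- 2 ^ 20, so a value of degree k is at most X ^ k.
cellDeg maxDeg : ℕ
cellDeg = 30
maxDeg = 4000

opDegree : Op -> ℕ -> ℕ -> ℕ
opDegree add i j = 1 + (i + j)
opDegree _ i j = i + j

degree : Exp -> ℕ
degree (lit c) = 20
degree (reg a) = cellDeg
degree (prm q) = 2
degree (rd r e) = 1 + degree e
degree (ld b e) = 21 + (cellDeg + degree e)
degree (bin o e1 e2) = opDegree o (degree e1) (degree e2)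

-- A Boolean, so that the whole program is checked by evaluation. The depth `d` keeps intermediate
-- results below the first register.
adm : ℕ -> Exp -> Bool
adm d (lit c) = c <ᵇ 2 ^ 20
adm d (reg a) = reg# ≤ᵇ a
adm d (prm q) = true
adm d (rd r e) = adm d e
adm d (ld b e) = (suc d <ᵇ reg#) ∧ (reg# ≤ᵇ b) ∧ (b <ᵇ 2 ^ 20) ∧ adm d e
adm d (bin o e1 e2) = (suc d <ᵇ reg#) ∧ adm d e1 ∧ adm (suc d) e2

isRegister : Addr -> Bool
isRegister r = (reg# ≤ᵇ r) ∧ (r <ᵇ firstCell)

admissibleSet : List (Addr × Exp) -> Bool
admissibleSet [] = true
admissibleSet ((r , e) ∷ bs) = isRegister r ∧ adm 0 e ∧ (degree e <ᵇ maxDeg) ∧ admissibleSet bs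

admC : Cmd -> Bool
admC (set bs) = admissibleSet bs
admC (store b e1 e2) = (reg# ≤ᵇ b) ∧ (b <ᵇ 2 ^ 20) ∧ adm 0 e1 ∧ (21 + degree e1 <ᵇ maxDeg) ∧ adm 1 e2 ∧ (degree e2 <ᵇ maxDeg)
admC (flip r) = isRegister r
admC (when e c) = adm 0 e ∧ (degree e <ᵇ maxDeg) ∧ admC c
admC (while r c) = isRegister r ∧ admC c
admC (c1 ⨾ c2) = admC c1 ∧ admC c2
admC accept = true

-- Runs as trees of coin tosses.

Env : Set
Env = Addr -> ℕ

-- A run unfolded over its coins; each `tick` or `flip` is one machine step. `stuck` marks a value
-- that exceeds its bound or a loop that outruns its counter. Correctness, time and failure
-- probability are proved for trees and carried over to the machine once.
data Tree : Set where
 ret : Env -> Tree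
 tick : Tree -> Tree
 flip : Tree -> Tree -> Tree
 accepted : Tree
 stuck : Tree

infixl 4 _>>=_
_>>=_ : Tree -> (Env -> Tree) -> Tree
ret ρ >>= K = K ρ
tick t >>= K = tick (t >>= K)
flip t u >>= K = flip (t >>= K) (u >>= K)
accepted >>= K = accepted
stuck >>= K = stuck

ticks : ℕ -> Tree -> Tree
ticks zero t = t
ticks (suc k) t = tick (ticks k t)

ticks->>= : ∀ k t K -> (ticks k t >>= K) ≡ ticks k (t >>= K)
ticks->>= zero t K = refl
ticks->>= (suc k) t K = ap tick (ticks->>= k t K)

guard : ∀ {P : Set} -> Dec P -> Tree -> Tree
guard (yes _) t = t
guard (no _) t = stuck

upd : Addr -> ℕ -> Env -> Env
upd r v ρ a = if a ≡ᵇ r then v else ρ a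

-- The number of the 2 ^ t coin sequences of length t on which a tree of
-- depth at most t does not accept.
rejections : ℕ -> Tree -> ℕ
rejections t (ret ρ) = 2 ^ t
rejections t accepted = 0
rejections t stuck = 2 ^ t
rejections zero (tick u) = 1
rejections zero (flip u v) = 1
rejections (suc t) (tick u) = 2 * rejections t u
rejections (suc t) (flip u v) = rejections t u + rejections t v

-- Correctness, time and absence of errors at once: no `stuck` leaf, depth at most `d`, `Q` at every
-- return, and evidence for `Y` at every acceptance.
data Safe (Y : Set) (Q : Env -> Set) : ℕ -> Tree -> Set where
 ret : ∀ {d ρ} -> Q ρ -> Safe Y Q d (ret ρ)
 tick : ∀ {d t} -> Safe Y Q d t -> Safe Y Q (suc d) (tick t)
 flip : ∀ {d t u} -> Safe Y Q d t -> Safe Y Q d u -> Safe Y Q (suc d) (flip t u)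
 accepted : ∀ {d} -> Y -> Safe Y Q d accepted

module Semantics {n m : ℕ} (I : Input n m) (h : RandomFunction n m) (cap cells : ℕ) where

 value : Exp -> Env -> ℕ
 value (lit c) ρ = c
 value (reg a) ρ = ρ a
 value (prm q) ρ = paramValue {w = 0} I h q
 value (rd r e) ρ = readValue {w = 0} I h r (value e ρ)
 value (ld b e) ρ = ρ (value e ρ + b)
 value (bin o e1 e2) ρ = ⟦ o ⟧ (value e1 ρ) (value e2 ρ)

 semSet : List (Addr × Exp) -> Env -> Tree
 semSet [] ρ = ret ρ
 semSet ((r , e) ∷ bs) ρ = ticks (costE e + 2) (guard (value e ρ ≤? cap) (semSet bs (upd r (value e ρ) ρ)))

 semStore : Addr -> Exp -> Exp -> Env -> Tree
 semStore b e1 e2 ρ = ticks (length (compStore b e1 e2))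
  (guard (value e1 ρ + b <? cells) (guard (value e2 ρ ≤? cap) (ret (upd (value e1 ρ + b) (value e2 ρ) ρ))))

 branch : ℕ -> Tree -> Tree -> Tree
 branch zero t u = t
 branch (suc _) t u = u

 -- `sem` takes the initial value of the loop register as the fuel, so a loop is `stuck` unless its
 -- register reaches 0 within that many iterations.
 loop : Addr -> (Env -> Tree) -> ℕ -> Env -> Tree
 loop r body fuel ρ with ρ r
 ... | zero = tick (ret ρ)
 loop r body zero ρ | suc _ = stuck
 loop r body (suc fuel) ρ | suc _ = tick (body ρ >>= λ ρ' -> tick (tick (loop r body fuel ρ')))

 sem : Cmd -> Env -> Tree
 sem (set bs) ρ = semSet bs ρ
 sem (store b e1 e2) ρ = semStore b e1 e2 ρ
 sem (flip r) ρ = flip (ret (upd r 1 ρ)) (ret (upd r 0 ρ))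
 sem (when e c) ρ = ticks (suc (costE e)) (branch (value e ρ) (ret ρ) (sem c ρ))
 sem (while r c) ρ = loop r (sem c) (ρ r) ρ
 sem (c1 ⨾ c2) ρ = sem c1 ρ >>= sem c2
 sem accept ρ = tick accepted

-- The machine follows the trees.

At : List Instr -> Label -> List Instr -> Set
At code l [] = ⊤
At code l (i ∷ is) = fetch code l ≡ just i × At code (suc l) is

At-++ : ∀ code l is js -> At code l (is ++ js) -> At code l is × At code (l + length is) js
At-++ code l [] js at = tt , subst (λ k -> At code k js) (sym (+0 l)) at
At-++ code l (i ∷ is) js (eq , at) =
 let p , q = At-++ code (suc l) is js at in (eq , p) , subst (λ k -> At code k js) (sym (+-suc l (length is))) q

At-self : ∀ code -> At code 0 code
At-self code = go [] code
 where
 fetch-++ : ∀ pre i is -> fetch (pre ++ i ∷ is) (length pre) ≡ just i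
 fetch-++ [] i is = refl
 fetch-++ (_ ∷ pre) i is = fetch-++ pre i is
 go : ∀ pre is -> At (pre ++ is) (length pre) is
 go pre [] = tt
 go pre (i ∷ is) = fetch-++ pre i is , subst₂ (λ c l -> At c l is) (List.++-assoc pre (i ∷ []) is)
  (tr (List.length-++ pre) (+-comm (length pre) 1)) (go (pre ++ i ∷ []) is)

fetch-end : ∀ code -> fetch code (length code) ≡ nothing
fetch-end [] = refl
fetch-end (_ ∷ is) = fetch-end is

straight : Instr -> Bool
straight (coin _) = false
straight (jumpz _ _) = false
straight (halt _) = false
straight _ = true

straights : List Instr -> Bool
straights [] = true
straights (i ∷ is) = straight i ∧ straights is

∧⁻ : ∀ {a b} -> T (a ∧ b) -> T a × T b
∧⁻ {true} t = tt , t

∧⁺ : ∀ {a b} -> T a -> T b -> T (a ∧ b)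
∧⁺ {true} _ t = t

straights-++ : ∀ is js -> T (straights is) -> T (straights js) -> T (straights (is ++ js))
straights-++ [] js _ q = q
straights-++ (i ∷ is) js p q = let a , b = ∧⁻ {straight i} p in ∧⁺ {straight i} a (straights-++ is js b q)

straight-E : ∀ e d -> T (straights (compE e d))
straight-E (lit c) d = tt
straight-E (reg a) d = tt
straight-E (prm q) d = tt
straight-E (rd r e) d = straights-++ (compE e d) _ (straight-E e d) tt
straight-E (ld b e) d = straights-++ (compE e d) _ (straight-E e d) tt
straight-E (bin o e1 e2) d = straights-++ (compE e1 d) _ (straight-E e1 d) (straights-++ (compE e2 (suc d)) _ (straight-E e2 (suc d)) tt)

-- `cap` bounds what is stored, and powers of `X` bound what is computed on the way; the last power
-- fits into a word, so truncation never acts.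
record Capacity {n m : ℕ} (w : ℕ) (I : Input n m) (X cap cells : ℕ) : Set where
 field
  cap≥ : 1 ≤ cap
  cap≤ : cap ≤ X ^ cellDeg
  2≤X : 2 ≤ X
  n≤X : n ≤ X
  m≤X : m ≤ X
  s≤X² : Input.s I ≤ X ^ 2
  p≤X² : Input.p I ≤ X ^ 2
  X<2^w : X ^ maxDeg ≤ 2 ^ w
  cells≥ : firstCell ≤ cells

module Simulation {n m w : ℕ} {I : Input n m} {X cap cells : ℕ} (capacity : Capacity w I X cap cells) (h : RandomFunction n m) (code : List Instr) where

 open Capacity capacity

 open Semantics I h cap cells

 X≥1 : 1 ≤ X
 X≥1 = ⊑ (s≤s z≤n) 2≤X

 instance
  X≢0 : NonZero X
  X≢0 = >-nonZero X≥1

  2^w≢0 : NonZero (2 ^ w)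
  2^w≢0 = m^n≢0 2 w

 X^-mono : ∀ a b -> a ≤ b -> X ^ a ≤ X ^ b
 X^-mono a b = ^-monoʳ-≤ X {a} {b}

 <maxDegree⇒<2^w : ∀ {v k} -> v ≤ X ^ k -> k < maxDeg -> v < 2 ^ w
 <maxDegree⇒<2^w {v} {k} v≤ k< = <≤ (≤< v≤ (^-monoʳ-< X 2≤X k<)) X<2^w

 toℕ-truncate : ∀ {v} -> v < 2 ^ w -> toℕ (truncate w v) ≡ v
 toℕ-truncate {v} v< = tr (Fin.toℕ-fromℕ< (m%n<n v (2 ^ w))) (m<n⇒m%n≡m v<)

 entry≤X : ∀ {k l} -> k ≤ X -> (z : Vec (Fin k) l) -> ∀ i -> entry z i ≤ X
 entry≤X {l = l} k≤ z i with i <? l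
 ... | yes i<l = <⇒≤ (<≤ (Fin.toℕ<n (Vec.lookup z (fromℕ< i<l))) k≤)
 ... | no _ = z≤n

 readValue≤X : ∀ r i -> readValue {w = 0} I h r i ≤ X
 readValue≤X x-list = entry≤X m≤X (Input.x I)
 readValue≤X y-list = entry≤X m≤X (Input.y I)
 readValue≤X h-fun = entry≤X n≤X h

 paramValue≤X² : ∀ q -> paramValue {w = 0} I h q ≤ X ^ 2
 paramValue≤X² n-param = ⊑ n≤X (m≤m^n X 2)
  where
  m≤m^n : ∀ a k .{{_ : NonZero k}} -> a ≤ a ^ k
  m≤m^n zero k = z≤n
  m≤m^n a@(suc _) (suc k) = m≤m*n a (a ^ k) {{m^n≢0 a k}}
 paramValue≤X² m-param = ⊑ m≤X (m≤m*n X (X ^ 1) {{m^n≢0 X 1}})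
 paramValue≤X² s-param = s≤X²
 paramValue≤X² p-param = p≤X²

 lit≤ : ∀ {c} -> c < 2 ^ 20 -> c ≤ X ^ 20
 lit≤ c< = ⊑ (<⇒≤ c<) (^-monoˡ-≤ 20 2≤X)

 add≤ : ∀ {a b i j} -> a ≤ X ^ i -> b ≤ X ^ j -> a + b ≤ X ^ (1 + (i + j))
 add≤ {a} {b} {i} {j} a≤ b≤ = begin
  a + b ≤⟨ +≤ (⊑ a≤ (X^-mono i (i + j) (m≤m+n i j))) (⊑ b≤ (X^-mono j (i + j) (m≤n+m j i))) ⟩
  _ ≡⟨ ap (X ^ (i + j) +_) (+0 _) ⟨
  _ ≤⟨ *ˡ (X ^ (i + j)) 2≤X ⟩ _ ∎
  where open ≤R

 op≤ : ∀ o {a b} i j -> a ≤ X ^ i -> b ≤ X ^ j -> ⟦ o ⟧ a b ≤ X ^ opDegree o i j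
 op≤ add i j a≤ b≤ = add≤ {i = i} {j} a≤ b≤
 op≤ sub {a} {b} i j a≤ b≤ = ⊑ (m∸n≤m a b) (⊑ a≤ (X^-mono i (i + j) (m≤m+n i j)))
 op≤ mul i j a≤ b≤ = subst (_ ≤_) (sym (^-distribˡ-+-* X i j)) (*≤ a≤ b≤)
 op≤ div {a} {zero} i j a≤ b≤ = z≤n
 op≤ div {a} {suc b} i j a≤ b≤ = ⊑ (m/n≤m a (suc b)) (⊑ a≤ (X^-mono i (i + j) (m≤m+n i j)))
 op≤ rem {a} {zero} i j a≤ b≤ = z≤n
 op≤ rem {a} {suc b} i j a≤ b≤ = ⊑ (m%n≤m a (suc b)) (⊑ a≤ (X^-mono i (i + j) (m≤m+n i j)))

 record Rep (σ : State w) (ρ : Env) : Set where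
  field
   cell : ∀ a -> reg# ≤ a -> toℕ (memory σ a) ≡ ρ a
   bounded : ∀ a -> reg# ≤ a -> ρ a ≤ cap
   used≤ : used σ ≤ cells
   running : output σ ≡ nothing

 open Rep

 value≤ : ∀ {σ ρ} -> Rep σ ρ -> ∀ d e -> T (adm d e) -> value e ρ ≤ X ^ degree e
 value≤ R d (lit c) ok = lit≤ (<ᵇ⇒< c _ ok)
 value≤ R d (reg a) ok = ⊑ (bounded R a (≤ᵇ⇒≤ _ a ok)) cap≤
 value≤ R d (prm q) ok = paramValue≤X² q
 value≤ {ρ = ρ} R d (rd r e) ok = ⊑ (readValue≤X r (value e ρ)) (m≤m*n X (X ^ degree e) {{m^n≢0 X (degree e)}})
 value≤ {ρ = ρ} R d (ld b e) ok =
  let _ , ok1 = ∧⁻ {suc d <ᵇ reg#} ok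
      b≥ , _ = ∧⁻ {reg# ≤ᵇ b} ok1
  in ⊑ (bounded R _ (⊑ (≤ᵇ⇒≤ reg# b b≥) (m≤n+m b (value e ρ))))
   (⊑ cap≤ (X^-mono cellDeg (21 + (cellDeg + degree e)) (⊑ (m≤m+n cellDeg (degree e)) (m≤n+m _ 21))))
 value≤ R d (bin o e1 e2) ok =
  let _ , ok1 = ∧⁻ {suc d <ᵇ reg#} ok
      p , q = ∧⁻ {adm d e1} ok1
  in op≤ o (degree e1) (degree e2) (value≤ R d e1 p) (value≤ R (suc d) e2 q)

 exec0 : Instr -> State w -> State w
 exec0 i σ = exec I h i false σ

 execs : List Instr -> State w -> State w
 execs [] σ = σ
 execs (i ∷ is) σ = execs is (exec0 i σ)

 execs-++ : ∀ is js σ -> execs (is ++ js) σ ≡ execs js (execs is σ)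
 execs-++ [] js σ = refl
 execs-++ (i ∷ is) js σ = execs-++ is js (exec0 i σ)

 write-here : ∀ {v} d (σ : State w) -> v < 2 ^ w -> toℕ (memory (write I h d v σ) d) ≡ v
 write-here d σ v< with d ≡ᵇ d in eq
 ... | true = toℕ-truncate v<
 ... | false = ⊥-elim (subst T eq (≡⇒≡ᵇ d d refl))

 write-there : ∀ {v} d (σ : State w) a -> a ≢ d -> memory (write I h d v σ) a ≡ memory σ a
 write-there d σ a a≢d with a ≡ᵇ d in eq
 ... | true = refute (≡ᵇ⇒≡ a d (subst T (sym eq) tt)) a≢d
 ... | false = refl

 cells≥16 : reg# ≤ cells
 cells≥16 = ⊑ (≤ᵇ⇒≤ reg# firstCell tt) cells≥

 -- σ′ arises from σ in k straight steps that write only cells between d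
 -- and the first register.
 record Frame (d : Addr) (k : ℕ) (σ σ' : State w) : Set where
  field
   pc≡ : pc σ' ≡ pc σ + k
   frame : ∀ a -> a < d ⊎ reg# ≤ a -> memory σ' a ≡ memory σ a
   usedOK : used σ ≤ cells -> used σ' ≤ cells
   output≡ : output σ' ≡ output σ

 open Frame

 frame-trans : ∀ {d u k k' σ τ υ} -> d ≤ u -> Frame d k σ τ -> Frame u k' τ υ -> Frame d (k + k') σ υ
 frame-trans {k = k} {k'} {σ} d≤u F G = record
  { pc≡ = tr (pc≡ G) (tr (ap (_+ k') (pc≡ F)) (+-assoc (pc σ) k k'))
  ; frame = λ { a (inj₁ a<d) -> tr (frame G a (inj₁ (<≤ a<d d≤u))) (frame F a (inj₁ a<d))
   ; a (inj₂ a≥) -> tr (frame G a (inj₂ a≥)) (frame F a (inj₂ a≥)) }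
  ; usedOK = usedOK G ∘ usedOK F
  ; output≡ = tr (output≡ G) (output≡ F)
  }

 frame-write : ∀ {d v} σ -> d < reg# -> Frame d 1 σ (write I h d v σ)
 frame-write {d} {v} σ d< = record
  { pc≡ = +-comm 1 (pc σ)
  ; frame = λ { a (inj₁ a<d) -> write-there {v} d σ a (<⇒≢ a<d)
   ; a (inj₂ a≥) -> write-there {v} d σ a (λ { refl -> <⇒≱ d< a≥ }) }
  ; usedOK = λ u≤ -> ⊔-lub u≤ (⊑ d< cells≥16)
  ; output≡ = refl
  }

 rep-frame : ∀ {d k σ σ' ρ} -> Frame d k σ σ' -> Rep σ ρ -> Rep σ' ρ
 rep-frame F R = record
  { cell = λ a a≥ -> tr (ap toℕ (frame F a (inj₂ a≥))) (cell R a a≥)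
  ; bounded = bounded R
  ; used≤ = usedOK F (used≤ R)
  ; running = tr (output≡ F) (running R)
  }

 pv : ∀ q -> paramValue {w = w} I h q ≡ paramValue {w = 0} I h q
 pv n-param = refl
 pv m-param = refl
 pv s-param = refl
 pv p-param = refl

 rv : ∀ r i -> readValue {w = w} I h r i ≡ readValue {w = 0} I h r i
 rv x-list i = refl
 rv y-list i = refl
 rv h-fun i = refl

 Computed : Addr -> Exp -> Env -> State w -> Set
 Computed d e ρ σ = Frame d (length (compE e d)) σ (execs (compE e d) σ) ×
  toℕ (memory (execs (compE e d) σ) d) ≡ value e ρ

 then-write : ∀ {d k k' σ τ ρ} e v {σ'} -> Frame d k σ τ -> d < reg# -> σ' ≡ write I h d v τ -> v ≡ value e ρ ->
  Rep σ ρ -> ∀ {d'} -> T (adm d' e) -> degree e < maxDeg -> k' ≡ k + 1 ->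
  Frame d k' σ σ' × toℕ (memory σ' d) ≡ value e ρ
 then-write {d} {τ = τ} e v F d< refl refl R {d'} ok deg refl =
  frame-trans rfl≤ F (frame-write τ d<) , write-here d τ (<maxDegree⇒<2^w {k = degree e} (value≤ R d' e ok) deg)

 degree-left : ∀ o e1 e2 -> degree e1 ≤ degree (bin o e1 e2)
 degree-left add e1 e2 = ⊑ (m≤m+n _ _) (n≤1+n _)
 degree-left sub e1 e2 = m≤m+n _ _
 degree-left mul e1 e2 = m≤m+n _ _
 degree-left div e1 e2 = m≤m+n _ _
 degree-left rem e1 e2 = m≤m+n _ _

 degree-right : ∀ o e1 e2 -> degree e2 ≤ degree (bin o e1 e2)
 degree-right add e1 e2 = ⊑ (m≤n+m _ _) (n≤1+n _)
 degree-right sub e1 e2 = m≤n+m _ _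
 degree-right mul e1 e2 = m≤n+m _ _
 degree-right div e1 e2 = m≤n+m _ _
 degree-right rem e1 e2 = m≤n+m _ _

 small⇒<2^w : ∀ {c} -> c < 2 ^ 20 -> c < 2 ^ w
 small⇒<2^w c< = <maxDegree⇒<2^w {k = 20} (lit≤ c<) (<ᵇ⇒< 20 maxDeg tt)

 computed : ∀ e d σ ρ -> T (adm d e) -> d < reg# -> degree e < maxDeg -> Rep σ ρ -> Computed d e ρ σ
 computed (lit c) d σ ρ ok d< deg R = frame-write σ d< , write-here d σ (small⇒<2^w (<ᵇ⇒< c _ ok))
 computed (reg a) d σ ρ ok d< deg R = then-write {k = 1} (reg a) _ (frame-write σ d<) d< refl
  (tr (ap₂ _+_ (cell (rep-frame (frame-write σ d<) R) a (≤ᵇ⇒≤ _ a ok)) (write-here d σ (small⇒<2^w (<ᵇ⇒< 0 _ tt))))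
   (+0 (ρ a))) R {d} ok deg refl
 computed (prm q) d σ ρ ok d< deg R = frame-write σ d< ,
  tr (write-here d σ (<maxDegree⇒<2^w {k = 2} (subst (_≤ X ^ 2) (sym (pv q)) (paramValue≤X² q)) (<ᵇ⇒< 2 maxDeg tt))) (pv q)
 computed (rd r e) d σ ρ ok d< deg R =
  let F , val = computed e d σ ρ ok d< (<-trans (n<1+n _) deg) R
  in then-write (rd r e) _ F d< (execs-++ (compE e d) _ σ) (tr (rv r _) (ap (readValue {w = 0} I h r) val)) R {d} ok deg
   (List.length-++ (compE e d))
 computed (ld b e) d σ ρ ok d< deg R =
  let sd< , ok1 = ∧⁻ {suc d <ᵇ reg#} ok
      b≥ , ok2 = ∧⁻ {reg# ≤ᵇ b} ok1
      b< , ok3 = ∧⁻ {b <ᵇ 2 ^ 20} ok2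
      deg' = ≤< (⊑ (m≤n+m (degree e) cellDeg) (m≤n+m _ 21)) deg
      F , val = computed e d σ ρ ok3 d< deg' R
      τ = execs (compE e d) σ
      sd<' = <ᵇ⇒< (suc d) reg# sd<
      b<' = <ᵇ⇒< b (2 ^ 20) b<
      τ1 = write I h (suc d) b τ
      G = frame-trans (n≤1+n d) F (frame-write {v = b} τ sd<')
      val1 = tr (ap toℕ (frame (frame-write {v = b} τ sd<') d (inj₁ rfl≤))) val
      eq = ap₂ _+_ val1 (write-here (suc d) τ (small⇒<2^w b<'))
      τ2 = write I h d (toℕ (memory τ1 d) + toℕ (memory τ1 (suc d))) τ1
      H = frame-trans rfl≤ G (frame-write τ1 d<)
      sum≤ = subst (_≤ X ^ (1 + (degree e + 20))) (sym eq) (add≤ {i = degree e} {20} (value≤ R d e ok3) (lit≤ b<'))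
      addr = tr (write-here d τ1 (<maxDegree⇒<2^w sum≤ (≤< (leq (+-comm (1 + degree e) 20)) (deg'' (degree e) deg)))) eq
      in then-write (ld b e) _ H d< (execs-++ (compE e d) _ σ)
       (tr (ap (λ a -> toℕ (memory τ2 a)) addr) (cell (rep-frame H R) _ (⊑ (≤ᵇ⇒≤ reg# b b≥) (m≤n+m b _)))) R {d} ok deg
       (tr (List.length-++ (compE e d)) (len (length (compE e d))))
  where
  len : ∀ k -> k + 3 ≡ k + 1 + 1 + 1
  len k = tr (sym (+-assoc k 1 2)) (sym (+-assoc (k + 1) 1 1))
  deg'' : ∀ k -> 21 + (cellDeg + k) < maxDeg -> 20 + (1 + k) < maxDeg
  deg'' k lt = ≤< (⊑ (leq (+-suc 20 k)) (+ʳ 21 (m≤n+m k cellDeg))) lt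
 computed (bin o e1 e2) d σ ρ ok d< deg R =
  let sd< , ok1 = ∧⁻ {suc d <ᵇ reg#} ok
      ok2 , ok3 = ∧⁻ {adm d e1} ok1
      sd<' = <ᵇ⇒< (suc d) reg# sd<
      F , val1 = computed e1 d σ ρ ok2 d< (≤< (degree-left o e1 e2) deg) R
      τ = execs (compE e1 d) σ
      G , val2 = computed e2 (suc d) τ ρ ok3 sd<' (≤< (degree-right o e1 e2) deg) (rep-frame F R)
      val1' = tr (ap toℕ (frame G d (inj₁ rfl≤))) val1
  in then-write (bin o e1 e2) _ (frame-trans (n≤1+n d) F G) d<
   (tr (execs-++ (compE e1 d) _ σ) (execs-++ (compE e2 (suc d)) _ τ)) (ap₂ ⟦ o ⟧ val1' val2) R {d} ok deg
   (tr (List.length-++ (compE e1 d)) (tr (ap (length (compE e1 d) +_) (List.length-++ (compE e2 (suc d))))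
    (sym (+-assoc (length (compE e1 d)) _ 1))))

 -- `ret` is the state reached after the code has been left, when the claim NO has been made. Of
 -- `stuck` nothing is demanded, since `Safe` excludes it.
 Sim : Tree -> State w -> Set
 Sim (ret ρ) σ = output σ ≡ just false × used σ ≤ cells
 Sim (tick t) σ = output σ ≡ nothing × (∀ b -> Sim t (step I h code b σ))
 Sim (flip t u) σ = output σ ≡ nothing × Sim t (step I h code true σ) × Sim u (step I h code false σ)
 Sim accepted σ = output σ ≡ just true × used σ ≤ cells
 Sim stuck σ = ⊤

 step-exec : ∀ {i} b (σ : State w) -> output σ ≡ nothing -> fetch code (pc σ) ≡ just i -> step I h code b σ ≡ exec I h i b σ
 step-exec b σ eq1 eq2 with output σ | fetch code (pc σ)
 step-exec b σ refl refl | nothing | just i = refl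

 exec-straight : ∀ i b σ -> T (straight i) ->
  exec I h i b σ ≡ exec0 i σ × pc (exec0 i σ) ≡ suc (pc σ) × output (exec0 i σ) ≡ output σ
 exec-straight (const _ _) b σ _ = refl , refl , refl
 exec-straight (arith _ _ _ _) b σ _ = refl , refl , refl
 exec-straight (load _ _) b σ _ = refl , refl , refl
 exec-straight (store _ _) b σ _ = refl , refl , refl
 exec-straight (param _ _) b σ _ = refl , refl , refl
 exec-straight (read _ _ _) b σ _ = refl , refl , refl

 sim-straight : ∀ is {t} σ -> T (straights is) -> output σ ≡ nothing -> At code (pc σ) is ->
  Sim t (execs is σ) -> Sim (ticks (length is) t) σ
 sim-straight [] σ _ _ _ sim = sim
 sim-straight (i ∷ is) {t} σ st run (fet , at) sim =
  let s1 , s2 = ∧⁻ {straight i} st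
      _ , pc≡' , out≡ = exec-straight i false σ s1
  in run , λ b -> subst (Sim (ticks (length is) t))
   (sym (tr (step-exec b σ run fet) (proj₁ (exec-straight i b σ s1))))
   (sim-straight is (exec0 i σ) s2 (tr out≡ run) (subst (λ l -> At code l is) (sym pc≡') at) sim)

 sim-guard : ∀ {P : Set} (d : Dec P) {t σ} -> (P -> Sim t σ) -> Sim (guard d t) σ
 sim-guard (yes p) sim = sim p
 sim-guard (no _) sim = tt

 guard->>= : ∀ {P : Set} (d : Dec P) t K -> (guard d t >>= K) ≡ guard d (t >>= K)
 guard->>= (yes _) t K = refl
 guard->>= (no _) t K = refl

 rep-write : ∀ {σ ρ} r v -> Rep σ ρ -> reg# ≤ r -> r < cells -> v ≤ cap -> v < 2 ^ w ->
  Rep (write I h r v σ) (upd r v ρ)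
 rep-write {σ} {ρ} r v R r≥ r< v≤ v< = record
  { cell = λ a a≥ -> lemma a a≥
  ; bounded = λ a a≥ -> lemma' a a≥
  ; used≤ = ⊔-lub (used≤ R) r<
  ; running = running R
  }
  where
  lemma : ∀ a -> reg# ≤ a -> toℕ (if a ≡ᵇ r then truncate w v else memory σ a) ≡ upd r v ρ a
  lemma a a≥ with a ≡ᵇ r
  ... | true = toℕ-truncate v<
  ... | false = cell R a a≥
  lemma' : ∀ a -> reg# ≤ a -> upd r v ρ a ≤ cap
  lemma' a a≥ with a ≡ᵇ r
  ... | true = v≤
  ... | false = bounded R a a≥

 cap<2^w : ∀ {v} -> v ≤ cap -> v < 2 ^ w
 cap<2^w v≤ = <maxDegree⇒<2^w {k = cellDeg} (⊑ v≤ cap≤) (<ᵇ⇒< cellDeg maxDeg tt)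

 -- A tree simulated at every state that represents its environment and is
 -- about to execute label l.
 SimAt : Label -> (Env -> Tree) -> Set
 SimAt l K = ∀ ρ σ -> pc σ ≡ l -> Rep σ ρ -> Sim (K ρ) σ

 sim-≡ : ∀ {t u σ} -> t ≡ u -> Sim t σ -> Sim u σ
 sim-≡ refl s = s

 0<16 : 0 < reg#
 0<16 = <ᵇ⇒< 0 _ tt

 isRegister⁻ : ∀ r -> T (isRegister r) -> reg# ≤ r × r < cells
 isRegister⁻ r ok = let p , q = ∧⁻ {reg# ≤ᵇ r} ok in ≤ᵇ⇒≤ reg# r p , <≤ (<ᵇ⇒< r firstCell q) cells≥

 At-join : ∀ l is {js} -> At code l is -> At code (l + length is) js -> At code l (is ++ js)
 At-join l [] {js} _ q = subst (λ k -> At code k js) (+0 l) q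
 At-join l (i ∷ is) {js} (p , r) q = p , At-join (suc l) is r (subst (λ k -> At code k js) (+-suc l (length is)) q)

 sim-set : ∀ bs {l K} -> T (admissibleSet bs) -> At code l (compileSet bs) ->
  SimAt (l + length (compileSet bs)) K -> SimAt l (λ ρ -> semSet bs ρ >>= K)
 sim-set [] {l} ok at sim ρ σ pc≡l R = sim ρ σ (tr pc≡l (sym (+0 l))) R
 sim-set ((r , e) ∷ bs) {l} {K} ok at sim ρ σ refl R =
  let ok1 , ok2 = ∧⁻ {isRegister r} ok
      ok3 , ok4 = ∧⁻ {adm 0 e} ok2
      ok5 , ok6 = ∧⁻ {degree e <ᵇ maxDeg} ok4
      r≥ , r< = isRegister⁻ r ok1
      at1 , at2 = At-++ code l (compE e 0) _ at
      a1 , a2 , at3 = at2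
      F , val = computed e 0 σ ρ ok3 0<16 (<ᵇ⇒< _ maxDeg ok5) R
      τ = execs (compE e 0) σ
      G = frame-trans z≤n F (frame-write {v = 0} τ (<ᵇ⇒< 1 reg# tt))
      τ1 = write I h 1 0 τ
      v≡ = tr (ap₂ _+_ (tr (ap toℕ (write-there {0} 1 τ 0 (λ ()))) val) (write-here 1 τ (small⇒<2^w (<ᵇ⇒< 0 (2 ^ 20) tt)))) (+0 _)
      block = compE e 0 ++ const 1 0 ∷ arith add r 0 1 ∷ []
      pc2 = tr (ap suc (pc≡ G)) (tr (sym (+-suc l (costE e + 1))) (ap (l +_) (tr (sym (+-suc (costE e) 1)) refl)))
  in sim-≡ (tr (ap (λ k -> ticks k (guard (value e ρ ≤? cap) (semSet bs (upd r (value e ρ) ρ) >>= K))) (List.length-++ (compE e 0)))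
   (tr (ap (ticks (costE e + 2)) (sym (guard->>= (value e ρ ≤? cap) _ K))) (sym (ticks->>= (costE e + 2) _ K))))
   (sim-straight block σ (straights-++ (compE e 0) _ (straight-E e 0) tt) (running R)
    (At-join l (compE e 0) at1 (a1 , a2 , tt))
    (subst (Sim _) (sym (execs-++ (compE e 0) _ σ)) (sim-guard (value e ρ ≤? cap) λ v≤ ->
     sim-set bs ok6 (subst (λ k -> At code k (compileSet bs)) (tr (+-comm 2 _) (+-assoc l (costE e) 2)) at3)
      (λ ρ' σ' eq -> sim ρ' σ' (tr eq (tr (+-assoc l (costE e + 2) _) (ap (l +_) (tr (+-assoc (costE e) 2 _) (sym (List.length-++ (compE e 0))))))))
      _ _ pc2 (subst (λ v -> Rep (write I h r v τ1) (upd r (value e ρ) ρ)) (sym v≡) (rep-write r (value e ρ) (rep-frame G R) r≥ r< v≤ (cap<2^w v≤))))))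

 sim-store : ∀ b e1 e2 {l K} -> T (admC (store b e1 e2)) -> At code l (compStore b e1 e2) ->
  SimAt (l + length (compStore b e1 e2)) K -> SimAt l (λ ρ -> semStore b e1 e2 ρ >>= K)
 sim-store b e1 e2 {l} {K} ok at sim ρ σ refl R =
  let b≥ , ok1 = ∧⁻ {reg# ≤ᵇ b} ok
      b< , ok2 = ∧⁻ {b <ᵇ 2 ^ 20} ok1
      ok3 , ok4 = ∧⁻ {adm 0 e1} ok2
      deg1 , ok5 = ∧⁻ {21 + degree e1 <ᵇ maxDeg} ok4
      ok6 , deg2 = ∧⁻ {adm 1 e2} ok5
      b<' = <ᵇ⇒< b (2 ^ 20) b<
      deg1' = <ᵇ⇒< (21 + degree e1) maxDeg deg1
      F1 , val1 = computed e1 0 σ ρ ok3 0<16 (≤< (m≤n+m _ 21) deg1') R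
      τ1 = execs (compE e1 0) σ
      1<16 = <ᵇ⇒< 1 reg# tt
      F2 = frame-trans z≤n F1 (frame-write {v = b} τ1 1<16)
      τ2 = write I h 1 b τ1
      τ3 = exec0 (arith add 0 0 1) τ2
      F3 = frame-trans z≤n F2 (frame-write {v = toℕ (memory τ2 0) + toℕ (memory τ2 1)} τ2 0<16)
      eq = ap₂ _+_ (tr (ap toℕ (write-there {b} 1 τ1 0 (λ ()))) val1) (write-here 1 τ1 (small⇒<2^w b<'))
      sum≤ = add≤ {i = degree e1} {20} (value≤ R 0 e1 ok3) (lit≤ b<')
      sum< = <maxDegree⇒<2^w {k = 1 + (degree e1 + 20)} sum≤ (subst (_< maxDeg) (ap suc (+-comm 20 (degree e1))) deg1')
      addr = tr (write-here 0 τ2 (subst (_< 2 ^ w) (sym eq) sum<)) eq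
      F4 , val4 = computed e2 1 τ3 ρ ok6 1<16 (<ᵇ⇒< (degree e2) maxDeg deg2) (rep-frame F3 R)
      τ4 = execs (compE e2 1) τ3
      F = frame-trans z≤n F3 F4
      addr4 = tr (ap toℕ (frame F4 0 (inj₁ (s≤s z≤n)))) addr
      a = value e1 ρ + b
      is = compStore b e1 e2
      e≡ = tr (execs-++ (compE e1 0) _ σ) (execs-++ (compE e2 1) _ τ3)
      len≡ = tr (List.length-++ (compE e1 0)) (tr (ap (λ k -> costE e1 + suc (suc k)) (List.length-++ (compE e2 1)))
       (alg (costE e1) (length (compE e2 1))))
      pc4 = tr (ap suc (pc≡ F)) (tr (sym (+-suc l _)) (ap (l +_) (sym len≡)))
  in sim-≡ (tr (ap (ticks (length is)) (tr (ap (guard (a <? cells)) (sym (guard->>= (value e2 ρ ≤? cap) _ K))) (sym (guard->>= (a <? cells) _ K))))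
   (sym (ticks->>= (length is) _ K)))
   (sim-straight is σ (straights-++ (compE e1 0) _ (straight-E e1 0) (straights-++ (compE e2 1) _ (straight-E e2 1) tt)) (running R) at
    (subst (Sim _) (sym e≡) (sim-guard (a <? cells) λ a< -> sim-guard (value e2 ρ ≤? cap) λ v≤ ->
     sim _ _ pc4 (subst₂ (λ x v -> Rep (write I h x v τ4) (upd a (value e2 ρ) ρ)) (sym addr4) (sym val4)
      (rep-write a (value e2 ρ) (rep-frame F R) (⊑ (≤ᵇ⇒≤ reg# b b≥) (m≤n+m b _)) a< v≤ (cap<2^w v≤))))))
  where
  alg : ∀ a b -> a + suc (suc (b + 1)) ≡ suc (a + 1 + 1 + b)
  alg = ring

 jump : ∀ {l'} a b σ -> output σ ≡ nothing -> fetch code (pc σ) ≡ just (jumpz a l') ->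
  step I h code b σ ≡ record σ { pc = if toℕ (memory σ a) ≡ᵇ 0 then l' else suc (pc σ) }
 jump a b σ run fet = step-exec b σ run fet

 rep-jump : ∀ {σ ρ} l -> Rep σ ρ -> Rep (record σ { pc = l }) ρ
 rep-jump l R = record { cell = cell R ; bounded = bounded R ; used≤ = used≤ R ; running = running R }

 >>=-assoc : ∀ t J K -> (t >>= J >>= K) ≡ (t >>= λ ρ -> J ρ >>= K)
 >>=-assoc (ret ρ) J K = refl
 >>=-assoc (tick t) J K = ap tick (>>=-assoc t J K)
 >>=-assoc (flip t u) J K = ap₂ flip (>>=-assoc t J K) (>>=-assoc u J K)
 >>=-assoc accepted J K = refl
 >>=-assoc stuck J K = refl

 -- The continuation `K` stands for the rest of the program. Sequences and loops thus compose
 -- without any statement about the states in between.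
 simulates : ∀ c {l K} -> T (admC c) -> At code l (compile c l) -> SimAt (l + size c) K -> SimAt l (λ ρ -> sem c ρ >>= K)
 sim-loop : ∀ r c {l K} -> T (isRegister r) -> T (admC c) -> At code l (compile (while r c) l) ->
  SimAt (l + size (while r c)) K -> ∀ fuel -> SimAt l (λ ρ -> loop r (sem c) fuel ρ >>= K)

 simulates (set bs) ok at sim = sim-set bs ok at sim
 simulates (store b e1 e2) ok at sim = sim-store b e1 e2 ok at sim
 simulates (flip r) {l} ok (fet , _) sim ρ σ refl R =
  let r≥ , r< = isRegister⁻ r ok
      bit : ∀ b -> b ≤ 1 -> Sim _ (write I h r b σ)
      bit b b≤1 = sim _ _ (+-comm 1 l) (rep-write r b R r≥ r< (⊑ b≤1 cap≥) (≤< b≤1 (small⇒<2^w (<ᵇ⇒< 1 (2 ^ 20) tt))))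
  in running R , subst (Sim _) (sym (step-exec true σ (running R) fet)) (bit 1 rfl≤)
   , subst (Sim _) (sym (step-exec false σ (running R) fet)) (bit 0 z≤n)
 simulates (when e c) {l} {K} ok at sim ρ σ refl R =
  let ok1 , ok2 = ∧⁻ {adm 0 e} ok
      deg , ok3 = ∧⁻ {degree e <ᵇ maxDeg} ok2
      at1 , fet , at2 = At-++ code l (compE e 0) _ at
      F , val = computed e 0 σ ρ ok1 0<16 (<ᵇ⇒< _ maxDeg deg) R
      τ = execs (compE e 0) σ
      R' = rep-frame F R
      out : ∀ b -> Sim (branch (value e ρ) (ret ρ) (sem c ρ) >>= K) (step I h code b τ)
      out b = subst (Sim _) (sym (jump 0 b τ (running R') (subst (λ k -> fetch code k ≡ _) (sym (pc≡ F)) fet)))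
       (subst (λ v -> Sim (branch v (ret ρ) (sem c ρ) >>= K) (record τ { pc = if toℕ (memory τ 0) ≡ᵇ 0 then l + size (when e c) else suc (pc τ) })) val
        (cases (toℕ (memory τ 0)) at2 ok3 (pc≡ F) R'))
  in sim-≡ (tr (hoist (costE e) _) (sym (ticks->>= (suc (costE e)) _ K)))
   (sim-straight (compE e 0) σ (straight-E e 0) (running R) at1 (running R' , out))
  where
  hoist : ∀ k t -> ticks k (tick t) ≡ ticks (suc k) t
  hoist zero t = refl
  hoist (suc k) t = ap tick (hoist k t)
  cases : ∀ v {τ} -> At code (suc (l + costE e)) (compile c (suc (l + costE e))) -> T (admC c) -> pc τ ≡ l + costE e -> Rep τ ρ ->
   Sim (branch v (ret ρ) (sem c ρ) >>= K) (record τ { pc = if v ≡ᵇ 0 then l + size (when e c) else suc (pc τ) })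
  cases zero at ok pc R = sim ρ _ refl (rep-jump _ R)
  cases (suc v) at ok pc R = simulates c ok at (λ ρ' σ' eq -> sim ρ' σ' (tr eq (tr (ap suc (+-assoc l (costE e) (size c)))
   (tr (sym (+-suc l (costE e + size c))) (ap (l +_) (sym (+-suc (costE e) (size c)))))))) ρ _ (ap suc pc) (rep-jump _ R)
 simulates (while r c) ok at sim ρ =
  let ok1 , ok2 = ∧⁻ {isRegister r} ok in sim-loop r c ok1 ok2 at sim (ρ r) ρ
 simulates (c1 ⨾ c2) {l} {K} ok at sim ρ σ pc≡l R =
  let ok1 , ok2 = ∧⁻ {admC c1} ok
      at1 , at2 = At-++ code l (compile c1 l) _ at
  in sim-≡ (sym (>>=-assoc (sem c1 ρ) (sem c2) K))
   (simulates c1 ok1 at1 (simulates c2 ok2 (subst (λ k -> At code (l + k) (compile c2 (l + size c1))) (len-comp c1 l) at2)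
    (λ ρ' σ' eq -> sim ρ' σ' (tr eq (+-assoc l (size c1) (size c2))))) ρ σ pc≡l R)
 simulates accept ok (fet , _) sim ρ σ refl R =
  running R , λ b -> subst (Sim accepted) (sym (step-exec b σ (running R) fet)) (refl , used≤ R)

 sim-loop r c {l} {K} okr ok at@(fet , at1) sim fuel ρ σ refl R with ρ r in eq
 ... | zero = running R , λ b -> subst (Sim (K ρ)) (sym (jump r b σ (running R) fet))
  (sim ρ _ (ap (λ v -> if v ≡ᵇ 0 then _ else _) (tr (cell R r (proj₁ (isRegister⁻ r okr))) eq)) (rep-jump _ R))
 sim-loop r c okr ok at sim zero ρ σ refl R | suc _ = tt
 sim-loop r c {l} {K} okr ok at@(fet , at1) sim (suc fuel) ρ σ refl R | suc v = running R , λ b ->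
  subst (Sim _) (sym (jump r b σ (running R) fet))
   (sim-≡ (sym (>>=-assoc (sem c ρ) _ K))
    (simulates c ok atc again ρ _ (ap (λ v -> if v ≡ᵇ 0 then _ else _) (tr (cell R r (proj₁ (isRegister⁻ r okr))) eq)) (rep-jump _ R)))
  where
  atc = proj₁ (At-++ code (suc l) (compile c (suc l)) _ at1)
  atj : At code (suc l + size c) (const 0 0 ∷ jumpz 0 l ∷ [])
  atj = subst (λ k -> At code (suc l + k) (const 0 0 ∷ jumpz 0 l ∷ [])) (len-comp c (suc l)) (proj₂ (At-++ code (suc l) (compile c (suc l)) _ at1))
  again : SimAt (suc l + size c) (λ ρ' -> tick (tick (loop r (sem c) fuel ρ')) >>= K)
  again ρ' σ' pc≡l R' =
   let τ = write I h 0 0 σ'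
       F = frame-write {v = 0} σ' 0<16
       R'' = rep-frame F R'
       f1 , f2 , _ = atj
   in sim-straight (const 0 0 ∷ []) {tick (loop r (sem c) fuel ρ' >>= K)} σ' tt (running R') (subst (λ k -> At code k (const 0 0 ∷ [])) (sym pc≡l) (f1 , tt))
    (running R'' , λ b -> subst (Sim (loop r (sem c) fuel ρ' >>= K))
     (sym (jump 0 b τ (running R'') (subst (λ k -> fetch code (suc k) ≡ just (jumpz 0 l)) (sym pc≡l) f2)))
     (sim-loop r c okr ok at sim fuel ρ' _
      (ap (λ v -> if v ≡ᵇ 0 then l else _) (write-here 0 σ' (small⇒<2^w (<ᵇ⇒< 0 (2 ^ 20) tt)))) (rep-jump _ R'')))

 steps-halted : ∀ {b k} (coins : Vec Bool k) (σ : State w) -> output σ ≡ just b -> steps I h code coins σ ≡ σ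
 steps-halted [] σ eq = refl
 steps-halted (bit ∷ coins) σ eq = tr (ap (steps I h code coins) (step-halted bit)) (steps-halted coins σ eq)
  where
  step-halted : ∀ bit -> step I h code bit σ ≡ σ
  step-halted bit with output σ | fetch code (pc σ)
  step-halted bit | just _ | _ = refl

 Outcome : Set -> State w -> Set
 Outcome Y σ = Is-just (output σ) × used σ ≤ cells × (output σ ≡ just true -> Y)

 outcome : ∀ {Y Q d t} -> Safe Y Q d t -> ∀ σ -> Sim t σ -> (coins : Vec Bool d) -> Outcome Y (steps I h code coins σ)
 outcome {Y} (ret q) σ (out , u≤) coins = subst (Outcome Y) (sym (steps-halted coins σ out))
  (subst Is-just (sym out) (MaybeAny.just tt) , u≤ , λ eq -> refute (tr (sym out) eq) λ ())
 outcome {Y} (accepted y) σ (out , u≤) coins = subst (Outcome Y) (sym (steps-halted coins σ out))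
  (subst Is-just (sym out) (MaybeAny.just tt) , u≤ , λ _ -> y)
 outcome (tick safe) σ (_ , sim) (b ∷ coins) = outcome safe _ (sim b) coins
 outcome (flip s1 s2) σ (_ , sim , _) (true ∷ coins) = outcome s1 _ sim coins
 outcome (flip s1 s2) σ (_ , _ , sim) (false ∷ coins) = outcome s2 _ sim coins

 rejects : ∀ d -> State w -> Vec Bool d -> ℕ
 rejects d σ coins = 𝟙 (Maybe.≡-dec Bool._≟_ (output (steps I h code coins σ)) (just false))

 bits : List Bool
 bits = true ∷ false ∷ []

 count-rejections : ∀ {Y Q d t} -> Safe Y Q d t -> ∀ σ -> Sim t σ -> Ʃ (vecs bits d) (rejects d σ) ≡ rejections d t
 count-rejections {d = d} (ret {d} q) σ (out , _) = tr (Ʃ≡ (vecs bits d) (λ coins -> 𝟙-yes (Maybe.≡-dec Bool._≟_ _ (just false))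
  (tr (ap output (steps-halted coins σ out)) out))) (tr (Ʃ-const (vecs bits d) 1) (tr (*1 _) (length-vecs bits d)))
 count-rejections {d = d} (accepted y) σ (out , _) = tr (Ʃ≡ (vecs bits d) (λ coins -> 𝟙-no (Maybe.≡-dec Bool._≟_ _ (just false))
  (λ eq -> refute (tr (sym (tr (ap output (steps-halted coins σ out)) out)) eq) λ ()))) (Ʃ-0 (vecs bits d))
 count-rejections (tick {d} {t} safe) σ (_ , sim) = tr (Ʃ-vecs-suc bits d _)
  (ap₂ _+_ (count-rejections safe _ (sim true)) (ap (_+ 0) (count-rejections safe _ (sim false))))
 count-rejections (flip {d} {t} {u} s1 s2) σ (_ , sim1 , sim2) = tr (Ʃ-vecs-suc bits d _)
  (ap₂ _+_ (count-rejections s1 _ sim1) (tr (+0 _) (count-rejections s2 _ sim2)))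

 -- The last `tick` is the step in which the machine runs past the end of the code and thereby
 -- claims NO.
 sim-program : ∀ c -> T (admC c) -> code ≡ compile c 0 -> Sim (sem c (λ _ -> 0) >>= λ ρ -> tick (ret ρ)) (initial w)
 sim-program c ok refl = simulates c ok (At-self code) end (λ _ -> 0) (initial w) refl record
  { cell = λ _ _ -> toℕ-truncate (small⇒<2^w (<ᵇ⇒< 0 (2 ^ 20) tt))
  ; bounded = λ _ _ -> z≤n
  ; used≤ = z≤n
  ; running = refl
  }
  where
  step-end : ∀ b (σ : State w) -> output σ ≡ nothing -> fetch code (pc σ) ≡ nothing -> step I h code b σ ≡ record σ { output = just false }
  step-end b σ eq1 eq2 with output σ | fetch code (pc σ)
  step-end b σ refl refl | nothing | nothing = refl
  end : SimAt (size c) (λ ρ -> tick (ret ρ))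
  end ρ σ pc≡ R = running R , λ b -> subst (Sim (ret ρ))
   (sym (step-end b σ (running R) (tr (ap (fetch code) (tr pc≡ (sym (len-comp c 0)))) (fetch-end code)))) (refl , used≤ R)

-- Safety and failure probability of trees.

safe-weaken : ∀ {Y Q d d' t} -> d ≤ d' -> Safe Y Q d t -> Safe Y Q d' t
safe-weaken le (ret q) = ret q
safe-weaken (s≤s le) (tick s) = tick (safe-weaken le s)
safe-weaken (s≤s le) (flip s1 s2) = flip (safe-weaken le s1) (safe-weaken le s2)
safe-weaken le (accepted y) = accepted y

safe-map : ∀ {Y Q R d t} -> (∀ ρ -> Q ρ -> R ρ) -> Safe Y Q d t -> Safe Y R d t
safe-map f (ret q) = ret (f _ q)
safe-map f (tick s) = tick (safe-map f s)
safe-map f (flip s1 s2) = flip (safe-map f s1) (safe-map f s2)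
safe-map f (accepted y) = accepted y

safe->>= : ∀ {Y Q R d d' t K} -> Safe Y Q d t -> (∀ ρ -> Q ρ -> Safe Y R d' (K ρ)) -> Safe Y R (d + d') (t >>= K)
safe->>= {d = d} (ret q) f = safe-weaken (m≤n+m _ d) (f _ q)
safe->>= (tick s) f = tick (safe->>= s f)
safe->>= (flip s1 s2) f = flip (safe->>= s1 f) (safe->>= s2 f)
safe->>= (accepted y) f = accepted y

safe-ticks : ∀ {Y Q d t} k -> Safe Y Q d t -> Safe Y Q (k + d) (ticks k t)
safe-ticks zero s = s
safe-ticks (suc k) s = tick (safe-ticks k s)

-- The depth bound of `Safe` alone, by recursion on the tree so that it passes to subtrees.
Depth : ℕ -> Tree -> Set
Depth d (ret ρ) = ⊤
Depth d accepted = ⊤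
Depth d stuck = ⊤
Depth zero (tick t) = ⊥
Depth zero (flip t u) = ⊥
Depth (suc d) (tick t) = Depth d t
Depth (suc d) (flip t u) = Depth d t × Depth d u

safe⇒depth : ∀ {Y Q d t} -> Safe Y Q d t -> Depth d t
safe⇒depth (ret q) = tt
safe⇒depth (tick s) = safe⇒depth s
safe⇒depth (flip s1 s2) = safe⇒depth s1 , safe⇒depth s2
safe⇒depth (accepted y) = tt

-- The probability that a tree does not accept is at most x / y.
Fails : ℕ -> ℕ -> Tree -> Set
Fails x y t = ∀ d -> Depth d t -> rejections d t * y ≤ x * 2 ^ d

rejections≤ : ∀ d t -> rejections d t ≤ 2 ^ d
rejections≤ d (ret ρ) = rfl≤
rejections≤ d accepted = z≤n
rejections≤ d stuck = rfl≤
rejections≤ zero (tick t) = rfl≤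
rejections≤ zero (flip t u) = rfl≤
rejections≤ (suc d) (tick t) = *ʳ 2 (rejections≤ d t)
rejections≤ (suc d) (flip t u) = +≤ (rejections≤ d t) (⊑ (rejections≤ d u) (leq (sym (+0 _))))

fails-any : ∀ {x y} t -> y ≤ x -> Fails x y t
fails-any {x} t y≤x d _ = ⊑ (*≤ (rejections≤ d t) y≤x) (leq (*-comm (2 ^ d) x))

fails-tick : ∀ {x y t} -> Fails x y t -> Fails x y (tick t)
fails-tick {x} {y} {t} f (suc d) dep = begin _ ≡⟨ *-assoc 2 (rejections d t) y ⟩
 _ ≤⟨ *ʳ 2 {rejections d t * y} (f d dep) ⟩
 _ ≡⟨ alg 2 x (2 ^ d) ⟩ _ ∎
 where
 open ≤R
 alg : ∀ a b c -> a * (b * c) ≡ b * (a * c)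
 alg = ring

fails-ticks : ∀ {x y t} k -> Fails x y t -> Fails x y (ticks k t)
fails-ticks zero f = f
fails-ticks {x} {y} {t} (suc k) f = fails-tick {x} {y} {ticks k t} (fails-ticks {x} {y} {t} k f)

fails-flip : ∀ {x x' y t u} -> Fails x y t -> Fails x' y u -> Fails (x + x') (2 * y) (flip t u)
fails-flip {x} {x'} {y} {t} {u} f g (suc d) (p , q) = begin _ ≡⟨ distrib (rejections d t) (rejections d u) y ⟩
 _ ≤⟨ *ʳ 2 (+≤ {rejections d t * y} {x * 2 ^ d} {rejections d u * y} {x' * 2 ^ d} (f d p) (g d q)) ⟩
 _ ≡⟨ distrib' x x' (2 ^ d) ⟩ _ ∎
 where
 open ≤R
 distrib : ∀ a b y -> (a + b) * (2 * y) ≡ 2 * (a * y + b * y)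
 distrib = ring
 distrib' : ∀ a b z -> 2 * (a * z + b * z) ≡ (a + b) * (2 * z)
 distrib' = ring

-- `Fails` speaks of every sufficient number of coins, so a prefix may use up any number of them
-- before the bound for the continuation applies.
fails->>= : ∀ {Y Q d x y t K} -> Safe Y Q d t -> (∀ ρ -> Q ρ -> Fails x y (K ρ)) -> Fails x y (t >>= K)
fails->>= (ret q) f = f _ q
fails->>= {x = x} {y} {tick t} {K} (tick s) f = fails-tick {x} {y} {t >>= K} (fails->>= {x = x} {y} {t} {K} s f)
fails->>= {x = x} {y} {flip t u} {K} (flip s1 s2) f (suc d) (p , q) =
 ⊑ (leq (*-distribʳ-+ y (rejections d (t >>= K)) _))
  (⊑ (+≤ (fails->>= {x = x} {y} {t} {K} s1 f d p) (fails->>= {x = x} {y} {u} {K} s2 f d q)) (leq (double x (2 ^ d))))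
 where
 double : ∀ x z -> x * z + x * z ≡ x * (2 * z)
 double = ring
fails->>= (accepted y) f d _ = z≤n

>>=-assoc' : ∀ t (K L : Env -> Tree) -> (t >>= K >>= L) ≡ (t >>= λ ρ -> K ρ >>= L)
>>=-assoc' (ret ρ) K L = refl
>>=-assoc' (tick t) K L = ap tick (>>=-assoc' t K L)
>>=-assoc' (flip t u) K L = ap₂ flip (>>=-assoc' t K L) (>>=-assoc' u K L)
>>=-assoc' accepted K L = refl
>>=-assoc' stuck K L = refl

-- Continuing can only turn non-accepting runs into accepting ones.
fails->>=ˡ : ∀ {x y} t {K} -> Fails x y t -> Fails x y (t >>= K)
fails->>=ˡ {x} {y} t {K} f d dep = let dep' , le = prefix d t dep in ⊑ (*ˡ y le) (f d dep')
 where
 prefix : ∀ d t -> Depth d (t >>= K) -> Depth d t × rejections d (t >>= K) ≤ rejections d t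
 prefix d (ret ρ) dep = tt , rejections≤ d (K ρ)
 prefix d accepted dep = tt , rfl≤
 prefix d stuck dep = tt , rfl≤
 prefix (suc d) (tick t) dep = let p , le = prefix d t dep in p , *ʳ 2 le
 prefix (suc d) (flip t u) (dep1 , dep2) =
  let p , le = prefix d t dep1 ; p' , le' = prefix d u dep2 in (p , p') , +≤ le le'

-- Environments and rules for commands.

upd-here : ∀ r v (ρ : Env) -> upd r v ρ r ≡ v
upd-here r v ρ with r ≡ᵇ r in eq
... | true = refl
... | false = ⊥-elim (subst T eq (≡⇒≡ᵇ r r refl))

upd-there : ∀ {r v} (ρ : Env) {a} -> a ≢ r -> upd r v ρ a ≡ ρ a
upd-there {r} ρ {a} a≢r with a ≡ᵇ r in eq
... | true = refute (≡ᵇ⇒≡ a r (subst T (sym eq) tt)) a≢r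
... | false = refl

-- The cells outside [lo , hi).
Outside : Addr -> Addr -> Addr -> Set
Outside lo hi a = a < lo ⊎ hi ≤ a

Keep : Addr -> Addr -> Env -> Env -> Set
Keep lo hi ρ ρ' = ∀ a -> Outside lo hi a -> ρ' a ≡ ρ a

keep-refl : ∀ {lo hi ρ} -> Keep lo hi ρ ρ
keep-refl a _ = refl

keep-trans : ∀ {lo hi ρ ρ' ρ''} -> Keep lo hi ρ ρ' -> Keep lo hi ρ' ρ'' -> Keep lo hi ρ ρ''
keep-trans k k' a out = tr (k' a out) (k a out)

outside-widen : ∀ {lo lo' hi hi' a} -> lo' ≤ lo -> hi ≤ hi' -> Outside lo' hi' a -> Outside lo hi a
outside-widen lo≤ hi≤ (inj₁ a<) = inj₁ (<≤ a< lo≤)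
outside-widen lo≤ hi≤ (inj₂ a≥) = inj₂ (⊑ hi≤ a≥)

keep-widen : ∀ {lo lo' hi hi' ρ ρ'} -> lo' ≤ lo -> hi ≤ hi' -> Keep lo hi ρ ρ' -> Keep lo' hi' ρ ρ'
keep-widen lo≤ hi≤ k a out = k a (outside-widen lo≤ hi≤ out)

keep-upd : ∀ {lo hi} r {v ρ} -> lo ≤ r -> r < hi -> Keep lo hi ρ (upd r v ρ)
keep-upd r {ρ = ρ} lo≤ <hi a (inj₁ a<) = upd-there ρ (<⇒≢ (<≤ a< lo≤))
keep-upd r {ρ = ρ} lo≤ <hi a (inj₂ a≥) = upd-there ρ (λ eq -> <⇒≢ (<≤ <hi a≥) (sym eq))

within : Addr -> Addr -> List (Addr × Exp) -> Bool
within lo hi [] = true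
within lo hi ((r , e) ∷ bs) = (lo ≤ᵇ r) ∧ (r <ᵇ hi) ∧ within lo hi bs

costSet : List (Addr × Exp) -> ℕ
costSet [] = 0
costSet ((r , e) ∷ bs) = costE e + 2 + costSet bs

-- Every straight command is charged the same `u`; its actual length is compared with 2000 by
-- evaluation.
module Rules {n m : ℕ} (I : Input n m) (h : RandomFunction n m) (cap cells : ℕ) (Y : Set) (u : ℕ) (u≥ : 2000 ≤ u) where

 open Semantics I h cap cells public

 runSet : List (Addr × Exp) -> Env -> Env
 runSet [] ρ = ρ
 runSet ((r , e) ∷ bs) ρ = runSet bs (upd r (value e ρ) ρ)

 Fits : List (Addr × Exp) -> Env -> Set
 Fits [] ρ = ⊤
 Fits ((r , e) ∷ bs) ρ = value e ρ ≤ cap × Fits bs (upd r (value e ρ) ρ)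

 keep-runSet : ∀ {lo hi} bs {_ : T (within lo hi bs)} ρ -> Keep lo hi ρ (runSet bs ρ)
 keep-runSet [] ρ = keep-refl
 keep-runSet {lo} {hi} ((r , e) ∷ bs) {ok} ρ =
  let p , ok' = ∧⁻ {lo ≤ᵇ r} ok ; q , ok'' = ∧⁻ {r <ᵇ hi} ok'
  in keep-trans {lo} {hi} {ρ} {upd r (value e ρ) ρ} {runSet bs (upd r (value e ρ) ρ)} (keep-upd r {value e ρ} {ρ} (≤ᵇ⇒≤ lo r p) (<ᵇ⇒< r hi q)) (keep-runSet bs {ok''} _)

 safe-guard : ∀ {P : Set} {Q d t} (dec : Dec P) -> P -> Safe Y Q d t -> Safe Y Q d (guard dec t)
 safe-guard (yes _) p s = s
 safe-guard (no ¬p) p s = refute p ¬p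

 safe-set' : ∀ bs ρ {Q} -> Fits bs ρ -> Q (runSet bs ρ) -> Safe Y Q (costSet bs) (sem (set bs) ρ)
 safe-set' [] ρ _ q = ret q
 safe-set' ((r , e) ∷ bs) ρ (v≤ , fs) q = safe-ticks (costE e + 2) (safe-guard (value e ρ ≤? cap) v≤ (safe-set' bs _ fs q))

 safe-store' : ∀ b e1 e2 ρ {Q} -> value e1 ρ + b < cells -> value e2 ρ ≤ cap -> Q (upd (value e1 ρ + b) (value e2 ρ) ρ) ->
  Safe Y Q (length (compStore b e1 e2) + 0) (sem (store b e1 e2) ρ)
 safe-store' b e1 e2 ρ a< v≤ q = safe-ticks (length (compStore b e1 e2))
  (safe-guard (value e1 ρ + b <? cells) a< (safe-guard (value e2 ρ ≤? cap) v≤ (ret q)))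

 safe-when' : ∀ e c ρ {Q d} -> (value e ρ ≡ 0 -> Q ρ) -> (0 < value e ρ -> Safe Y Q d (sem c ρ)) -> Safe Y Q (suc (costE e) + d) (sem (when e c) ρ)
 safe-when' e c ρ z p = safe-ticks (suc (costE e)) (go (value e ρ) z p)
  where
  go : ∀ v {Q d} -> (v ≡ 0 -> Q ρ) -> (0 < v -> Safe Y Q d (sem c ρ)) -> Safe Y Q d (branch v (ret ρ) (sem c ρ))
  go zero z p = ret (z refl)
  go (suc v) z p = p (s≤s z≤n)

 loop-zero : ∀ r body fuel ρ -> ρ r ≡ 0 -> loop r body fuel ρ ≡ tick (ret ρ)
 loop-zero r body fuel ρ eq with ρ r
 loop-zero r body fuel ρ refl | zero = refl

 loop-suc : ∀ r body fuel ρ -> 0 < ρ r -> loop r body (suc fuel) ρ ≡ tick (body ρ >>= λ ρ' -> tick (tick (loop r body fuel ρ')))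
 loop-suc r body fuel ρ pos with ρ r
 loop-suc r body fuel ρ pos | suc _ = refl

 -- Inv k bounds the number of remaining iterations by k.
 safe-loop : ∀ r body (Inv : ℕ -> Env -> Set) d -> (∀ {ρ} -> Inv 0 ρ -> ρ r ≡ 0) ->
  (∀ k ρ -> Inv (suc k) ρ -> 0 < ρ r -> Safe Y (λ ρ' -> Inv k ρ' × ρ' r < ρ r) d (body ρ)) ->
  ∀ k fuel ρ -> ρ r ≤ fuel -> Inv k ρ -> Safe Y (λ ρ' -> ∃ λ k -> Inv k ρ' × ρ' r ≡ 0) (suc (k * (d + 3))) (loop r body fuel ρ)
 safe-loop r body Inv d done iter k fuel ρ ≤fuel inv with ρ r in eq
 ... | zero = tick (ret (k , inv , eq))
 safe-loop r body Inv d done iter zero fuel ρ ≤fuel inv | suc v = refute (tr (sym eq) (done inv)) λ ()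
 safe-loop r body Inv d done iter (suc k) (suc fuel) ρ ≤fuel inv | suc v =
  tick (safe-weaken (leq (alg d k)) (safe->>= (iter k ρ inv (subst (0 <_) (sym eq) (s≤s z≤n)))
   λ ρ' (inv' , lt) -> tick (tick (safe-loop r body Inv d done iter k fuel ρ' (s≤s⁻¹ (⊑ lt (⊑ (leq eq) ≤fuel))) inv'))))
  where
  alg : ∀ d k -> d + (2 + suc (k * (d + 3))) ≡ suc k * (d + 3)
  alg = ring

 safe-count' : ∀ r c (J : ℕ -> Env -> Set) d ->
  (∀ k ρ -> ρ r ≡ suc k -> J (suc k) ρ -> Safe Y (λ ρ' -> ρ' r ≡ k × J k ρ') d (sem c ρ)) ->
  ∀ k ρ -> ρ r ≡ k -> J k ρ -> Safe Y (λ ρ' -> ρ' r ≡ 0 × J 0 ρ') (suc (k * (d + 3))) (sem (while r c) ρ)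
 safe-count' r c J d iter k ρ eq j = safe-map (λ { ρ' (k , (eq , j) , eq') -> eq' , subst (λ k -> J k ρ') (tr (sym eq) eq') j })
  (safe-loop r (sem c) (λ k ρ -> ρ r ≡ k × J k ρ) d proj₁
   (λ k ρ (eq , j) _ -> safe-map (λ { ρ' (eq' , j') -> (eq' , j') , leq (tr (ap suc eq') (sym eq)) }) (iter k ρ eq j)) k (ρ r) ρ rfl≤ (eq , j))

 safe-set : ∀ bs {_ : T (costSet bs ≤ᵇ 2000)} ρ {Q : Env -> Set} -> Fits bs ρ -> Q (runSet bs ρ) -> Safe Y Q u (sem (set bs) ρ)
 safe-set bs {ok} ρ fs q = safe-weaken (⊑ (≤ᵇ⇒≤ _ 2000 ok) u≥) (safe-set' bs ρ fs q)

 safe-store : ∀ b e1 e2 {_ : T (length (compStore b e1 e2) + 0 ≤ᵇ 2000)} ρ {Q : Env -> Set} -> value e1 ρ + b < cells -> value e2 ρ ≤ cap ->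
  Q (upd (value e1 ρ + b) (value e2 ρ) ρ) -> Safe Y Q u (sem (store b e1 e2) ρ)
 safe-store b e1 e2 {ok} ρ a< v≤ q = safe-weaken (⊑ (≤ᵇ⇒≤ _ 2000 ok) u≥) (safe-store' b e1 e2 ρ a< v≤ q)

 safe-when : ∀ e c {_ : T (suc (costE e) ≤ᵇ 2000)} ρ {Q : Env -> Set} {d} -> (value e ρ ≡ 0 -> Q ρ) -> (0 < value e ρ -> Safe Y Q d (sem c ρ)) -> Safe Y Q (u + d) (sem (when e c) ρ)
 safe-when e c {ok} ρ z p = safe-weaken (+ˡ _ (⊑ (≤ᵇ⇒≤ _ 2000 ok) u≥)) (safe-when' e c ρ z p)

 module _ (x y : ℕ) where

  fails-by-refl : ∀ {t t'} -> t ≡ t' -> Fails x y t' -> Fails x y t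
  fails-by-refl refl f = f

  -- Passing over the iterations before the one that is likely to accept.
  fails-loop-here : ∀ r body fuel ρ -> 0 < ρ r -> ρ r ≤ fuel -> Fails x y (body ρ) -> Fails x y (loop r body fuel ρ)
  fails-loop-here r body zero ρ pos ≤fuel f = refute (⊑ pos ≤fuel) λ ()
  fails-loop-here r body (suc fuel) ρ pos ≤fuel f = fails-by-refl (loop-suc r body fuel ρ pos) (fails-tick {x} {y} {body ρ >>= _} (fails->>=ˡ {x} {y} (body ρ) f))

  fails-loop-later : ∀ r body fuel ρ {Q : Env -> Set} {d} -> 0 < ρ r -> ρ r ≤ fuel -> Safe Y (λ ρ' -> Q ρ' × ρ' r < ρ r) d (body ρ) ->
   (∀ fuel ρ' -> ρ' r ≤ fuel -> Q ρ' -> Fails x y (loop r body fuel ρ')) -> Fails x y (loop r body fuel ρ)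
  fails-loop-later r body zero ρ pos ≤fuel s f = refute (⊑ pos ≤fuel) λ ()
  fails-loop-later r body (suc fuel) ρ pos ≤fuel s f = fails-by-refl (loop-suc r body fuel ρ pos) (fails-tick {x} {y} {body ρ >>= _}
   (fails->>= {x = x} {y} {body ρ} s λ ρ' (q , lt) -> fails-ticks {x} {y} {loop r body fuel ρ'} 2 (f fuel ρ' (s≤s⁻¹ (⊑ lt ≤fuel)) q)))

 -- The hypothesis on the body holds for arbitrary continuations, so the failure ratio of one
 -- iteration multiplies that of all later ones.
 fails-power : ∀ r body a A (J : Env -> Set) ->
  (∀ k ρ x y K -> ρ r ≡ suc k -> J ρ -> (∀ ρ' -> ρ' r ≡ k -> J ρ' -> Fails x y (K ρ')) -> Fails (a * x) (A * y) (body ρ >>= K)) ->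
  ∀ k ρ -> ρ r ≡ k -> J ρ -> Fails (a ^ k) (A ^ k) (loop r body k ρ)
 fails-power r body a A J iter zero ρ eq j = fails-any {1} {1} (loop r body 0 ρ) rfl≤
 fails-power r body a A J iter (suc k) ρ eq j = fails-by-refl (a ^ suc k) (A ^ suc k) (loop-suc r body k ρ (subst (0 <_) (sym eq) (s≤s z≤n)))
  (fails-tick {a ^ suc k} {A ^ suc k} {body ρ >>= _} (iter k ρ (a ^ k) (A ^ k) _ eq j
   λ ρ' eq' j' -> fails-ticks {a ^ k} {A ^ k} {loop r body k ρ'} 2 (fails-power r body a A J iter k ρ' eq' j')))

-- The program.

pattern rL = 16
pattern rD = 17
pattern rW = 18
pattern rM = 19
pattern rC = 20
pattern rGG = 21
pattern rG1 = 22
pattern rG2 = 23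
pattern rQ = 24
pattern rRC = 25
pattern rI = 26
pattern rV = 27
pattern rB = 28
pattern rBit = 29
pattern rK = 30
pattern rU = 31
pattern rST = 32
pattern rT = 33
pattern rLU = 34
pattern rHit = 35
pattern rLB = 36
pattern rLC = 37
pattern rBK = 38
pattern rX = 39
pattern rLX = 40
pattern rDX = 41
pattern rDU = 42

infixl 6 _⊕_ _⊟_
infixl 7 _⊗_ _⊘_ _⊙_

_⊕_ _⊟_ _⊗_ _⊘_ _⊙_ : Exp -> Exp -> Exp
_⊕_ = bin add
_⊟_ = bin sub
_⊗_ = bin mul
_⊘_ = bin div
_⊙_ = bin rem

n' m' s' p' : Exp
n' = prm n-param
m' = prm m-param
s' = prm s-param
p' = prm p-param

-- Both lists are read and the parity of the vertex selects one value by multiplication, which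
-- avoids a branch.
labelE : Addr -> Exp
labelE r = rd x-list ((reg r ⊕ reg rG1) ⊙ n') ⊗ (lit 1 ⊟ reg r ⊙ lit 2) ⊕ rd y-list ((reg r ⊕ reg rG2) ⊙ n') ⊗ (reg r ⊙ lit 2)

-- The final product with 0 makes the value agree literally with `poly`.
polyE : Exp -> Exp
polyE v = reg 64 ⊕ v ⊗ (reg 65 ⊕ v ⊗ (reg 66 ⊕ v ⊗ (reg 67 ⊕ v ⊗ lit 0)))

stepE : Addr -> Exp
stepE r = (rd h-fun (reg r) ⊕ polyE (reg r) ⊙ reg rM ⊗ n' ⊘ reg rM) ⊙ n'

offsetE : Exp
offsetE = (reg rU ⊕ reg 68 ⊙ n') ⊙ n'

-- Cells 64 to 67 hold the coefficients of the hash, 68 the offset, and at most `2 s` starts follow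
-- from 69 on. The table begins `2 s` cells later, with a start and a length for each slot.
slotE : Exp
slotE = s' ⊕ s' ⊕ (reg rBK ⊕ reg rBK)

-- `rHit` is positive exactly if the new vertex lies in the stopping interval; it then clears the
-- counter `rT` and so ends the loop.
walkBody : List (Addr × Exp)
walkBody =
 (rLB , labelE rU) ∷ (rU , stepE rLB) ∷ (rLU , reg rLU ⊕ lit 1) ∷ (rHit , reg rD ⊟ offsetE) ∷ (rT , (reg rT ⊟ lit 1) ⊗ (lit 1 ⊟ reg rHit)) ∷ []

labels : List (Addr × Exp)
labels = (rLB , labelE rX) ∷ (rLC , labelE rU) ∷ []

-- Positive exactly if the labels agree and the parities differ, so that one label comes from each
-- list.
matchE : Exp
matchE = (lit 1 ⊟ ((reg rLB ⊟ reg rLC) ⊕ (reg rLC ⊟ reg rLB))) ⊗ ((reg rX ⊕ reg rU) ⊙ lit 2)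

-- The walk with more steps left moves.
advance : List (Addr × Exp)
advance =
 (rDX , lit 1 ⊟ (reg rLU ⊟ reg rLX)) ∷ (rDU , lit 1 ⊟ (reg rLX ⊟ reg rLU)) ∷
 (rX , reg rX ⊗ (lit 1 ⊟ reg rDX) ⊕ stepE rLB ⊗ reg rDX) ∷ (rU , reg rU ⊗ (lit 1 ⊟ reg rDU) ⊕ stepE rLC ⊗ reg rDU) ∷
 (rLX , reg rLX ⊟ reg rDX) ∷ (rLU , reg rLU ⊟ reg rDU) ∷ (rT , reg rT ⊟ lit 1) ∷ []

compareBody : Cmd
compareBody = set labels ⨾ when matchE accept ⨾ set advance

startWalk : List (Addr × Exp)
startWalk = (rK , reg rK ⊟ lit 1) ∷ (rST , ld 69 (reg rK) ⊙ n') ∷ (rU , reg rST) ∷ (rLU , lit 0) ∷ (rHit , lit 0) ∷ (rT , reg rL ⊕ reg rL) ∷ []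

-- The table is never cleared, so a slot may hold data of an earlier round or of a walk that has
-- nothing to do with the present one. The remainders make any content a legal start and length.
-- Wrong data cost time but cannot cause a false YES, since only equal labels are accepted.
recall : List (Addr × Exp)
recall = (rBK , offsetE ⊙ s') ∷ (rX , ld 69 slotE ⊙ n') ∷ (rLX , ld 70 slotE ⊙ (reg rL ⊕ reg rL ⊕ lit 1)) ∷ []

restart : List (Addr × Exp)
restart = (rU , reg rST) ∷ (rT , reg rL ⊕ reg rL) ∷ []

revisit : Cmd
revisit = set recall ⨾ store 69 slotE (reg rST) ⨾ store 70 slotE (reg rLU) ⨾ set restart ⨾ while rT compareBody

pathBody : Cmd
pathBody = set startWalk ⨾ while rT (set walkBody) ⨾ when (reg rHit) revisit

paths : Cmd
paths = set ((rK , reg rQ ⊕ reg rQ) ∷ []) ⨾ while rK pathBody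

wordBody : Cmd
wordBody = flip rBit ⨾ set ((rV , reg rV ⊕ reg rV ⊕ reg rBit) ∷ (rB , reg rB ⊟ lit 1) ∷ [])

fillBody : Cmd
fillBody = set ((rV , lit 0) ∷ (rB , reg rW) ∷ []) ⨾ while rB wordBody ⨾ store 64 (lit 5 ⊕ (reg rQ ⊕ reg rQ) ⊟ reg rI) (reg rV) ⨾ set ((rI , reg rI ⊟ lit 1) ∷ [])

fill : Cmd
fill = set ((rI , lit 5 ⊕ (reg rQ ⊕ reg rQ)) ∷ []) ⨾ while rI fillBody

round : Cmd
round = fill ⨾ paths ⨾ set ((rRC , reg rRC ⊟ lit 1) ∷ [])

level : Cmd
level = set ((rRC , lit 1 ⊕ p' ⊘ reg rQ) ∷ []) ⨾ while rRC round ⨾ set ((rQ , reg rQ ⊘ lit 2) ∷ [])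

alignment : Cmd
alignment = set ((rG1 , reg rGG ⊙ lit 2) ∷ (rG2 , (reg rGG ⊟ lit 1) ⊘ lit 2) ∷ (rQ , s') ∷ []) ⨾ while rQ level ⨾ set ((rGG , reg rGG ⊟ lit 1) ∷ [])

lengthBody : List (Addr × Exp)
lengthBody = (rL , reg rL ⊕ (lit 1 ⊟ (s' ⊗ p' ⊗ ((lit 1 ⊕ reg rL) ⊗ (lit 1 ⊕ reg rL)) ⊗ lit 8192 ⊟ n' ⊗ n'))) ∷ (rC , reg rC ⊟ lit 1) ∷ []

-- `rC` is halved down to 0 while the modulus doubles, which leaves a modulus above the initial `rC`
-- by at most a factor 2.
widthBody : List (Addr × Exp)
widthBody = (rM , reg rM ⊕ reg rM) ∷ (rW , reg rW ⊕ lit 1) ∷ (rC , reg rC ⊘ lit 2) ∷ []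

setup : Cmd
setup = set ((rL , lit 1) ∷ (rC , n') ∷ []) ⨾ while rC (set lengthBody) ⨾
 set ((rM , lit 1) ∷ (rW , lit 0) ∷ (rC , lit 8 ⊗ (n' ⊗ n') ⊗ (m' ⊗ m' ⊗ m')) ∷ []) ⨾ while rC (set widthBody) ⨾
 set ((rD , lit 1 ⊕ n' ⊘ (reg rL ⊗ lit 144)) ∷ (rGG , lit 6) ∷ [])

program : Cmd
program = setup ⨾ while rGG alignment

program-admissible : T (admC program)
program-admissible = tt

-- Correctness of one round.

rem≡ : ∀ a b .{{_ : NonZero b}} -> ⟦ rem ⟧ a b ≡ a % b
rem≡ a (suc b) = refl

div≡ : ∀ a b .{{_ : NonZero b}} -> ⟦ div ⟧ a b ≡ a / b
div≡ a (suc b) = refl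

%2-cases : ∀ a -> a % 2 ≡ 0 ⊎ a % 2 ≡ 1
%2-cases a with a % 2 | m%n<n a 2
... | 0 | _ = inj₁ refl
... | 1 | _ = inj₂ refl
... | suc (suc _) | s≤s (s≤s ())

entry≤ : ∀ {k l} (z : Vec (Fin k) l) i -> entry z i ≤ k
entry≤ {l = l} z i with i <? l
... | yes i<l = <⇒≤ (Fin.toℕ<n (Vec.lookup z (fromℕ< i<l)))
... | no _ = z≤n

entry-just : ∀ {k l} (z : Vec (Fin k) l) i -> i < l -> ∃ λ j -> entry z i ≡ toℕ (Vec.lookup z j)
entry-just {l = l} z i i<l with i <? l
... | yes i<l' = fromℕ< i<l' , refl
... | no i≮l = refute i<l i≮l

record Setting : Set where
 field
  n m s ℓ : ℕ
  {{n≢0}} : NonZero n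
  {{m≢0}} : NonZero m
  {{s≢0}} : NonZero s
  {{ℓ≢0}} : NonZero ℓ
  p : ℕ
  x y : Vec (Fin m) n
  h : Vec (Fin n) m
  cap cells u : ℕ
  W Δ : ℕ
  u≥ : 2000 ≤ u
  n<cap : n < cap
  m≤cap : m ≤ cap
  s≤cap : 5 + (s + s) ≤ cap
  p<cap : p < cap
  Δ≤cap : Δ ≤ cap
  ℓ≤cap : ℓ + ℓ + 1 ≤ cap
  W≤cap : W ≤ cap
  2^W≤cap : 2 ^ W ≤ cap
  cells≥ : 70 + (s + s + (s + s)) ≤ cells
  s<2^W : s < 2 ^ W

-- The environment ρ₀ holds the random words of a round.
record Registers (setting : Setting) : Set where
 open Setting setting using (s; ℓ; Δ; W)
 field
  ρ0 : Env
  g1 g2 q : ℕ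
  L≡ : ρ0 rL ≡ ℓ
  D≡ : ρ0 rD ≡ Δ
  M≡ : ρ0 rM ≡ 2 ^ W
  G1≡ : ρ0 rG1 ≡ g1
  G2≡ : ρ0 rG2 ≡ g2
  Q≡ : ρ0 rQ ≡ q
  q≤s : q ≤ s

module Walker {setting : Setting} (registers : Registers setting) where

 open Registers registers
 open Setting setting using (n; m; s; ℓ; n≢0; m≢0; s≢0; ℓ≢0; p; x; y; h; cap; cells; u; u≥; W; Δ; m≤cap; Δ≤cap; ℓ≤cap; cells≥)

 width : ℕ
 width = 2 ^ W

 instance
  width≢0 : NonZero width
  width≢0 = m^n≢0 2 W

 n≤cap : n ≤ cap
 n≤cap = <⇒≤ (Setting.n<cap setting)

 s≤cap : s + s ≤ cap
 s≤cap = ⊑ (m≤n+m (s + s) 5) (Setting.s≤cap setting)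

 open Rules (input s p x y) h cap cells (NotDisjoint x y) u u≥
 open Labelling x y g1 g2 using (label)

 α : Vec ℕ 4
 α = ρ0 64 ∷ ρ0 65 ∷ ρ0 66 ∷ ρ0 67 ∷ []

 next offset start : ℕ -> ℕ
 next v = (entry h (label v) + hash n width m α (label v)) % n
 offset v = (v + toℕ (ρ0 68 mod n)) % n
 start κ = ρ0 (69 + κ) % n

 Ctx : Env -> Set
 Ctx ρ = ∀ a -> a < 26 ⊎ (64 ≤ a × a < 69 + (s + s)) -> ρ a ≡ ρ0 a

 ctx-keep : ∀ {ρ ρ'} -> Keep 26 64 ρ ρ' -> Ctx ρ -> Ctx ρ'
 ctx-keep k c a (inj₁ a<) = tr (k a (inj₁ a<)) (c a (inj₁ a<))
 ctx-keep k c a (inj₂ (a≥ , a<)) = tr (k a (inj₂ a≥)) (c a (inj₂ (a≥ , a<)))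

 ctx-upd : ∀ r {_ : T ((26 ≤ᵇ r) ∧ (r <ᵇ 64))} {v ρ} -> Ctx ρ -> Ctx (upd r v ρ)
 ctx-upd r {ok} {v} {ρ} c = let p , q = ∧⁻ {26 ≤ᵇ r} ok in ctx-keep {ρ} (keep-upd r {v} {ρ} (≤ᵇ⇒≤ 26 r p) (<ᵇ⇒< r 64 q)) c

 low : ∀ a {_ : T (a <ᵇ 26)} -> a < 26 ⊎ (64 ≤ a × a < 69 + (s + s))
 low a {ok} = inj₁ (<ᵇ⇒< a 26 ok)

 word : ∀ i {_ : T (i <ᵇ 5)} -> 64 + i < 26 ⊎ (64 ≤ 64 + i × 64 + i < 69 + (s + s))
 word i {ok} = inj₂ (m≤m+n 64 i , ⊑ (+ʳ 64 (<ᵇ⇒< i 5 ok)) (m≤m+n 69 (s + s)))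

 label≤m : ∀ v -> label v ≤ m
 label≤m v with v % 2 ≡ᵇ 0
 ... | true = entry≤ x _
 ... | false = entry≤ y _

 label-value : ∀ ρ r -> Ctx ρ -> value (labelE r) ρ ≡ label (ρ r)
 label-value ρ r c = tr (ap₂ (λ i j -> entry x i * (1 ∸ ρ r % 2) + entry y j * (ρ r % 2))
  (tr (rem≡ _ n) (ap (λ g -> (ρ r + g) % n) (tr (c rG1 (low rG1)) G1≡)))
  (tr (rem≡ _ n) (ap (λ g -> (ρ r + g) % n) (tr (c rG2 (low rG2)) G2≡))))
  (choose (ρ r) (entry x ((ρ r + g1) % n)) (entry y ((ρ r + g2) % n)))
  where
  choose : ∀ v a b -> a * (1 ∸ v % 2) + b * (v % 2) ≡ (if v % 2 ≡ᵇ 0 then a else b)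
  choose v a b with v % 2 | %2-cases v
  ... | _ | inj₁ refl = tr (ap₂ _+_ (*1 a) (*-zeroʳ b)) (+0 a)
  ... | _ | inj₂ refl = tr (ap₂ _+_ (*-zeroʳ a) (*1 b)) refl

 step-value : ∀ ρ r v -> Ctx ρ -> ρ r ≡ label v -> value (stepE r) ρ ≡ next v
 step-value ρ r v c eq = tr (rem≡ _ n) (ap (_% n) (ap₂ _+_ (ap (entry h) eq) (tr (div≡' (c rM (low rM)))
  (ap (λ k -> k % width * n / width) (tr (ap₂ (λ a w -> a + w) (c 64 (word 0)) (ap₂ _*_ eq (ap₂ _+_ (c 65 (word 1)) (ap₂ _*_ eq (ap₂ _+_ (c 66 (word 2)) (ap₂ _*_ eq (ap₂ _+_ (c 67 (word 3)) (ap (_* 0) eq)))))))) refl)))))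
  where
  div≡' : ∀ {w k} -> w ≡ ρ0 rM -> ⟦ div ⟧ (⟦ rem ⟧ k w * n) w ≡ k % width * n / width
  div≡' {k = k} eq = tr (ap (λ w -> ⟦ div ⟧ (⟦ rem ⟧ k w * n) w) (tr eq M≡))
   (tr (div≡ (⟦ rem ⟧ k width * n) width) (ap (λ r -> r * n / width) (rem≡ k width)))

 step<n : ∀ v -> next v < n
 step<n v = m%n<n _ n

 offset-value : ∀ ρ -> Ctx ρ -> value offsetE ρ ≡ offset (ρ rU)
 offset-value ρ c = tr (rem≡ _ n) (ap (λ k -> (ρ rU + k) % n) (tr (rem≡ (ρ 68) n) (tr (ap (_% n) (c 68 (word 4))) (sym (Fin.toℕ-fromℕ< (m%n<n (ρ0 68) n))))))

 2ℓ : ℕ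
 2ℓ = 2 * ℓ

 2ℓ≡ : ℓ + ℓ ≡ 2ℓ
 2ℓ≡ = ap (ℓ +_) (sym (+0 ℓ))

 2ℓ<cap : 2ℓ + 1 ≤ cap
 2ℓ<cap = ⊑ (leq (ap (_+ 1) (sym 2ℓ≡))) ℓ≤cap

 walk-U : ∀ ρ -> Ctx ρ -> runSet walkBody ρ rU ≡ next (ρ rU)
 walk-U ρ c = step-value (upd rLB (value (labelE rU) ρ) ρ) rLB (ρ rU) (ctx-upd rLB {v = value (labelE rU) ρ} {ρ} c) (label-value ρ rU c)

 walk-Hit : ∀ ρ -> Ctx ρ -> runSet walkBody ρ rHit ≡ Δ ∸ offset (next (ρ rU))
 walk-Hit ρ c = ap₂ _∸_ (tr (c rD (low rD)) D≡)
  (tr (offset-value ρ3 c3) (ap offset (walk-U ρ c)))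
  where
  ρ1 = upd rLB (value (labelE rU) ρ) ρ
  ρ2 = upd rU (value (stepE rLB) ρ1) ρ1
  ρ3 = upd rLU (ρ rLU + 1) ρ2
  c3 : Ctx ρ3
  c3 = ctx-upd rLU {v = ρ rLU + 1} {ρ2} (ctx-upd rU {v = value (stepE rLB) ρ1} {ρ1} (ctx-upd rLB {v = value (labelE rU) ρ} {ρ} c))

 walk-fits : ∀ ρ -> Ctx ρ -> ρ rLU + 1 ≤ cap -> ρ rT ≤ cap -> Fits walkBody ρ
 walk-fits ρ c lu≤ t≤ =
  subst (_≤ cap) (sym (label-value ρ rU c)) (⊑ (label≤m (ρ rU)) m≤cap) ,
  subst (_≤ cap) (sym (walk-U ρ c)) (⊑ (<⇒≤ (step<n (ρ rU))) n≤cap) ,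
  lu≤ ,
  subst (_≤ cap) (sym (walk-Hit ρ c)) (⊑ (m∸n≤m Δ (offset (next (ρ rU)))) Δ≤cap) ,
  ⊑ (*ʳ (ρ rT ∸ 1) (m∸n≤m 1 (runSet walkBody ρ rHit))) (⊑ (leq (*1 _)) (⊑ (m∸n≤m (ρ rT) 1) t≤)) ,
  tt

 iter-step : ∀ j v -> iter next (j + 1) v ≡ next (iter next j v)
 iter-step j v = iter-+ next j 1 v

 -- The walk from v has made j steps and the last one, if any, decides
 -- whether it stops.
 record Walking (v : ℕ) (ρ1 ρ : Env) : Set where
  field
   j : ℕ
   LU≡ : ρ rLU ≡ j
   U≡ : ρ rU ≡ iter next j v
   U<n : ρ rU < n
   ST≡ : ρ rST ≡ ρ1 rST
   keep : Keep 31 64 ρ1 ρ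
   before : ∀ i -> 0 < i -> i < j -> Δ ≤ offset (iter next i v)

 data Status (v j k : ℕ) (ρ : Env) : Set where
  going : ρ rT ≡ k -> j + k ≡ 2ℓ -> (0 < j -> Δ ≤ offset (iter next j v)) -> Status v j k ρ
  stopped : ρ rT ≡ 0 -> 0 < j -> j ≤ 2ℓ -> offset (iter next j v) < Δ -> ρ rHit ≡ Δ ∸ offset (iter next j v) -> Status v j k ρ

 record Walked (v : ℕ) (ρ1 ρ : Env) : Set where
  field
   walking : Walking v ρ1 ρ
  open Walking walking public
  field
   j≤ : j ≤ 2ℓ
   verdict : (ρ rHit ≡ 0 × j ≡ 2ℓ × Δ ≤ offset (iter next j v)) ⊎ (0 < ρ rHit × 0 < j × offset (iter next j v) < Δ)

 -- A stop and running out of steps both leave `rT` at 0. They are told apart by `rHit`, which every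
 -- step recomputes.
 walk : ∀ v ρ1 -> Ctx ρ1 -> ρ1 rU ≡ v -> v < n -> ρ1 rLU ≡ 0 -> ρ1 rT ≡ 2ℓ ->
  Safe (NotDisjoint x y) (Walked v ρ1) (suc (2ℓ * (u + 3))) (sem (while rT (set walkBody)) ρ1)
 walk v ρ1 c1 U1≡ v<n LU1≡ T1≡ = safe-map finish (safe-loop rT (sem (set walkBody)) Inv u done body 2ℓ (ρ1 rT) ρ1 rfl≤
  (record { j = 0 ; LU≡ = LU1≡ ; U≡ = U1≡ ; U<n = subst (_< n) (sym U1≡) v<n ; ST≡ = refl ; keep = keep-refl ; before = λ _ _ () } , (λ ()) , going T1≡ refl λ ()))
  where
  Inv : ℕ -> Env -> Set
  Inv k ρ = Σ (Walking v ρ1 ρ) λ w -> (0 < Walking.j w -> ρ rHit ≡ Δ ∸ offset (ρ rU)) × Status v (Walking.j w) k ρ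
  done : ∀ {ρ} -> Inv 0 ρ -> ρ rT ≡ 0
  done (_ , _ , going eq _ _) = eq
  done (_ , _ , stopped eq _ _ _ _) = eq
  body : ∀ k ρ -> Inv (suc k) ρ -> 0 < ρ rT -> Safe (NotDisjoint x y) (λ ρ' -> Inv k ρ' × ρ' rT < ρ rT) u (sem (set walkBody) ρ)
  body k ρ (w , _ , stopped eq _ _ _ _) pos = refute (subst (0 <_) eq pos) λ ()
  body k ρ (w , _ , going T≡ j+k on) pos = safe-set walkBody ρ (walk-fits ρ c lu≤ t≤) ((w' , (λ _ -> Hit'≡) , status) , t<)
   where
   open Walking w
   c : Ctx ρ
   c = ctx-keep {ρ1} (keep-widen {31} {26} {64} {64} (m≤m+n 26 5) rfl≤ keep) c1
   lu≤ : ρ rLU + 1 ≤ cap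
   lu≤ = ⊑ (+ˡ 1 (⊑ (leq LU≡) (⊑ (m≤m+n j (suc k)) (leq j+k)))) 2ℓ<cap
   t≤ : ρ rT ≤ cap
   t≤ = ⊑ (leq T≡) (⊑ (m≤n+m (suc k) j) (⊑ (leq j+k) (⊑ (m≤m+n 2ℓ 1) 2ℓ<cap)))
   ρ' = runSet walkBody ρ
   U'≡ : ρ' rU ≡ iter next (j + 1) v
   U'≡ = tr (walk-U ρ c) (tr (ap next U≡) (sym (iter-step j v)))
   Hit'≡ : ρ' rHit ≡ Δ ∸ offset (ρ' rU)
   Hit'≡ = tr (walk-Hit ρ c) (ap (λ u -> Δ ∸ offset u) (sym (walk-U ρ c)))
   w' : Walking v ρ1 ρ'
   w' = record
    { j = j + 1
    ; LU≡ = ap (_+ 1) LU≡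
    ; U≡ = U'≡
    ; U<n = subst (_< n) (sym (walk-U ρ c)) (step<n (ρ rU))
    ; ST≡ = ST≡
    ; keep = keep-trans {31} {64} {ρ1} {ρ} {ρ'} keep (keep-runSet walkBody ρ)
    ; before = λ i 0<i i<j+1 -> [ before i 0<i , (λ { refl -> on 0<i }) ]′ (m≤n⇒m<n∨m≡n (s≤s⁻¹ (subst (i <_) (+-comm j 1) i<j+1)))
    }
   T'≡ : ρ' rT ≡ k * (1 ∸ ρ' rHit)
   T'≡ = ap (λ t -> (t ∸ 1) * (1 ∸ ρ' rHit)) T≡
   t< : ρ' rT < ρ rT
   t< = subst₂ _<_ (sym T'≡) (sym T≡) (s≤s (⊑ (*ʳ k (m∸n≤m 1 (ρ' rHit))) (leq (*1 k))))
   shift-j : j + 1 + k ≡ 2ℓ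
   shift-j = tr (+-assoc j 1 k) j+k
   status : Status v (j + 1) k ρ'
   status with offset (iter next (j + 1) v) <? Δ
   ... | no ≮ = going (tr T'≡ (tr (ap (λ z -> k * (1 ∸ z)) (tr Hit'≡ (m≤n⇒m∸n≡0 (subst (λ u -> Δ ≤ offset u) (sym U'≡) (≮⇒≥ ≮))))) (*1 k))) shift-j (λ _ -> ≮⇒≥ ≮)
   ... | yes lt = stopped (tr T'≡ (tr (ap (k *_) (m≤n⇒m∸n≡0 (subst (1 ≤_) (sym Hit'≡) (m<n⇒0<n∸m (subst (λ u -> offset u < Δ) (sym U'≡) lt))))) (*-zeroʳ k)))
    (m≤n+m 1 j) (⊑ (m≤m+n (j + 1) k) (leq shift-j)) lt (tr Hit'≡ (ap (λ u -> Δ ∸ offset u) U'≡))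
  finish : ∀ ρ -> (∃ λ k -> Inv k ρ × ρ rT ≡ 0) -> Walked v ρ1 ρ
  finish ρ (k , (w , hit , stopped eq 0<j j≤ lt hit≡) , T≡0) = record { walking = w ; j≤ = j≤ ; verdict = inj₂ (subst (0 <_) (sym hit≡) (m<n⇒0<n∸m lt) , 0<j , lt) }
  finish ρ (k , (w , hit , going eq j+k on) , T≡0) = record { walking = w ; j≤ = leq j≡
   ; verdict = inj₁ (tr (hit 0<j) (m≤n⇒m∸n≡0 (subst (λ u -> Δ ≤ offset u) (sym (Walking.U≡ w)) (on 0<j))) , j≡ , on 0<j) }
   where
   j≡ : Walking.j w ≡ 2ℓ
   j≡ = tr (sym (tr (ap (Walking.j w +_) (tr (sym eq) T≡0)) (+0 _))) j+k
   0<j : 0 < Walking.j w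
   0<j = subst (0 <_) (sym j≡) (⊑ (>-nonZero⁻¹ ℓ) (m≤m+n ℓ _))

 label-even : ∀ v -> v % 2 ≡ 0 -> label v ≡ entry x ((v + g1) % n)
 label-even v eq rewrite eq = refl

 label-odd : ∀ v -> v % 2 ≡ 1 -> label v ≡ entry y ((v + g2) % n)
 label-odd v eq rewrite eq = refl

 -- This justifies every YES: an odd sum means one even and one odd vertex, hence one label from
 -- each list.
 label-match : ∀ v w -> label v ≡ label w -> (v + w) % 2 ≡ 1 -> NotDisjoint x y
 label-match v w eq odd with %2-cases v | %2-cases w
 ... | inj₁ v0 | inj₁ w0 = refute (tr (sym odd) (tr (%-distribˡ-+ v w 2) (ap₂ (λ a b -> (a + b) % 2) v0 w0))) λ ()
 ... | inj₂ v1 | inj₂ w1 = refute (tr (sym odd) (tr (%-distribˡ-+ v w 2) (ap₂ (λ a b -> (a + b) % 2) v1 w1))) λ ()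
 ... | inj₁ v0 | inj₂ w1 =
  let i , i≡ = entry-just x ((v + g1) % n) (m%n<n _ n) ; j , j≡ = entry-just y ((w + g2) % n) (m%n<n _ n)
  in i , j , Fin.toℕ-injective (tr (sym i≡) (tr (sym (label-even v v0)) (tr eq (tr (label-odd w w1) j≡))))
 ... | inj₂ v1 | inj₁ w0 =
  let i , i≡ = entry-just x ((w + g1) % n) (m%n<n _ n) ; j , j≡ = entry-just y ((v + g2) % n) (m%n<n _ n)
  in i , j , Fin.toℕ-injective (tr (sym i≡) (tr (sym (label-even w w0)) (tr (sym eq) (tr (label-odd v v1) j≡))))

 -- Walks of lengths lx from w and lu from v that meet r steps before their end.
 record Match (w lx v lu : ℕ) : Set where
  field
   a b r : ℕ
   lx≡ : lx ≡ a + r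
   lu≡ : lu ≡ b + r
   a< : a < 2ℓ
   b< : b < 2ℓ
   meets : label (iter next a w) ≡ label (iter next b v)
   odd-sum : (iter next a w + iter next b v) % 2 ≡ 1

 -- `i` and `j` steps separate the two walks from their meeting, and both go on for `r` steps after
 -- it. Comparing the remaining lengths thus compares `i` with `j`. The walk farther away moves, or
 -- both if they are tied, so the larger of `i` and `j` drops in every iteration and stays below the
 -- counter `k`.
 record Ahead {w lx v lu : ℕ} (mt : Match w lx v lu) (k : ℕ) (ρ : Env) : Set where
  open Match mt
  field
   i j : ℕ
   X≡ : iter next i (ρ rX) ≡ iter next a w
   LX≡ : ρ rLX ≡ i + r
   U≡ : iter next j (ρ rU) ≡ iter next b v
   LU≡ : ρ rLU ≡ j + r
   i<k : i < k
   j<k : j < k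

 record Comparing (ρ1 ρ : Env) : Set where
  field
   keep : Keep 31 64 ρ1 ρ
   X<n : ρ rX < n
   U<n : ρ rU < n
   LX≤ : ρ rLX ≤ 2ℓ
   LU≤ : ρ rLU ≤ 2ℓ

 -- One iteration after the labels have been read and did not match.
 module Advance (ρ : Env) (c : Ctx ρ) (LB≡ : ρ rLB ≡ label (ρ rX)) (LC≡ : ρ rLC ≡ label (ρ rU)) where

  ρ' : Env
  ρ' = runSet advance ρ

  dx du : ℕ
  dx = 1 ∸ (ρ rLU ∸ ρ rLX)
  du = 1 ∸ (ρ rLX ∸ ρ rLU)

  ρ1 ρ2 : Env
  ρ1 = upd rDU du (upd rDX dx ρ)
  ρ2 = upd rX (value (reg rX ⊗ (lit 1 ⊟ reg rDX) ⊕ stepE rLB ⊗ reg rDX) ρ1) ρ1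

  c1 : Ctx ρ1
  c1 = ctx-upd rDU {v = du} {upd rDX dx ρ} (ctx-upd rDX {v = dx} {ρ} c)

  X'≡ : ρ' rX ≡ ρ rX * (1 ∸ dx) + next (ρ rX) * dx
  X'≡ = ap (λ s -> ρ rX * (1 ∸ dx) + s * dx) (step-value ρ1 rLB (ρ rX) c1 LB≡)

  U'≡ : ρ' rU ≡ ρ rU * (1 ∸ du) + next (ρ rU) * du
  U'≡ = ap (λ s -> ρ rU * (1 ∸ du) + s * du) (step-value ρ2 rLC (ρ rU) (ctx-upd rX {v = ρ2 rX} {ρ1} c1) LC≡)

  select : ∀ a b d -> d ≤ 1 -> (d ≡ 0 × a * (1 ∸ d) + b * d ≡ a) ⊎ (d ≡ 1 × a * (1 ∸ d) + b * d ≡ b)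
  select a b 0 _ = inj₁ (refl , tr (ap₂ _+_ (*1 a) (*-zeroʳ b)) (+0 a))
  select a b 1 _ = inj₂ (refl , tr (ap₂ _+_ (*-zeroʳ a) (*1 b)) refl)
  select a b (suc (suc _)) (s≤s ())

  X-moves : (dx ≡ 0 × ρ' rX ≡ ρ rX) ⊎ (dx ≡ 1 × ρ' rX ≡ next (ρ rX))
  X-moves = [ (λ (d , e) -> inj₁ (d , tr X'≡ e)) , (λ (d , e) -> inj₂ (d , tr X'≡ e)) ]′ (select (ρ rX) (next (ρ rX)) dx (m∸n≤m 1 (ρ rLU ∸ ρ rLX)))

  U-moves : (du ≡ 0 × ρ' rU ≡ ρ rU) ⊎ (du ≡ 1 × ρ' rU ≡ next (ρ rU))
  U-moves = [ (λ (d , e) -> inj₁ (d , tr U'≡ e)) , (λ (d , e) -> inj₂ (d , tr U'≡ e)) ]′ (select (ρ rU) (next (ρ rU)) du (m∸n≤m 1 (ρ rLX ∸ ρ rLU)))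

  X'<n : ρ rX < n -> ρ' rX < n
  X'<n X<n = [ (λ (_ , e) -> subst (_< n) (sym e) X<n) , (λ (_ , e) -> subst (_< n) (sym e) (step<n (ρ rX))) ]′ X-moves

  U'<n : ρ rU < n -> ρ' rU < n
  U'<n U<n = [ (λ (_ , e) -> subst (_< n) (sym e) U<n) , (λ (_ , e) -> subst (_< n) (sym e) (step<n (ρ rU))) ]′ U-moves

  fits : ρ rX < n -> ρ rU < n -> ρ rLX ≤ 2ℓ -> ρ rLU ≤ 2ℓ -> ρ rT ≤ 2ℓ -> Fits advance ρ
  fits X<n U<n LX≤ LU≤ T≤ =
   bit (ρ rLU ∸ ρ rLX) , bit (ρ rLX ∸ ρ rLU) , ⊑ (<⇒≤ (X'<n X<n)) n≤cap , ⊑ (<⇒≤ (U'<n U<n)) n≤cap ,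
   ⊑ (m∸n≤m (ρ rLX) dx) (⊑ LX≤ 2ℓ≤) , ⊑ (m∸n≤m (ρ rLU) du) (⊑ LU≤ 2ℓ≤) , ⊑ (m∸n≤m (ρ rT) 1) (⊑ T≤ 2ℓ≤) , tt
   where
   2ℓ≤ : 2ℓ ≤ cap
   2ℓ≤ = ⊑ (m≤m+n 2ℓ 1) 2ℓ<cap
   bit : ∀ k -> 1 ∸ k ≤ cap
   bit k = ⊑ (m∸n≤m 1 k) (⊑ (m≤n+m 1 2ℓ) 2ℓ<cap)

  ahead : ∀ {w lx v lu} {mt : Match w lx v lu} {k} (ah : Ahead mt (suc k) ρ) -> ¬ (Ahead.i ah ≡ 0 × Ahead.j ah ≡ 0) -> Ahead mt k ρ'
  ahead {w} {lx} {v} {lu} {mt} {k} ah ≢0 = go i j X≡ U≡ LX≡ LU≡ i<k j<k ≢0 (<-cmp i j)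
   where
   open Match mt using (a; b; r)
   open Ahead ah
   open import Relation.Binary.Definitions using (Tri; tri<; tri≈; tri>)
   dx≡1 : ∀ {i j} -> ρ rLX ≡ i + r -> ρ rLU ≡ j + r -> j ≤ i -> dx ≡ 1
   dx≡1 {i} {j} e f j≤i = ap (1 ∸_) (m≤n⇒m∸n≡0 (subst₂ _≤_ (sym f) (sym e) (+ˡ r j≤i)))
   dx≡0 : ∀ {i j} -> ρ rLX ≡ i + r -> ρ rLU ≡ j + r -> i < j -> dx ≡ 0
   dx≡0 {i} {j} e f i<j = m≤n⇒m∸n≡0 (m<n⇒0<n∸m (subst₂ _<_ (sym e) (sym f) (+-monoˡ-< r i<j)))
   du≡1 : ∀ {i j} -> ρ rLX ≡ i + r -> ρ rLU ≡ j + r -> i ≤ j -> du ≡ 1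
   du≡1 {i} {j} e f i≤j = ap (1 ∸_) (m≤n⇒m∸n≡0 (subst₂ _≤_ (sym e) (sym f) (+ˡ r i≤j)))
   du≡0 : ∀ {i j} -> ρ rLX ≡ i + r -> ρ rLU ≡ j + r -> j < i -> du ≡ 0
   du≡0 {i} {j} e f j<i = m≤n⇒m∸n≡0 (m<n⇒0<n∸m (subst₂ _<_ (sym f) (sym e) (+-monoˡ-< r j<i)))
   X-next : ∀ {i} -> dx ≡ 1 -> iter next (suc i) (ρ rX) ≡ iter next a w -> iter next i (ρ' rX) ≡ iter next a w
   X-next {i} d e = tr (ap (iter next i) ([ (λ (d0 , _) -> refute (tr (sym d) d0) λ ()) , proj₂ ]′ X-moves)) e
   X-stay : ∀ {i} -> dx ≡ 0 -> iter next i (ρ rX) ≡ iter next a w -> iter next i (ρ' rX) ≡ iter next a w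
   X-stay {i} d e = tr (ap (iter next i) ([ proj₂ , (λ (d0 , _) -> refute (tr (sym d) d0) λ ()) ]′ X-moves)) e
   U-next : ∀ {j} -> du ≡ 1 -> iter next (suc j) (ρ rU) ≡ iter next b v -> iter next j (ρ' rU) ≡ iter next b v
   U-next {j} d e = tr (ap (iter next j) ([ (λ (d0 , _) -> refute (tr (sym d) d0) λ ()) , proj₂ ]′ U-moves)) e
   U-stay : ∀ {j} -> du ≡ 0 -> iter next j (ρ rU) ≡ iter next b v -> iter next j (ρ' rU) ≡ iter next b v
   U-stay {j} d e = tr (ap (iter next j) ([ proj₂ , (λ (d0 , _) -> refute (tr (sym d) d0) λ ()) ]′ U-moves)) e
   go : ∀ i j -> iter next i (ρ rX) ≡ iter next a w -> iter next j (ρ rU) ≡ iter next b v -> ρ rLX ≡ i + r -> ρ rLU ≡ j + r -> i < suc k -> j < suc k ->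
    ¬ (i ≡ 0 × j ≡ 0) -> Tri (i < j) (i ≡ j) (j < i) -> Ahead mt k ρ'
   go zero j@(suc j') ex eu lx lu i< j< _ _ = record { i = 0 ; j = j' ; X≡ = X-stay {0} d0 ex ; LX≡ = ap₂ _∸_ lx d0
    ; U≡ = U-next {j'} d1 eu ; LU≡ = ap₂ _∸_ lu d1 ; i<k = ⊑ (s≤s z≤n) (s≤s⁻¹ j<) ; j<k = s≤s⁻¹ j< }
    where
    d0 = dx≡0 {0} {j} lx lu (s≤s z≤n)
    d1 = du≡1 {0} {j} lx lu z≤n
   go zero zero _ _ _ _ _ _ ≢0 _ = refute (refl , refl) ≢0
   go i@(suc i') j ex eu lx lu i< j< _ (tri> _ _ j<i) = record { i = i' ; j = j ; X≡ = X-next {i'} d1 ex ; LX≡ = ap₂ _∸_ lx d1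
    ; U≡ = U-stay {j} d0 eu ; LU≡ = ap₂ _∸_ lu d0 ; i<k = s≤s⁻¹ i< ; j<k = <≤ j<i (s≤s⁻¹ i<) }
    where
    d1 = dx≡1 {i} {j} lx lu (<⇒≤ j<i)
    d0 = du≡0 {i} {j} lx lu j<i
   go i@(suc i') j@(suc j') ex eu lx lu i< j< _ (tri≈ _ i≡j _) = record { i = i' ; j = j' ; X≡ = X-next {i'} d1 ex ; LX≡ = ap₂ _∸_ lx d1
    ; U≡ = U-next {j'} d2 eu ; LU≡ = ap₂ _∸_ lu d2 ; i<k = s≤s⁻¹ i< ; j<k = s≤s⁻¹ j< }
    where
    d1 = dx≡1 {i} {j} lx lu (leq (sym i≡j))
    d2 = du≡1 {i} {j} lx lu (leq i≡j)
   go i@(suc i') j@(suc j') ex eu lx lu i< j< _ (tri< i<j _ _) = record { i = i ; j = j' ; X≡ = X-stay {i} d0 ex ; LX≡ = ap₂ _∸_ lx d0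
    ; U≡ = U-next {j'} d1 eu ; LU≡ = ap₂ _∸_ lu d1 ; i<k = <≤ i<j (s≤s⁻¹ j<) ; j<k = s≤s⁻¹ j< }
    where
    d0 = dx≡0 {i} {j} lx lu i<j
    d1 = du≡1 {i} {j} lx lu (<⇒≤ i<j)
   go (suc _) zero _ _ _ _ _ _ _ (tri< () _ _)
   go (suc _) zero _ _ _ _ _ _ _ (tri≈ _ () _)

 compareCost : ℕ
 compareCost = u + (u + 1 + u)

 -- A meeting would be reached, and accepted, before the counter runs out. A comparison that returns
 -- has therefore seen none.
 compareWalks : ∀ ρ1 -> Ctx ρ1 -> Comparing ρ1 ρ1 -> ρ1 rT ≡ 2ℓ ->
  Safe (NotDisjoint x y) (λ ρ -> Comparing ρ1 ρ × ¬ Match (ρ1 rX) (ρ1 rLX) (ρ1 rU) (ρ1 rLU)) (suc (2ℓ * (compareCost + 3))) (sem (while rT compareBody) ρ1)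
 compareWalks ρ1 c1 cmp1 T≡ = safe-map (λ ρ (_ , _ , cmp , ahead) -> cmp , λ mt -> refute (Ahead.i<k (ahead mt)) λ ())
  (safe-count' rT compareBody Inv compareCost body 2ℓ ρ1 T≡ (rfl≤ , cmp1 , λ mt -> record { i = Match.a mt ; j = Match.b mt ; X≡ = refl ; LX≡ = Match.lx≡ mt ; U≡ = refl ; LU≡ = Match.lu≡ mt ; i<k = Match.a< mt ; j<k = Match.b< mt }))
  where
  Inv : ℕ -> Env -> Set
  Inv k ρ = k ≤ 2ℓ × Comparing ρ1 ρ × ((mt : Match (ρ1 rX) (ρ1 rLX) (ρ1 rU) (ρ1 rLU)) -> Ahead mt k ρ)
  product : ∀ a b e -> 0 < (1 ∸ ((a ∸ b) + (b ∸ a))) * e -> a ≡ b × 0 < e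
  product a b e pos with a ∸ b in eq | b ∸ a in eq'
  ... | zero | zero = ≤-antisym (m∸n≡0⇒m≤n eq) (m∸n≡0⇒m≤n eq') , subst (0 <_) (+0 e) pos
  ... | zero | suc zero = refute pos λ ()
  ... | zero | suc (suc _) = refute pos λ ()
  ... | suc d | w = refute (subst (λ k -> 0 < k * e) (0∸n≡0 (d + w)) pos) λ ()
  body : ∀ k ρ -> ρ rT ≡ suc k -> Inv (suc k) ρ -> Safe (NotDisjoint x y) (λ ρ' -> ρ' rT ≡ k × Inv k ρ') compareCost (sem compareBody ρ)
  body k ρ T≡ (k≤ , cmp , ahead) = safe->>= (safe-set labels ρ {Q = _≡ ρ'} label-fits refl) λ { _ refl ->
   safe->>= (safe-when matchE accept ρ' {Q = λ ρ'' -> ρ'' ≡ ρ' × value matchE ρ' ≡ 0} {d = 1} (refl ,_)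
    (λ pos -> tick (accepted (let lb≡lc , odd = product (ρ' rLB) (ρ' rLC) ((ρ rX + ρ rU) % 2) pos in
     label-match (ρ rX) (ρ rU) (tr (sym LB≡) (tr lb≡lc LC≡)) ([ (λ e -> refute (subst (0 <_) e odd) λ ()) , id ]′ (%2-cases (ρ rX + ρ rU)))))))
    λ { _ (refl , unmatched) -> safe-set advance ρ' (Adv.fits X<n U<n LX≤ LU≤ (⊑ (leq T≡) k≤))
     ( ap (_∸ 1) T≡ , <⇒≤ k≤
     , record { keep = keep-trans {31} {64} {ρ1} {ρ} {Adv.ρ'} keep (keep-trans {31} {64} {ρ} {ρ'} {Adv.ρ'} (keep-runSet labels ρ) (keep-runSet advance ρ'))
      ; X<n = Adv.X'<n X<n ; U<n = Adv.U'<n U<n ; LX≤ = ⊑ (m∸n≤m (ρ rLX) Adv.dx) LX≤ ; LU≤ = ⊑ (m∸n≤m (ρ rLU) Adv.du) LU≤ }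
     , λ mt -> let module A = Ahead (ahead mt) in Adv.ahead {mt = mt}
      (record { i = A.i ; j = A.j ; X≡ = A.X≡ ; LX≡ = A.LX≡ ; U≡ = A.U≡ ; LU≡ = A.LU≡ ; i<k = A.i<k ; j<k = A.j<k })
      (λ (i≡0 , j≡0) -> refute (tr (sym (matched mt (subst (λ i -> iter next i (ρ rX) ≡ _) i≡0 A.X≡) (subst (λ j -> iter next j (ρ rU) ≡ _) j≡0 A.U≡))) unmatched) λ ())
     ) } }
   where
   open Comparing cmp
   c : Ctx ρ
   c = ctx-keep {ρ1} (keep-widen {31} {26} {64} {64} (m≤m+n 26 5) rfl≤ keep) c1
   ρ' : Env
   ρ' = runSet labels ρ
   LB≡ : ρ' rLB ≡ label (ρ rX)
   LB≡ = label-value ρ rX c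
   LC≡ : ρ' rLC ≡ label (ρ rU)
   LC≡ = label-value (upd rLB (value (labelE rX) ρ) ρ) rU (ctx-upd rLB {v = value (labelE rX) ρ} {ρ} c)
   label-fits : Fits labels ρ
   label-fits = ⊑ (leq LB≡) (⊑ (label≤m (ρ rX)) m≤cap) , ⊑ (leq LC≡) (⊑ (label≤m (ρ rU)) m≤cap) , tt
   module Adv = Advance ρ' (ctx-upd rLC {v = ρ' rLC} (ctx-upd rLB {v = ρ' rLB} {ρ} c)) LB≡ LC≡
   matched : (mt : Match (ρ1 rX) (ρ1 rLX) (ρ1 rU) (ρ1 rLU)) -> ρ rX ≡ iter next (Match.a mt) (ρ1 rX) -> ρ rU ≡ iter next (Match.b mt) (ρ1 rU) -> value matchE ρ' ≡ 1
   matched mt X≡ U≡ = ap₂ (λ e o -> (1 ∸ e) * o)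
    (tr (ap₂ (λ a b -> (a ∸ b) + (b ∸ a)) (tr LB≡ (tr (ap label X≡) meets)) (tr LC≡ (ap label U≡))) (ap₂ _+_ (n∸n≡0 (label (iter next b (ρ1 rU)))) (n∸n≡0 (label (iter next b (ρ1 rU))))))
    (tr (ap (_% 2) (ap₂ _+_ X≡ U≡)) odd-sum)
    where open Match mt

 Collides : Set
 Collides = Collision (q + q) 2ℓ Δ s start label next offset

 walked-to : ∀ {v ρ1 ρ} (w : Walked v ρ1 ρ) N -> 0 < N -> N ≤ 2ℓ -> offset (iter next N v) < Δ -> (∀ i -> 0 < i -> i < N -> Δ ≤ offset (iter next i v)) ->
  0 < ρ rHit × Walked.j w ≡ N
 walked-to w N 0<N N≤ stops on with Walked.verdict w
 ... | inj₁ (_ , j≡ , never) = refute stops (≤⇒≯ ([ Walked.before w N 0<N , (λ { refl -> never }) ]′ (m≤n⇒m<n∨m≡n (⊑ N≤ (leq (sym j≡))))))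
 ... | inj₂ (hit , 0<j , lt) = hit , ≤-antisym (≮⇒≥ λ N<j -> ≤⇒≯ (Walked.before w N 0<N N<j) stops) (≮⇒≥ λ j<N -> ≤⇒≯ (on (Walked.j w) 0<j j<N) lt)

 slot slot' : ℕ -> Addr
 slot β = s + s + (β + β) + 69
 slot' β = s + s + (β + β) + 70

 double-injective : ∀ a b -> a + a ≡ b + b -> a ≡ b
 double-injective a b eq = *-cancelʳ-≡ a b 2 (tr (double a) (tr eq (sym (double b))))
  where
  double : ∀ a -> a * 2 ≡ a + a
  double = ring

 double≢suc-double : ∀ a b -> a + a ≢ suc (b + b)
 double≢suc-double a b eq = refute (tr (sym (even a)) (tr (ap (_% 2) eq) (odd b))) λ ()
  where
  double : ∀ a -> a + a ≡ a * 2
  double = ring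
  even : ∀ a -> (a + a) % 2 ≡ 0
  even a = tr (ap (_% 2) (double a)) (m*n%n≡0 a 2)
  odd : ∀ b -> suc (b + b) % 2 ≡ 1
  odd b = tr (ap (λ k -> suc k % 2) (double b)) ([m+kn]%n≡m%n 1 b 2)

 slot-injective : ∀ {β γ} -> slot β ≡ slot γ -> β ≡ γ
 slot-injective {β} {γ} eq = double-injective β γ (+-cancelˡ-≡ (s + s) _ _ (+-cancelʳ-≡ 69 _ _ eq))

 slot'-injective : ∀ {β γ} -> slot' β ≡ slot' γ -> β ≡ γ
 slot'-injective {β} {γ} eq = double-injective β γ (+-cancelˡ-≡ (s + s) _ _ (+-cancelʳ-≡ 70 _ _ eq))

 slot≢slot' : ∀ β γ -> slot β ≢ slot' γ
 slot≢slot' β γ eq = double≢suc-double β γ (+-cancelˡ-≡ (s + s) _ _ (+-cancelʳ-≡ 69 _ _ (tr eq (hoist (s + s) (γ + γ)))))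
  where
  hoist : ∀ a b -> a + b + 70 ≡ a + suc b + 69
  hoist = ring

 slot≥ : ∀ β -> 69 + (s + s) ≤ slot β
 slot≥ β = ⊑ (m≤m+n (69 + (s + s)) (β + β)) (leq (eq (s + s) (β + β)))
  where
  eq : ∀ a b -> 69 + a + b ≡ a + b + 69
  eq = ring

 slot'≥ : ∀ β -> 69 + (s + s) ≤ slot' β
 slot'≥ β = ⊑ (slot≥ β) (+ʳ (s + s + (β + β)) (n≤1+n 69))

 slot< : ∀ {β} -> β < s -> slot β < cells × slot' β < cells
 slot< {β} β<s = <≤ (≤< (+ʳ (s + s + (β + β)) (n≤1+n 69)) lt) cells≥ , <≤ lt cells≥
  where
  lt : slot' β < 70 + (s + s + (s + s))
  lt = <≤ (+-monoˡ-< 70 (+-monoʳ-< (s + s) (+-mono-< β<s β<s))) (leq (+-comm (s + s + (s + s)) 70))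

 ctx-store : ∀ {a v ρ} -> 69 + (s + s) ≤ a -> Ctx ρ -> Ctx (upd a v ρ)
 ctx-store {a} {v} {ρ} a≥ c b (inj₁ b<) = tr (upd-there ρ (<⇒≢ (<≤ b< (⊑ (m≤m+n 26 43) (⊑ (m≤m+n 69 (s + s)) a≥))))) (c b (inj₁ b<))
 ctx-store {a} {v} {ρ} a≥ c b (inj₂ (b≥ , b<)) = tr (upd-there ρ (<⇒≢ (<≤ b< a≥))) (c b (inj₂ (b≥ , b<)))

 -- Walks are traced from the highest index down, so `k'` leaves its data behind before `k` comes to
 -- look for them.
 Held : Collides -> Env -> Set
 Held cl ρ = ρ (slot (offset end % s)) ≡ start k' × ρ (slot' (offset end % s)) ≡ b + suc t
  where open Collision cl

 -- A collision would have been found when the second of its walks stopped.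
 Pending : ℕ -> Env -> Set
 Pending κ ρ = Ctx ρ × κ ≤ q + q × ((cl : Collides) -> Collision.k cl < κ × (κ ≤ Collision.k' cl -> Held cl ρ))

 revisitCost pathCost : ℕ
 revisitCost = u + (u + (u + (u + suc (2ℓ * (compareCost + 3)))))
 pathCost = u + (suc (2ℓ * (u + 3)) + (u + revisitCost))

 start<n : ∀ κ -> start κ < n
 start<n κ = m%n<n _ n

 held-keep : ∀ {lo ρ ρ'} cl -> Keep lo 64 ρ ρ' -> Held cl ρ -> Held cl ρ'
 held-keep cl k (e1 , e2) = tr (k _ (inj₂ (above (slot≥ (offset (Collision.end cl) % s))))) e1 , tr (k _ (inj₂ (above (slot'≥ (offset (Collision.end cl) % s))))) e2
  where
  above : ∀ {a} -> 69 + (s + s) ≤ a -> 64 ≤ a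
  above = ⊑ (⊑ (m≤m+n 64 5) (m≤m+n 69 (s + s)))

 module Path (κ : ℕ) (ρ : Env) (K≡ : ρ rK ≡ suc κ) (pending : Pending (suc κ) ρ) where

  c : Ctx ρ
  c = proj₁ pending

  κ< : κ < q + q
  κ< = proj₁ (proj₂ pending)

  κ<s+s : κ < s + s
  κ<s+s = <≤ κ< (+≤ q≤s q≤s)

  ρ1 : Env
  ρ1 = runSet startWalk ρ

  c1 : Ctx ρ1
  c1 = ctx-keep {ρ} {ρ1} (keep-runSet startWalk ρ) c

  K1≡ : ρ1 rK ≡ κ
  K1≡ = ap (_∸ 1) K≡

  ST≡ : ρ1 rST ≡ start κ
  ST≡ = tr (rem≡ _ n) (ap (_% n) (tr (ap (λ k -> upd rK (ρ rK ∸ 1) ρ (k + 69)) K1≡)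
   (tr (upd-there {rK} {ρ rK ∸ 1} ρ (λ eq -> <⇒≢ (⊑ (m≤m+n 31 38) (m≤n+m 69 κ)) (sym eq)))
    (tr (c (κ + 69) (inj₂ (⊑ (m≤m+n 64 5) (m≤n+m 69 κ) , ⊑ (+-monoˡ-< 69 κ<s+s) (leq (+-comm (s + s) 69))))) (ap ρ0 (+-comm κ 69))))))

  T1≡ : ρ1 rT ≡ 2ℓ
  T1≡ = tr (ap₂ _+_ (tr (c rL (low rL)) L≡) (tr (c rL (low rL)) L≡)) 2ℓ≡

  2ℓ≤cap : 2ℓ ≤ cap
  2ℓ≤cap = ⊑ (m≤m+n 2ℓ 1) 2ℓ<cap

  start-fits : Fits startWalk ρ
  start-fits = ⊑ (leq K1≡) (⊑ (<⇒≤ κ<s+s) s≤cap) , ST≤ , ST≤ , z≤n , z≤n , ⊑ (leq T1≡) 2ℓ≤cap , tt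
   where
   ST≤ : ρ1 rST ≤ cap
   ST≤ = ⊑ (leq ST≡) (⊑ (<⇒≤ (start<n κ)) n≤cap)

  module Stop (ρ2 : Env) (w : Walked (start κ) ρ1 ρ2) where

   open Walked w using (j; LU≡; U≡; keep; j≤)
   open Walked w using () renaming (ST≡ to ST2≡)

   c2 : Ctx ρ2
   c2 = ctx-keep {ρ1} (keep-widen {31} {26} {64} {64} (m≤m+n 26 5) rfl≤ keep) c1

   K2≡ : ρ2 rK ≡ κ
   K2≡ = tr (keep rK (inj₁ rfl≤)) K1≡

   keep2 : Keep 30 64 ρ ρ2
   keep2 = keep-trans {30} {64} {ρ} {ρ1} {ρ2} (keep-runSet startWalk ρ) (keep-widen {31} {30} {64} {64} (n≤1+n 30) rfl≤ keep)

   module _ (cl : Collides) where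

    open Collision cl using (k; k'; a; b; t; a-short; b-short; end≡; end≡'; stops; goes-on; goes-on')

    stop-k : κ ≡ k -> 0 < ρ2 rHit × j ≡ a + suc t
    stop-k eq = walked-to w (a + suc t) (⊑ (s≤s z≤n) (m≤n+m (suc t) a)) a-short
     (subst (λ e -> offset e < Δ) (sym (tr (ap (λ κ -> iter next (a + suc t) (start κ)) eq) end≡)) stops)
     (λ i 0<i i< -> subst (λ κ -> Δ ≤ offset (iter next i (start κ))) (sym eq) (goes-on i 0<i i<))

    stop-k' : κ ≡ k' -> 0 < ρ2 rHit × j ≡ b + suc t
    stop-k' eq = walked-to w (b + suc t) (⊑ (s≤s z≤n) (m≤n+m (suc t) b)) b-short
     (subst (λ e -> offset e < Δ) (sym (tr (ap (λ κ -> iter next (b + suc t) (start κ)) eq) end≡')) stops)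
     (λ i 0<i i< -> subst (λ κ -> Δ ≤ offset (iter next i (start κ))) (sym eq) (goes-on' i 0<i i<))

   missed : ρ2 rHit ≡ 0 -> ρ2 rK ≡ κ × Pending κ ρ2
   missed hit≡0 = K2≡ , c2 , <⇒≤ κ< , λ cl ->
    let k< , held = proj₂ (proj₂ pending) cl
    in ≤∧≢⇒< (s≤s⁻¹ k<) (λ eq -> absurd (proj₁ (stop-k cl (sym eq)))) ,
     λ κ≤k' -> held-keep cl keep2 (held (≤∧≢⇒< κ≤k' λ eq -> absurd (proj₁ (stop-k' cl eq))))
    where
    absurd : ¬ 0 < ρ2 rHit
    absurd pos = refute (subst (0 <_) hit≡0 pos) λ ()

   module Revisit (pos : 0 < ρ2 rHit) where

    β : ℕ
    β = value (offsetE ⊙ s') ρ2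

    β≡ : β ≡ offset (ρ2 rU) % s
    β≡ = tr (rem≡ _ s) (ap (_% s) (offset-value ρ2 c2))

    β<s : β < s
    β<s = subst (_< s) (sym β≡) (m%n<n _ s)

    instance
     2ℓ+1≢0 : NonZero (ℓ + ℓ + 1)
     2ℓ+1≢0 = >-nonZero (m≤n+m 1 (ℓ + ℓ))

    ρ3 ρ4 ρ5 ρ6 : Env
    ρ3 = runSet recall ρ2
    ρ4 = upd (slot β) (ρ3 rST) ρ3
    ρ5 = upd (slot' β) (ρ3 rLU) ρ4
    ρ6 = runSet restart ρ5

    high : ∀ {a} r -> r < 64 -> 69 + (s + s) ≤ a -> a ≢ r
    high r r< a≥ eq = <⇒≢ (<≤ r< (⊑ (⊑ (m≤m+n 64 5) (m≤m+n 69 (s + s))) a≥)) (sym eq)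

    X3≡ : ρ3 rX ≡ ρ2 (slot β) % n
    X3≡ = tr (rem≡ _ n) (ap (_% n) (upd-there {rBK} {β} ρ2 (high rBK (m≤m+n 39 25) (slot≥ β))))

    LX3≡ : ρ3 rLX ≡ ρ2 (slot' β) % (ℓ + ℓ + 1)
    LX3≡ = tr (ap (⟦ rem ⟧ _) (ap (_+ 1) (ap₂ _+_ L2≡ L2≡))) (tr (rem≡ _ (ℓ + ℓ + 1)) (ap (_% (ℓ + ℓ + 1))
     (tr (upd-there {rX} {ρ3 rX} (upd rBK β ρ2) (high rX (m≤m+n 40 24) (slot'≥ β))) (upd-there {rBK} {β} ρ2 (high rBK (m≤m+n 39 25) (slot'≥ β))))))
     where
     L2≡ : ρ2 rL ≡ ℓ
     L2≡ = tr (c2 rL (low rL)) L≡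

    X<n : ρ3 rX < n
    X<n = subst (_< n) (sym X3≡) (m%n<n _ n)

    LX≤ : ρ3 rLX ≤ 2ℓ
    LX≤ = ⊑ (s≤s⁻¹ (subst₂ _<_ (sym LX3≡) (+-comm (ℓ + ℓ) 1) (m%n<n _ (ℓ + ℓ + 1)))) (leq 2ℓ≡)

    ST3≡ : ρ3 rST ≡ start κ
    ST3≡ = tr ST2≡ ST≡

    c5 : Ctx ρ5
    c5 = ctx-store {slot' β} {ρ3 rLU} {ρ4} (slot'≥ β) (ctx-store {slot β} {ρ3 rST} {ρ3} (slot≥ β) (ctx-keep {ρ2} {ρ3} (keep-runSet recall ρ2) c2))

    reg4 : ∀ r {_ : T (r <ᵇ 64)} -> ρ4 r ≡ ρ3 r
    reg4 r {ok} = upd-there ρ3 (λ eq -> high r (<ᵇ⇒< r 64 ok) (slot≥ β) (sym eq))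

    reg5 : ∀ r {_ : T (r <ᵇ 64)} -> ρ5 r ≡ ρ3 r
    reg5 r {ok} = tr (upd-there ρ4 (λ eq -> high r (<ᵇ⇒< r 64 ok) (slot'≥ β) (sym eq))) (reg4 r {ok})

    c6 : Ctx ρ6
    c6 = ctx-keep {ρ5} {ρ6} (keep-runSet restart ρ5) c5

    T6≡ : ρ6 rT ≡ 2ℓ
    T6≡ = tr (ap₂ _+_ L5≡ L5≡) 2ℓ≡
     where
     L5≡ : ρ5 rL ≡ ℓ
     L5≡ = tr (c5 rL (low rL)) L≡

    LU6≡ : ρ6 rLU ≡ j
    LU6≡ = tr (reg5 rLU) LU≡

    U6≡ : ρ6 rU ≡ start κ
    U6≡ = tr (reg5 rST) ST3≡

    comparing : Comparing ρ6 ρ6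
    comparing = record { keep = keep-refl ; X<n = subst (_< n) (sym (reg5 rX)) X<n ; U<n = subst (_< n) (sym U6≡) (start<n κ)
     ; LX≤ = subst (_≤ 2ℓ) (sym (reg5 rLX)) LX≤ ; LU≤ = subst (_≤ 2ℓ) (sym LU6≡) j≤ }

    keep6 : ∀ {ρ'} -> Comparing ρ6 ρ' -> Keep 30 64 ρ5 ρ'
    keep6 {ρ'} cmp = keep-trans {30} {64} {ρ5} {ρ6} {ρ'} (keep-runSet restart ρ5) (keep-widen {31} {30} {64} {64} (n≤1+n 30) rfl≤ (Comparing.keep cmp))

    slot-β : ρ5 (slot β) ≡ start κ
    slot-β = tr (upd-there ρ4 (slot≢slot' β β)) (tr (upd-here (slot β) (ρ3 rST) ρ3) ST3≡)

    slot'-β : ρ5 (slot' β) ≡ j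
    slot'-β = tr (upd-here (slot' β) (ρ3 rLU) ρ4) LU≡

    above : ∀ {a} -> 69 + (s + s) ≤ a -> Outside 36 64 a
    above a≥ = inj₂ (⊑ (⊑ (m≤m+n 64 5) (m≤m+n 69 (s + s))) a≥)

    slot-other : ∀ γ -> γ ≢ β -> ρ5 (slot γ) ≡ ρ2 (slot γ)
    slot-other γ γ≢β = tr (upd-there ρ4 (slot≢slot' γ β)) (tr (upd-there ρ3 (γ≢β ∘ slot-injective)) (keep-runSet recall ρ2 (slot γ) (above (slot≥ γ))))

    slot'-other : ∀ γ -> γ ≢ β -> ρ5 (slot' γ) ≡ ρ2 (slot' γ)
    slot'-other γ γ≢β = tr (upd-there ρ4 (γ≢β ∘ slot'-injective)) (tr (upd-there ρ3 (λ eq -> slot≢slot' β γ (sym eq))) (keep-runSet recall ρ2 (slot' γ) (above (slot'≥ γ))))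

    module _ (cl : Collides) where

     open Collision cl using (k; k'; k<k'; k'<S; a; b; t; a-short; b-short; even; odd; meets; end; end≡; end≡'; apart)

     γ : ℕ
     γ = offset end % s

     held2 : suc κ ≤ k' -> Held cl ρ2
     held2 κ<k' = held-keep cl keep2 (proj₂ (proj₂ (proj₂ pending) cl) κ<k')

     γ≡β : ∀ {N} -> j ≡ N -> iter next N (start κ) ≡ end -> γ ≡ β
     γ≡β refl eq = sym (tr β≡ (ap (λ u -> offset u % s) (tr U≡ eq)))

     -- The recalled walk is that of `k'` and the present one that of `k`, hence the exchange of `a`
     -- and `b`.
     matched : κ ≡ k -> Match (ρ6 rX) (ρ6 rLX) (ρ6 rU) (ρ6 rLU)
     matched refl = record
      { a = b ; b = a ; r = suc t
      ; lx≡ = tr (reg5 rLX) (tr LX3≡ (tr (ap (_% (ℓ + ℓ + 1)) (tr (ap (ρ2 ∘ slot') (sym (γ≡β j≡ end≡))) (proj₂ (held2 k<k')))) (m<n⇒m%n≡m b<)))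
      ; lu≡ = tr LU6≡ j≡
      ; a< = ⊑ (⊑ (leq (+-comm 1 b)) (+ʳ b (s≤s z≤n))) b-short
      ; b< = ⊑ (⊑ (leq (+-comm 1 a)) (+ʳ a (s≤s z≤n))) a-short
      ; meets = tr (ap (λ v -> label (iter next b v)) X6≡) (tr (sym meets) (ap (λ v -> label (iter next a v)) (sym U6≡)))
      ; odd-sum = tr (ap₂ (λ v v' -> (iter next b v + iter next a v') % 2) X6≡ U6≡) (tr (%-distribˡ-+ (iter next b (start k')) _ 2) (ap₂ (λ i j -> (i + j) % 2) odd even))
      }
      where
      j≡ : j ≡ a + suc t
      j≡ = proj₂ (stop-k cl refl)
      b< : b + suc t < ℓ + ℓ + 1
      b< = ⊑ (s≤s b-short) (leq (tr (ap suc (sym 2ℓ≡)) (+-comm 1 (ℓ + ℓ))))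
      X6≡ : ρ6 rX ≡ start k'
      X6≡ = tr (reg5 rX) (tr X3≡ (tr (ap (_% n) (tr (ap (ρ2 ∘ slot) (sym (γ≡β j≡ end≡))) (proj₁ (held2 k<k')))) (m<n⇒m%n≡m (start<n k'))))

     -- Either the present walk is that of `k'` and has just written the data, or it is a third
     -- walk, which `apart` keeps out of this slot.
     held5 : κ ≢ k -> κ ≤ k' -> Held cl ρ5
     held5 κ≢k κ≤k' with m≤n⇒m<n∨m≡n κ≤k'
     ... | inj₂ refl =
      let j≡ = proj₂ (stop-k' cl refl) ; eq = γ≡β j≡ end≡'
      in tr (ap (ρ5 ∘ slot) eq) slot-β , tr (ap (ρ5 ∘ slot') eq) (tr slot'-β j≡)
     ... | inj₁ κ<k' = tr (slot-other γ γ≢β) (proj₁ (held2 κ<k')) , tr (slot'-other γ γ≢β) (proj₂ (held2 κ<k'))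
      where
      γ≢β : γ ≢ β
      γ≢β eq with Walked.verdict w
      ... | inj₁ (hit≡0 , _ , _) = refute (subst (0 <_) hit≡0 pos) λ ()
      ... | inj₂ (_ , 0<j , lt) = apart κ κ< κ≢k (<⇒≢ κ<k') j j≤ lt (tr (ap (λ u -> offset u % s) (sym U≡)) (tr (sym β≡) (sym eq)))

    after : ∀ ρ' -> Comparing ρ6 ρ' × ¬ Match (ρ6 rX) (ρ6 rLX) (ρ6 rU) (ρ6 rLU) -> ρ' rK ≡ κ × Pending κ ρ'
    after ρ' (cmp , unmatched) =
     tr (Comparing.keep cmp rK (inj₁ rfl≤)) (tr (reg5 rK) K2≡) ,
     ctx-keep {ρ6} (keep-widen {31} {26} {64} {64} (m≤m+n 26 5) rfl≤ (Comparing.keep cmp)) c6 , <⇒≤ κ< ,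
     λ cl -> let κ≢k = λ eq -> unmatched (matched cl eq)
      in ≤∧≢⇒< (s≤s⁻¹ (proj₁ (proj₂ (proj₂ pending) cl))) (κ≢k ∘ sym) , λ κ≤k' -> held-keep cl (keep6 cmp) (held5 cl κ≢k κ≤k')

    LU≤cap : ρ3 rLU ≤ cap
    LU≤cap = ⊑ (leq LU≡) (⊑ j≤ 2ℓ≤cap)

    revisited : Safe (NotDisjoint x y) (λ ρ' -> ρ' rK ≡ κ × Pending κ ρ') revisitCost (sem revisit ρ2)
    revisited =
     safe->>= (safe-set recall ρ2 {Q = _≡ ρ3} (⊑ (<⇒≤ β<s) (⊑ (m≤m+n s s) s≤cap) , ⊑ (<⇒≤ X<n) n≤cap , ⊑ LX≤ 2ℓ≤cap , tt) refl) λ { _ refl ->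
     safe->>= (safe-store 69 slotE (reg rST) ρ3 {Q = _≡ ρ4} (proj₁ (slot< β<s)) (⊑ (leq ST3≡) (⊑ (<⇒≤ (start<n κ)) n≤cap)) refl) λ { _ refl ->
     safe->>= (safe-store 70 slotE (reg rLU) ρ4 {Q = _≡ ρ5} (subst (_< cells) (ap (λ b -> slot' b) (sym (reg4 rBK))) (proj₂ (slot< β<s))) (⊑ (leq (reg4 rLU)) LU≤cap)
      (ap₂ (λ b v -> upd (slot' b) v ρ4) (reg4 rBK) (reg4 rLU))) λ { _ refl ->
     safe->>= (safe-set restart ρ5 {Q = _≡ ρ6} (⊑ (leq U6≡) (⊑ (<⇒≤ (start<n κ)) n≤cap) , ⊑ (leq T6≡) 2ℓ≤cap , tt) refl) λ { _ refl ->
     safe-map after (compareWalks ρ6 c6 comparing T6≡) } } } }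

  body : Safe (NotDisjoint x y) (λ ρ' -> ρ' rK ≡ κ × Pending κ ρ') pathCost (sem pathBody ρ)
  body = safe->>= (safe-set startWalk ρ {Q = _≡ ρ1} start-fits refl) λ { _ refl ->
   safe->>= (walk (start κ) ρ1 c1 ST≡ (start<n κ) refl T1≡) λ ρ2 w ->
   safe-when (reg rHit) revisit ρ2 {d = revisitCost} (Stop.missed ρ2 w) (Stop.Revisit.revisited ρ2 w) }

 pathsCost : ℕ
 pathsCost = u + suc ((q + q) * (pathCost + 3))

 -- A search that returns refutes every collision, because `Pending` at the end would put `k` below
 -- 0. A round with a collision must therefore accept.
 search : Safe (NotDisjoint x y) (λ ρ -> Ctx ρ × ¬ Collides) pathsCost (sem paths ρ0)
 search = safe->>= (safe-set ((rK , reg rQ ⊕ reg rQ) ∷ []) ρ0 {Q = _≡ ρ1} (⊑ (leq K≡) (⊑ (+≤ q≤s q≤s) s≤cap) , tt) refl) λ { _ refl ->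
  safe-map (λ ρ (_ , c , _ , absurd) -> c , λ cl -> refute (proj₁ (absurd cl)) λ ())
   (safe-count' rK pathBody Pending pathCost (λ κ ρ -> Path.body κ ρ) (q + q) ρ1 K≡
    ((ctx-upd rK {v = ρ0 rQ + ρ0 rQ} {ρ0} (λ _ _ -> refl)) , rfl≤ , λ cl -> <-trans (Collision.k<k' cl) (Collision.k'<S cl) , λ S≤k' -> refute (Collision.k'<S cl) (≤⇒≯ S≤k'))) }
  where
  ρ1 : Env
  ρ1 = runSet ((rK , reg rQ ⊕ reg rQ) ∷ []) ρ0
  K≡ : ρ1 rK ≡ q + q
  K≡ = ap₂ _+_ Q≡ Q≡

-- Running time and failure probability of the program.

Holds : ∀ {i} -> Addr -> Vec ℕ i -> Env -> Set
Holds a [] ρ = ⊤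
Holds a (v ∷ β) ρ = ρ a ≡ v × Holds (suc a) β ρ

fails-cong : ∀ {x x' y y' t} -> x ≡ x' -> y ≡ y' -> Fails x y t -> Fails x' y' t
fails-cong refl refl f = f

module Prog (setting : Setting) where

 open Setting setting

 Y : Set
 Y = NotDisjoint x y

 open Rules (input s p x y) h cap cells Y u u≥

 instance
  2^W≢0 : NonZero (2 ^ W)
  2^W≢0 = m^n≢0 2 W

 fails-seq : ∀ {x y} c1 c2 ρ {K} -> Fails x y (sem c1 ρ >>= λ ρ' -> sem c2 ρ' >>= K) -> Fails x y (sem (c1 ⨾ c2) ρ >>= K)
 fails-seq {x} {y} c1 c2 ρ {K} = fails-by-refl x y (>>=-assoc' (sem c1 ρ) (sem c2) K)

 digit : List (Addr × Exp)
 digit = (rV , reg rV ⊕ reg rV ⊕ reg rBit) ∷ (rB , reg rB ⊟ lit 1) ∷ []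

 wordCost fillBodyCost : ℕ
 wordCost = suc (W * (suc u + 3))
 fillBodyCost = u + (wordCost + (u + u))

 module Word (ρ1 : Env) where

  -- The product bound says that the `k` bits still to come cannot push the word beyond `W` bits.
  Reading : ℕ -> Env -> Set
  Reading k ρ = Keep 27 30 ρ1 ρ × k ≤ W × suc (ρ rV) * 2 ^ k ≤ 2 ^ W

  digit-fits : ∀ {k ρ} b -> b ≤ 1 -> ρ rB ≡ suc k -> Reading (suc k) ρ -> Fits digit (upd rBit b ρ) × Reading k (runSet digit (upd rBit b ρ))
  digit-fits {k} {ρ} b b≤1 B≡ (keep , k< , V≤) = (⊑ (⊑ (n≤1+n _) (⊑ (m≤m*n _ (2 ^ k) {{m^n≢0 2 k}}) V'≤)) 2^W≤cap , ⊑ (m∸n≤m (ρ rB) 1) (⊑ (leq B≡) (⊑ k< W≤cap)) , tt) ,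
   keep-trans {27} {30} {ρ1} {ρ} {ρ'} keep (keep-trans {27} {30} {ρ} {upd rBit b ρ} {ρ'} (keep-upd rBit {b} {ρ} (m≤m+n 27 2) rfl≤) (keep-runSet digit (upd rBit b ρ))) , <⇒≤ k< , V'≤
   where
   ρ' = runSet digit (upd rBit b ρ)
   V'≤ : suc (ρ rV + ρ rV + b) * 2 ^ k ≤ 2 ^ W
   V'≤ = ⊑ (*ˡ (2 ^ k) (⊑ (s≤s (+ʳ (ρ rV + ρ rV) b≤1)) (leq (eq (ρ rV))))) (⊑ (leq (*-assoc (suc (ρ rV)) 2 (2 ^ k))) V≤)
    where
    eq : ∀ v -> suc (v + v + 1) ≡ suc v * 2
    eq = ring

  word-body : ∀ k ρ -> ρ rB ≡ suc k -> Reading (suc k) ρ -> Safe Y (λ ρ' -> ρ' rB ≡ k × Reading k ρ') (suc u) (sem wordBody ρ)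
  word-body k ρ B≡ r = flip (one 1 rfl≤) (one 0 z≤n)
   where
   one : ∀ b -> b ≤ 1 -> Safe Y (λ ρ' -> ρ' rB ≡ k × Reading k ρ') u (sem (set digit) (upd rBit b ρ))
   one b b≤1 = let fs , r' = digit-fits {k} {ρ} b b≤1 B≡ r in safe-set digit (upd rBit b ρ) fs (ap (_∸ 1) B≡ , r')

  -- Each coin averages two subtrees, so after `k` coins the failure bounds `φ i` of all `2 ^ k`
  -- continuations enter with equal weight.
  fails-word : ∀ k ρ φ y K -> ρ rB ≡ k -> Reading k ρ ->
   (∀ i ρ' -> i < 2 ^ k -> Keep 27 30 ρ1 ρ' -> suc (ρ' rV) ≤ 2 ^ W -> ρ' rV ≡ ρ rV * 2 ^ k + i -> Fails (φ i) y (K ρ')) ->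
   Fails (Ʃ< (2 ^ k) φ) (2 ^ k * y) (loop rB (sem wordBody) k ρ >>= K)
  fails-word zero ρ φ y K B≡ (keep , _ , V≤) hyp = fails-by-refl (Ʃ< 1 φ) (1 * y) (ap (_>>= K) (loop-zero rB (sem wordBody) 0 ρ B≡))
   (fails-tick {Ʃ< 1 φ} {1 * y} {K ρ} (fails-cong {t = K ρ} (sym (+0 (φ 0))) (sym (+0 y))
    (hyp 0 ρ (s≤s z≤n) keep (⊑ (leq (sym (*1 _))) V≤) (sym (tr (+0 _) (*1 (ρ rV)))))))
  fails-word (suc k) ρ φ y K B≡ r@(keep , _ , _) hyp = fails-by-refl X' Y' (ap (_>>= K) (loop-suc rB (sem wordBody) k ρ (subst (0 <_) (sym B≡) (s≤s z≤n))))
   (fails-tick {X'} {Y'} {(sem wordBody ρ >>= B) >>= K} (fails-cong {t = (sem wordBody ρ >>= B) >>= K} x≡ (sym (*-assoc 2 (2 ^ k) y))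
    (fails-flip {x1} {x0} {2 ^ k * y} {(sem (set digit) (upd rBit 1 ρ) >>= B) >>= K} {(sem (set digit) (upd rBit 0 ρ) >>= B) >>= K}
     (branch' 1 rfl≤) (branch' 0 z≤n))))
   where
   X' = Ʃ< (2 ^ suc k) φ
   Y' = 2 ^ suc k * y
   B : Env -> Tree
   B ρ' = tick (tick (loop rB (sem wordBody) k ρ'))
   φ' : ℕ -> ℕ -> ℕ
   φ' b i = φ (b * 2 ^ k + i)
   x1 = Ʃ< (2 ^ k) (φ' 1)
   x0 = Ʃ< (2 ^ k) (φ' 0)
   x≡ : x1 + x0 ≡ X'
   x≡ = tr (+-comm x1 x0) (tr (ap (x0 +_) (Ʃ<-cong (2 ^ k) λ i _ -> ap (λ a -> φ (a + i)) (+0 (2 ^ k)))) (tr (sym (Ʃ<-+ (2 ^ k) (2 ^ k) φ)) (ap (λ a -> Ʃ< (2 ^ k + a) φ) (sym (+0 (2 ^ k))))))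
   branch' : ∀ b -> b ≤ 1 -> Fails (Ʃ< (2 ^ k) (φ' b)) (2 ^ k * y) ((sem (set digit) (upd rBit b ρ) >>= B) >>= K)
   branch' b b≤1 = fails-by-refl x' y' (>>=-assoc' (sem (set digit) (upd rBit b ρ)) B K)
    (fails->>= {x = x'} {y'} {sem (set digit) (upd rBit b ρ)} (safe-set digit (upd rBit b ρ) {Q = _≡ ρ'} (proj₁ ok) refl) λ { _ refl ->
     fails-ticks {x'} {y'} {loop rB (sem wordBody) k ρ' >>= K} 2 (fails-word k ρ' (φ' b) y K (ap (_∸ 1) B≡) (proj₂ ok)
      λ i ρ'' i< keep'' V< V≡ -> hyp (b * 2 ^ k + i) ρ'' (bound b b≤1 i<) keep'' V< (tr V≡ (grp (ρ rV) b (2 ^ k) i))) })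
    where
    x' = Ʃ< (2 ^ k) (φ' b)
    y' = 2 ^ k * y
    ρ' = runSet digit (upd rBit b ρ)
    ok = digit-fits {k} {ρ} b b≤1 B≡ r
    bound : ∀ b -> b ≤ 1 -> ∀ {i} -> i < 2 ^ k -> b * 2 ^ k + i < 2 ^ suc k
    bound b b≤1 i< = ⊑ (+-mono-≤-< (⊑ (*ˡ (2 ^ k) b≤1) (leq (*-identityˡ (2 ^ k)))) i<) (leq (ap (2 ^ k +_) (sym (+0 (2 ^ k)))))
    grp : ∀ v b z i -> (v + v + b) * z + i ≡ v * (2 * z) + (b * z + i)
    grp = ring

 module Fill (q : ℕ) (q≤s : q ≤ s) where

  N : ℕ
  N = 5 + (q + q)

  Regs : Env -> Set
  Regs ρ = ρ rQ ≡ q × ρ rW ≡ W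

  fresh : List (Addr × Exp)
  fresh = (rV , lit 0) ∷ (rB , reg rW) ∷ []

  address : Exp
  address = lit 5 ⊕ (reg rQ ⊕ reg rQ) ⊟ reg rI

  N≤cap : N ≤ cap
  N≤cap = ⊑ (+ʳ 5 (+≤ q≤s q≤s)) s≤cap

  Below : Addr -> Env -> Env -> Set
  Below a ρ ρ' = ∀ b -> b < 26 ⊎ (64 ≤ b × b < a) -> ρ' b ≡ ρ b

  module Step (i : ℕ) (ρ : Env) (I≡ : ρ rI ≡ suc i) (i< : i < N) (regs : Regs ρ) where

   ρ1 : Env
   ρ1 = runSet fresh ρ

   B≡ : ρ1 rB ≡ W
   B≡ = proj₂ regs

   open Word ρ1

   a : Addr
   a = N ∸ suc i + 64

   fits1 : Fits fresh ρ
   fits1 = z≤n , ⊑ (leq B≡) W≤cap , tt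

   reading : Reading W ρ1
   reading = keep-refl , rfl≤ , leq (*-identityˡ (2 ^ W))

   module After (ρ2 : Env) (keep : Keep 27 30 ρ1 ρ2) (V≤ : suc (ρ2 rV) ≤ 2 ^ W) where

    keep' : Keep 27 30 ρ ρ2
    keep' = keep-trans {27} {30} {ρ} {ρ1} {ρ2} (keep-runSet fresh ρ) keep

    a≡ : value address ρ2 + 64 ≡ a
    a≡ = ap (_+ 64) (ap₂ _∸_ (ap (λ q -> 5 + (q + q)) (tr (keep' rQ (inj₁ (m≤m+n 25 2))) (proj₁ regs))) (tr (keep' rI (inj₁ rfl≤)) I≡))

    a< : a < cells
    a< = <≤ (+-monoˡ-< 64 (≤< (∸-monoʳ-≤ N (s≤s (z≤n {i}))) (rfl≤ {suc (4 + (q + q))}))) (⊑ (⊑ (leq (+-comm N 64)) (⊑ (+ʳ 69 (+≤ q≤s q≤s)) (⊑ (n≤1+n (69 + (s + s))) (m≤m+n (70 + (s + s)) (s + s))))) (⊑ (leq (+-assoc 70 (s + s) (s + s))) cells≥))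

    ρ3 ρ4 : Env
    ρ3 = upd a (ρ2 rV) ρ2
    ρ4 = runSet ((rI , reg rI ⊟ lit 1) ∷ []) ρ3

    reg3 : ∀ r {_ : T (r <ᵇ 64)} -> ρ3 r ≡ ρ2 r
    reg3 r {ok} = upd-there ρ2 (λ eq -> <⇒≢ (<≤ (<ᵇ⇒< r 64 ok) (m≤n+m 64 (N ∸ suc i))) eq)

    I4≡ : ρ4 rI ≡ i
    I4≡ = ap (_∸ 1) (tr (reg3 rI) (tr (keep' rI (inj₁ rfl≤)) I≡))

    below : Below a ρ ρ4
    below b out = tr (upd-there ρ3 (λ { refl -> b≢26 out })) (tr (upd-there ρ2 (b≢a out)) (keep' b (outside out)))
     where
     b≢26 : ¬ (26 < 26 ⊎ (64 ≤ 26 × 26 < a))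
     b≢26 (inj₁ lt) = <-irrefl refl lt
     b≢26 (inj₂ (le , _)) = <⇒≱ (m≤m+n 27 37) le
     b≢a : ∀ {b} -> b < 26 ⊎ (64 ≤ b × b < a) -> b ≢ a
     b≢a (inj₁ lt) eq = <⇒≢ (<≤ lt (⊑ (m≤m+n 26 38) (m≤n+m 64 (N ∸ suc i)))) eq
     b≢a (inj₂ (_ , lt)) eq = <⇒≢ lt eq
     outside : ∀ {b} -> b < 26 ⊎ (64 ≤ b × b < a) -> Outside 27 30 b
     outside (inj₁ lt) = inj₁ (⊑ lt (m≤m+n 26 1))
     outside (inj₂ (le , _)) = inj₂ (⊑ (m≤m+n 30 34) le)

    regs4 : Regs ρ4
    regs4 = tr (below rQ (inj₁ (m≤m+n 25 1))) (proj₁ regs) , tr (below rW (inj₁ (m≤m+n 19 7))) (proj₂ regs)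

    stored : ρ4 a ≡ ρ2 rV
    stored = tr (upd-there ρ3 (λ eq -> <⇒≢ (<≤ (m≤m+n 27 37) (m≤n+m 64 (N ∸ suc i))) (sym eq))) (upd-here a (ρ2 rV) ρ2)

    store-safe : Safe Y (_≡ ρ3) u (sem (store 64 address (reg rV)) ρ2)
    store-safe = safe-store 64 address (reg rV) ρ2 (subst (_< cells) (sym a≡) a<) (⊑ (n≤1+n _) (⊑ V≤ 2^W≤cap)) (ap (λ a -> upd a (ρ2 rV) ρ2) a≡)

    count-safe : Safe Y (_≡ ρ4) u (sem (set ((rI , reg rI ⊟ lit 1) ∷ [])) ρ3)
    count-safe = safe-set ((rI , reg rI ⊟ lit 1) ∷ []) ρ3 (⊑ (leq I4≡) (⊑ (<⇒≤ i<) N≤cap) , tt) refl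

   step-safe : Safe Y (λ ρ' -> ρ' rI ≡ i × Below a ρ ρ' × Regs ρ') fillBodyCost (sem fillBody ρ)
   step-safe = safe->>= (safe-set fresh ρ {Q = _≡ ρ1} fits1 refl) λ { _ refl ->
    safe->>= (safe-count' rB wordBody Reading (suc u) word-body W ρ1 B≡ reading) λ { ρ2 (_ , keep , _ , V≤) ->
    let module Af = After ρ2 keep (⊑ (leq (sym (*1 _))) V≤)
    in safe->>= Af.store-safe λ { _ refl -> safe-map (λ { _ refl -> Af.I4≡ , Af.below , Af.regs4 }) Af.count-safe } } }

  fillCost : ℕ
  fillCost = u + suc (N * (fillBodyCost + 3))

  begin-fill : List (Addr × Exp)
  begin-fill = (rI , lit 5 ⊕ (reg rQ ⊕ reg rQ)) ∷ []

  I1≡ : ∀ ρ -> Regs ρ -> runSet begin-fill ρ rI ≡ N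
  I1≡ ρ regs = ap (λ q -> 5 + (q + q)) (proj₁ regs)

  fill-safe : ∀ ρ -> Regs ρ -> Safe Y (λ ρ' -> ∀ a -> a < 26 -> ρ' a ≡ ρ a) fillCost (sem fill ρ)
  fill-safe ρ regs = safe->>= (safe-set begin-fill ρ {Q = _≡ ρ1} (⊑ (leq (I1≡ ρ regs)) N≤cap , tt) refl) λ { _ refl ->
   safe-map (λ ρ' (_ , _ , same , _) -> same)
    (safe-count' rI fillBody Inv fillBodyCost body N ρ1 (I1≡ ρ regs) (rfl≤ , (λ a a< -> keep-runSet {26} {27} begin-fill ρ a (inj₁ a<)) , regs)) }
   where
   ρ1 = runSet begin-fill ρ
   Inv : ℕ -> Env -> Set
   Inv i ρ' = i ≤ N × (∀ a -> a < 26 -> ρ' a ≡ ρ a) × Regs ρ'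
   body : ∀ k ρ' -> ρ' rI ≡ suc k -> Inv (suc k) ρ' -> Safe Y (λ ρ'' -> ρ'' rI ≡ k × Inv k ρ'') fillBodyCost (sem fillBody ρ')
   body k ρ' I≡ (k< , same , regs) = safe-map (λ ρ'' (I≡ , below , regs) -> I≡ , <⇒≤ k< , (λ a a< -> tr (below a (inj₁ a<)) (same a a<)) , regs) (Step.step-safe k ρ' I≡ k< regs)

  fails-fill-loop : ∀ i ρ (φ : Vec ℕ i -> ℕ) y K -> ρ rI ≡ i -> i ≤ N -> Regs ρ ->
   (∀ β ρ' -> Below (N ∸ i + 64) ρ ρ' -> Holds (N ∸ i + 64) β ρ' -> Fails (φ β) y (K ρ')) ->
   Fails (Ʃ (vecs (upTo (2 ^ W)) i) φ) ((2 ^ W) ^ i * y) (loop rI (sem fillBody) i ρ >>= K)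
  fails-fill-loop zero ρ φ y K I≡ _ regs hyp = fails-by-refl (φ [] + 0) (1 * y) (ap (_>>= K) (loop-zero rI (sem fillBody) 0 ρ I≡))
   (fails-tick {φ [] + 0} {1 * y} {K ρ} (fails-cong {t = K ρ} (sym (+0 (φ []))) (sym (+0 y)) (hyp [] ρ (λ _ _ -> refl) tt)))
  fails-fill-loop (suc i) ρ φ y K I≡ i< regs hyp =
   fails-cong {t = loop rI (sem fillBody) (suc i) ρ >>= K} (sym (Ʃ-vecs-suc (upTo (2 ^ W)) i φ)) (sym (*-assoc (2 ^ W) ((2 ^ W) ^ i) y))
   (fails-by-refl X' Y' (ap (_>>= K) (loop-suc rI (sem fillBody) i ρ (subst (0 <_) (sym I≡) (s≤s z≤n))))
   (fails-tick {X'} {Y'} {(sem fillBody ρ >>= B) >>= K} (fails-by-refl X' Y' (>>=-assoc' (sem fillBody ρ) B K)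
   (fails-seq {X'} {Y'} (set fresh) (while rB wordBody ⨾ rest) ρ {BK}
   (fails->>= {x = X'} {Y'} {sem (set fresh) ρ} (safe-set fresh ρ {Q = _≡ St.ρ1} St.fits1 refl) λ { _ refl ->
   fails-seq {X'} {Y'} (while rB wordBody) rest St.ρ1 {BK} (fails-by-refl X' Y' (ap (λ k -> loop rB (sem wordBody) k St.ρ1 >>= λ ρ' -> sem rest ρ' >>= BK) St.B≡)
    (Word.fails-word St.ρ1 W St.ρ1 (λ v -> Ʃ[ β ← vecs (upTo (2 ^ W)) i ] φ (v ∷ β)) y' (λ ρ' -> sem rest ρ' >>= BK) St.B≡ St.reading after)) })))))
   where
   module St = Step i ρ I≡ i< regs
   y' = (2 ^ W) ^ i * y
   X' = Ʃ[ v ← upTo (2 ^ W) ] Ʃ[ β ← vecs (upTo (2 ^ W)) i ] φ (v ∷ β)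
   Y' = 2 ^ W * y'
   B BK : Env -> Tree
   B ρ' = tick (tick (loop rI (sem fillBody) i ρ'))
   BK ρ' = B ρ' >>= K
   rest : Cmd
   rest = store 64 address (reg rV) ⨾ set ((rI , reg rI ⊟ lit 1) ∷ [])
   after : ∀ v ρ2 -> v < 2 ^ W -> Keep 27 30 St.ρ1 ρ2 -> suc (ρ2 rV) ≤ 2 ^ W -> ρ2 rV ≡ St.ρ1 rV * 2 ^ W + v -> Fails (Ʃ[ β ← vecs (upTo (2 ^ W)) i ] φ (v ∷ β)) y' (sem rest ρ2 >>= BK)
   after v ρ2 v< keep V≤ V≡ = fails-seq {x'} {y'} (store 64 address (reg rV)) (set ((rI , reg rI ⊟ lit 1) ∷ [])) ρ2 {BK}
    (fails->>= {x = x'} {y'} {sem (store 64 address (reg rV)) ρ2} Af.store-safe λ { _ refl ->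
     fails->>= {x = x'} {y'} {sem (set ((rI , reg rI ⊟ lit 1) ∷ [])) Af.ρ3} Af.count-safe λ { _ refl ->
     fails-ticks {x'} {y'} {loop rI (sem fillBody) i Af.ρ4 >>= K} 2
      (fails-fill-loop i Af.ρ4 (φ ∘ (v ∷_)) y K Af.I4≡ (<⇒≤ i<) Af.regs4 λ β ρ' below holds ->
       hyp (v ∷ β) ρ' (λ b out -> tr (below b (widen out)) (Af.below b out))
        (tr (below (N ∸ suc i + 64) (inj₂ (m≤n+m 64 (N ∸ suc i) , leq next))) (tr Af.stored V≡) , subst (λ a -> Holds a β ρ') (sym next) holds)) } })
    where
    x' = Ʃ[ β ← vecs (upTo (2 ^ W)) i ] φ (v ∷ β)
    module Af = St.After ρ2 keep V≤
    next : suc (N ∸ suc i + 64) ≡ N ∸ i + 64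
    next = ap (_+ 64) (sym (+-∸-assoc 1 i<))
    widen : ∀ {b} -> b < 26 ⊎ (64 ≤ b × b < N ∸ suc i + 64) -> b < 26 ⊎ (64 ≤ b × b < N ∸ i + 64)
    widen (inj₁ lt) = inj₁ lt
    widen (inj₂ (le , lt)) = inj₂ (le , <-trans lt (leq next))

  -- The stored words are uniform over all vectors, so the bounds for the continuations are averaged
  -- over `β`. Dependence of the rest of the round on its random words is confined to `φ`.
  fails-fill : ∀ ρ (φ : Vec ℕ N -> ℕ) y K -> Regs ρ ->
   (∀ β ρ' -> (∀ a -> a < 26 -> ρ' a ≡ ρ a) -> Holds 64 β ρ' -> Fails (φ β) y (K ρ')) ->
   Fails (Ʃ (vecs (upTo (2 ^ W)) N) φ) ((2 ^ W) ^ N * y) (sem fill ρ >>= K)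
  fails-fill ρ φ y K regs hyp = fails-seq {X'} {Y'} (set begin-fill) (while rI fillBody) ρ {K}
   (fails->>= {x = X'} {Y'} {sem (set begin-fill) ρ} (safe-set begin-fill ρ {Q = _≡ ρ1} (⊑ (leq (I1≡ ρ regs)) N≤cap , tt) refl) λ { _ refl ->
   fails-by-refl X' Y' (ap (λ k -> loop rI (sem fillBody) k ρ1 >>= K) (I1≡ ρ regs))
   (fails-fill-loop N ρ1 φ y K (I1≡ ρ regs) rfl≤ regs λ β ρ' below holds ->
    hyp β ρ' (λ a a< -> tr (below a (inj₁ a<)) (keep-runSet {26} {27} begin-fill ρ a (inj₁ a<))) (subst (λ a -> Holds a β ρ') (ap (_+ 64) (n∸n≡0 N)) holds)) })
   where
   ρ1 = runSet begin-fill ρ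
   X' = Ʃ (vecs (upTo (2 ^ W)) N) φ
   Y' = (2 ^ W) ^ N * y

 searchCost X : ℕ
 searchCost = u + (suc (2 * ℓ * (u + 3)) + (u + (u + (u + (u + (u + suc (2 * ℓ * (u + (u + 1 + u) + 3))))))))
 X = 3 * u + 5 + 7 * (fillBodyCost + 3) + 2 * (searchCost + 3)

 Regs : ℕ -> ℕ -> Env -> Set
 Regs g1 g2 ρ = (ρ rL ≡ ℓ × ρ rD ≡ Δ) × (ρ rW ≡ W × ρ rM ≡ 2 ^ W) × (ρ rG1 ≡ g1 × ρ rG2 ≡ g2)

 regs-same : ∀ {g1 g2 ρ ρ'} -> (∀ a -> a < 24 -> ρ' a ≡ ρ a) -> Regs g1 g2 ρ -> Regs g1 g2 ρ'
 regs-same same ((l , d) , (w , z) , (g , g')) =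
  (tr (same rL (m≤m+n 17 7)) l , tr (same rD (m≤m+n 18 6)) d) , (tr (same rW (m≤m+n 19 5)) w , tr (same rM (m≤m+n 20 4)) z) ,
  (tr (same rG1 (m≤m+n 23 1)) g , tr (same rG2 rfl≤) g')

 module Round (g1 g2 q : ℕ) .{{_ : NonZero q}} (q≤s : q ≤ s) where

  open Fill q q≤s using (N; fillCost; fill-safe; fails-fill)
  open Labelling x y g1 g2 using (label)

  roundCost : ℕ
  roundCost = fillCost + (u + suc ((q + q) * (searchCost + 3)) + u)

  Ready : Env -> Set
  Ready ρ = Regs g1 g2 ρ × ρ rQ ≡ q × ρ rRC ≤ suc p

  Meets : Env -> Set
  Meets ρ = Collision (q + q) (2 * ℓ) Δ s (λ κ -> ρ (69 + κ) % n) label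
   (λ v -> (entry h (label v) + hash n (2 ^ W) m (ρ 64 ∷ ρ 65 ∷ ρ 66 ∷ ρ 67 ∷ []) (label v)) % n) (λ v -> (v + toℕ (ρ 68 mod n)) % n)

  ready-same : ∀ {ρ ρ'} -> (∀ a -> a < 26 -> ρ' a ≡ ρ a) -> Ready ρ -> Ready ρ'
  ready-same {ρ} {ρ'} same (regs , q≡ , rc) = regs-same {ρ = ρ} {ρ'} (λ a a< -> same a (⊑ a< (m≤m+n 24 2))) regs , tr (same rQ (m≤m+n 25 1)) q≡ , ⊑ (leq (same rRC rfl≤)) rc

  search-safe : ∀ ρ -> Ready ρ -> Safe Y (λ ρ' -> (∀ a -> a < 26 -> ρ' a ≡ ρ a) × ¬ Meets ρ) (u + suc ((q + q) * (searchCost + 3))) (sem paths ρ)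
  search-safe ρ (((l , d) , (w , z) , (g , g')) , q≡ , _) = safe-map (λ ρ' (ctx , none) -> (λ a a< -> ctx a (inj₁ a<)) , none)
   (Walker.search {setting} record { ρ0 = ρ ; L≡ = l ; D≡ = d ; M≡ = z ; G1≡ = g ; G2≡ = g' ; Q≡ = q≡ ; q≤s = q≤s })

  tally : List (Addr × Exp)
  tally = (rRC , reg rRC ⊟ lit 1) ∷ []

  tally-ready : ∀ {ρ} -> Ready ρ -> Ready (runSet tally ρ)
  tally-ready {ρ} (regs , q≡ , rc) = regs-same {ρ = ρ} {runSet tally ρ} (λ a a< -> keep-runSet {25} {26} tally ρ a (inj₁ (⊑ a< (n≤1+n 24)))) regs , q≡ , ⊑ (m∸n≤m (ρ rRC) 1) rc

  tally-safe : ∀ ρ -> Ready ρ -> Safe Y (_≡ runSet tally ρ) u (sem (set tally) ρ)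
  tally-safe ρ (_ , _ , rc) = safe-set tally ρ (⊑ (m∸n≤m (ρ rRC) 1) (⊑ rc p<cap) , tt) refl

  regs-fill : ∀ {ρ} -> Ready ρ -> ρ rQ ≡ q × ρ rW ≡ W
  regs-fill ((_ , (w , _) , _) , q≡ , _) = q≡ , w

  round-safe : ∀ k ρ -> ρ rRC ≡ suc k -> Ready ρ -> Safe Y (λ ρ' -> ρ' rRC ≡ k × (∀ a -> a < 25 -> ρ' a ≡ ρ a) × Ready ρ') roundCost (sem round ρ)
  round-safe k ρ rc≡ ready = safe->>= (fill-safe ρ (regs-fill {ρ} ready)) λ ρ1 same1 -> let ready1 = ready-same {ρ} {ρ1} same1 ready in
   safe->>= (search-safe ρ1 ready1) λ ρ2 (same2 , _) -> let ready2 = ready-same {ρ1} {ρ2} same2 ready1 in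
   safe-map (λ { _ refl -> ap (_∸ 1) (tr (same2 rRC rfl≤) (tr (same1 rRC rfl≤) rc≡)) ,
    (λ a a< -> tr (keep-runSet {25} {26} tally ρ2 a (inj₁ a<)) (tr (same2 a (⊑ a< (n≤1+n 25))) (same1 a (⊑ a< (n≤1+n 25))))) , tally-ready {ρ2} ready2 }) (tally-safe ρ2 ready2)

  module Lucky (good : Vec ℕ N -> ℕ) (meets : ∀ w ρ -> Holds 64 w ρ -> 0 < good w -> Meets ρ) where

   misses : ℕ
   misses = Ʃ[ w ← vecs (upTo (2 ^ W)) N ] (1 ∸ good w)

   fails-round : ∀ k ρ a b K -> ρ rRC ≡ suc k -> Ready ρ -> (∀ ρ' -> ρ' rRC ≡ k -> Ready ρ' -> Fails a b (K ρ')) ->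
    Fails (misses * a) ((2 ^ W) ^ N * b) (sem round ρ >>= K)
   fails-round k ρ a b K rc≡ ready hyp = fails-cong {t = sem round ρ >>= K} (Ʃ-*ʳ a (vecs (upTo (2 ^ W)) N) (λ w -> 1 ∸ good w)) refl
    (fails-seq {X'} {Y'} fill (paths ⨾ set tally) ρ {K} (fails-fill ρ (λ w -> (1 ∸ good w) * a) b _ (regs-fill {ρ} ready) after))
    where
    X' = Ʃ[ w ← vecs (upTo (2 ^ W)) N ] ((1 ∸ good w) * a)
    Y' = (2 ^ W) ^ N * b
    after : ∀ w ρ1 -> (∀ a -> a < 26 -> ρ1 a ≡ ρ a) -> Holds 64 w ρ1 -> Fails ((1 ∸ good w) * a) b (sem (paths ⨾ set tally) ρ1 >>= K)
    after w ρ1 same1 holds = fails-seq {(1 ∸ good w) * a} {b} paths (set tally) ρ1 {K} (decide (good w) refl)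
     where
     ready1 = ready-same {ρ} {ρ1} same1 ready
     decide : ∀ g -> good w ≡ g -> Fails ((1 ∸ g) * a) b (sem paths ρ1 >>= λ ρ' -> sem (set tally) ρ' >>= K)
     -- A lucky round cannot return: the search would have refuted the collision that `meets`
     -- provides.
     decide (suc g) eq = fails->>= {x = (0 ∸ g) * a} {b} {sem paths ρ1} (search-safe ρ1 ready1) λ ρ2 (_ , none) ->
      refute (meets w ρ1 holds (subst (0 <_) (sym eq) (s≤s z≤n))) none
     decide zero eq = fails-cong {t = sem paths ρ1 >>= λ ρ' -> sem (set tally) ρ' >>= K} (sym (+0 a)) refl
      (fails->>= {x = a} {b} {sem paths ρ1} (search-safe ρ1 ready1) λ ρ2 (same2 , _) ->
       let ready2 = ready-same {ρ1} {ρ2} same2 ready1 in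
       fails->>= {x = a} {b} {sem (set tally) ρ2} (tally-safe ρ2 ready2) λ { _ refl ->
        hyp _ (ap (_∸ 1) (tr (same2 rRC rfl≤) (tr (same1 rRC rfl≤) rc≡))) (tally-ready {ρ2} ready2) })

  rounds : List (Addr × Exp)
  rounds = (rRC , lit 1 ⊕ p' ⊘ reg rQ) ∷ []

  module Begin (ρ : Env) (regs : Regs g1 g2 ρ) (q≡ : ρ rQ ≡ q) where

   ρ1 : Env
   ρ1 = runSet rounds ρ

   rc≡ : ρ1 rRC ≡ suc (p / q)
   rc≡ = ap suc (tr (ap (⟦ div ⟧ p) q≡) (div≡ p q))

   ready : Ready ρ1
   ready = regs-same {ρ = ρ} {ρ1} (λ a a< -> keep-runSet {25} {26} rounds ρ a (inj₁ (⊑ a< (n≤1+n 24)))) regs , q≡ , ⊑ (leq rc≡) (s≤s (m/n≤m p q))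

   rounds-safe : Safe Y (_≡ ρ1) u (sem (set rounds) ρ)
   rounds-safe = safe-set rounds ρ (⊑ (proj₂ (proj₂ ready)) p<cap , tt) refl

  halve : List (Addr × Exp)
  halve = (rQ , reg rQ ⊘ lit 2) ∷ []

  level-safe : ∀ ρ -> Regs g1 g2 ρ -> ρ rQ ≡ q ->
   Safe Y (λ ρ' -> (∀ a -> a < 24 -> ρ' a ≡ ρ a) × ρ' rQ ≡ q / 2) (u + (suc (suc (p / q) * (roundCost + 3)) + u)) (sem level ρ)
  level-safe ρ regs q≡ = safe->>= Bg.rounds-safe λ { _ refl ->
   safe->>= (safe-count' rRC round Inv roundCost body (suc (p / q)) Bg.ρ1 Bg.rc≡ ((λ _ _ -> refl) , Bg.ready)) λ ρ2 (_ , same , _) ->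
   safe-set halve ρ2 (⊑ (m/n≤m (ρ2 rQ) 2) (⊑ (leq (tr (same rQ rfl≤) q≡)) (⊑ q≤s (⊑ (m≤m+n s s) (⊑ (m≤n+m (s + s) 5) s≤cap)))) , tt)
    ((λ a a< -> tr (keep-runSet {24} {25} halve ρ2 a (inj₁ a<)) (tr (same a (⊑ a< (n≤1+n 24))) (keep-runSet {25} {26} rounds ρ a (inj₁ (⊑ a< (n≤1+n 24)))))) ,
     ap (_/ 2) (tr (same rQ rfl≤) q≡)) }
   where
   module Bg = Begin ρ regs q≡
   Inv : ℕ -> Env -> Set
   Inv k ρ' = (∀ a -> a < 25 -> ρ' a ≡ Bg.ρ1 a) × Ready ρ'
   body : ∀ k ρ' -> ρ' rRC ≡ suc k -> Inv (suc k) ρ' -> Safe Y (λ ρ'' -> ρ'' rRC ≡ k × Inv k ρ'') roundCost (sem round ρ')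
   body k ρ' rc≡ (same , ready) = safe-map (λ ρ'' (rc , same' , ready') -> rc , (λ a a< -> tr (same' a a<) (same a a<)) , ready') (round-safe k ρ' rc≡ ready)

  module LuckyLevel (good : Vec ℕ N -> ℕ) (meets : ∀ w ρ -> Holds 64 w ρ -> 0 < good w -> Meets ρ) where

   open Lucky good meets

   a b : ℕ
   a = misses ^ suc (p / q)
   b = ((2 ^ W) ^ N) ^ suc (p / q)

   fails-level : ∀ ρ -> Regs g1 g2 ρ -> ρ rQ ≡ q -> Fails a b (sem level ρ)
   fails-level ρ regs q≡ = fails->>= {x = a} {b} {sem (set rounds) ρ} Bg.rounds-safe λ { _ refl ->
    fails->>=ˡ {a} {b} (sem (while rRC round) Bg.ρ1)
     (subst (λ k -> Fails a b (loop rRC (sem round) k Bg.ρ1)) (sym Bg.rc≡)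
      (fails-power rRC (sem round) misses ((2 ^ W) ^ N) Ready fails-round (suc (p / q)) Bg.ρ1 Bg.rc≡ Bg.ready)) }
    where
    module Bg = Begin ρ regs q≡

 levelCost alignmentCost : ℕ
 levelCost = u + (suc ((s + p) * X) + u)
 alignmentCost = u + (suc (W * (levelCost + 3)) + u)

 -- A round costs at most `q * X`, and `suc (p / q)` rounds make at most `(q + p) * X`. With `q ≤ s`
 -- the bound no longer depends on the level.
 level-cost : ∀ q .{{_ : NonZero q}} (q≤s : q ≤ s) -> u + (suc (suc (p / q) * (Round.roundCost 0 0 q q≤s + 3)) + u) ≤ levelCost
 level-cost q q≤s = +ʳ u (+ˡ u (s≤s (begin
  suc (p / q) * (u + suc ((5 + (q + q)) * (fillBodyCost + 3)) + (u + suc ((q + q) * (searchCost + 3)) + u) + 3)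
   ≤⟨ *ʳ (suc (p / q)) (⊑ (leq (split u (5 + (q + q)) (fillBodyCost + 3) q (searchCost + 3))) (⊑ (+ˡ (2 * q * (searchCost + 3)) (+≤ (m≤n*m (3 * u + 5) q) (*ˡ (fillBodyCost + 3) (+ˡ (q + q) (m≤m*n 5 q))))) (leq (collect q u (fillBodyCost + 3) (searchCost + 3))))) ⟩
  suc (p / q) * (q * X) ≡⟨ *-assoc (suc (p / q)) q X ⟨
  (q + p / q * q) * X ≤⟨ *ˡ X (+≤ q≤s (m/n*n≤m p q)) ⟩
  (s + p) * X ∎)))
  where
  open ≤R
  split : ∀ u N f q g -> u + suc (N * f) + (u + suc ((q + q) * g) + u) + 3 ≡ 3 * u + 5 + N * f + 2 * q * g
  split = ring
  collect : ∀ q u f g -> q * (3 * u + 5) + (5 * q + (q + q)) * f + 2 * q * g ≡ q * (3 * u + 5 + 7 * f + 2 * g)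
  collect = ring

 Base : Env -> Set
 Base ρ = (ρ rL ≡ ℓ × ρ rD ≡ Δ) × (ρ rW ≡ W × ρ rM ≡ 2 ^ W)

 base-same : ∀ {ρ ρ'} -> (∀ a -> a < 20 -> ρ' a ≡ ρ a) -> Base ρ -> Base ρ'
 base-same same ((l , d) , (w , z)) = (tr (same rL (m≤m+n 17 3)) l , tr (same rD (m≤m+n 18 2)) d) , (tr (same rW (m≤m+n 19 1)) w , tr (same rM rfl≤) z)

 align : List (Addr × Exp)
 align = (rG1 , reg rGG ⊙ lit 2) ∷ (rG2 , (reg rGG ⊟ lit 1) ⊘ lit 2) ∷ (rQ , s') ∷ []

 countdown : List (Addr × Exp)
 countdown = (rGG , reg rGG ⊟ lit 1) ∷ []

 6≤cap : 6 ≤ cap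
 6≤cap = ⊑ (+ʳ 5 (⊑ (>-nonZero⁻¹ s) (m≤m+n s s))) s≤cap

 module Alignment (k : ℕ) (k<6 : k < 6) (ρ : Env) (gg≡ : ρ rGG ≡ suc k) (base : Base ρ) where

  g1 g2 : ℕ
  g1 = suc k % 2
  g2 = k / 2

  ρ1 : Env
  ρ1 = runSet align ρ

  keep1 : ∀ a -> a < 22 -> ρ1 a ≡ ρ a
  keep1 a a< = keep-runSet {22} {25} align ρ a (inj₁ a<)

  regs : Regs g1 g2 ρ1
  regs = let lens , wm = base-same {ρ} {ρ1} (λ a a< -> keep1 a (⊑ a< (m≤m+n 20 2))) base
   in lens , wm , (ap (_% 2) gg≡ , ap (λ g -> (g ∸ 1) / 2) gg≡)

  k≤cap : suc k ≤ cap
  k≤cap = ⊑ k<6 6≤cap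

  align-safe : Safe Y (_≡ ρ1) u (sem (set align) ρ)
  align-safe = safe-set align ρ
   ( ⊑ (m%n≤m (ρ rGG) 2) gg≤
   , ⊑ (m/n≤m (ρ rGG ∸ 1) 2) (⊑ (m∸n≤m (ρ rGG) 1) gg≤)
   , ⊑ (m≤m+n s s) (⊑ (m≤n+m (s + s) 5) s≤cap) , tt) refl
   where
   gg≤ : ρ rGG ≤ cap
   gg≤ = ⊑ (leq gg≡) k≤cap

  Inv : ℕ -> Env -> Set
  Inv i ρ' = (∀ a -> a < 24 -> ρ' a ≡ ρ1 a) × ρ' rQ ≤ s × ρ' rQ < 2 ^ i

  one-level : ∀ ρ' -> (∀ a -> a < 24 -> ρ' a ≡ ρ1 a) -> 0 < ρ' rQ -> ρ' rQ ≤ s ->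
   Safe Y (λ ρ'' -> ((∀ a -> a < 24 -> ρ'' a ≡ ρ1 a) × ρ'' rQ ≡ ρ' rQ / 2) × ρ'' rQ < ρ' rQ) levelCost (sem level ρ')
  one-level ρ' same pos q≤s = safe-weaken (level-cost (ρ' rQ) q≤s) (safe-map
   (λ ρ'' (same' , half) -> ((λ a a< -> tr (same' a a<) (same a a<)) , half) , ≤< (leq half) (m/n<m (ρ' rQ) 2 rfl≤))
   (Round.level-safe g1 g2 (ρ' rQ) q≤s ρ' (regs-same {ρ = ρ1} {ρ'} same regs) refl))
   where
   instance
    q≢0 : NonZero (ρ' rQ)
    q≢0 = >-nonZero pos

  alignment-safe : Safe Y (λ ρ' -> ρ' rGG ≡ k × Base ρ') alignmentCost (sem alignment ρ)
  alignment-safe = safe->>= align-safe λ { _ refl ->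
   safe->>= (safe-loop rQ (sem level) Inv levelCost (λ (_ , _ , lt) -> n≤0⇒n≡0 (s≤s⁻¹ lt))
    (λ i ρ' (same , q≤s , q<) pos -> safe-map (λ ρ'' ((same' , half) , lt) -> (same' , ⊑ (<⇒≤ lt) q≤s ,
     ≤< (leq half) (m<n*o⇒m/o<n (<≤ q< (leq (*-comm 2 (2 ^ i)))))) , lt) (one-level ρ' same pos q≤s))
    W (ρ1 rQ) ρ1 rfl≤ ((λ _ _ -> refl) , rfl≤ , s<2^W)) λ ρ2 (_ , (same , _) , _) ->
   let gg2 = tr (same rGG (m≤m+n 22 2)) (tr (keep1 rGG rfl≤) gg≡) in
   safe-set countdown ρ2 (⊑ (m∸n≤m (ρ2 rGG) 1) (⊑ (leq gg2) k≤cap) , tt)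
    (ap (_∸ 1) gg2 , base-same {ρ} {runSet countdown ρ2} (λ a a< -> tr (keep-runSet {21} {22} countdown ρ2 a (inj₁ (⊑ a< (n≤1+n 20))))
     (tr (same a (⊑ a< (m≤m+n 20 4))) (keep1 a (⊑ a< (m≤m+n 20 2))))) base) }

  fails-alignment : ∀ x y i q -> 0 < q -> iter (_/ 2) i s ≡ q ->
   (∀ ρ' -> Regs g1 g2 ρ' -> ρ' rQ ≡ q -> Fails x y (sem level ρ')) -> Fails x y (sem alignment ρ)
  fails-alignment x y i q 0<q reach lucky = fails->>= {x = x} {y} {sem (set align) ρ} align-safe λ { _ refl ->
   fails->>=ˡ {x} {y} (sem (while rQ level) ρ1) (go i (ρ1 rQ) ρ1 rfl≤ (λ _ _ -> refl) rfl≤ reach) }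
   where
   positive : ∀ i q' -> iter (_/ 2) i q' ≡ q -> 0 < q'
   positive zero q' refl = 0<q
   positive (suc i) (suc q') eq = s≤s z≤n
   positive (suc i) zero eq = positive i 0 eq
   go : ∀ i fuel ρ' -> ρ' rQ ≤ fuel -> (∀ a -> a < 24 -> ρ' a ≡ ρ1 a) -> ρ' rQ ≤ s -> iter (_/ 2) i (ρ' rQ) ≡ q -> Fails x y (loop rQ (sem level) fuel ρ')
   go zero fuel ρ' ≤fuel same q≤s reach = fails-loop-here x y rQ (sem level) fuel ρ' (subst (0 <_) (sym reach) 0<q) ≤fuel (lucky ρ' (regs-same {ρ = ρ1} {ρ'} same regs) reach)
   go (suc i) fuel ρ' ≤fuel same q≤s reach = fails-loop-later x y rQ (sem level) fuel ρ' pos ≤fuel (one-level ρ' same pos q≤s)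
    λ fuel ρ'' ≤fuel (same' , half) -> go i fuel ρ'' ≤fuel same' (⊑ (leq half) (⊑ (m/n≤m (ρ' rQ) 2) q≤s)) (tr (ap (iter (_/ 2) i) half) reach)
    where
    pos = positive (suc i) (ρ' rQ) reach

 grow : ℕ -> ℕ
 grow l = l + (1 ∸ (s * p * ((1 + l) * (1 + l)) * 8192 ∸ n * n))

 -- A modulus above this number is large enough for both requirements of the analysis:
 -- `(2 + m ^ 3) * n` for the hash and `2 * (suc (q + q) * n)` for words reduced modulo `n`.
 X0 : ℕ
 X0 = 8 * (n * n) * (m * m * m)

 module Whole (ℓ≡ : iter grow n 1 ≡ ℓ) (Δ≡ : suc (_/_ n (ℓ * 144) {{m*n≢0 ℓ 144}}) ≡ Δ)
  (X0≤cap : X0 ≤ cap) (X0<2^W : X0 < 2 ^ W) (2^W≤2X0 : 2 ^ W ≤ X0 + X0) where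

  begin1 begin2 begin3 : List (Addr × Exp)
  begin1 = (rL , lit 1) ∷ (rC , n') ∷ []
  begin2 = (rM , lit 1) ∷ (rW , lit 0) ∷ (rC , lit 8 ⊗ (n' ⊗ n') ⊗ (m' ⊗ m' ⊗ m')) ∷ []
  begin3 = (rD , lit 1 ⊕ n' ⊘ (reg rL ⊗ lit 144)) ∷ (rGG , lit 6) ∷ []

  setupCost : ℕ
  setupCost = u + (suc (n * (u + 3)) + (u + (suc (W * (u + 3)) + u)))

  1≤cap : 1 ≤ cap
  1≤cap = ⊑ (s≤s z≤n) 6≤cap

  Growing : ℕ -> Env -> Set
  Growing k ρ = iter grow k (ρ rL) ≡ ℓ × ρ rL + k ≤ suc n

  grow-step : ∀ k ρ -> ρ rC ≡ suc k -> Growing (suc k) ρ -> Safe Y (λ ρ' -> ρ' rC ≡ k × Growing k ρ') u (sem (set lengthBody) ρ)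
  grow-step k ρ C≡ (reach , L≤) = safe-set lengthBody ρ
   (⊑ (m≤m+n (grow (ρ rL)) k) (⊑ L'≤ n<cap) , ⊑ (m∸n≤m (ρ rC) 1) (⊑ (leq C≡) (⊑ (m≤n+m (suc k) (ρ rL)) (⊑ L≤ n<cap))) , tt)
   (ap (_∸ 1) C≡ , reach , L'≤)
   where
   L'≤ : grow (ρ rL) + k ≤ suc n
   L'≤ = ⊑ (+ˡ k (+ʳ (ρ rL) (m∸n≤m 1 (s * p * ((1 + ρ rL) * (1 + ρ rL)) * 8192 ∸ n * n)))) (⊑ (leq (+-assoc (ρ rL) 1 k)) L≤)

  -- `rC` is the quotient of `X0` by the current modulus, so it vanishes as soon as the modulus
  -- exceeds `X0`.
  Doubling : ℕ -> Env -> Set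
  Doubling k ρ = ρ rL ≡ ℓ × ρ rM ≡ 2 ^ ρ rW × ρ rW + k ≡ W × ρ rC * ρ rM ≤ X0 × X0 < suc (ρ rC) * ρ rM

  double-step : ∀ k ρ -> Doubling (suc k) ρ -> 0 < ρ rC -> Safe Y (λ ρ' -> Doubling k ρ' × ρ' rC < ρ rC) u (sem (set widthBody) ρ)
  double-step k ρ (L≡ , M≡ , W≡ , C≤ , <C) pos = safe-set widthBody ρ
   ( ⊑ (leq M'≡) (⊑ (^-monoʳ-≤ 2 W'≤) 2^W≤cap)
   , ⊑ W'≤ W≤cap
   , ⊑ (m/n≤m (ρ rC) 2) (⊑ (m≤m*n (ρ rC) (ρ rM) {{subst NonZero (sym M≡) (m^n≢0 2 (ρ rW))}}) (⊑ C≤ X0≤cap)) , tt)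
   ((L≡ , M'≡ , tr (+-assoc (ρ rW) 1 k) W≡ ,
    ⊑ (leq (grp (ρ rC / 2) (ρ rM))) (⊑ (*ˡ (ρ rM) (m/n*n≤m (ρ rC) 2)) C≤) ,
    <≤ <C (⊑ (*ˡ (ρ rM) halves) (leq (sym (grp (suc (ρ rC / 2)) (ρ rM)))))) , m/n<m (ρ rC) 2 {{>-nonZero pos}} rfl≤)
   where
   M'≡ : ρ rM + ρ rM ≡ 2 ^ (ρ rW + 1)
   M'≡ = tr (ap₂ _+_ M≡ M≡) (tr (ap (2 ^ ρ rW +_) (sym (+0 (2 ^ ρ rW)))) (ap (2 ^_) (+-comm 1 (ρ rW))))
   W'≤ : ρ rW + 1 ≤ W
   W'≤ = ⊑ (+ʳ (ρ rW) (s≤s z≤n)) (leq W≡)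
   grp : ∀ c z -> c * (z + z) ≡ c * 2 * z
   grp = ring
   halves : suc (ρ rC) ≤ suc (ρ rC / 2) * 2
   halves = ⊑ (leq (ap suc (m≡m%n+[m/n]*n (ρ rC) 2))) (+ˡ (ρ rC / 2 * 2) (m%n<n (ρ rC) 2))

  doubled : ∀ ρ -> (∃ λ k -> Doubling k ρ × ρ rC ≡ 0) -> ρ rL ≡ ℓ × ρ rW ≡ W × ρ rM ≡ 2 ^ W
  doubled ρ (zero , (L≡ , M≡ , W≡ , _) , _) = let W≡' = tr (sym (+0 _)) W≡ in L≡ , W≡' , tr M≡ (ap (2 ^_) W≡')
  -- Stopping with fewer than `W` bits would give `X0 + X0 < 2 ^ W`.
  doubled ρ (suc k , (L≡ , M≡ , W≡ , _ , <C) , C≡0) = refute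
   (⊑ (+-mono-< X0<M X0<M) (⊑ (leq (tr (ap (2 ^ ρ rW +_) (sym (+0 (2 ^ ρ rW)))) refl)) (^-monoʳ-≤ 2 {suc (ρ rW)} {W} (⊑ (⊑ (s≤s (m≤m+n (ρ rW) k)) (leq (sym (+-suc (ρ rW) k)))) (leq W≡)))))
   (≤⇒≯ 2^W≤2X0)
   where
   X0<M : X0 < 2 ^ ρ rW
   X0<M = <≤ <C (leq (tr (ap (λ c -> suc c * ρ rM) C≡0) (tr (+0 (ρ rM)) M≡)))

  setup-safe : Safe Y (λ ρ -> ρ rGG ≡ 6 × Base ρ) setupCost (sem setup (λ _ -> 0))
  setup-safe = safe->>= (safe-set begin1 (λ _ -> 0) {Q = λ ρ -> ρ rC ≡ n × Growing n ρ} (1≤cap , <⇒≤ n<cap , tt) (refl , ℓ≡ , rfl≤)) λ ρ1 (C1 , growing) ->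
   safe->>= (safe-count' rC (set lengthBody) Growing u grow-step n ρ1 C1 growing) λ ρ2 (_ , L2 , _) ->
   safe->>= (safe-set begin2 ρ2 {Q = λ ρ -> Doubling W ρ} (1≤cap , z≤n , X0≤cap , tt)
    (L2 , refl , refl , leq (*1 X0) , leq (sym (*1 (suc X0))))) λ ρ3 doubling ->
   safe->>= (safe-loop rC (sem (set widthBody)) Doubling u (λ {ρ} d -> C≡0 ρ d) double-step W (ρ3 rC) ρ3 rfl≤ doubling) λ ρ4 final ->
   let L4 , W4 , M4 = doubled ρ4 final
       D≡ = tr (ap suc (tr (ap (λ l -> ⟦ div ⟧ n (l * 144)) L4) (div≡ n (ℓ * 144) {{m*n≢0 ℓ 144}}))) Δ≡
   in safe-set begin3 ρ4 (⊑ (leq D≡) Δ≤cap , 6≤cap , tt) (refl , (L4 , D≡) , (W4 , M4))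
   where
   C≡0 : ∀ ρ -> Doubling 0 ρ -> ρ rC ≡ 0
   C≡0 ρ (_ , M≡ , W≡ , C≤ , _) = none (ρ rC) (subst (λ z -> ρ rC * z ≤ X0) (tr M≡ (ap (2 ^_) (tr (sym (+0 _)) W≡))) C≤)
    where
    none : ∀ c -> c * 2 ^ W ≤ X0 -> c ≡ 0
    none zero _ = refl
    none (suc c) le = refute (⊑ (m≤n*m (2 ^ W) (suc c)) le) (<⇒≱ X0<2^W)

  finish : Env -> Tree
  finish ρ = tick (ret ρ)

  totalCost : ℕ
  totalCost = setupCost + suc (6 * (alignmentCost + 3)) + 1

  Aligned : ℕ -> Env -> Set
  Aligned k ρ = k ≤ 6 × Base ρ

  aligned : ∀ k ρ -> ρ rGG ≡ suc k -> Aligned (suc k) ρ -> Safe Y (λ ρ' -> ρ' rGG ≡ k × Aligned k ρ') alignmentCost (sem alignment ρ)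
  aligned k ρ gg≡ (k< , base) = safe-map (λ ρ' (gg , base') -> gg , <⇒≤ k< , base') (Alignment.alignment-safe k k< ρ gg≡ base)

  program-safe : Safe Y (λ _ -> ⊤) totalCost (sem program (λ _ -> 0) >>= finish)
  program-safe = safe->>= (safe->>= setup-safe λ ρ (gg≡ , base) -> safe-count' rGG alignment Aligned alignmentCost aligned 6 ρ gg≡ (rfl≤ , base)) λ ρ _ -> tick (ret tt)

  fails-program : ∀ x y k -> k < 6 -> ∀ i q -> 0 < q -> iter (_/ 2) i s ≡ q ->
   (∀ ρ -> Regs (suc k % 2) (k / 2) ρ -> ρ rQ ≡ q -> Fails x y (sem level ρ)) -> Fails x y (sem program (λ _ -> 0) >>= finish)
  fails-program x y k k<6 i q 0<q reach lucky = fails->>=ˡ {x} {y} (sem program (λ _ -> 0)) (fails->>= {x = x} {y} {sem setup (λ _ -> 0)} setup-safe λ ρ (gg≡ , base) ->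
   go (6 ∸ suc k) 5 (ρ rGG) ρ rfl≤ rfl≤ gg≡ (sym (m+[n∸m]≡n (s≤s⁻¹ k<6))) base)
   where
   go : ∀ d k' fuel ρ -> ρ rGG ≤ fuel -> k' < 6 -> ρ rGG ≡ suc k' -> k' ≡ k + d -> Base ρ -> Fails x y (loop rGG (sem alignment) fuel ρ)
   go zero k' fuel ρ ≤fuel k'< gg≡ k'≡ base = fails-loop-here x y rGG (sem alignment) fuel ρ (subst (0 <_) (sym gg≡) (s≤s z≤n)) ≤fuel
    (Alignment.fails-alignment k' k'< ρ gg≡ base x y i q 0<q reach (subst (λ k -> ∀ ρ -> Regs (suc k % 2) (k / 2) ρ -> ρ rQ ≡ q -> Fails x y (sem level ρ)) (sym (tr k'≡ (+0 k))) lucky))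
   go (suc d) k' fuel ρ ≤fuel k'< gg≡ k'≡ base = fails-loop-later x y rGG (sem alignment) fuel ρ (subst (0 <_) (sym gg≡) (s≤s z≤n)) ≤fuel
    (safe-map (λ ρ' (gg' , base') -> (gg' , base') , ⊑ (s≤s (leq gg')) (leq (sym gg≡))) (Alignment.alignment-safe k' k'< ρ gg≡ base))
    λ fuel ρ' ≤fuel (gg' , base') -> go d (k + d) fuel ρ' ≤fuel (⊑ (⊑ (leq (sym (+-suc k d))) (leq (sym k'≡))) (<⇒≤ k'<)) (tr gg' (tr k'≡ (+-suc k d))) refl base'

-- Constants.

opaque
 unit : ℕ
 unit = 2000

 2000≤unit : 2000 ≤ unit
 2000≤unit = rfl≤

 spread rate : ℕ
 spread = 384
 rate = 8192 * 4 * 2048 * 2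

 384≤spread : 384 ≤ spread
 384≤spread = rfl≤

 rate≥ : 8192 * 4 * 2048 * 2 ≤ rate
 rate≥ = rfl≤

opaque
 margin : ℕ
 margin = 1152 * rate * suc (9 * (suc spread * suc spread))

 margin≡ : 1152 * rate * suc (9 * (suc spread * suc spread)) ≡ margin
 margin≡ = refl

1≤margin : 1 ≤ margin
1≤margin = subst (1 ≤_) margin≡ (*≤ {1} {1152 * rate} (*≤ {1} {1152} {1} (s≤s z≤n) (⊑ (s≤s z≤n) rate≥)) (s≤s z≤n))

instance
 unit≢0 : NonZero unit
 unit≢0 = >-nonZero (⊑ (s≤s z≤n) 2000≤unit)

disjointness : Algorithm
disjointness = record { code = compile program 0 ; wordFactor = maxDeg }

k≤2^k : ∀ k -> k ≤ 2 ^ k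
k≤2^k zero = z≤n
k≤2^k (suc k) = ⊑ (+≤ (m^n>0 2 k) (k≤2^k k)) (leq (ap (2 ^ k +_) (sym (+0 (2 ^ k)))))

-- Since `s` is positive, the 70 fixed cells and the `4 s` others are at most `74 s`. The factor
-- `1 + d` bounds `log n + log m` by `log n`.
spaceFactor : ℕ -> ℕ -> ℕ
spaceFactor e d = 74 * (e * (1 + d))

opaque
 -- The square comes from the two occurrences of `W` in the running time, each at most `6 + 3 d`
 -- times the logarithm of the time bound's argument.
 factor : ℕ -> ℕ
 factor d = Costs.totalC unit * ((6 + 3 * d) * (6 + 3 * d)) + spaceFactor maxDeg d

 factor-time : ∀ d -> Costs.totalC unit * ((6 + 3 * d) * (6 + 3 * d)) ≤ factor d
 factor-time d = m≤m+n _ _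

 factor-space : ∀ d -> spaceFactor maxDeg d ≤ factor d
 factor-space d = m≤n+m _ _

-- The theorem for one instance.

record Task : Set where
 field
  n m s p d : ℕ
  {{s≢0}} : NonZero s
  {{p≢0}} : NonZero p
  x y : Vec (Fin m) n
  m≤ : m ≤ n ^ d
  freqs≤ : sumSquaredFreqs x y ≤ p
  sp≤' : s * p ≤ n ^ 2

module Solve (task : Task) where

 open Task task

 sp≤ : s * p ≤ n * n
 sp≤ = ⊑ sp≤' (leq (ap (n *_) (*1 n)))

 1≤n : 1 ≤ n
 1≤n = go n sp≤
  where
  go : ∀ n -> s * p ≤ n * n -> 1 ≤ n
  go zero le = ⊑ (*≤ (>-nonZero⁻¹ s) (>-nonZero⁻¹ p)) le
  go (suc _) _ = s≤s z≤n

 instance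
  n≢0 : NonZero n
  n≢0 = >-nonZero 1≤n
  m≢0 : NonZero m
  m≢0 = Fin.nonZeroIndex (lookup x (fromℕ< 1≤n))

 2n≤p : n * 2 ≤ p
 2n≤p = ⊑ (2n≤sumSquaredFreqs x y) freqs≤

 n≤p : n ≤ p
 n≤p = ⊑ (m≤m*n n 2) 2n≤p

 p≤n² : p ≤ n * n
 p≤n² = ⊑ (m≤n*m p s) sp≤

 2≤n : 2 ≤ n
 2≤n = /ʳ 2 n n (⊑ (leq (*-comm 2 n)) (⊑ 2n≤p p≤n²))

 2s≤n : s * 2 ≤ n
 2s≤n = /ʳ (s * 2) n n (⊑ (leq (tr (*-assoc s 2 n) (ap (s *_) (*-comm 2 n)))) (⊑ (*ʳ s 2n≤p) sp≤))

 s+s≤n : s + s ≤ n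
 s+s≤n = ⊑ (leq (tr (ap (s +_) (sym (+0 s))) (*-comm 2 s))) 2s≤n

 s≤n : s ≤ n
 s≤n = ⊑ (m≤m+n s s) s+s≤n

 open module G = Greedy (λ l -> s * p * (l * l) * 8192) (n * n) using (fits; increasing; maximal) renaming (grow to lengthen)

 ℓ : ℕ
 ℓ = iter lengthen n 1

 instance
  ℓ≢0 : NonZero ℓ
  ℓ≢0 = >-nonZero (increasing n 1)

 ℓ-fits : ℓ ≡ 1 ⊎ s * p * (ℓ * ℓ) * 8192 ≤ n * n
 ℓ-fits = fits n 1 (inj₁ refl)

 spℓ²≤ : s * p * (ℓ * ℓ) ≤ n * n
 spℓ²≤ = [ (λ eq -> ⊑ (leq (tr (ap (λ l -> s * p * (l * l)) eq) (*1 _))) sp≤) , ⊑ (m≤m*n _ 8192) ]′ ℓ-fits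

 1≤sp : 1 ≤ s * p
 1≤sp = *≤ (>-nonZero⁻¹ s) (>-nonZero⁻¹ p)

 ℓ≤n : ℓ ≤ n
 ℓ≤n = square-cancel-≤ ℓ n (⊑ (m≤n*m (ℓ * ℓ) (s * p) {{>-nonZero 1≤sp}}) spℓ²≤)

 ℓ-maximal : n * n < s * p * (suc ℓ * suc ℓ) * 8192
 ℓ-maximal = [ id , (λ eq -> refute ℓ≤n (<⇒≱ (leq (sym eq)))) ]′ (maximal n 1)

 X0 : ℕ
 X0 = 8 * (n * n) * (m * m * m)

 instance
  m³≢0 : NonZero (m * m * m)
  m³≢0 = m*n≢0 (m * m) m {{m*n≢0 m m}}
  n²≢0 : NonZero (n * n)
  n²≢0 = m*n≢0 n n

 8n²≤X0 : 8 * (n * n) ≤ X0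
 8n²≤X0 = m≤m*n (8 * (n * n)) (m * m * m)

 n≤n² : n ≤ n * n
 n≤n² = m≤m*n n n

 1≤X0 : 1 ≤ X0
 1≤X0 = ⊑ (⊑ (>-nonZero⁻¹ (n * n)) (m≤n*m (n * n) 8)) 8n²≤X0

 module Wide (W : ℕ) (X0<2^W : X0 < 2 ^ W) (2^W≤2X0 : 2 ^ W ≤ X0 + X0) where

  instance
   W≢0 : NonZero W
   W≢0 = ≢-nonZero λ eq -> <⇒≱ X0<2^W (⊑ (leq (ap (2 ^_) eq)) 1≤X0)
   M≢0 : NonZero (2 ^ W)
   M≢0 = m^n≢0 2 W

  Δ cap cells : ℕ
  Δ = suc (_/_ n (ℓ * 144) {{m*n≢0 ℓ 144}})
  cap = X0 + X0
  cells = 70 + (s + s + (s + s))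

  small : ∀ {a} c -> a ≤ c * (n * n) -> c ≤ 8 -> a ≤ X0
  small c a≤ c≤ = ⊑ a≤ (⊑ (*ˡ (n * n) c≤) 8n²≤X0)

  X0≤cap : X0 ≤ cap
  X0≤cap = m≤m+n X0 X0

  1≤n² : 1 ≤ n * n
  1≤n² = >-nonZero⁻¹ (n * n)

  n<cap : n < cap
  n<cap = ⊑ (small 2 (+≤ 1≤n² (⊑ n≤n² (m≤m+n (n * n) 0))) (m≤m+n 2 6)) X0≤cap

  m≤cap : m ≤ cap
  m≤cap = ⊑ (⊑ (m≤n*m m (m * m) {{m*n≢0 m m}}) (m≤n*m (m * m * m) (8 * (n * n)) {{m*n≢0 8 (n * n)}})) X0≤cap

  s≤cap : 5 + (s + s) ≤ cap
  s≤cap = ⊑ (small 6 (⊑ (leq (+-comm 5 (s + s))) (+≤ (⊑ s+s≤n n≤n²) (⊑ (leq (sym (*1 5))) (*ʳ 5 1≤n²)))) (m≤m+n 6 2)) X0≤cap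

  p<cap : p < cap
  p<cap = ⊑ (small 2 (+≤ 1≤n² (⊑ p≤n² (m≤m+n (n * n) 0))) (m≤m+n 2 6)) X0≤cap

  Δ≤cap : Δ ≤ cap
  Δ≤cap = ⊑ (s≤s (m/n≤m n (ℓ * 144) {{m*n≢0 ℓ 144}})) n<cap

  ℓ≤cap : ℓ + ℓ + 1 ≤ cap
  ℓ≤cap = ⊑ (small 3 (⊑ (+≤ (+≤ (⊑ ℓ≤n n≤n²) (⊑ ℓ≤n n≤n²)) 1≤n²) (leq (triple (n * n)))) (m≤m+n 3 5)) X0≤cap
   where
   triple : ∀ a -> a + a + a ≡ 3 * a
   triple = ring

  W≤cap : W ≤ cap
  W≤cap = ⊑ (k≤2^k W) 2^W≤2X0

  s<2^W : s < 2 ^ W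
  s<2^W = ≤< (⊑ (⊑ s≤n n≤n²) (⊑ (m≤n*m (n * n) 8) 8n²≤X0)) X0<2^W

  a b bound : ℕ
  a = ⌈log₂ n ⌉
  b = ⌈log₂ m ⌉
  bound = ⌈ n √[ p / s ]⌉

  1≤a : 1 ≤ a
  1≤a = ⌈log₂⌉-mono-≤ {2} {n} 2≤n

  b≤ : b ≤ d * a
  b≤ = ⊑ (⌈log₂⌉-mono-≤ m≤) (⌈log₂^⌉ n d)

  pℓ≤T : p * ℓ ≤ bound
  pℓ≤T = T≥ n s p (p * ℓ) (⊑ (leq (grp s p ℓ)) (*ˡ p spℓ²≤)) (⊑ (*ʳ p (⊑ ℓ≤n n≤n²)) (leq (*-comm p (n * n))))
   where
   grp : ∀ s p l -> s * (p * l * (p * l)) ≡ s * p * (l * l) * p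
   grp = ring

  W≤a : W ≤ (6 + 3 * d) * a
  W≤a = ⊑ (2^-cancel-≤ W (4 + (2 * a + 3 * b)) (begin
   2 ^ W ≤⟨ 2^W≤2X0 ⟩
   _ ≡⟨ grp n m ⟩
   _ ≤⟨ *ʳ 16 (*≤ (^-monoˡ-≤ 2 (n≤2^⌈log₂n⌉ n)) (^-monoˡ-≤ 3 (n≤2^⌈log₂n⌉ m))) ⟩
   _ ≡⟨ ap (2 ^ 4 *_) (ap₂ _*_ (tr (^-*-assoc 2 a 2) (ap (2 ^_) (*-comm a 2))) (tr (^-*-assoc 2 b 3) (ap (2 ^_) (*-comm b 3)))) ⟩
   _ ≡⟨ ap (2 ^ 4 *_) (^-distribˡ-+-* 2 (2 * a) (3 * b)) ⟨
   _ ≡⟨ ^-distribˡ-+-* 2 4 (2 * a + 3 * b) ⟨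
   _ ∎))
   (⊑ (+≤ (*ʳ 4 1≤a) (+ʳ (2 * a) (*ʳ 3 b≤))) (leq (collect a d)))
   where
   open ≤R
   grp : ∀ n m -> 8 * (n * n) * (m * m * m) + 8 * (n * n) * (m * m * m) ≡ 16 * (n * (n * 1) * (m * (m * (m * 1))))
   grp = ring
   collect : ∀ a d -> 4 * a + (2 * a + 3 * (d * a)) ≡ (6 + 3 * d) * a
   collect = ring

  a≤logT : a ≤ ⌈log₂ bound ⌉
  a≤logT = ⌈log₂⌉-mono-≤ (⊑ n≤p (⊑ (m≤m*n p ℓ) pℓ≤T))

  time : ℕ
  time = Õ-bound (factor d) 2 bound

  total≤time : Costs.total unit n s p ℓ W n≤p (⊑ s≤n n≤p) ≤ time
  total≤time = begin _ ≤⟨ Costs.total≤ unit n s p ℓ W n≤p (⊑ s≤n n≤p) ⟩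
   _ ≤⟨ *ʳ c (*≤ W≤e (*ʳ p (*ˡ ℓ W≤e))) ⟩
   _ ≡⟨ grp c e l p ℓ ⟩
   _ ≤⟨ *≤ (factor-time d) (*ˡ (l ^ 2) pℓ≤T) ⟩
   time ∎
   where
   open ≤R
   c = Costs.totalC unit
   e = 6 + 3 * d
   l = ⌈log₂ bound ⌉
   W≤e : W ≤ e * l
   W≤e = ⊑ W≤a (*ʳ e a≤logT)
   grp : ∀ c e l p k -> c * (e * l * (p * (e * l * k))) ≡ c * (e * e) * (p * k * (l * (l * 1)))
   grp = ring

  space≤ : ∀ D -> spaceFactor D d ≤ factor d -> ∀ used -> used ≤ cells -> used * (D * (a + b)) ≤ factor d * (s * a)
  space≤ D factor≥ used used≤ = begin _ ≤⟨ *≤ (⊑ used≤ cells≤) (*ʳ D (+ʳ a b≤)) ⟩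
   _ ≡⟨ grp s D a d ⟩
   _ ≤⟨ *ˡ (s * a) factor≥ ⟩ _ ∎
   where
   open ≤R
   cells≤ : cells ≤ 74 * s
   cells≤ = ⊑ (+ˡ (s + s + (s + s)) (m≤m*n 70 s)) (leq (collect s))
    where
    collect : ∀ s -> 70 * s + (s + s + (s + s)) ≡ 74 * s
    collect = ring
   grp : ∀ s D a d -> 74 * s * (D * (a + d * a)) ≡ 74 * (D * (1 + d)) * (s * a)
   grp = ring

  I : Input n m
  I = input s p x y

  steps-word : ℕ
  steps-word = wordSize disjointness n m

  X : ℕ
  X = n * m

  n≤X : n ≤ X
  n≤X = m≤m*n n m

  m≤X : m ≤ X
  m≤X = m≤n*m m n

  n²≤X² : n * n ≤ X ^ 2
  n²≤X² = ⊑ (*≤ n≤X n≤X) (leq (ap (X *_) (sym (*1 X))))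

  cap≤ : cap ≤ X ^ cellDeg
  cap≤ = begin _ ≡⟨ grp n m ⟩
   _ ≤⟨ *≤ (^-monoˡ-≤ 4 (⊑ 2≤n n≤X)) (*≤ n²≤X² (⊑ (*≤ (*≤ m≤X m≤X) m≤X) (leq (cube X)))) ⟩
   _ ≡⟨ ap (X ^ 4 *_) (^-distribˡ-+-* X 2 3) ⟨
   _ ≡⟨ ^-distribˡ-+-* X 4 5 ⟨
   X ^ 9 ≤⟨ ^-monoʳ-≤ X {{m*n≢0 n m}} (m≤m+n 9 21) ⟩ _ ∎
   where
   open ≤R
   grp : ∀ n m -> 8 * (n * n) * (m * m * m) + 8 * (n * n) * (m * m * m) ≡ 16 * (n * n * (m * m * m))
   grp = ring
   cube : ∀ X -> X * X * X ≡ X * (X * (X * 1))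
   cube = ring

  wide : ∀ D -> X ^ D ≤ 2 ^ (D * (a + b))
  wide D = ⊑ (^-monoˡ-≤ D (⊑ (*≤ (n≤2^⌈log₂n⌉ n) (n≤2^⌈log₂n⌉ m)) (leq (sym (^-distribˡ-+-* 2 a b)))))
   (leq (tr (^-*-assoc 2 (a + b) D) (ap (2 ^_) (*-comm (a + b) D))))

  module Run (h : RandomFunction n m) where

   setting : Setting
   setting = record
    { n = n ; m = m ; s = s ; ℓ = ℓ ; n≢0 = n≢0 ; m≢0 = m≢0 ; s≢0 = s≢0 ; ℓ≢0 = ℓ≢0
    ; p = p ; x = x ; y = y ; h = h ; cap = cap ; cells = cells ; u = unit ; W = W ; Δ = Δ
    ; u≥ = 2000≤unit ; n<cap = n<cap ; m≤cap = m≤cap ; s≤cap = s≤cap ; p<cap = p<cap ; Δ≤cap = Δ≤cap ; ℓ≤cap = ℓ≤cap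
    ; W≤cap = W≤cap ; 2^W≤cap = 2^W≤2X0 ; cells≥ = rfl≤ ; s<2^W = s<2^W }

   capacity : Capacity steps-word I X cap cells
   capacity = record
    { cap≥ = ⊑ 1≤X0 X0≤cap ; cap≤ = cap≤ ; 2≤X = ⊑ 2≤n n≤X ; n≤X = n≤X ; m≤X = m≤X
    ; s≤X² = ⊑ s≤n (⊑ n≤n² n²≤X²) ; p≤X² = ⊑ p≤n² n²≤X² ; X<2^w = wide maxDeg
    ; cells≥ = ⊑ (m≤m+n 64 6) (m≤m+n 70 (s + s + (s + s))) }

   tree : Tree
   tree = Semantics.sem I h cap cells program (λ _ -> 0) >>= λ ρ -> tick (ret ρ)

   safe : Safe (NotDisjoint x y) (λ _ -> ⊤) time tree
   safe = safe-weaken total≤time (Prog.Whole.program-safe setting refl refl X0≤cap X0<2^W 2^W≤2X0)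

   sim : Simulation.Sim capacity h (compile program 0) tree (initial steps-word)
   sim = Simulation.sim-program capacity h (compile program 0) program program-admissible refl

   outcome : ∀ coins -> Simulation.Outcome capacity h (compile program 0) (NotDisjoint x y) (run disjointness I h coins)
   outcome = Simulation.outcome capacity h (compile program 0) safe (initial steps-word) sim

  rejected : RandomFunction n m -> ℕ
  rejected h = rejections time (Run.tree h)

  total : ℕ
  total = n ^ m * 2 ^ time

  length-sampleSpace : length (sampleSpace n m time) ≡ total
  length-sampleSpace = tr (length≡Ʃ (sampleSpace n m time)) (tr (Ʃ-⊗ _,_ (vecs (allFin n) m) (vecs (true ∷ false ∷ []) time) (λ _ -> 1))
   (tr (Ʃ≡ (vecs (allFin n) m) λ _ -> tr (sym (length≡Ʃ (vecs (true ∷ false ∷ []) time))) (length-vecs (true ∷ false ∷ []) time))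
    (tr (Ʃ-const (vecs (allFin n) m) (2 ^ time)) (ap (_* 2 ^ time) (tr (length-vecs (allFin n) m) (ap (_^ m) length-V))))))
   where
   length≡Ʃ : ∀ {A : Set} (xs : List A) -> length xs ≡ Ʃ[ _ ← xs ] 1
   length≡Ʃ xs = sym (tr (Ʃ-const xs 1) (*1 _))

  length-runs : length (runsClaimingNo disjointness I time) ≡ Ʃ[ h ← vecs (allFin n) m ] rejected h
  length-runs = tr (filter-length (λ (h , coins) -> Maybe.≡-dec Bool._≟_ (output (run disjointness I h coins)) (just false)) (sampleSpace n m time))
   (tr (Ʃ-⊗ _,_ (vecs (allFin n) m) (vecs (true ∷ false ∷ []) time) _)
    (Ʃ≡ (vecs (allFin n) m) λ h -> Simulation.count-rejections (Run.capacity h) h (compile program 0) (Run.safe h) (initial steps-word) (Run.sim h)))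

  few⇒ε : ∀ k -> 1 ≤ k -> Ʃ[ h ← vecs (allFin n) m ] rejected h * (k * k) + total ≤ k * k * total -> ProbClaimingNo≤ (ratio (k * k ∸ 1)) disjointness I time
  few⇒ε k 1≤k le = ≤ratio* (k * k ∸ 1) (length (runsClaimingNo disjointness I time)) (length (sampleSpace n m time))
   (+-cancelʳ-≤ total _ _ (begin _ ≡⟨ ap₂ (λ r K -> r * K + total) length-runs K≡ ⟩
    _ ≤⟨ le ⟩
    _ ≡⟨ ap (_* total) (sym K≡) ⟩
    _ ≡⟨ +-comm total _ ⟩
    _ ≡⟨ ap (λ t -> (k * k ∸ 1) * t + total) length-sampleSpace ⟨
    _ ∎))
   where
   open ≤R
   K≡ : suc (k * k ∸ 1) ≡ k * k
   K≡ = m+[n∸m]≡n (*≤ 1≤k 1≤k)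

  -- The register counts from 6 down to 1, and its predecessor encodes the rotations as
  -- `k = 2 g2 + 1 - g1`.
  align-index : ∀ {g1 g2} -> g1 < 2 -> g2 < 3 -> ∃ λ k -> k < 6 × suc k % 2 ≡ g1 × k / 2 ≡ g2
  align-index {0} {0} _ _ = 1 , s≤s (s≤s z≤n) , refl , refl
  align-index {0} {1} _ _ = 3 , s≤s (s≤s (s≤s (s≤s z≤n))) , refl , refl
  align-index {0} {2} _ _ = 5 , rfl≤ , refl , refl
  align-index {1} {0} _ _ = 0 , s≤s z≤n , refl , refl
  align-index {1} {1} _ _ = 2 , s≤s (s≤s (s≤s z≤n)) , refl , refl
  align-index {1} {2} _ _ = 4 , s≤s (s≤s (s≤s (s≤s (s≤s z≤n)))) , refl , refl
  align-index {suc (suc _)} (s≤s (s≤s ())) _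
  align-index {_} {suc (suc (suc _))} _ (s≤s (s≤s (s≤s ())))

  module Sampled (κ g1 g2 halvings q : ℕ) .{{_ : NonZero q}} (κ<6 : κ < 6) (g1≡ : suc κ % 2 ≡ g1) (g2≡ : κ / 2 ≡ g2) (reach : iter (_/ 2) halvings s ≡ q) (q≤s : q ≤ s)
   (sampler : Sampler n m q (2 ^ W) ℓ Δ s (suc (p / q)) margin (Labelling.label x y g1 g2)) where

   M R : ℕ
   M = 2 ^ W
   R = suc (p / q)

   open Sampler sampler

   A≡ : M ^ (5 + (q + q)) ≡ A
   A≡ = ^-distribˡ-+-* M 4 (suc (q + q))

   instance
    A^R≢0 : NonZero (A ^ R)
    A^R≢0 = m^n≢0 A R {{subst NonZero A≡ (m^n≢0 M (5 + (q + q)))}}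

   module _ (h : RandomFunction n m) where

    lucky : Vec ℕ (5 + (q + q)) -> ℕ
    lucky (α0 ∷ α1 ∷ α2 ∷ α3 ∷ γ) = goodnessOf (α0 ∷ α1 ∷ α2 ∷ α3 ∷ []) (Vec.map (_mod n) γ) h

    lucky≤1 : ∀ w -> lucky w ≤ 1
    lucky≤1 (α0 ∷ α1 ∷ α2 ∷ α3 ∷ c ∷ st) = goodness≤1 _ _ _

    held : ∀ {k} a (st : Vec ℕ k) ρ -> Holds a st ρ -> ∀ κ -> ρ (a + toℕ κ) ≡ lookup st κ
    held a (v ∷ st) ρ (eq , _) Fin.zero = tr (ap ρ (+0 a)) eq
    held a (v ∷ st) ρ (_ , holds) (Fin.suc κ) = tr (ap ρ (+-suc a (toℕ κ))) (held (suc a) st ρ holds κ)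

    meets : ∀ w ρ -> Holds 64 w ρ -> 0 < lucky w -> Prog.Round.Meets (Run.setting h) g1 g2 q q≤s ρ
    meets (α0 ∷ α1 ∷ α2 ∷ α3 ∷ c ∷ st) ρ (refl , refl , refl , refl , refl , holds) pos = collision (ρ 64 ∷ ρ 65 ∷ ρ 66 ∷ ρ 67 ∷ []) h (ρ 68 mod n) (Vec.map (_mod n) st) (λ κ -> ρ (69 + κ) % n)
     (λ κ -> tr (ap (_% n) (held 69 st ρ holds κ)) (tr (sym (Fin.toℕ-fromℕ< (m%n<n (lookup st κ) n))) (ap toℕ (sym (Vec.lookup-map κ (_mod n) st))))) pos

    misses : Ʃ[ w ← vecs (upTo M) (5 + (q + q)) ] (1 ∸ lucky w) ≡ A ∸ good h
    misses = m+n≡o⇒m≡o∸n' (begin _ ≡⟨ ap (Ʃ[ w ← ws ] (1 ∸ lucky w) +_) (sym good≡) ⟩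
     _ ≡⟨ Ʃ-+ ws (λ w -> 1 ∸ lucky w) lucky ⟨
     _ ≡⟨ Ʃ≡ ws (λ w -> m∸n+n≡m (lucky≤1 w)) ⟩
     _ ≡⟨ tr (Ʃ-const ws 1) (*1 _) ⟩
     _ ≡⟨ tr (length-vecs (upTo M) (5 + (q + q))) (tr (ap (_^ (5 + (q + q))) (List.length-upTo M)) A≡) ⟩
     A ∎)
     where
     open ≡R
     ws = vecs (upTo M) (5 + (q + q))
     m+n≡o⇒m≡o∸n' : ∀ {m n o} -> m + n ≡ o -> m ≡ o ∸ n
     m+n≡o⇒m≡o∸n' {m} {n} refl = sym (m+n∸n≡m m n)
     good≡ : Ʃ[ w ← ws ] lucky w ≡ good h
     good≡ = tr (Ʃ-vecs-++ (upTo M) 4 (suc (q + q)) lucky) (Ʃ≡ (vecs (upTo M) 4) λ { (α0 ∷ α1 ∷ α2 ∷ α3 ∷ []) -> refl })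

    rejected≤ : rejected h * A ^ R ≤ (A ∸ good h) ^ R * 2 ^ time
    rejected≤ = subst₂ (λ x y -> rejected h * y ^ R ≤ x ^ R * 2 ^ time) misses A≡ (fails time (safe⇒depth (Run.safe h)))
     where
     fails : Fails ((Ʃ[ w ← vecs (upTo M) (5 + (q + q)) ] (1 ∸ lucky w)) ^ R) ((M ^ (5 + (q + q))) ^ R) (Run.tree h)
     fails = Prog.Whole.fails-program (Run.setting h) refl refl X0≤cap X0<2^W 2^W≤2X0 ((Ʃ[ w ← vecs (upTo M) (5 + (q + q)) ] (1 ∸ lucky w)) ^ R) ((M ^ (5 + (q + q))) ^ R) κ κ<6 halvings q (>-nonZero⁻¹ q) reach λ ρ regs q≡ ->
      Prog.Round.LuckyLevel.fails-level (Run.setting h) g1 g2 q q≤s lucky meets ρ (subst₂ (λ g1 g2 -> Prog.Regs (Run.setting h) g1 g2 ρ) g1≡ g2≡ regs) q≡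

   -- For each `h` the rejecting share of the coins is at most `(1 - good h / A) ^ R`; after
   -- multiplication by `A ^ R`, the average over `h` is what `amplified` bounds.
   few : Ʃ[ h ← vecs (allFin n) m ] rejected h * (margin * margin) + total ≤ margin * margin * total
   few = /ʳ _ _ (A ^ R) (begin _ ≡⟨ grp (Ʃ hs rejected) K (n ^ m) (2 ^ time) (A ^ R) ⟩
    _ ≡⟨ ap (λ r -> r * K + 2 ^ time * (A ^ R * n ^ m)) (sym (Ʃ-*ʳ (A ^ R) hs rejected)) ⟩
    _ ≤⟨ +ˡ _ (*ˡ K (⊑ (Ʃ≤ hs rejected≤) (leq (Ʃ-*ʳ (2 ^ time) hs (λ h -> (A ∸ good h) ^ R))))) ⟩
    _ ≡⟨ grp' (Ʃ[ h ← hs ] ((A ∸ good h) ^ R)) (2 ^ time) K (A ^ R * n ^ m) ⟩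
    _ ≤⟨ *ʳ (2 ^ time) amplified ⟩
    _ ≡⟨ grp'' (2 ^ time) K (A ^ R) (n ^ m) ⟩ _ ∎)
    where
    open ≤R
    hs = vecs (allFin n) m
    K = margin * margin
    grp : ∀ r K c t a -> (r * K + c * t) * a ≡ r * a * K + t * (a * c)
    grp = ring
    grp' : ∀ f t K c -> f * t * K + t * c ≡ t * (f * K + c)
    grp' = ring
    grp'' : ∀ t K a c -> t * (K * (a * c)) ≡ K * (c * t) * a
    grp'' = ring

  -- One common entry, made visible by suitable rotations, supplies all that the analysis assumes:
  -- the value `v*`, an even and an odd vertex that carry it, and the level `q` that fits its
  -- weight. The program knows none of these and tries all rotations and levels.
  module Hidden (i j : Fin n) (same : lookup x i ≡ lookup y j) (g1 g2 : ℕ) (u w : ℕ) (u<n : u < n) (w<n : w < n)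
   (even : u % 2 ≡ 0) (odd : w % 2 ≡ 1) (u+g1 : (u + g1) % n ≡ toℕ i) (w+g2 : (w + g2) % n ≡ toℕ j) where

   open Labelling x y g1 g2 using (z; module Ends; module Raw)

   v* : Fin m
   v* = lookup x i

   open Ends v*

   iP iQ : Fin n
   iP = fromℕ< u<n
   iQ = fromℕ< w<n

   iP∈ : P iP
   iP∈ = even' , tr (ap (λ r -> if r ≡ᵇ 0 then lookup x (shift g1 iP) else lookup y (shift g2 iP)) even')
    (ap (lookup x) (Fin.toℕ-injective (tr (toℕ-shift g1 iP) (tr (ap (λ k -> (k + g1) % n) (Fin.toℕ-fromℕ< u<n)) u+g1))))
    where
    even' : toℕ iP % 2 ≡ 0
    even' = tr (ap (_% 2) (Fin.toℕ-fromℕ< u<n)) even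

   iQ∈ : Q iQ
   iQ∈ = odd' , tr (ap (λ r -> if r ≡ᵇ 0 then lookup x (shift g1 iQ) else lookup y (shift g2 iQ)) odd')
    (tr (ap (lookup y) (Fin.toℕ-injective (tr (toℕ-shift g2 iQ) (tr (ap (λ k -> (k + g2) % n) (Fin.toℕ-fromℕ< w<n)) w+g2)))) (sym same))
    where
    odd' : toℕ iQ % 2 ≡ 1
    odd' = tr (ap (_% 2) (Fin.toℕ-fromℕ< w<n)) odd

   f : ℕ
   f = Raw.wt v*

   1≤f : 1 ≤ f
   1≤f = ⊑ (leq (sym (𝟙-yes (z iP Fin.≟ v*) (proj₂ iP∈)))) (term≤Ʃ (λ u -> 𝟙 (z u Fin.≟ v*)) (Mem.∈-allFin iP))

   open Levels.Level (Levels.level f s 1≤f (>-nonZero⁻¹ s)) public using (q; reach; 0<q; q≤s; fine; coarse) renaming (i to halvings)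

   instance
    q≢0 : NonZero q
    q≢0 = >-nonZero 0<q

   M : ℕ
   M = 2 ^ W

   M-large : (2 + m ^ 3) * n ≤ M
   M-large = ⊑ (⊑ (*≤ (+ˡ (m ^ 3) (⊑ (s≤s (s≤s z≤n)) (*ʳ 2 {1} {m * m * m} (>-nonZero⁻¹ (m * m * m))))) n≤n²) (leq (grp n m)))
    (⊑ (*ˡ (m * m * m) (*ˡ (n * n) (m≤m+n 3 5))) (<⇒≤ X0<2^W))
    where
    grp : ∀ n m -> (2 * (m * m * m) + m * (m * (m * 1))) * (n * n) ≡ 3 * (n * n) * (m * m * m)
    grp = ring

   M-large' : 2 * (suc (q + q) * n) ≤ M
   M-large' = ⊑ (small 4 (⊑ (*ʳ 2 (*ˡ n (+≤ 1≤n (⊑ (+≤ q≤s q≤s) s+s≤n)))) (leq (grp n))) (m≤m+n 4 4)) (<⇒≤ X0<2^W)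
    where
    grp : ∀ n -> 2 * ((n + n) * n) ≡ 4 * (n * n)
    grp = ring

   sampler : Sampler n m q M ℓ Δ s (suc (p / q)) margin (Labelling.label x y g1 g2)
   sampler = Instance.sampler x y g1 g2 s p ℓ q M spread rate 384≤spread rate≥ v* M-large M-large' freqs≤ sp≤ ℓ-fits ℓ-maximal iP iQ iP∈ iQ∈ fine coarse margin margin≡

  few-rejected : NotDisjoint x y -> Ʃ[ h ← vecs (allFin n) m ] rejected h * (margin * margin) + total ≤ margin * margin * total
  few-rejected (i , j , same) with even-alignment n (toℕ i) (Fin.toℕ<n i) | odd-alignment n 2≤n (toℕ j) (Fin.toℕ<n j)
  ... | u , g1 , u<n , even , u+g1 , g1<2 | w , g2 , w<n , odd , w+g2 , g2<3 with align-index g1<2 g2<3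
  ... | κ , κ<6 , g1≡ , g2≡ = Sampled.few κ g1 g2 Hd.halvings Hd.q κ<6 g1≡ g2≡ Hd.reach Hd.q≤s Hd.sampler
   where module Hd = Hidden i j same g1 g2 u w u<n w<n even odd u+g1 w+g2

  solves : MonteCarloSolves disjointness (ratio (margin * margin ∸ 1)) I time (factor d * (s * ⌈log₂ n ⌉))
  solves = record
   { halts = λ h coins -> proj₁ (Run.outcome h coins)
   ; spaceBound = λ h coins -> space≤ maxDeg (factor-space d) (used (run disjointness I h coins)) (proj₁ (proj₂ (Run.outcome h coins)))
   ; noFalsePositives = λ h coins -> proj₂ (proj₂ (Run.outcome h coins))
   ; falseNegatives = λ yes -> few⇒ε margin 1≤margin (few-rejected yes)
   }

theorem3 :
  Σ[ A ∈ Algorithm ] Σ[ ε ∈ ℚ ] ε <ℚ 1ℚ ×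
  ((d : ℕ) → ∃[ C ] ∃[ k ]
    ((n m s p : ℕ) .{{_ : NonZero s}} .{{_ : NonZero p}} (x y : Vec (Fin m) n) →
     m ≤ n ^ d →
     sumSquaredFreqs x y ≤ p →
     s * p ≤ n ^ 2 →
     MonteCarloSolves A ε (input s p x y)
       (Õ-bound C k ⌈ n √[ p / s ]⌉)
       (C * (s * ⌈log₂ n ⌉))))
theorem3 = disjointness , ratio (margin * margin ∸ 1) , ratio<1 (margin * margin ∸ 1) , λ d -> factor d , 2 , λ n m s p x y m≤ freqs≤ sp≤ ->
 let open Solve record { n = n ; m = m ; s = s ; p = p ; d = d ; s≢0 = >-nonZero (>-nonZero⁻¹ s) ; p≢0 = >-nonZero (>-nonZero⁻¹ p) ; x = x ; y = y ; m≤ = m≤ ; freqs≤ = freqs≤ ; sp≤' = sp≤ }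
     -- This is the width at which the doubling loop of the program arrives; it is an input of the
     -- analysis only.
     W , X0<2^W , 2^W≤2X0 = bitlength X0 1≤X0
 in Wide.solves W X0<2^W 2^W≤2X0
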